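{- Let $p=p(n)\in[0,1]$ be a function of $n$ with $p(n)\leq 1/2$. If \[ \lim_{n\to+\infty}(np-\log n-\log\log n)=+\infty, \] then with high probability a random graph $G\sim\mathcal{G}(n,p)$ is a homomorphic core. Conversely, if \[ \lim_{n\to+\infty}(np-\log n-\log\log n)=-\infty, \] then with high probability $G\sim\mathcal{G}(n,p)$ is not a homomorphic core.
   Context: All graphs are finite, simple, loopless and undirected, and $n$-vertex graphs have vertex set $[n]=\{1,\dots,n\}$. $\log$ is the natural logarithm. $\mathcal{G}(n,p)$ is the Erdős–Rényi random graph: each pair of distinct vertices of $[n]$ is joined by an edge independently with probability $p$. "With high probability" means with probability tending to $1$ as $n\to+\infty$. An endomorphism of a graph $G$ is a map $f:V(G)\to V(G)$ such that $xy\in E(G)$ implies $f(x)f(y)\in E(G)$; an automorphism is a bijection $g:V(G)\to V(G)$ with $xy\in E(G)\iff g(x)g(y)\in E(G)$. A graph $G$ is a homomorphic core if every endomorphism of $G$ is an automorphism. Equivalently, $G$ has no proper retraction, where a proper retraction is an endomorphism $r$ of $G$ with image $r(V(G))=S\neq V(G)$ and $r(s)=s$ for every $s\in S$. -}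

module Defs where

open import Data.Empty using (⊥-elim)
open import Data.Fin.Base as Fin using (Fin; finToFun; funToFin)
open import Data.Fin.Properties as FinP using (all?; any?; finToFun-funToFin)
open import Data.Integer.Base as ℤ using (+_; -[1+_])
import Data.Integer.Properties as ℤP
open import Data.List.Base as List
  using (List; []; _∷_; _++_; allFin; cartesianProduct; filter; foldr; length; map)
import Data.List.Membership.DecPropositional as DecMembership
open import Data.List.Membership.Propositional using (_∈_)
import Data.Nat.Coprimality as Coprimality
open import Data.Nat.Base as ℕ using (ℕ; zero; suc)
import Data.Nat.Properties as ℕP
open import Data.Product.Base using (∃; ∃₂; _×_; _,_; proj₁; proj₂)
open import Data.Product.Properties using (≡-dec)
open import Data.Rational.Base
open import Data.Rational.Properties
open import Data.Rational.Solver using (module +-*-Solver)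
import Data.Rational.Unnormalised.Base as ℚᵘ
import Data.Rational.Unnormalised.Properties as ℚᵘP
open import Data.Sum.Base as Sum using (_⊎_; inj₁; inj₂)
open import Function.Base using (_∘_)
open import Function.Bundles using (_⇔_; mk⇔; module Equivalence)
open import Function.Definitions using (Bijective)
open import Level using (0ℓ)
open import Relation.Binary.Core using (Rel)
open import Relation.Binary.Definitions using (Symmetric; Irreflexive)
import Relation.Binary.Definitions as B
open import Relation.Binary.PropositionalEquality
open import Relation.Nullary using (¬_; Dec; yes; no; ¬?; _×-dec_; _⊎-dec_; _→-dec_)
open import Relation.Nullary.Decidable using (map′)
open import Relation.Unary using (Pred; Decidable)
open +-*-Solver using (solve; _:=_; _:+_; _:*_; _:-_; :-_; con)

-- Total reciprocal, with recip 0 = 0.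
recip : ℚ → ℚ
recip q with q ≟ 0ℚ
... | yes _   = 0ℚ
... | no q≢0 = 1/_ q {{≢-nonZero q≢0}}

*-nonneg : ∀ {p q} → 0ℚ ≤ p → 0ℚ ≤ q → 0ℚ ≤ p * q
*-nonneg {p} {q} 0≤p 0≤q =
  nonNegative⁻¹ (p * q)
    {{nonNeg*nonNeg⇒nonNeg p {{nonNegative 0≤p}} q {{nonNegative 0≤q}}}}

*-pos : ∀ {p q} → 0ℚ < p → 0ℚ < q → 0ℚ < p * q
*-pos {p} {q} 0<p 0<q =
  positive⁻¹ (p * q) {{pos*pos⇒pos p {{positive 0<p}} q {{positive 0<q}}}}

*-mono : ∀ {p q r s} → 0ℚ ≤ q → 0ℚ ≤ r → p ≤ r → q ≤ s → p * q ≤ r * s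
*-mono {p} {q} {r} {s} 0≤q 0≤r p≤r q≤s =
  ≤-trans (*-monoʳ-≤-nonNeg q {{nonNegative 0≤q}} p≤r)
          (*-monoˡ-≤-nonNeg r {{nonNegative 0≤r}} q≤s)

∣*∣-≤ : ∀ p q {r s} → ∣ p ∣ ≤ r → ∣ q ∣ ≤ s → ∣ p * q ∣ ≤ r * s
∣*∣-≤ p q p≤r q≤s rewrite ∣p*q∣≡∣p∣*∣q∣ p q =
  *-mono (0≤∣p∣ q) (≤-trans (0≤∣p∣ p) p≤r) p≤r q≤s

∣+∣-≤ : ∀ p q {r s} → ∣ p ∣ ≤ r → ∣ q ∣ ≤ s → ∣ p + q ∣ ≤ r + s
∣+∣-≤ p q p≤r q≤s = ≤-trans (∣p+q∣≤∣p∣+∣q∣ p q) (+-mono-≤ p≤r q≤s)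

∣-∣-sym : ∀ p q → ∣ p - q ∣ ≡ ∣ q - p ∣
∣-∣-sym p q = trans (sym (∣-p∣≡∣p∣ (p - q)))
  (cong ∣_∣ (solve 2 (λ p q → :- (p :- q) := q :- p) refl p q))

p≤∣p∣ : ∀ p → p ≤ ∣ p ∣
p≤∣p∣ p with ≤-total 0ℚ p
... | inj₁ 0≤p = ≤-reflexive (sym (0≤p⇒∣p∣≡p 0≤p))
... | inj₂ p≤0 = ≤-trans p≤0 (0≤∣p∣ p)

∣∣-lub : ∀ p {q} → p ≤ q → - p ≤ q → ∣ p ∣ ≤ q
∣∣-lub p a b with ∣p∣≡p∨∣p∣≡-p p
... | inj₁ e rewrite e = a
... | inj₂ e rewrite e = b

∣∣-Lipschitz : ∀ p q → ∣ ∣ p ∣ - ∣ q ∣ ∣ ≤ ∣ p - q ∣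
∣∣-Lipschitz p q = ∣∣-lub (∣ p ∣ - ∣ q ∣) (half p q)
    (subst₂ _≤_ (solve 2 (λ a b → b :- a := :- (a :- b)) refl ∣ p ∣ ∣ q ∣)
                (∣-∣-sym q p) (half q p))
  where
  half : ∀ p q → ∣ p ∣ - ∣ q ∣ ≤ ∣ p - q ∣
  half p q = subst (∣ p ∣ - ∣ q ∣ ≤_)
    (solve 2 (λ a b → (a :+ b) :- b := a) refl ∣ p - q ∣ ∣ q ∣)
    (+-monoˡ-≤ (- ∣ q ∣)
      (subst (λ r → ∣ r ∣ ≤ ∣ p - q ∣ + ∣ q ∣)
        (solve 2 (λ p q → (p :- q) :+ q := p) refl p q)
        (∣p+q∣≤∣p∣+∣q∣ (p - q) q)))

*-recip : ∀ {q} → 0ℚ < q → q * recip q ≡ 1ℚ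
*-recip {q} 0<q with q ≟ 0ℚ
... | yes refl = ⊥-elim (<-irrefl refl 0<q)
... | no q≢0   = *-inverseʳ q {{≢-nonZero q≢0}}

recip-pos : ∀ {q} → 0ℚ < q → 0ℚ < recip q
recip-pos {q} 0<q = ≰⇒> λ r≤0 →
  <-irrefl refl (<-≤-trans (positive⁻¹ 1ℚ)
      (subst₂ _≤_ (*-recip 0<q) (*-zeroʳ q)
        (*-monoˡ-≤-nonNeg q {{nonNegative (<⇒≤ 0<q)}} r≤0)))

recip-anti : ∀ {c q} → 0ℚ < c → c ≤ q → recip q ≤ recip c
recip-anti {c} {q} 0<c c≤q = subst₂ _≤_ eq₁ eq₂
    (*-mono {c} {recip q * recip c} {q} {recip q * recip c}
      0≤rr (≤-trans (<⇒≤ 0<c) c≤q) c≤q ≤-refl)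
  where
  0<q = <-≤-trans 0<c c≤q
  0≤rr = *-nonneg (<⇒≤ (recip-pos 0<q)) (<⇒≤ (recip-pos 0<c))
  eq₁ : c * (recip q * recip c) ≡ recip q
  eq₁ = trans (solve 3 (λ c r s → c :* (r :* s) := r :* (c :* s)) refl c (recip q) (recip c))
          (trans (cong (recip q *_) (*-recip 0<c)) (*-identityʳ (recip q)))
  eq₂ : q * (recip q * recip c) ≡ recip c
  eq₂ = trans (sym (*-assoc q (recip q) (recip c)))
          (trans (cong (_* recip c) (*-recip 0<q)) (*-identityˡ (recip c)))

recip-∣∣ : ∀ {c q} → 0ℚ < c → c ≤ q → ∣ recip q ∣ ≤ recip c
recip-∣∣ 0<c c≤q =
  subst (_≤ _) (sym (0≤p⇒∣p∣≡p (<⇒≤ (recip-pos (<-≤-trans 0<c c≤q))))) (recip-anti 0<c c≤q)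

recip-diff : ∀ {p q} → 0ℚ < p → 0ℚ < q → recip p - recip q ≡ (q - p) * (recip p * recip q)
recip-diff {p} {q} 0<p 0<q = begin
  r - s                           ≡⟨ cong₂ _-_ (*-identityʳ r) (*-identityʳ s) ⟨
  r * 1ℚ - s * 1ℚ                 ≡⟨ cong₂ (λ u v → r * u - s * v) (*-recip 0<q) (*-recip 0<p) ⟨
  r * (q * s) - s * (p * r)       ≡⟨ solve 4 (λ p q r s → r :* (q :* s) :- s :* (p :* r) := (q :- p) :* (r :* s)) refl p q r s ⟩
  (q - p) * (r * s)               ∎
  where
  open ≡-Reasoning
  r = recip p
  s = recip q

½^_ : ℕ → ℚ
½^ zero  = 1ℚ
½^ suc k = ½ * ½^ k

0≤½^ : ∀ k → 0ℚ ≤ ½^ k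
0≤½^ zero    = nonNegative⁻¹ 1ℚ
0≤½^ (suc k) = *-nonneg (nonNegative⁻¹ ½) (0≤½^ k)

halves : ∀ q → ½ * q + ½ * q ≡ q
halves = solve 1 (λ q → con ½ :* q :+ con ½ :* q := q) refl

½^-anti : ∀ {k n} → k ℕ.≤ n → ½^ n ≤ ½^ k
½^-anti {n = n} ℕ.z≤n = go n
  where
  step : ∀ k → ½^ suc k ≤ ½^ k
  step k = subst (½ * ½^ k ≤_) (halves (½^ k))
    (subst (_≤ ½ * ½^ k + ½ * ½^ k) (+-identityʳ (½ * ½^ k))
      (+-monoʳ-≤ (½ * ½^ k) (*-nonneg (nonNegative⁻¹ ½) (0≤½^ k))))
  go : ∀ n → ½^ n ≤ 1ℚ
  go zero    = ≤-refl
  go (suc n) = ≤-trans (step n) (go n)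
½^-anti (ℕ.s≤s k≤n) = *-monoˡ-≤-nonNeg ½ (½^-anti k≤n)

fromℕℚ : ℕ → ℚ
fromℕℚ n = mkℚ (+ n) 0 (Coprimality.sym (Coprimality.1-coprimeTo n))

fromℕℚ-suc : ∀ n → fromℕℚ (suc n) ≡ 1ℚ + fromℕℚ n
fromℕℚ-suc n = toℚᵘ-injective (ℚᵘP.≃-trans
  (ℚᵘ.*≡* (cong (ℤ._* + 1) (cong (λ k → + 1 ℤ.+ k) (sym (ℤP.*-identityʳ (+ n))))))
  (ℚᵘP.≃-sym (toℚᵘ-homo-+ 1ℚ (fromℕℚ n))))

≤fromℕℚ : ∀ q → ∃ λ n → q ≤ fromℕℚ n
≤fromℕℚ (mkℚ (+ n) d _)      = n , *≤* (ℤP.*-monoˡ-≤-nonNeg (+ n) (ℤ.+≤+ (ℕ.s≤s ℕ.z≤n)))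
≤fromℕℚ (mkℚ (-[1+ n ]) d _) = 0 , *≤* (ℤ.-≤+)

fromℕℚ*½^≤1 : ∀ n → fromℕℚ n * ½^ n ≤ 1ℚ
fromℕℚ*½^≤1 zero    = ≤-trans (≤-reflexive (*-zeroˡ 1ℚ)) (nonNegative⁻¹ 1ℚ)
fromℕℚ*½^≤1 (suc n) = subst₂ _≤_ eq (halves 1ℚ)
    (+-mono-≤ (*-monoˡ-≤-nonNeg ½ (½^-anti {0} {n} ℕ.z≤n))
              (*-monoˡ-≤-nonNeg ½ (fromℕℚ*½^≤1 n)))
  where
  eq : ½ * ½^ n + ½ * (fromℕℚ n * ½^ n) ≡ fromℕℚ (suc n) * ½^ suc n
  eq = trans (solve 2 (λ f h → con ½ :* h :+ con ½ :* (f :* h) := (con 1ℚ :+ f) :* (con ½ :* h)) refl (fromℕℚ n) (½^ n))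
             (cong (_* ½^ suc n) (sym (fromℕℚ-suc n)))

*½^-small : ∀ q {ε} → 0ℚ < ε → ∃ λ k → ∀ n → k ℕ.≤ n → q * ½^ n ≤ ε
*½^-small q {ε} 0<ε = k , λ n k≤n → subst₂ _≤_ (eq (½^ n)) (*-identityˡ ε)
    (*-monoʳ-≤-nonNeg ε {{nonNegative (<⇒≤ 0<ε)}} (lemma n k≤n))
  where
  a = ≤fromℕℚ (q * recip ε)
  k = proj₁ a
  lemma : ∀ n → k ℕ.≤ n → (q * recip ε) * ½^ n ≤ 1ℚ
  lemma n k≤n = ≤-trans
    (*-monoʳ-≤-nonNeg (½^ n) {{nonNegative (0≤½^ n)}} (proj₂ a))
    (≤-trans (*-monoˡ-≤-nonNeg (fromℕℚ k) (½^-anti k≤n)) (fromℕℚ*½^≤1 k))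
  eq : ∀ h → ((q * recip ε) * h) * ε ≡ q * h
  eq h = trans (solve 4 (λ q r h e → ((q :* r) :* h) :* e := (q :* h) :* (e :* r)) refl q (recip ε) h ε)
    (trans (cong (q * h *_) (*-recip 0<ε)) (*-identityʳ (q * h)))

∣+∣-≤-split : ∀ p q {r s t} → p + q ≡ r → ∣ p ∣ ≤ s → ∣ q ∣ ≤ t → ∣ r ∣ ≤ s + t
∣+∣-≤-split p q refl = ∣+∣-≤ p q

-- The right-endpoint Riemann sum of ∫ₐᵇ dt/t over 2ᵏ equal subintervals.
riemann : ℕ → ℚ → ℚ → ℚ
riemann zero    a b = (b - a) * recip b
riemann (suc k) a b = riemann k a m + riemann k m b
  where m = ½ * (a + b)

mid-≥ : ∀ {a b c} → c ≤ a → c ≤ b → c ≤ ½ * (a + b)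
mid-≥ {a} {b} {c} c≤a c≤b = subst (_≤ ½ * (a + b))
  (solve 1 (λ c → con ½ :* (c :+ c) := c) refl c)
  (*-monoˡ-≤-nonNeg ½ (+-mono-≤ c≤a c≤b))

∣½*∣-≤ : ∀ p {q r} → ½ * p ≡ r → ∣ p ∣ ≤ q → ∣ r ∣ ≤ ½ * q
∣½*∣-≤ p refl p≤q = ∣*∣-≤ ½ p ≤-refl p≤q

riemann-refine : ∀ k {a b c e} → 0ℚ < c → c ≤ a → c ≤ b → ∣ ½ * (b - a) ∣ ≤ e →
  ∣ riemann (suc k) a b - riemann k a b ∣ ≤ (e * e) * (recip c * recip c) * ½^ k
riemann-refine zero {a} {b} {c} {e} 0<c c≤a c≤b d≤e =
  subst₂ (λ p q → ∣ p ∣ ≤ q) (sym eq)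
    (solve 2 (λ e κ → e :* (e :* κ) := (e :* e) :* κ :* con 1ℚ) refl e (recip c * recip c))
    (∣*∣-≤ (½ * (b - a)) (½ * (b - a) * (recip m * recip b)) d≤e
      (∣*∣-≤ (½ * (b - a)) (recip m * recip b) d≤e
        (∣*∣-≤ (recip m) (recip b) (recip-∣∣ 0<c c≤m) (recip-∣∣ 0<c c≤b))))
  where
  open ≡-Reasoning
  m = ½ * (a + b)
  c≤m = mid-≥ {a} {b} c≤a c≤b
  eq : ((m - a) * recip m + (b - m) * recip b) - (b - a) * recip b
       ≡ ½ * (b - a) * (½ * (b - a) * (recip m * recip b))
  eq = begin
    ((m - a) * recip m + (b - m) * recip b) - (b - a) * recip b
      ≡⟨ solve 4 (λ a b r s →
           ((con ½ :* (a :+ b) :- a) :* r :+ (b :- con ½ :* (a :+ b)) :* s) :- (b :- a) :* s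
           := con ½ :* (b :- a) :* (r :- s)) refl a b (recip m) (recip b) ⟩
    ½ * (b - a) * (recip m - recip b)
      ≡⟨ cong (½ * (b - a) *_) (recip-diff (<-≤-trans 0<c c≤m) (<-≤-trans 0<c c≤b)) ⟩
    ½ * (b - a) * ((b - m) * (recip m * recip b))
      ≡⟨ cong (λ d → ½ * (b - a) * (d * (recip m * recip b)))
           (solve 2 (λ a b → b :- con ½ :* (a :+ b) := con ½ :* (b :- a)) refl a b) ⟩
    ½ * (b - a) * (½ * (b - a) * (recip m * recip b)) ∎
riemann-refine (suc k) {a} {b} {c} {e} 0<c c≤a c≤b d≤e =
  subst (∣ riemann (2 ℕ.+ k) a b - riemann (suc k) a b ∣ ≤_)
    (solve 3 (λ e κ h → (con ½ :* e :* (con ½ :* e)) :* κ :* h :+ (con ½ :* e :* (con ½ :* e)) :* κ :* h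
       := (e :* e) :* κ :* (con ½ :* h)) refl e (recip c * recip c) (½^ k))
    (∣+∣-≤-split (riemann (suc k) a m - riemann k a m) (riemann (suc k) m b - riemann k m b)
      (solve 4 (λ p q r s → (p :- q) :+ (r :- s) := (p :+ r) :- (q :+ s)) refl
        (riemann (suc k) a m) (riemann k a m) (riemann (suc k) m b) (riemann k m b))
      (riemann-refine k 0<c c≤a c≤m
        (∣½*∣-≤ (½ * (b - a)) (solve 2 (λ a b → con ½ :* (con ½ :* (b :- a))
          := con ½ :* (con ½ :* (a :+ b) :- a)) refl a b) d≤e))
      (riemann-refine k 0<c c≤m c≤b
        (∣½*∣-≤ (½ * (b - a)) (solve 2 (λ a b → con ½ :* (con ½ :* (b :- a))
          := con ½ :* (b :- con ½ :* (a :+ b))) refl a b) d≤e)))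
  where
  m = ½ * (a + b)
  c≤m = mid-≥ {a} {b} c≤a c≤b

riemann-tail : ∀ {a b c e} → 0ℚ < c → c ≤ a → c ≤ b → ∣ ½ * (b - a) ∣ ≤ e →
  let C = (e * e) * (recip c * recip c) in
  ∀ {k n} → k ℕ.≤ n → ∣ riemann n a b - riemann k a b ∣ ≤ (C + C) * ½^ k
riemann-tail {a} {b} {c} {e} 0<c c≤a c≤b d≤e {k} {n} k≤n =
  ≤-trans (subst (λ n → ∣ R n - R k ∣ ≤ (C + C) * (½^ k - ½^ n)) (ℕP.m∸n+n≡m k≤n) (go (n ℕ.∸ k)))
    (*-monoˡ-≤-nonNeg (C + C) {{nonNegative (+-mono-≤ 0≤C 0≤C)}}
      (subst (½^ k - ½^ n ≤_) (+-identityʳ (½^ k))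
        (+-monoʳ-≤ (½^ k) (neg-antimono-≤ (0≤½^ n)))))
  where
  R : ℕ → ℚ
  R n = riemann n a b
  C = (e * e) * (recip c * recip c)
  0≤e = ≤-trans (0≤∣p∣ (½ * (b - a))) d≤e
  0≤κ = <⇒≤ (recip-pos 0<c)
  0≤C : 0ℚ ≤ C
  0≤C = *-nonneg (*-nonneg 0≤e 0≤e) (*-nonneg 0≤κ 0≤κ)
  go : ∀ j → ∣ R (j ℕ.+ k) - R k ∣ ≤ (C + C) * (½^ k - ½^ (j ℕ.+ k))
  go zero = ≤-reflexive (trans (cong ∣_∣ (+-inverseʳ (R k)))
    (sym (trans (cong ((C + C) *_) (+-inverseʳ (½^ k))) (*-zeroʳ (C + C)))))
  go (suc j) = subst (∣ R (suc j ℕ.+ k) - R k ∣ ≤_)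
    (solve 3 (λ C h g → C :* g :+ (C :+ C) :* (h :- g) := (C :+ C) :* (h :- con ½ :* g)) refl C (½^ k) (½^ (j ℕ.+ k)))
    (∣+∣-≤-split (R (suc j ℕ.+ k) - R (j ℕ.+ k)) (R (j ℕ.+ k) - R k)
      (solve 3 (λ p q r → (p :- q) :+ (q :- r) := p :- r) refl (R (suc j ℕ.+ k)) (R (j ℕ.+ k)) (R k))
      (riemann-refine (j ℕ.+ k) 0<c c≤a c≤b d≤e) (go j))

riemann-Lipschitz : ∀ k {a b a′ b′ c d e w} → 0ℚ < c → c ≤ a → c ≤ b → c ≤ a′ → c ≤ b′ →
  ∣ a′ - a ∣ ≤ e → ∣ b′ - b ∣ ≤ e → ∣ (b - a) - (b′ - a′) ∣ ≤ w → ∣ b′ - a′ ∣ ≤ d →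
  ∣ riemann k a b - riemann k a′ b′ ∣ ≤ w * recip c + d * (e * (recip c * recip c))
riemann-Lipschitz zero {a} {b} {a′} {b′} 0<c c≤a c≤b c≤a′ c≤b′ a≤e b≤e w d =
  ∣+∣-≤-split (((b - a) - (b′ - a′)) * recip b) ((b′ - a′) * ((b′ - b) * (recip b * recip b′)))
    (trans (cong (λ r → ((b - a) - (b′ - a′)) * recip b + (b′ - a′) * r)
             (sym (recip-diff (<-≤-trans 0<c c≤b) (<-≤-trans 0<c c≤b′))))
      (solve 4 (λ x y r s → (x :- y) :* r :+ y :* (r :- s) := x :* r :- y :* s) refl
        (b - a) (b′ - a′) (recip b) (recip b′)))
    (∣*∣-≤ ((b - a) - (b′ - a′)) (recip b) w (recip-∣∣ 0<c c≤b))
    (∣*∣-≤ (b′ - a′) ((b′ - b) * (recip b * recip b′)) d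
      (∣*∣-≤ (b′ - b) (recip b * recip b′) b≤e
        (∣*∣-≤ (recip b) (recip b′) (recip-∣∣ 0<c c≤b) (recip-∣∣ 0<c c≤b′))))
riemann-Lipschitz (suc k) {a} {b} {a′} {b′} {c} {d} {e} {w} 0<c c≤a c≤b c≤a′ c≤b′ a≤e b≤e w≤ d≤ =
  subst (∣ riemann (suc k) a b - riemann (suc k) a′ b′ ∣ ≤_)
    (solve 4 (λ w d κ f → (con ½ :* w :* κ :+ con ½ :* d :* f) :+ (con ½ :* w :* κ :+ con ½ :* d :* f)
       := w :* κ :+ d :* f) refl w d (recip c) (e * (recip c * recip c)))
    (∣+∣-≤-split (riemann k a m - riemann k a′ m′) (riemann k m b - riemann k m′ b′)
      (solve 4 (λ p q r s → (p :- q) :+ (r :- s) := (p :+ r) :- (q :+ s)) refl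
        (riemann k a m) (riemann k a′ m′) (riemann k m b) (riemann k m′ b′))
      (riemann-Lipschitz k 0<c c≤a c≤m c≤a′ c≤m′ a≤e m≤e
        (∣½*∣-≤ ((b - a) - (b′ - a′)) (solve 4 (λ a b a′ b′ → con ½ :* ((b :- a) :- (b′ :- a′))
          := (con ½ :* (a :+ b) :- a) :- (con ½ :* (a′ :+ b′) :- a′)) refl a b a′ b′) w≤)
        (∣½*∣-≤ (b′ - a′) (solve 2 (λ a b → con ½ :* (b :- a) := con ½ :* (a :+ b) :- a) refl a′ b′) d≤))
      (riemann-Lipschitz k 0<c c≤m c≤b c≤m′ c≤b′ m≤e b≤e
        (∣½*∣-≤ ((b - a) - (b′ - a′)) (solve 4 (λ a b a′ b′ → con ½ :* ((b :- a) :- (b′ :- a′))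
          := (b :- con ½ :* (a :+ b)) :- (b′ :- con ½ :* (a′ :+ b′))) refl a b a′ b′) w≤)
        (∣½*∣-≤ (b′ - a′) (solve 2 (λ a b → con ½ :* (b :- a) := b :- con ½ :* (a :+ b)) refl a′ b′) d≤)))
  where
  m  = ½ * (a + b)
  m′ = ½ * (a′ + b′)
  c≤m = mid-≥ {a} {b} c≤a c≤b
  c≤m′ = mid-≥ {a′} {b′} c≤a′ c≤b′
  m≤e : ∣ m′ - m ∣ ≤ e
  m≤e = subst (∣ m′ - m ∣ ≤_) (halves e)
    (∣+∣-≤-split (½ * (a′ - a)) (½ * (b′ - b))
      (solve 4 (λ a b a′ b′ → con ½ :* (a′ :- a) :+ con ½ :* (b′ :- b)
        := con ½ :* (a′ :+ b′) :- con ½ :* (a :+ b)) refl a b a′ b′)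
      (∣½*∣-≤ (a′ - a) refl a≤e) (∣½*∣-≤ (b′ - b) refl b≤e))

riemann-lower : ∀ k {a b u} → 0ℚ < a → a ≤ b → b ≤ u → (b - a) * recip u ≤ riemann k a b
riemann-lower zero {a} {b} 0<a a≤b b≤u =
  *-monoˡ-≤-nonNeg (b - a) {{nonNegative (subst (_≤ b - a) (+-inverseʳ a) (+-monoˡ-≤ (- a) a≤b))}}
    (recip-anti (<-≤-trans 0<a a≤b) b≤u)
riemann-lower (suc k) {a} {b} {u} 0<a a≤b b≤u = subst (_≤ riemann (suc k) a b)
    (solve 3 (λ a b r → (con ½ :* (a :+ b) :- a) :* r :+ (b :- con ½ :* (a :+ b)) :* r
      := (b :- a) :* r) refl a b (recip u))
    (+-mono-≤ (riemann-lower k 0<a a≤m (≤-trans m≤b b≤u))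
              (riemann-lower k (<-≤-trans 0<a a≤m) m≤b b≤u))
  where
  m = ½ * (a + b)
  a≤m = mid-≥ {a} {b} ≤-refl a≤b
  m≤b : m ≤ b
  m≤b = subst (m ≤_) (solve 1 (λ b → con ½ :* (b :+ b) := b) refl b)
    (*-monoˡ-≤-nonNeg ½ (+-monoˡ-≤ b a≤b))

Cauchy : (ℕ → ℚ) → Set
Cauchy x = ∀ ε → 0ℚ < ε → ∃ λ N → ∀ m n → N ℕ.≤ m → N ℕ.≤ n → ∣ x m - x n ∣ ≤ ε

-- Reals as Cauchy sequences of rationals.  Distinct sequences may represent
-- the same number; the relations and operations below respect this.
record ℝ : Set where
  constructor _,cauchy_
  field
    seq       : ℕ → ℚ
    is-cauchy : Cauchy seq
open ℝ

+-pos : ∀ {p q} → 0ℚ < p → 0ℚ < q → 0ℚ < p + q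
+-pos {p} {q} 0<p 0<q = subst (_< p + q) (+-identityʳ 0ℚ) (+-mono-< 0<p 0<q)

half-pos : ∀ {ε} → 0ℚ < ε → 0ℚ < ½ * ε
half-pos = *-pos (positive⁻¹ ½)

Cauchy-bounded : ∀ {x} → Cauchy x → ∃₂ λ B N → 0ℚ < B × (∀ n → N ℕ.≤ n → ∣ x n ∣ ≤ B)
Cauchy-bounded {x} cx with cx 1ℚ (positive⁻¹ 1ℚ)
... | N , h = 1ℚ + ∣ x N ∣ , N ,
  <-≤-trans (positive⁻¹ 1ℚ)
    (subst (_≤ 1ℚ + ∣ x N ∣) (+-identityʳ 1ℚ) (+-monoʳ-≤ 1ℚ (0≤∣p∣ (x N)))) ,
  λ n N≤n → ∣+∣-≤-split (x n - x N) (x N)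
    (solve 2 (λ p q → (p :- q) :+ q := p) refl (x n) (x N)) (h n N N≤n ℕP.≤-refl) ≤-refl

const-Cauchy : ∀ q → Cauchy (λ _ → q)
const-Cauchy q ε 0<ε = 0 , λ _ _ _ _ → ≤-trans (≤-reflexive (cong ∣_∣ (+-inverseʳ q))) (<⇒≤ 0<ε)

+-Cauchy : ∀ {x y} → Cauchy x → Cauchy y → Cauchy (λ n → x n + y n)
+-Cauchy {x} {y} cx cy ε 0<ε with cx (½ * ε) (half-pos 0<ε) | cy (½ * ε) (half-pos 0<ε)
... | N₁ , h₁ | N₂ , h₂ = N₁ ℕ.⊔ N₂ , λ m n N≤m N≤n →
  subst (∣ (x m + y m) - (x n + y n) ∣ ≤_) (halves ε)
    (∣+∣-≤-split (x m - x n) (y m - y n)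
      (solve 4 (λ p q r s → (p :- q) :+ (r :- s) := (p :+ r) :- (q :+ s)) refl (x m) (x n) (y m) (y n))
      (h₁ m n (ℕP.m⊔n≤o⇒m≤o N₁ N₂ N≤m) (ℕP.m⊔n≤o⇒m≤o N₁ N₂ N≤n))
      (h₂ m n (ℕP.m⊔n≤o⇒n≤o N₁ N₂ N≤m) (ℕP.m⊔n≤o⇒n≤o N₁ N₂ N≤n)))

neg-Cauchy : ∀ {x} → Cauchy x → Cauchy (λ n → - x n)
neg-Cauchy {x} cx ε 0<ε with cx ε 0<ε
... | N , h = N , λ m n N≤m N≤n → subst (λ p → ∣ p ∣ ≤ ε)
  (solve 2 (λ p q → q :- p := (:- p) :- (:- q)) refl (x m) (x n)) (h n m N≤n N≤m)

∣∣-Cauchy : ∀ {x} → Cauchy x → Cauchy (λ n → ∣ x n ∣)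
∣∣-Cauchy {x} cx ε 0<ε with cx ε 0<ε
... | N , h = N , λ m n N≤m N≤n → ≤-trans (∣∣-Lipschitz (x m) (x n)) (h m n N≤m N≤n)

*-Cauchy-bounded : ∀ {x y} → Cauchy x → Cauchy y →
  ∀ B₁ M₁ → 0ℚ < B₁ → (∀ n → M₁ ℕ.≤ n → ∣ x n ∣ ≤ B₁) →
  ∀ B₂ M₂ → 0ℚ < B₂ → (∀ n → M₂ ℕ.≤ n → ∣ y n ∣ ≤ B₂) →
  Cauchy (λ n → x n * y n)
*-Cauchy-bounded {x} {y} cx cy B₁ M₁ 0<B₁ b₁ B₂ M₂ 0<B₂ b₂ ε 0<ε =
    (N₁ ℕ.⊔ N₂) ℕ.⊔ (M₁ ℕ.⊔ M₂) , λ m n N≤m N≤n →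
    subst (∣ x m * y m - x n * y n ∣ ≤_) eq
      (∣+∣-≤-split (x m * (y m - y n)) ((x m - x n) * y n)
        (solve 4 (λ p q r s → p :* (q :- s) :+ (p :- r) :* s := p :* q :- r :* s) refl (x m) (y m) (x n) (y n))
        (∣*∣-≤ (x m) (y m - y n) (b₁ m (ℕP.m⊔n≤o⇒m≤o M₁ M₂ (M≤ N≤m)))
          (proj₂ c₂ m n (ℕP.m⊔n≤o⇒n≤o N₁ N₂ (N≤ N≤m)) (ℕP.m⊔n≤o⇒n≤o N₁ N₂ (N≤ N≤n))))
        (∣*∣-≤ (x m - x n) (y n)
          (proj₂ c₁ m n (ℕP.m⊔n≤o⇒m≤o N₁ N₂ (N≤ N≤m)) (ℕP.m⊔n≤o⇒m≤o N₁ N₂ (N≤ N≤n)))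
          (b₂ n (ℕP.m⊔n≤o⇒n≤o M₁ M₂ (M≤ N≤n)))))
  where
  0<B : 0ℚ < B₁ + B₂
  0<B = +-pos 0<B₁ 0<B₂
  δ : ℚ
  δ = ε * recip (B₁ + B₂)
  0<δ : 0ℚ < δ
  0<δ = *-pos 0<ε (recip-pos 0<B)
  c₁  = cx δ 0<δ
  c₂  = cy δ 0<δ
  N₁  = proj₁ c₁
  N₂  = proj₁ c₂
  N≤ : ∀ {k} → (N₁ ℕ.⊔ N₂) ℕ.⊔ (M₁ ℕ.⊔ M₂) ℕ.≤ k → N₁ ℕ.⊔ N₂ ℕ.≤ k
  N≤ = ℕP.m⊔n≤o⇒m≤o (N₁ ℕ.⊔ N₂) (M₁ ℕ.⊔ M₂)
  M≤ : ∀ {k} → (N₁ ℕ.⊔ N₂) ℕ.⊔ (M₁ ℕ.⊔ M₂) ℕ.≤ k → M₁ ℕ.⊔ M₂ ℕ.≤ k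
  M≤ = ℕP.m⊔n≤o⇒n≤o (N₁ ℕ.⊔ N₂) (M₁ ℕ.⊔ M₂)
  eq : B₁ * δ + δ * B₂ ≡ ε
  eq = trans (solve 4 (λ b c e r → b :* (e :* r) :+ (e :* r) :* c := e :* ((b :+ c) :* r)) refl B₁ B₂ ε (recip (B₁ + B₂)))
    (trans (cong (ε *_) (*-recip 0<B)) (*-identityʳ ε))

*-Cauchy : ∀ {x y} → Cauchy x → Cauchy y → Cauchy (λ n → x n * y n)
*-Cauchy {x} {y} cx cy ε 0<ε = let
    (B₁ , M₁ , 0<B₁ , b₁) = Cauchy-bounded cx
    (B₂ , M₂ , 0<B₂ , b₂) = Cauchy-bounded cy
  in *-Cauchy-bounded {x} {y} cx cy B₁ M₁ 0<B₁ b₁ B₂ M₂ 0<B₂ b₂ ε 0<ε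

log-Cauchy : ∀ {x} → Cauchy x → (∃₂ λ c N → 0ℚ < c × (∀ n → N ℕ.≤ n → c ≤ x n)) →
  Cauchy (λ n → riemann n 1ℚ (x n))
log-Cauchy {x} cx (c₀ , N₀ , 0<c₀ , pos) ε 0<ε = N , λ m n N≤m N≤n →
    subst (∣ riemann m 1ℚ (x m) - riemann n 1ℚ (x n) ∣ ≤_) (halves ε)
      (∣+∣-≤-split (riemann m 1ℚ (x m) - riemann N 1ℚ (x m) + (riemann N 1ℚ (x n) - riemann n 1ℚ (x n)))
                   (riemann N 1ℚ (x m) - riemann N 1ℚ (x n))
        (solve 4 (λ p q r s → ((p :- q) :+ (r :- s)) :+ (q :- r) := p :- s) refl
          (riemann m 1ℚ (x m)) (riemann N 1ℚ (x m)) (riemann N 1ℚ (x n)) (riemann n 1ℚ (x n)))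
        (≤-trans (∣+∣-≤ (riemann m 1ℚ (x m) - riemann N 1ℚ (x m)) (riemann N 1ℚ (x n) - riemann n 1ℚ (x n))
            (tail m N≤m)
            (subst (_≤ (C + C) * ½^ N) (∣-∣-sym (riemann n 1ℚ (x n)) (riemann N 1ℚ (x n))) (tail n N≤n)))
          (≤-trans (≤-reflexive (sym (*-distribʳ-+ (½^ N) (C + C) (C + C)))) (proj₂ small N K≤N)))
        (subst (∣ riemann N 1ℚ (x m) - riemann N 1ℚ (x n) ∣ ≤_) δ-eq
          (riemann-Lipschitz N 0<c c≤1 (c≤ m N≤m) c≤1 (c≤ n N≤n)
            (<⇒≤ 0<δ) (near n m N≤n N≤m)
            (subst (λ p → ∣ p ∣ ≤ δ) (solve 2 (λ p q → p :- q := (p :- con 1ℚ) :- (q :- con 1ℚ)) refl (x m) (x n))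
              (near m n N≤m N≤n))
            (width n N≤n))))
  where
  bounded = Cauchy-bounded cx
  B   = proj₁ bounded
  N₁  = proj₁ (proj₂ bounded)
  0<B = proj₁ (proj₂ (proj₂ bounded))
  bdd = proj₂ (proj₂ (proj₂ bounded))
  c = c₀ ⊓ 1ℚ
  c≤1 = p⊓q≤q c₀ 1ℚ
  0<c : 0ℚ < c
  0<c with ≤-total c₀ 1ℚ
  ... | inj₁ le = subst (0ℚ <_) (sym (p≤q⇒p⊓q≡p le)) 0<c₀
  ... | inj₂ ge = subst (0ℚ <_) (sym (p≥q⇒p⊓q≡q ge)) (positive⁻¹ 1ℚ)
  κ = recip c
  0<κ : 0ℚ < κ
  0<κ = recip-pos 0<c
  d = B + 1ℚ
  0<d : 0ℚ < d
  0<d = +-pos 0<B (positive⁻¹ 1ℚ)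
  C = (½ * d * (½ * d)) * (κ * κ)
  L = κ + d * (κ * κ)
  0<L : 0ℚ < L
  0<L = +-pos 0<κ (*-pos 0<d (*-pos 0<κ 0<κ))
  δ = ½ * ε * recip L
  0<δ : 0ℚ < δ
  0<δ = *-pos (half-pos 0<ε) (recip-pos 0<L)
  δ-eq : δ * κ + d * (δ * (κ * κ)) ≡ ½ * ε
  δ-eq = trans (solve 4 (λ e r k d → (e :* r) :* k :+ d :* ((e :* r) :* (k :* k)) := e :* ((k :+ d :* (k :* k)) :* r))
                 refl (½ * ε) (recip L) κ d)
           (trans (cong (½ * ε *_) (*-recip 0<L)) (*-identityʳ (½ * ε)))
  small = *½^-small ((C + C) + (C + C)) (half-pos 0<ε)
  K  = proj₁ small
  N₂ = proj₁ (cx δ 0<δ)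
  N  = (N₀ ℕ.⊔ N₁) ℕ.⊔ (N₂ ℕ.⊔ K)
  N₀₁≤ : ∀ {n} → N ℕ.≤ n → N₀ ℕ.⊔ N₁ ℕ.≤ n
  N₀₁≤ = ℕP.m⊔n≤o⇒m≤o (N₀ ℕ.⊔ N₁) (N₂ ℕ.⊔ K)
  N₂K≤ : ∀ {n} → N ℕ.≤ n → N₂ ℕ.⊔ K ℕ.≤ n
  N₂K≤ = ℕP.m⊔n≤o⇒n≤o (N₀ ℕ.⊔ N₁) (N₂ ℕ.⊔ K)
  K≤N : K ℕ.≤ N
  K≤N = ℕP.m⊔n≤o⇒n≤o N₂ K (N₂K≤ ℕP.≤-refl)
  c≤ : ∀ n → N ℕ.≤ n → c ≤ x n
  c≤ n N≤n = ≤-trans (p⊓q≤p c₀ 1ℚ) (pos n (ℕP.m⊔n≤o⇒m≤o N₀ N₁ (N₀₁≤ N≤n)))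
  near : ∀ m n → N ℕ.≤ m → N ℕ.≤ n → ∣ x m - x n ∣ ≤ δ
  near m n N≤m N≤n = proj₂ (cx δ 0<δ) m n (ℕP.m⊔n≤o⇒m≤o N₂ K (N₂K≤ N≤m)) (ℕP.m⊔n≤o⇒m≤o N₂ K (N₂K≤ N≤n))
  width : ∀ n → N ℕ.≤ n → ∣ x n - 1ℚ ∣ ≤ d
  width n N≤n = ∣+∣-≤ (x n) (- 1ℚ) (bdd n (ℕP.m⊔n≤o⇒n≤o N₀ N₁ (N₀₁≤ N≤n))) ≤-refl
  tail : ∀ n → N ℕ.≤ n → ∣ riemann n 1ℚ (x n) - riemann N 1ℚ (x n) ∣ ≤ (C + C) * ½^ N
  tail n N≤n = riemann-tail 0<c c≤1 (c≤ n N≤n) (∣½*∣-≤ (x n - 1ℚ) refl (width n N≤n)) N≤n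

infix  4 _<ℝ_ _≤ℝ_
infixl 6 _+ℝ_ _-ℝ_
infixl 7 _*ℝ_
infix  8 -ℝ_
infixr 8 _^ℝ_

fromℚ : ℚ → ℝ
fromℚ q = (λ _ → q) ,cauchy const-Cauchy q

fromℕ : ℕ → ℝ
fromℕ n = fromℚ (fromℕℚ n)

0ℝ 1ℝ ½ℝ : ℝ
0ℝ = fromℚ 0ℚ
1ℝ = fromℚ 1ℚ
½ℝ = fromℚ ½

_+ℝ_ _*ℝ_ : ℝ → ℝ → ℝ
-ℝ_ ∣_∣ℝ : ℝ → ℝ
x +ℝ y = (λ n → seq x n + seq y n) ,cauchy +-Cauchy {seq x} {seq y} (is-cauchy x) (is-cauchy y)
x *ℝ y = (λ n → seq x n * seq y n) ,cauchy *-Cauchy {seq x} {seq y} (is-cauchy x) (is-cauchy y)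
-ℝ x   = (λ n → - seq x n)         ,cauchy neg-Cauchy {seq x} (is-cauchy x)
∣ x ∣ℝ = (λ n → ∣ seq x n ∣)       ,cauchy ∣∣-Cauchy {seq x} (is-cauchy x)

_-ℝ_ : ℝ → ℝ → ℝ
x -ℝ y = x +ℝ (-ℝ y)

_^ℝ_ : ℝ → ℕ → ℝ
x ^ℝ zero  = 1ℝ
x ^ℝ suc n = x *ℝ x ^ℝ n

_<ℝ_ _≤ℝ_ : Rel ℝ 0ℓ
x <ℝ y = ∃₂ λ ε N → 0ℚ < ε × (∀ n → N ℕ.≤ n → ε ≤ seq y n - seq x n)
x ≤ℝ y = ¬ y <ℝ x

-- log x = ∫₁ˣ dt/t.
log : (x : ℝ) → 0ℝ <ℝ x → ℝ
log x (ε , N , 0<ε , pos) = (λ n → riemann n 1ℚ (seq x n)) ,cauchy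
  log-Cauchy {seq x} (is-cauchy x) (ε , N , 0<ε , λ n N≤n → subst (ε ≤_) (+-identityʳ (seq x n)) (pos n N≤n))

fromℕℚ-pos : ∀ n → 0ℚ < fromℕℚ (suc n)
fromℕℚ-pos n = *<* (ℤ.+<+ (ℕ.s≤s ℕ.z≤n))

fromℕ-pos : ∀ n → 0ℝ <ℝ fromℕ (suc n)
fromℕ-pos n = fromℕℚ (suc n) , 0 , fromℕℚ-pos n ,
  λ _ _ → ≤-reflexive (sym (+-identityʳ (fromℕℚ (suc n))))

log-pos : ∀ n → 0ℝ <ℝ log (fromℕ (2 ℕ.+ n)) (fromℕ-pos (suc n))
log-pos n = (q - 1ℚ) * recip q , 0 , *-pos 0<q-1 (recip-pos (fromℕℚ-pos (suc n))) ,
  λ k _ → subst ((q - 1ℚ) * recip q ≤_) (sym (+-identityʳ (riemann k 1ℚ q)))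
    (riemann-lower k {1ℚ} {q} {q} (positive⁻¹ 1ℚ) 1≤q ≤-refl)
  where
  q : ℚ
  q = fromℕℚ (2 ℕ.+ n)
  0<q-1 : 0ℚ < q - 1ℚ
  0<q-1 = subst (0ℚ <_)
    (trans (solve 1 (λ p → p := (con 1ℚ :+ p) :- con 1ℚ) refl (fromℕℚ (suc n)))
           (cong (_- 1ℚ) (sym (fromℕℚ-suc (suc n)))))
    (fromℕℚ-pos n)
  1≤q : 1ℚ ≤ q
  1≤q = *≤* (ℤ.+≤+ (ℕ.s≤s ℕ.z≤n))

-- log n and log (log n), with the junk value 0 at the finitely many n where
-- they are undefined.

logℕ : ℕ → ℝ
logℕ zero    = 0ℝ
logℕ (suc n) = log (fromℕ (suc n)) (fromℕ-pos n)

loglogℕ : ℕ → ℝ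
loglogℕ zero          = 0ℝ
loglogℕ (suc zero)    = 0ℝ
loglogℕ (suc (suc n)) = log (logℕ (2 ℕ.+ n)) (log-pos n)

TendsTo : (ℕ → ℝ) → ℝ → Set
TendsTo s l = ∀ ε → 0ℝ <ℝ ε → ∃ λ N → ∀ n → N ℕ.≤ n → ∣ s n -ℝ l ∣ℝ <ℝ ε

TendsTo+∞ TendsTo-∞ : (ℕ → ℝ) → Set
TendsTo+∞ s = ∀ M → ∃ λ N → ∀ n → N ℕ.≤ n → M <ℝ s n
TendsTo-∞ s = ∀ M → ∃ λ N → ∀ n → N ℕ.≤ n → s n <ℝ M

record Graph (n : ℕ) : Set₁ where
  field
    Adj    : Rel (Fin n) 0ℓ
    adj?   : B.Decidable Adj
    symm   : Symmetric Adj
    irrefl : Irreflexive _≡_ Adj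

module _ {n : ℕ} (G : Graph n) where
  open Graph G

  IsEndomorphism IsAutomorphism : (Fin n → Fin n) → Set
  IsEndomorphism f = ∀ x y → Adj x y → Adj (f x) (f y)
  IsAutomorphism f = Bijective _≡_ _≡_ f × (∀ x y → Adj x y ⇔ Adj (f x) (f y))

  IsCore : Set
  IsCore = ∀ f → IsEndomorphism f → IsAutomorphism f

  IsEndomorphism? : Decidable IsEndomorphism
  IsEndomorphism? f = map′ (λ h x y → h x y) (λ h x y → h x y)
    (all? λ x → all? λ y → adj? x y →-dec adj? (f x) (f y))

  IsAutomorphism? : Decidable IsAutomorphism
  IsAutomorphism? f = (injective? ×-dec surjective?) ×-dec adj-iff?
    where
    injective? : Dec (∀ {x y} → f x ≡ f y → x ≡ y)
    injective? = map′ (λ h {x} {y} → h x y) (λ h x y → h {x} {y})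
      (all? λ x → all? λ y → (f x FinP.≟ f y) →-dec (x FinP.≟ y))
    surjective? : Dec (∀ y → ∃ λ x → ∀ {z} → z ≡ x → f z ≡ y)
    surjective? = map′
      (λ h y → proj₁ (h y) , λ z≡x → trans (cong f z≡x) (proj₂ (h y)))
      (λ h y → proj₁ (h y) , proj₂ (h y) refl)
      (all? λ y → any? λ x → f x FinP.≟ y)
    adj-iff? : Dec (∀ x y → Adj x y ⇔ Adj (f x) (f y))
    adj-iff? = map′
      (λ h x y → mk⇔ (proj₁ (h x y)) (proj₂ (h x y)))
      (λ h x y → Equivalence.to (h x y) , Equivalence.from (h x y))
      (all? λ x → all? λ y →
        (adj? x y →-dec adj? (f x) (f y)) ×-dec (adj? (f x) (f y) →-dec adj? x y))

  IsEndomorphism-resp : ∀ {f g} → f ≗ g → IsEndomorphism f → IsEndomorphism g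
  IsEndomorphism-resp f≗g h x y = subst₂ Adj (f≗g x) (f≗g y) ∘ h x y

  IsAutomorphism-resp : ∀ {f g} → f ≗ g → IsAutomorphism f → IsAutomorphism g
  IsAutomorphism-resp f≗g ((inj , surj) , iff) =
    ((λ {x} {y} gx≡gy → inj (trans (f≗g x) (trans gx≡gy (sym (f≗g y))))) ,
     (λ y → proj₁ (surj y) , λ {z} z≡x → trans (sym (f≗g z)) (proj₂ (surj y) z≡x))) ,
    λ x y → mk⇔
      (subst₂ Adj (f≗g x) (f≗g y) ∘ Equivalence.to (iff x y))
      (Equivalence.from (iff x y) ∘ subst₂ Adj (sym (f≗g x)) (sym (f≗g y)))

IsCore? : ∀ {n} → Decidable (IsCore {n})
IsCore? {n} G = map′
  (λ h f endo → IsAutomorphism-resp G (finToFun-funToFin f)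
    (h (funToFin f) (IsEndomorphism-resp G (sym ∘ finToFun-funToFin f) endo)))
  (λ h k → h (finToFun k))
  (all? λ (k : Fin (n ℕ.^ n)) →
    IsEndomorphism? G (finToFun k) →-dec IsAutomorphism? G (finToFun k))

module _ {n : ℕ} where
  open DecMembership (≡-dec (FinP._≟_ {n}) (FinP._≟_ {n})) using (_∈?_)

  -- The graph whose edges are the pairs in S, read as unordered.
  fromEdges : List (Fin n × Fin n) → Graph n
  fromEdges S = record
    { Adj    = λ i j → i ≢ j × ((i , j) ∈ S ⊎ (j , i) ∈ S)
    ; adj?   = λ i j → ¬? (i FinP.≟ j) ×-dec ((i , j) ∈? S ⊎-dec (j , i) ∈? S)
    ; symm   = λ (i≢j , e) → i≢j ∘ sym , Sum.swap e
    ; irrefl = λ i≡j (i≢j , _) → i≢j i≡j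
    }

pairs : ∀ n → List (Fin n × Fin n)
pairs n = filter (λ (i , j) → i FinP.<? j) (cartesianProduct (allFin n) (allFin n))

sublists : ∀ {A : Set} → List A → List (List A)
sublists []       = [] ∷ []
sublists (x ∷ xs) = map (x ∷_) (sublists xs) ++ sublists xs

sumℝ : List ℝ → ℝ
sumℝ = foldr _+ℝ_ 0ℝ

GraphProperty : Set₁
GraphProperty = ∀ {n} → Pred (Graph n) 0ℓ

-- Each graph on n vertices is fromEdges S for exactly one sublist S of
-- pairs n, and G(n,p) equals it with probability
-- p^|S| (1-p)^(C(n,2)-|S|), where C(n,2) = length (pairs n).
ℙ[𝒢⟨_,_⟩∈_] : ∀ n → ℝ → {P : Pred (Graph n) 0ℓ} → Decidable P → ℝ
ℙ[𝒢⟨ n , p ⟩∈ P? ] =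
  sumℝ (map weight (filter (P? ∘ fromEdges) (sublists (pairs n))))
  where
  weight : List (Fin n × Fin n) → ℝ
  weight S = p ^ℝ length S *ℝ (1ℝ -ℝ p) ^ℝ (length (pairs n) ℕ.∸ length S)

WithHighProbability : (p : ℕ → ℝ) (P : GraphProperty) → (∀ {n} → Decidable (P {n})) → Set
WithHighProbability p P P? = TendsTo (λ n → ℙ[𝒢⟨ n , p n ⟩∈ P? ]) 1ℝ

-- A graph that is not a core has an idempotent endomorphism r ≠ id, which moves a vertex x
-- to a vertex r x adjacent to the images of all neighbours of x. Exposing first the edges
-- between the fixed points of r, one bounds the probability that r is such a fold by a
-- product over the moved vertices, and sums over r. When np is at least of order (log n)²,
-- the absence of cliques larger than a multiple of log n makes this work. When np is between
-- log n + log log n and (log n)², the minimum degree is at least 2, vertices of low degree are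
-- few and far apart, each vertex is in at most one triangle, and there is no large
-- independent set; these properties leave too little room for a fold. Tails are bounded by
-- exponential moments. Conversely, a graph with an isolated vertex or a leaf folds, and the
-- second moment of the number of these shows that one exists if np - log n - log log n → -∞.
-- As all probabilities are rational, exp and log enter only through rational certificates
-- for z ≤ exp y and w ≤ exp (- y).

module Submission where

open import Algebra.Bundles using (CommutativeRing)
open import Data.Bool.Base using (Bool; true; false; if_then_else_; not; _∧_; _∨_)
import Data.Bool.Properties as BoolP
open import Data.Empty using (⊥; ⊥-elim)
open import Data.Fin.Base as Fin using (Fin; zero; suc; funToFin; finToFun)
import Data.Fin.Properties as FinP
open import Data.List.Base as List
  using (List; []; _∷_; _++_; map; filter; length; cartesianProduct; cartesianProductWith; allFin)
import Data.List.Properties as ListP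
open import Data.List.Membership.Propositional using (_∈_; lose)
open import Data.List.Membership.Propositional.Properties
  using (∈-filter⁺; ∈-filter⁻; ∈-cartesianProduct⁺; ∈-cartesianProductWith⁺; ∈-allFin)
open import Data.List.Relation.Unary.All as All using (All; []; _∷_)
import Data.List.Relation.Unary.All.Properties as AllP
open import Data.List.Relation.Unary.AllPairs using ([]; _∷_)
open import Data.List.Relation.Unary.Any as Any using (Any; here; there)
open import Data.List.Relation.Unary.Unique.Propositional using (Unique)
import Data.List.Relation.Unary.Unique.Propositional.Properties as UniqueP
open import Data.Nat.Base as ℕ using (ℕ; zero; suc)
import Data.Nat.DivMod as DivMod
import Data.Nat.Properties as ℕP
import Data.Nat.Tactic.RingSolver as ℕSolver
open import Data.Product.Base using (∃; ∃₂; _×_; _,_; proj₁; proj₂)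
open import Data.Product.Properties using (≡-dec; ,-injectiveˡ; ,-injectiveʳ)
open import Data.Rational.Base hiding (floor)
open import Data.Rational.Properties
open import Data.Sum.Base as Sum using (_⊎_; inj₁; inj₂)
open import Data.Vec.Base as Vec using (Vec; []; _∷_; lookup; tabulate)
import Data.Vec.Properties as VecP
open import Function.Base using (_∘_)
open import Function.Bundles using (mk⇔)
open import Level using (0ℓ)
open import Relation.Binary.Definitions using (DecidableEquality; tri<; tri≈; tri>)
open import Relation.Binary.PropositionalEquality
open import Relation.Nullary using (¬_; Dec; yes; no; does; ¬?; _×-dec_; _→-dec_)
open import Relation.Nullary.Decidable using (dec-true; dec-false; dec⇒maybe; decidable-stable; map′)
open import Relation.Unary using (Pred; Decidable)
open import Tactic.RingSolver using (solve-∀)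
open import Tactic.RingSolver.Core.AlmostCommutativeRing
  using (AlmostCommutativeRing; fromCommutativeRing)
open import Algebra.Properties.CommutativeSemiring.Exp
  (CommutativeRing.commutativeSemiring +-*-commutativeRing)
  using (_^_; ^-homo-*; ^-assocʳ; ^-distrib-*)
open import Algebra.Properties.Semiring.Sum ℕP.+-*-semiring
  using (sum; ∑-distrib-+; ∑-comm; sum-cong-≗; *-distribˡ-sum)

open import Defs

-- There are at most n^(2t) maps that move `t` vertices, so a union bound over maps needs a factor
-- below n^(-2) from every moved vertex. With many edges, the pairs lying over non-edges, which must
-- be non-edges themselves, provide it. When np is close to log n they provide only about exp (-
-- np), near 1/n, and the rest has to come from the edges at moved vertices, all of which must lie
-- over edges. If `t` is small, few pairs lie over edges, and two edges per moved vertex on average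
-- suffice; leaves would spoil this, and it is why vertices of low degree must be far apart. If `t`
-- is large, at least half of the moved vertices have degree of order np, while a neighbourhood
-- spanning at most one edge has a small preimage, so that again few pairs are available for these
-- edges. Sizes are measured on a scale `e` with 2^(16e) ≤ n ≤ 2^(16e+16). A map costs about 2^(32e)
-- per moved vertex, the sparse case has p below 2^(-15e), and exceptional events other than a
-- vertex of degree at most 1 have probability of order 2^(-e).

ℚ-ring : AlmostCommutativeRing _ _
ℚ-ring = fromCommutativeRing +-*-commutativeRing (λ x → dec⇒maybe (0ℚ ≟ x))

-- Arithmetic of the rationals

0≤1 : 0ℚ ≤ 1ℚ
0≤1 = nonNegative⁻¹ 1ℚ

0≤½ : 0ℚ ≤ ½
0≤½ = nonNegative⁻¹ ½

2ℚ : ℚ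
2ℚ = fromℕℚ 2

0≤2 : 0ℚ ≤ 2ℚ
0≤2 = nonNegative⁻¹ 2ℚ

½≤1 : ½ ≤ 1ℚ
½≤1 = ≤ᵇ⇒≤ _

+-nonneg : ∀ {x y} → 0ℚ ≤ x → 0ℚ ≤ y → 0ℚ ≤ x + y
+-nonneg {x} {y} = +-mono-≤ {0ℚ} {x} {0ℚ} {y}

0≤-diff : ∀ {x y} → x ≤ y → 0ℚ ≤ y - x
0≤-diff {x} {y} x≤y = subst (_≤ y - x) (+-inverseʳ x) (+-monoˡ-≤ (- x) x≤y)

by-diff : ∀ {x y} e → 0ℚ ≤ e → x + e ≡ y → x ≤ y
by-diff {x} e 0≤e refl = subst (_≤ x + e) (+-identityʳ x) (+-monoʳ-≤ x 0≤e)

≤-diff : ∀ {x y} → 0ℚ ≤ y - x → x ≤ y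
≤-diff {x} {y} h = by-diff (y - x) h (e x y)
  where
  e : ∀ x y → x + (y - x) ≡ y
  e = solve-∀ ℚ-ring

*-monoʳ : ∀ {x y} z → 0ℚ ≤ z → x ≤ y → z * x ≤ z * y
*-monoʳ z 0≤z = *-monoˡ-≤-nonNeg z {{nonNegative 0≤z}}

*-monoˡ : ∀ {x y} z → 0ℚ ≤ z → x ≤ y → x * z ≤ y * z
*-monoˡ z 0≤z = *-monoʳ-≤-nonNeg z {{nonNegative 0≤z}}

*-cancelˡ : ∀ {x y} z → 0ℚ < z → z * x ≤ z * y → x ≤ y
*-cancelˡ z 0<z = *-cancelˡ-≤-pos z {{positive 0<z}}

*-mono₂ : ∀ {x y z w} → 0ℚ ≤ x → 0ℚ ≤ z → x ≤ y → z ≤ w → x * z ≤ y * w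
*-mono₂ 0≤x 0≤z x≤y z≤w = *-mono 0≤z (≤-trans 0≤x x≤y) x≤y z≤w

^-nonneg : ∀ {x} n → 0ℚ ≤ x → 0ℚ ≤ x ^ n
^-nonneg zero    0≤x = 0≤1
^-nonneg (suc n) 0≤x = *-nonneg 0≤x (^-nonneg n 0≤x)

^-pos : ∀ {x} n → 0ℚ < x → 0ℚ < x ^ n
^-pos zero    0<x = positive⁻¹ 1ℚ
^-pos (suc n) 0<x = *-pos 0<x (^-pos n 0<x)

^-mono : ∀ {x y} n → 0ℚ ≤ x → x ≤ y → x ^ n ≤ y ^ n
^-mono zero    0≤x x≤y = ≤-refl
^-mono (suc n) 0≤x x≤y = *-mono₂ 0≤x (^-nonneg n 0≤x) x≤y (^-mono n 0≤x x≤y)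

1^ : ∀ n → 1ℚ ^ n ≡ 1ℚ
1^ zero    = refl
1^ (suc n) = trans (*-identityˡ (1ℚ ^ n)) (1^ n)

1≤^ : ∀ {x} n → 1ℚ ≤ x → 1ℚ ≤ x ^ n
1≤^ {x} n 1≤x = subst (_≤ x ^ n) (1^ n) (^-mono n 0≤1 1≤x)

^≤1 : ∀ {x} n → 0ℚ ≤ x → x ≤ 1ℚ → x ^ n ≤ 1ℚ
^≤1 {x} n 0≤x x≤1 = subst (x ^ n ≤_) (1^ n) (^-mono n 0≤x x≤1)

^-antiʳ : ∀ {x m n} → 0ℚ ≤ x → x ≤ 1ℚ → m ℕ.≤ n → x ^ n ≤ x ^ m
^-antiʳ {x} {m} {n} 0≤x x≤1 m≤n =
  subst₂ _≤_ (trans (sym (^-homo-* x m (n ℕ.∸ m))) (cong (x ^_) (ℕP.m+[n∸m]≡n m≤n))) (*-identityʳ (x ^ m))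
    (*-monoʳ (x ^ m) (^-nonneg m 0≤x) (^≤1 (n ℕ.∸ m) 0≤x x≤1))

^-monoʳ : ∀ {x m n} → 1ℚ ≤ x → m ℕ.≤ n → x ^ m ≤ x ^ n
^-monoʳ {x} {m} {n} 1≤x m≤n =
  subst₂ _≤_ (*-identityʳ (x ^ m)) (trans (sym (^-homo-* x m (n ℕ.∸ m))) (cong (x ^_) (ℕP.m+[n∸m]≡n m≤n)))
    (*-monoʳ (x ^ m) (^-nonneg m (≤-trans 0≤1 1≤x)) (1≤^ (n ℕ.∸ m) 1≤x))

½^≡ : ∀ n → ½^ n ≡ ½ ^ n
½^≡ zero    = refl
½^≡ (suc n) = cong (½ *_) (½^≡ n)

fromℕℚ-+ : ∀ m n → fromℕℚ (m ℕ.+ n) ≡ fromℕℚ m + fromℕℚ n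
fromℕℚ-+ zero    n = sym (+-identityˡ (fromℕℚ n))
fromℕℚ-+ (suc m) n = trans (fromℕℚ-suc (m ℕ.+ n)) (trans (cong (1ℚ +_) (fromℕℚ-+ m n))
  (trans (sym (+-assoc 1ℚ (fromℕℚ m) (fromℕℚ n))) (cong (_+ fromℕℚ n) (sym (fromℕℚ-suc m)))))

fromℕℚ-* : ∀ m n → fromℕℚ (m ℕ.* n) ≡ fromℕℚ m * fromℕℚ n
fromℕℚ-* zero    n = sym (*-zeroˡ (fromℕℚ n))
fromℕℚ-* (suc m) n = trans (fromℕℚ-+ n (m ℕ.* n)) (trans (cong (fromℕℚ n +_) (fromℕℚ-* m n))
  (trans (e (fromℕℚ n) (fromℕℚ m)) (cong (_* fromℕℚ n) (sym (fromℕℚ-suc m)))))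
  where
  e : ∀ n m → n + m * n ≡ (1ℚ + m) * n
  e = solve-∀ ℚ-ring

fromℕℚ-^ : ∀ m n → fromℕℚ (m ℕ.^ n) ≡ fromℕℚ m ^ n
fromℕℚ-^ m zero    = refl
fromℕℚ-^ m (suc n) = trans (fromℕℚ-* m (m ℕ.^ n)) (cong (fromℕℚ m *_) (fromℕℚ-^ m n))

0≤fromℕℚ : ∀ n → 0ℚ ≤ fromℕℚ n
0≤fromℕℚ n = nonNegative⁻¹ (fromℕℚ n)

fromℕℚ-mono : ∀ {m n} → m ℕ.≤ n → fromℕℚ m ≤ fromℕℚ n
fromℕℚ-mono {m} {n} m≤n = by-diff (fromℕℚ (n ℕ.∸ m)) (0≤fromℕℚ (n ℕ.∸ m))
  (trans (sym (fromℕℚ-+ m (n ℕ.∸ m))) (cong fromℕℚ (ℕP.m+[n∸m]≡n m≤n)))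

fromℕℚ-cancel-≤ : ∀ {m n} → fromℕℚ m ≤ fromℕℚ n → m ℕ.≤ n
fromℕℚ-cancel-≤ {m} {n} h with m ℕP.≤? n
... | yes m≤n = m≤n
... | no  m≰n = ⊥-elim (<-irrefl refl (<-≤-trans (<-≤-trans
  (subst (_< 1ℚ + fromℕℚ n) (+-identityˡ (fromℕℚ n)) (+-monoˡ-< (fromℕℚ n) (positive⁻¹ 1ℚ)))
  (≤-trans (≤-reflexive (sym (fromℕℚ-suc n))) (fromℕℚ-mono (ℕP.≰⇒> m≰n)))) h))

floor : ∀ x → 0ℚ ≤ x → ∃ λ d → fromℕℚ d ≤ x × x ≤ fromℕℚ (suc d)
floor x 0≤x = go (proj₁ (≤fromℕℚ x)) (≤-trans (proj₂ (≤fromℕℚ x)) (fromℕℚ-mono (ℕP.n≤1+n _)))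
  where
  go : ∀ n → x ≤ fromℕℚ (suc n) → ∃ λ d → fromℕℚ d ≤ x × x ≤ fromℕℚ (suc d)
  go zero h = 0 , 0≤x , h
  go (suc n) h with ≤-total (fromℕℚ (suc n)) x
  ... | inj₁ le = suc n , le , h
  ... | inj₂ ge = go n ge

-- A converse to Bernoulli's inequality. The induction step produces a surplus `y * (2 n y)`, which
-- is at most the spare `y` on the right. It evaluates the sums arising in the union bounds over
-- subsets and over maps.
1+^≤ : ∀ {y} n → 0ℚ ≤ y → 2ℚ * (fromℕℚ n * y) ≤ 1ℚ → (1ℚ + y) ^ n ≤ 1ℚ + 2ℚ * (fromℕℚ n * y)
1+^≤ {y} zero    0≤y h = ≤-reflexive (sym (cong (λ z → 1ℚ + 2ℚ * z) (*-zeroˡ y)))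
1+^≤ {y} (suc n) 0≤y h = ≤-trans
  (*-monoʳ (1ℚ + y) (+-nonneg 0≤1 0≤y) (1+^≤ n 0≤y h′))
  (by-diff (y * (1ℚ - 2ℚ * (fromℕℚ n * y))) (*-nonneg 0≤y (0≤-diff h′))
    (trans (e y (fromℕℚ n)) (cong (λ m → 1ℚ + 2ℚ * (m * y)) (sym (fromℕℚ-suc n)))))
  where
  h′ : 2ℚ * (fromℕℚ n * y) ≤ 1ℚ
  h′ = ≤-trans (*-monoʳ 2ℚ 0≤2 (*-monoˡ y 0≤y (fromℕℚ-mono (ℕP.n≤1+n n)))) h
  e : ∀ y n → (1ℚ + y) * (1ℚ + 2ℚ * (n * y)) + y * (1ℚ - 2ℚ * (n * y)) ≡ 1ℚ + 2ℚ * ((1ℚ + n) * y)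
  e = solve-∀ ℚ-ring

-- Replaces the extraction of roots: inequalities that involve fractional powers of `n` are proved
-- after raising both sides to a power.
^-cancel : ∀ {x y} n → 0ℚ ≤ x → 0ℚ ≤ y → x ^ suc n ≤ y ^ suc n → x ≤ y
^-cancel {x} {y} n 0≤x 0≤y h with x ≤? y
... | yes x≤y = x≤y
... | no  x≰y = ⊥-elim (<-irrefl refl (<-≤-trans (lt n (≰⇒> x≰y)) h))
  where
  lt : ∀ n → y < x → y ^ suc n < x ^ suc n
  lt zero    y<x = subst₂ _<_ (sym (*-identityʳ y)) (sym (*-identityʳ x)) y<x
  lt (suc n) y<x = ≤-<-trans (*-monoʳ y 0≤y (<⇒≤ (lt n y<x)))
    (*-monoˡ-<-pos (x ^ suc n) {{positive (^-pos (suc n) (≤-<-trans 0≤y y<x))}} y<x)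

-- Rational certificates for bounds on the exponential function

total up down : List ℚ → ℚ
total = List.foldr _+_ 0ℚ
up    = List.foldr (λ u z → (1ℚ + u) * z) 1ℚ
down  = List.foldr (λ d z → (1ℚ - d) * z) 1ℚ

Frac : ℚ → Set
Frac d = 0ℚ ≤ d × d ≤ 1ℚ

up-nonneg : ∀ {us} → All (0ℚ ≤_) us → 0ℚ ≤ up us
up-nonneg []           = 0≤1
up-nonneg (0≤u ∷ 0≤us) = *-nonneg (+-nonneg 0≤1 0≤u) (up-nonneg 0≤us)

total-nonneg : ∀ {us} → All (0ℚ ≤_) us → 0ℚ ≤ total us
total-nonneg []           = ≤-refl
total-nonneg (0≤u ∷ 0≤us) = +-nonneg 0≤u (total-nonneg 0≤us)

1-d≤1 : ∀ d → 0ℚ ≤ d → 1ℚ - d ≤ 1ℚ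
1-d≤1 d 0≤d = by-diff d 0≤d (e d)
  where
  e : ∀ d → (1ℚ - d) + d ≡ 1ℚ
  e = solve-∀ ℚ-ring

down-frac : ∀ {ds} → All Frac ds → Frac (down ds)
down-frac [] = 0≤1 , ≤-refl
down-frac {d ∷ ds} ((0≤d , d≤1) ∷ fs) = let (l , u) = down-frac fs in
  *-nonneg (0≤-diff d≤1) l , *-mono₂ (0≤-diff d≤1) l (1-d≤1 d 0≤d) u

-- While the running factor 1 + r has r ≤ 0 it absorbs an up factor, otherwise a
-- down factor; either way the product of the two is at most 1 plus the sum.
up*down≤1 : ∀ us ds → All (0ℚ ≤_) us → All Frac ds → total us ≤ total ds → up us * down ds ≤ 1ℚ
up*down≤1 us ds 0≤us fs le = subst (_≤ 1ℚ) (e₀ (up us) (down ds))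
    (go 0ℚ us ds 0≤1+0 0≤us fs (subst (_≤ total ds) (sym (+-identityˡ (total us))) le))
  where
  0≤1+0 : 0ℚ ≤ 1ℚ + 0ℚ
  0≤1+0 = 0≤1
  e₀ : ∀ x y → (1ℚ + 0ℚ) * x * y ≡ x * y
  e₀ = solve-∀ ℚ-ring
  absorb-up : ∀ r u z → r ≤ 0ℚ → 0ℚ ≤ u → 0ℚ ≤ z → (1ℚ + r) * ((1ℚ + u) * z) ≤ (1ℚ + (r + u)) * z
  absorb-up r u z r≤0 0≤u 0≤z =
    by-diff ((0ℚ - r) * u * z) (*-nonneg (*-nonneg (0≤-diff r≤0) 0≤u) 0≤z) (e r u z)
    where
    e : ∀ r u z → (1ℚ + r) * ((1ℚ + u) * z) + (0ℚ - r) * u * z ≡ (1ℚ + (r + u)) * z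
    e = solve-∀ ℚ-ring
  absorb-down : ∀ r d z → 0ℚ ≤ r → 0ℚ ≤ d → 0ℚ ≤ z → (1ℚ + r) * ((1ℚ - d) * z) ≤ (1ℚ + (r - d)) * z
  absorb-down r d z 0≤r 0≤d 0≤z =
    by-diff (r * d * z) (*-nonneg (*-nonneg 0≤r 0≤d) 0≤z) (e r d z)
    where
    e : ∀ r d z → (1ℚ + r) * ((1ℚ - d) * z) + r * d * z ≡ (1ℚ + (r - d)) * z
    e = solve-∀ ℚ-ring
  1+r≤1 : ∀ r → r ≤ 0ℚ → 1ℚ + r ≤ 1ℚ
  1+r≤1 r r≤0 = ≤-trans (+-monoʳ-≤ 1ℚ r≤0) (≤-reflexive (+-identityʳ 1ℚ))
  0≤1+r+u : ∀ r u → 0ℚ ≤ 1ℚ + r → 0ℚ ≤ u → 0ℚ ≤ 1ℚ + (r + u)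
  0≤1+r+u r u h 0≤u = subst (0ℚ ≤_) (+-assoc 1ℚ r u) (+-nonneg h 0≤u)
  r≤0 : ∀ r x → 0ℚ ≤ x → r + x ≤ 0ℚ → r ≤ 0ℚ
  r≤0 r x 0≤x h = ≤-trans (≤-trans (≤-reflexive (sym (+-identityʳ r))) (+-monoʳ-≤ r 0≤x)) h
  ups : ∀ r us → 0ℚ ≤ 1ℚ + r → All (0ℚ ≤_) us → r + total us ≤ 0ℚ → (1ℚ + r) * up us ≤ 1ℚ
  ups r [] 0≤r [] h = ≤-trans (≤-reflexive (*-identityʳ (1ℚ + r))) (1+r≤1 r (r≤0 r 0ℚ ≤-refl h))
  ups r (u ∷ us) 0≤r (0≤u ∷ 0≤us) h = ≤-trans
    (absorb-up r u (up us) (r≤0 r (u + total us) (+-nonneg 0≤u (total-nonneg 0≤us)) h) 0≤u (up-nonneg 0≤us))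
    (ups (r + u) us (0≤1+r+u r u 0≤r 0≤u) 0≤us (≤-trans (≤-reflexive (+-assoc r u (total us))) h))
  go : ∀ r us ds → 0ℚ ≤ 1ℚ + r → All (0ℚ ≤_) us → All Frac ds → r + total us ≤ total ds →
    (1ℚ + r) * up us * down ds ≤ 1ℚ
  go r us [] 0≤r 0≤us [] h = ≤-trans (≤-reflexive (*-identityʳ ((1ℚ + r) * up us))) (ups r us 0≤r 0≤us h)
  go r us (d ∷ ds) 0≤r 0≤us (f ∷ fs) h with ≤-total r 0ℚ
  go r [] (d ∷ ds) 0≤r [] fs h | inj₁ r≤0 =
    *-mono₂ (*-nonneg 0≤r 0≤1) (proj₁ (down-frac fs))
      (≤-trans (≤-reflexive (*-identityʳ (1ℚ + r))) (1+r≤1 r r≤0)) (proj₂ (down-frac fs))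
  go r (u ∷ us) (d ∷ ds) 0≤r (0≤u ∷ 0≤us) fs h | inj₁ r≤0 = ≤-trans
    (*-monoˡ (down (d ∷ ds)) (proj₁ (down-frac fs)) (absorb-up r u (up us) r≤0 0≤u (up-nonneg 0≤us)))
    (go (r + u) us (d ∷ ds) (0≤1+r+u r u 0≤r 0≤u) 0≤us fs (≤-trans (≤-reflexive (+-assoc r u (total us))) h))
  go r us (d ∷ ds) 0≤r 0≤us ((0≤d , d≤1) ∷ fs) h | inj₂ 0≤r′ = ≤-trans
    (subst₂ _≤_ (e₁ r (up us) ((1ℚ - d) * down ds)) (e₂ (r - d) (down ds) (up us))
      (*-monoˡ (up us) (up-nonneg 0≤us) (absorb-down r d (down ds) 0≤r′ 0≤d (proj₁ (down-frac fs)))))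
    (go (r - d) us ds (subst (0ℚ ≤_) (e₃ r d) (+-nonneg 0≤r′ (0≤-diff d≤1))) 0≤us fs
      (≤-diff (subst (0ℚ ≤_) (e₄ d (total ds) r (total us)) (0≤-diff h))))
    where
    e₁ : ∀ r x y → (1ℚ + r) * y * x ≡ (1ℚ + r) * x * y
    e₁ = solve-∀ ℚ-ring
    e₂ : ∀ r y x → (1ℚ + r) * y * x ≡ (1ℚ + r) * x * y
    e₂ = solve-∀ ℚ-ring
    e₃ : ∀ r d → r + (1ℚ - d) ≡ 1ℚ + (r - d)
    e₃ = solve-∀ ℚ-ring
    e₄ : ∀ d y r x → d + y - (r + x) ≡ y - (r - d + x)
    e₄ = solve-∀ ℚ-ring

-- Grow y z is a certificate of z ≤ exp y, and Decay y w one of w ≤ exp (- y).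
record Grow (y z : ℚ) : Set where
  constructor grow
  field
    us    : List ℚ
    0≤us  : All (0ℚ ≤_) us
    us≤y  : total us ≤ y
    z≤us  : z ≤ up us

record Decay (y w : ℚ) : Set where
  constructor decay
  field
    ds    : List ℚ
    fracs : All Frac ds
    y≤ds  : y ≤ total ds
    w≤ds  : w ≤ down ds

-- The exponentials in `z ≤ exp y` and `w ≤ exp (- y)` cancel. Comparisons between powers and `n`
-- are obtained by building the two certificates with matching exponents.
grow*decay≤1 : ∀ {y z w} → Grow y z → Decay y w → 0ℚ ≤ w → z * w ≤ 1ℚ
grow*decay≤1 {y} {z} {w} (grow us 0≤us us≤y z≤us) (decay ds fs y≤ds w≤ds) 0≤w =
  ≤-trans (*-mono 0≤w (up-nonneg 0≤us) z≤us w≤ds) (up*down≤1 us ds 0≤us fs (≤-trans us≤y y≤ds))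

total-++ : ∀ us vs → total (us ++ vs) ≡ total us + total vs
total-++ []       vs = sym (+-identityˡ (total vs))
total-++ (u ∷ us) vs = trans (cong (u +_) (total-++ us vs)) (sym (+-assoc u (total us) (total vs)))

up-++ : ∀ us vs → up (us ++ vs) ≡ up us * up vs
up-++ []       vs = sym (*-identityˡ (up vs))
up-++ (u ∷ us) vs = trans (cong ((1ℚ + u) *_) (up-++ us vs)) (sym (*-assoc (1ℚ + u) (up us) (up vs)))

down-++ : ∀ us vs → down (us ++ vs) ≡ down us * down vs
down-++ []       vs = sym (*-identityˡ (down vs))
down-++ (u ∷ us) vs = trans (cong ((1ℚ - u) *_) (down-++ us vs)) (sym (*-assoc (1ℚ - u) (down us) (down vs)))

grow-mono : ∀ {y y′ z z′} → y ≤ y′ → z′ ≤ z → Grow y z → Grow y′ z′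
grow-mono y≤ z≤ (grow us a b c) = grow us a (≤-trans b y≤) (≤-trans z≤ c)

grow-1 : Grow 0ℚ 1ℚ
grow-1 = grow [] [] ≤-refl ≤-refl

grow-1+ : ∀ {y} → 0ℚ ≤ y → Grow y (1ℚ + y)
grow-1+ {y} 0≤y = grow (y ∷ []) (0≤y ∷ []) (≤-reflexive (+-identityʳ y)) (≤-reflexive (sym (*-identityʳ (1ℚ + y))))

grow-* : ∀ {y y′ z z′} → 0ℚ ≤ z → 0ℚ ≤ z′ → Grow y z → Grow y′ z′ → Grow (y + y′) (z * z′)
grow-* 0≤z 0≤z′ (grow us a b c) (grow us′ a′ b′ c′) = grow (us ++ us′) (AllP.++⁺ a a′)
  (subst (_≤ _) (sym (total-++ us us′)) (+-mono-≤ b b′))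
  (subst (_ ≤_) (sym (up-++ us us′)) (*-mono₂ 0≤z 0≤z′ c c′))

grow-^ : ∀ {y z} n → 0ℚ ≤ z → Grow y z → Grow (fromℕℚ n * y) (z ^ n)
grow-^ {y} zero    0≤z g = subst (λ y → Grow y 1ℚ) (sym (*-zeroˡ y)) grow-1
grow-^ {y} {z} (suc n) 0≤z g = subst (λ y → Grow y (z * z ^ n))
  (trans (e y (fromℕℚ n)) (cong (_* y) (sym (fromℕℚ-suc n))))
  (grow-* 0≤z (^-nonneg n 0≤z) g (grow-^ n 0≤z g))
  where
  e : ∀ y n → y + n * y ≡ (1ℚ + n) * y
  e = solve-∀ ℚ-ring

decay-mono : ∀ {y y′ w w′} → y′ ≤ y → w′ ≤ w → Decay y w → Decay y′ w′
decay-mono y≤ w≤ (decay ds a b c) = decay ds a (≤-trans y≤ b) (≤-trans w≤ c)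

decay-1 : Decay 0ℚ 1ℚ
decay-1 = decay [] [] ≤-refl ≤-refl

decay-1- : ∀ {y} → Frac y → Decay y (1ℚ - y)
decay-1- {y} fy = decay (y ∷ []) (fy ∷ []) (≤-reflexive (sym (+-identityʳ y))) (≤-reflexive (sym (*-identityʳ (1ℚ - y))))

decay-* : ∀ {y y′ w w′} → 0ℚ ≤ w → 0ℚ ≤ w′ → Decay y w → Decay y′ w′ → Decay (y + y′) (w * w′)
decay-* 0≤w 0≤w′ (decay ds a b c) (decay ds′ a′ b′ c′) = decay (ds ++ ds′) (AllP.++⁺ a a′)
  (subst (_ ≤_) (sym (total-++ ds ds′)) (+-mono-≤ b b′))
  (subst (_ ≤_) (sym (down-++ ds ds′)) (*-mono₂ 0≤w 0≤w′ c c′))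

decay-^ : ∀ {y w} n → 0ℚ ≤ w → Decay y w → Decay (fromℕℚ n * y) (w ^ n)
decay-^ {y} zero    0≤w g = subst (λ y → Decay y 1ℚ) (sym (*-zeroˡ y)) decay-1
decay-^ {y} {w} (suc n) 0≤w g = subst (λ y → Decay y (w * w ^ n))
  (trans (e y (fromℕℚ n)) (cong (_* y) (sym (fromℕℚ-suc n))))
  (decay-* 0≤w (^-nonneg n 0≤w) g (decay-^ n 0≤w g))
  where
  e : ∀ y n → y + n * y ≡ (1ℚ + n) * y
  e = solve-∀ ℚ-ring

grow-2^ : ∀ j → Grow (fromℕℚ j) (2ℚ ^ j)
grow-2^ j = subst (λ y → Grow y (2ℚ ^ j)) (*-identityʳ (fromℕℚ j)) (grow-^ j 0≤2 (grow-1+ 0≤1))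

decay-½^ : ∀ j → Decay (fromℕℚ j * ½) (½ ^ j)
decay-½^ j = decay-^ j 0≤½ (decay-1- (0≤½ , ½≤1))

2^*½^ : ∀ j → 2ℚ ^ j * ½ ^ j ≡ 1ℚ
2^*½^ j = trans (sym (^-distrib-* 2ℚ ½ j)) (1^ j)

0≤2^ : ∀ j → 0ℚ ≤ 2ℚ ^ j
0≤2^ j = ^-nonneg j 0≤2

0≤½^′ : ∀ j → 0ℚ ≤ ½ ^ j
0≤½^′ j = ^-nonneg j 0≤½

z*w≤1⇒w≤ : ∀ z w u → 0ℚ ≤ u → z * u ≡ 1ℚ → z * w ≤ 1ℚ → w ≤ u
z*w≤1⇒w≤ z w u 0≤u zu≡1 h = subst₂ _≤_ (trans (e u z w) (trans (cong (_* w) zu≡1) (*-identityˡ w))) (*-identityʳ u)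
  (*-monoʳ u 0≤u h)
  where
  e : ∀ u z w → u * (z * w) ≡ (z * u) * w
  e = solve-∀ ℚ-ring

-- `1 - ½` certifies `½ ≤ exp (- ½)`, that is `exp ½ ≤ 2`; hence the factor `½` in the hypothesis.
-- The conversion `decay⇒≤½^` rests on `2 ≤ exp 1` instead and loses no such factor.
grow⇒≤2^ : ∀ {y z} j → y ≤ fromℕℚ j * ½ → Grow y z → z ≤ 2ℚ ^ j
grow⇒≤2^ {y} {z} j y≤ g = z*w≤1⇒w≤ (½ ^ j) z (2ℚ ^ j) (0≤2^ j) (trans (*-comm (½ ^ j) (2ℚ ^ j)) (2^*½^ j))
  (subst (_≤ 1ℚ) (*-comm z (½ ^ j)) (grow*decay≤1 (grow-mono y≤ ≤-refl g) (decay-½^ j) (0≤½^′ j)))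

decay⇒≤½^ : ∀ {y w} j → 0ℚ ≤ w → fromℕℚ j ≤ y → Decay y w → w ≤ ½ ^ j
decay⇒≤½^ {w = w} j 0≤w j≤y d = z*w≤1⇒w≤ (2ℚ ^ j) w (½ ^ j) (0≤½^′ j) (2^*½^ j) (grow*decay≤1 (grow-2^ j) (decay-mono j≤y ≤-refl d) 0≤w)

grow-nonneg : ∀ {y z} → Grow y z → 0ℚ ≤ y
grow-nonneg (grow us a b c) = ≤-trans (total-nonneg a) b

-- Certificates from Riemann sums of the logarithm

mid : ℚ → ℚ → ℚ
mid a b = ½ * (a + b)

a≤mid : ∀ {a b} → a ≤ b → a ≤ mid a b
a≤mid {a} {b} a≤b = mid-≥ {a} {b} {a} ≤-refl a≤b

mid≤b : ∀ {a b} → a ≤ b → mid a b ≤ b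
mid≤b {a} {b} a≤b = by-diff (½ * (b - a)) (*-nonneg 0≤½ (0≤-diff a≤b)) (e a b)
  where
  e : ∀ a b → ½ * (a + b) + ½ * (b - a) ≡ b
  e = solve-∀ ℚ-ring

*-recip-assoc : ∀ b x → 0ℚ < b → b * (x * recip b) ≡ x
*-recip-assoc b x 0<b = trans (e b x (recip b)) (trans (cong (x *_) (*-recip 0<b)) (*-identityʳ x))
  where
  e : ∀ b x r → b * (x * r) ≡ x * (b * r)
  e = solve-∀ ℚ-ring

-- A right-endpoint term is `δ = (b - a) / b`, and `1 - δ` is exactly `a / b`. Over a subdivision
-- these ratios telescope, so there is no error term.
decay-riemann : ∀ k {a b} → 0ℚ < a → a ≤ b → Decay (riemann k a b) (a * recip b)
decay-riemann zero {a} {b} 0<a a≤b =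
  subst (Decay δ) (trans (cong (_- δ) (sym (*-recip 0<b))) (e a b (recip b)))
    (decay-1- (*-nonneg (0≤-diff a≤b) 0≤r , ≤-trans (*-monoˡ (recip b) 0≤r b-a≤b) (≤-reflexive (*-recip 0<b))))
  where
  0<b = <-≤-trans 0<a a≤b
  0≤r = <⇒≤ (recip-pos 0<b)
  δ = (b - a) * recip b
  b-a≤b : b - a ≤ b
  b-a≤b = by-diff a (<⇒≤ 0<a) (e′ a b)
    where
    e′ : ∀ a b → b - a + a ≡ b
    e′ = solve-∀ ℚ-ring
  e : ∀ a b r → b * r - (b - a) * r ≡ a * r
  e = solve-∀ ℚ-ring
decay-riemann (suc k) {a} {b} 0<a a≤b = subst (Decay (riemann (suc k) a b)) eq
    (decay-* (*-nonneg (<⇒≤ 0<a) (<⇒≤ (recip-pos 0<m))) (*-nonneg (<⇒≤ 0<m) (<⇒≤ (recip-pos (<-≤-trans 0<a a≤b))))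
      (decay-riemann k 0<a (a≤mid a≤b)) (decay-riemann k 0<m (mid≤b a≤b)))
  where
  m = mid a b
  0<m : 0ℚ < m
  0<m = <-≤-trans 0<a (a≤mid a≤b)
  e : ∀ a m r s → a * r * (m * s) ≡ (m * r) * (a * s)
  e = solve-∀ ℚ-ring
  eq : a * recip m * (m * recip b) ≡ a * recip b
  eq = trans (e a m (recip m) (recip b)) (trans (cong (_* (a * recip b)) (*-recip 0<m)) (*-identityˡ (a * recip b)))

-- The factors 1 + δ of the Riemann sum fall short of the ratios b / a by 1 - δ².
grow-riemann : ∀ k {a b c h} → 0ℚ < c → c ≤ a → a ≤ b → 0ℚ ≤ h → b - a ≤ h * c →
  ∃ λ z → Grow (riemann k a b) z × 0ℚ ≤ z × b * (1ℚ - ½^ k * (h * h)) ≤ a * z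
grow-riemann zero {a} {b} {c} {h} 0<c c≤a a≤b 0≤h b-a≤ =
    1ℚ + δ , grow-1+ 0≤δ , +-nonneg 0≤1 0≤δ ,
    subst (b * (1ℚ - 1ℚ * (h * h)) ≤_) eq
      (by-diff (b * (h * h - δ * δ)) (*-nonneg (<⇒≤ 0<b) (0≤-diff (*-mono₂ 0≤δ 0≤δ δ≤h δ≤h))) (e b h δ))
  where
  0<b = <-≤-trans 0<c (≤-trans c≤a a≤b)
  0≤r = <⇒≤ (recip-pos 0<b)
  δ = (b - a) * recip b
  0≤δ = *-nonneg (0≤-diff a≤b) 0≤r
  δ≤h : δ ≤ h
  δ≤h = ≤-trans (*-monoˡ (recip b) 0≤r (≤-trans b-a≤ (*-monoʳ h 0≤h (≤-trans c≤a a≤b))))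
    (≤-reflexive (trans (*-assoc h b (recip b)) (trans (cong (h *_) (*-recip 0<b)) (*-identityʳ h))))
  bδ : b * δ ≡ b - a
  bδ = *-recip-assoc b (b - a) 0<b
  e : ∀ b h δ → b * (1ℚ - 1ℚ * (h * h)) + b * (h * h - δ * δ) ≡ (b - b * δ) * (1ℚ + δ)
  e = solve-∀ ℚ-ring
  eq : (b - b * δ) * (1ℚ + δ) ≡ a * (1ℚ + δ)
  eq = cong (_* (1ℚ + δ)) (trans (cong (λ x → b - x) bδ) (e′ b a))
    where
    e′ : ∀ b a → b - (b - a) ≡ a
    e′ = solve-∀ ℚ-ring
grow-riemann (suc k) {a} {b} {c} {h} 0<c c≤a a≤b 0≤h b-a≤ = step
    (grow-riemann k {a} {m} {c} {½ * h} 0<c c≤a (a≤mid a≤b) (*-nonneg 0≤½ 0≤h)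
      (subst₂ _≤_ (e₁ a b) (e₂ h c) (*-monoʳ ½ 0≤½ b-a≤)))
    (grow-riemann k {m} {b} {c} {½ * h} 0<c (≤-trans c≤a (a≤mid a≤b)) (mid≤b a≤b) (*-nonneg 0≤½ 0≤h)
      (subst₂ _≤_ (e₃ a b) (e₂ h c) (*-monoʳ ½ 0≤½ b-a≤)))
  where
  e₁ : ∀ a b → ½ * (b - a) ≡ ½ * (a + b) - a
  e₁ = solve-∀ ℚ-ring
  e₂ : ∀ h c → ½ * (h * c) ≡ ½ * h * c
  e₂ = solve-∀ ℚ-ring
  e₃ : ∀ a b → ½ * (b - a) ≡ b - ½ * (a + b)
  e₃ = solve-∀ ℚ-ring
  m = mid a b
  x = ½^ k * (½ * h * (½ * h))
  0≤b = ≤-trans (<⇒≤ 0<c) (≤-trans c≤a a≤b)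
  0≤a = ≤-trans (<⇒≤ 0<c) c≤a
  0≤x : 0ℚ ≤ x
  0≤x = *-nonneg (0≤½^ k) (*-nonneg (*-nonneg 0≤½ 0≤h) (*-nonneg 0≤½ 0≤h))
  e₄ : ∀ f h → ½ * f * (h * h) ≡ f * (½ * h * (½ * h)) + f * (½ * h * (½ * h))
  e₄ = solve-∀ ℚ-ring
  e₅ : ∀ b x → b * (1ℚ - (x + x)) + b * (x * x) ≡ b * (1ℚ - x) * (1ℚ - x)
  e₅ = solve-∀ ℚ-ring
  e₆ : ∀ m x z → m * z * (1ℚ - x) ≡ (m * (1ℚ - x)) * z
  e₆ = solve-∀ ℚ-ring
  e₇ : ∀ b x → b * (1ℚ - (x + x)) + b * (x + x - 1ℚ) ≡ 0ℚ
  e₇ = solve-∀ ℚ-ring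
  product : ∀ z z′ → 0ℚ ≤ z → 0ℚ ≤ z′ → m * (1ℚ - x) ≤ a * z → b * (1ℚ - x) ≤ m * z′ →
    b * (1ℚ - (x + x)) ≤ a * (z * z′)
  -- If `x + x` exceeds 1, the left side is not positive. Otherwise `1 - x` is nonnegative, so the
  -- two inequalities may be multiplied, and `1 - 2x ≤ (1 - x)²`.
  product z z′ 0≤z 0≤z′ hz hz′ with ≤-total (x + x) 1ℚ
  ... | inj₁ le = ≤-trans (by-diff (b * (x * x)) (*-nonneg 0≤b (*-nonneg 0≤x 0≤x)) (e₅ b x))
      (≤-trans (*-monoˡ (1ℚ - x) 0≤1-x hz′)
        (≤-trans (≤-reflexive (e₆ m x z′)) (≤-trans (*-monoˡ z′ 0≤z′ hz) (≤-reflexive (*-assoc a z z′)))))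
    where
    0≤1-x : 0ℚ ≤ 1ℚ - x
    0≤1-x = 0≤-diff {x} {1ℚ} (≤-trans {x} {x + x} {1ℚ} (by-diff x 0≤x refl) le)
  ... | inj₂ ge = ≤-trans (by-diff (b * (x + x - 1ℚ)) (*-nonneg 0≤b (0≤-diff ge)) (e₇ b x))
      (*-nonneg 0≤a (*-nonneg 0≤z 0≤z′))
  step : (∃ λ z → Grow (riemann k a m) z × 0ℚ ≤ z × m * (1ℚ - x) ≤ a * z) →
    (∃ λ z → Grow (riemann k m b) z × 0ℚ ≤ z × b * (1ℚ - x) ≤ m * z) →
    ∃ λ z → Grow (riemann k a m + riemann k m b) z × 0ℚ ≤ z × b * (1ℚ - ½ * ½^ k * (h * h)) ≤ a * z
  step (z , g , 0≤z , hz) (z′ , g′ , 0≤z′ , hz′) =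
    z * z′ , grow-* 0≤z 0≤z′ g g′ , *-nonneg 0≤z 0≤z′ ,
    subst (λ y → b * (1ℚ - y) ≤ a * (z * z′)) (sym (e₄ (½^ k) h)) (product z z′ 0≤z 0≤z′ hz hz′)

riemann≤ : ∀ k {a b} → 1ℚ ≤ a → a ≤ b → riemann k a b ≤ b - a
riemann≤ zero {a} {b} 1≤a a≤b = ≤-trans (*-monoʳ (b - a) (0≤-diff a≤b) (recip-anti (positive⁻¹ 1ℚ) (≤-trans 1≤a a≤b)))
  (≤-reflexive (*-identityʳ (b - a)))
riemann≤ (suc k) {a} {b} 1≤a a≤b = ≤-trans
  (+-mono-≤ (riemann≤ k 1≤a (a≤mid a≤b)) (riemann≤ k (≤-trans 1≤a (a≤mid a≤b)) (mid≤b a≤b)))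
  (≤-reflexive (e a b))
  where
  e : ∀ a b → ½ * (a + b) - a + (b - ½ * (a + b)) ≡ b - a
  e = solve-∀ ℚ-ring

-- Right-endpoint sums stay below the integral, so `x` itself cannot be certified in general. Once
-- the mesh makes the relative error of `grow-riemann` at most `½`, half of `x` can, which costs
-- only constants in the probability bounds.
grow-riemann-½ : ∀ k {x} → 1ℚ ≤ x → ½^ k * (x * x) ≤ ½ → Grow (riemann k 1ℚ x) (½ * x)
grow-riemann-½ k {x} 1≤x h = weaken (grow-riemann k {1ℚ} {x} {1ℚ} {x} (positive⁻¹ 1ℚ) ≤-refl 1≤x (≤-trans 0≤1 1≤x)
    (by-diff 1ℚ 0≤1 (e x)))
  where
  e : ∀ x → x - 1ℚ + 1ℚ ≡ x * 1ℚ
  e = solve-∀ ℚ-ring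
  e′ : ∀ x f → ½ * x + x * (½ - f) ≡ x * (1ℚ - f)
  e′ = solve-∀ ℚ-ring
  weaken : (∃ λ z → Grow (riemann k 1ℚ x) z × 0ℚ ≤ z × x * (1ℚ - ½^ k * (x * x)) ≤ 1ℚ * z) →
    Grow (riemann k 1ℚ x) (½ * x)
  weaken (z , g , 0≤z , hz) = grow-mono ≤-refl
    (≤-trans (by-diff (x * (½ - ½^ k * (x * x))) (*-nonneg (≤-trans 0≤1 1≤x) (0≤-diff h)) (e′ x (½^ k * (x * x))))
      (≤-trans hz (≤-reflexive (*-identityˡ z)))) g

-- Finite sums and products, and expectations over independent coins

module _ {B : Set} where

  ΣL ΠL : List B → (B → ℚ) → ℚ
  ΣL []       f = 0ℚ
  ΣL (x ∷ xs) f = f x + ΣL xs f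
  ΠL []       f = 1ℚ
  ΠL (x ∷ xs) f = f x * ΠL xs f

  ΣL-cong : ∀ xs {f g} → (∀ x → f x ≡ g x) → ΣL xs f ≡ ΣL xs g
  ΣL-cong []       h = refl
  ΣL-cong (x ∷ xs) h = cong₂ _+_ (h x) (ΣL-cong xs h)

  ΣL-mono : ∀ xs {f g} → (∀ x → f x ≤ g x) → ΣL xs f ≤ ΣL xs g
  ΣL-mono []       h = ≤-refl
  ΣL-mono (x ∷ xs) h = +-mono-≤ (h x) (ΣL-mono xs h)

  ΣL-nonneg : ∀ xs {f} → (∀ x → 0ℚ ≤ f x) → 0ℚ ≤ ΣL xs f
  ΣL-nonneg []       h = ≤-refl
  ΣL-nonneg (x ∷ xs) h = +-nonneg (h x) (ΣL-nonneg xs h)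

  ΣL-∈ : ∀ {xs f x} → (∀ x → 0ℚ ≤ f x) → x ∈ xs → f x ≤ ΣL xs f
  ΣL-∈ {y ∷ xs} {f} h (here refl) = by-diff (ΣL xs f) (ΣL-nonneg xs h) refl
  ΣL-∈ {y ∷ xs} {f} {x} h (there x∈) = ≤-trans (ΣL-∈ h x∈)
    (by-diff (f y) (h y) (+-comm (ΣL xs f) (f y)))

  ΣL-+ : ∀ xs f g → ΣL xs (λ x → f x + g x) ≡ ΣL xs f + ΣL xs g
  ΣL-+ []       f g = refl
  ΣL-+ (x ∷ xs) f g = trans (cong (f x + g x +_) (ΣL-+ xs f g)) (e (f x) (g x) (ΣL xs f) (ΣL xs g))
    where
    e : ∀ a b c d → a + b + (c + d) ≡ a + c + (b + d)
    e = solve-∀ ℚ-ring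

  ΣL-* : ∀ xs c f → ΣL xs (λ x → c * f x) ≡ c * ΣL xs f
  ΣL-* []       c f = sym (*-zeroʳ c)
  ΣL-* (x ∷ xs) c f = trans (cong (c * f x +_) (ΣL-* xs c f)) (sym (*-distribˡ-+ c (f x) (ΣL xs f)))

  ΣL-const : ∀ xs c → ΣL xs (λ _ → c) ≡ fromℕℚ (length xs) * c
  ΣL-const []       c = sym (*-zeroˡ c)
  ΣL-const (x ∷ xs) c = trans (cong (c +_) (ΣL-const xs c))
    (trans (e c (fromℕℚ (length xs))) (cong (_* c) (sym (fromℕℚ-suc (length xs)))))
    where
    e : ∀ c n → c + n * c ≡ (1ℚ + n) * c
    e = solve-∀ ℚ-ring

  ΣL-++ : ∀ xs ys f → ΣL (xs ++ ys) f ≡ ΣL xs f + ΣL ys f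
  ΣL-++ []       ys f = sym (+-identityˡ (ΣL ys f))
  ΣL-++ (x ∷ xs) ys f = trans (cong (f x +_) (ΣL-++ xs ys f)) (sym (+-assoc (f x) (ΣL xs f) (ΣL ys f)))

  ΠL-cong : ∀ xs {f g} → (∀ {x} → x ∈ xs → f x ≡ g x) → ΠL xs f ≡ ΠL xs g
  ΠL-cong []       h = refl
  ΠL-cong (x ∷ xs) h = cong₂ _*_ (h (here refl)) (ΠL-cong xs (h ∘ there))

  ΠL-nonneg : ∀ xs {f} → (∀ x → 0ℚ ≤ f x) → 0ℚ ≤ ΠL xs f
  ΠL-nonneg []       h = 0≤1
  ΠL-nonneg (x ∷ xs) h = *-nonneg (h x) (ΠL-nonneg xs h)

  ΠL-* : ∀ xs f g → ΠL xs (λ x → f x * g x) ≡ ΠL xs f * ΠL xs g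
  ΠL-* []       f g = refl
  ΠL-* (x ∷ xs) f g = trans (cong (f x * g x *_) (ΠL-* xs f g)) (e (f x) (g x) (ΠL xs f) (ΠL xs g))
    where
    e : ∀ a b c d → a * b * (c * d) ≡ a * c * (b * d)
    e = solve-∀ ℚ-ring

ΣL-map : ∀ {B C : Set} (h : B → C) xs f → ΣL (map h xs) f ≡ ΣL xs (f ∘ h)
ΣL-map h []       f = refl
ΣL-map h (x ∷ xs) f = cong (f (h x) +_) (ΣL-map h xs f)

𝟙 : ∀ {ℓ} {P : Set ℓ} → Dec P → ℚ
𝟙 d = if does d then 1ℚ else 0ℚ

module Expectation (p : ℚ) where

  q : ℚ
  q = 1ℚ - p

  p+q : ∀ x → p * x + q * x ≡ x
  p+q x = e p x
    where
    e : ∀ p x → p * x + (1ℚ - p) * x ≡ x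
    e = solve-∀ ℚ-ring

  -- No bound on `p` is built in: as a polynomial in `p`, the expectation also makes sense at
  -- rational approximations of a real probability that fall slightly outside the unit interval.
  Ex : ∀ n → (Vec Bool n → ℚ) → ℚ
  Ex zero    f = f []
  Ex (suc n) f = p * Ex n (λ s → f (true ∷ s)) + q * Ex n (λ s → f (false ∷ s))

  Ex-cong : ∀ n {f g} → (∀ s → f s ≡ g s) → Ex n f ≡ Ex n g
  Ex-cong zero    h = h []
  Ex-cong (suc n) h = cong₂ (λ x y → p * x + q * y) (Ex-cong n (h ∘ (true ∷_))) (Ex-cong n (h ∘ (false ∷_)))

  Ex-const : ∀ n c → Ex n (λ _ → c) ≡ c
  Ex-const zero    c = refl
  Ex-const (suc n) c = trans (cong₂ (λ x y → p * x + q * y) (Ex-const n c) (Ex-const n c)) (p+q c)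

  Ex-+ : ∀ n f g → Ex n (λ s → f s + g s) ≡ Ex n f + Ex n g
  Ex-+ zero    f g = refl
  Ex-+ (suc n) f g = trans
    (cong₂ (λ x y → p * x + q * y) (Ex-+ n (f ∘ (true ∷_)) (g ∘ (true ∷_))) (Ex-+ n (f ∘ (false ∷_)) (g ∘ (false ∷_))))
    (e p q (Ex n (f ∘ (true ∷_))) (Ex n (g ∘ (true ∷_))) (Ex n (f ∘ (false ∷_))) (Ex n (g ∘ (false ∷_))))
    where
    e : ∀ p q a b c d → p * (a + b) + q * (c + d) ≡ (p * a + q * c) + (p * b + q * d)
    e = solve-∀ ℚ-ring

  Ex-* : ∀ n c f → Ex n (λ s → c * f s) ≡ c * Ex n f
  Ex-* zero    c f = refl
  Ex-* (suc n) c f = trans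
    (cong₂ (λ x y → p * x + q * y) (Ex-* n c (f ∘ (true ∷_))) (Ex-* n c (f ∘ (false ∷_))))
    (e p q c (Ex n (f ∘ (true ∷_))) (Ex n (f ∘ (false ∷_))))
    where
    e : ∀ p q c a b → p * (c * a) + q * (c * b) ≡ c * (p * a + q * b)
    e = solve-∀ ℚ-ring

  Ex-ΣL : ∀ {B : Set} n (xs : List B) (f : B → Vec Bool n → ℚ) →
    Ex n (λ s → ΣL xs (λ x → f x s)) ≡ ΣL xs (λ x → Ex n (f x))
  Ex-ΣL n []       f = Ex-const n 0ℚ
  Ex-ΣL n (x ∷ xs) f = trans (Ex-+ n (f x) (λ s → ΣL xs (λ x → f x s))) (cong (Ex n (f x) +_) (Ex-ΣL n xs f))

  Ex-mono : 0ℚ ≤ p → 0ℚ ≤ q → ∀ n {f g} → (∀ s → f s ≤ g s) → Ex n f ≤ Ex n g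
  Ex-mono 0≤p 0≤q zero    h = h []
  Ex-mono 0≤p 0≤q (suc n) h = +-mono-≤
    (*-monoʳ p 0≤p (Ex-mono 0≤p 0≤q n (h ∘ (true ∷_)))) (*-monoʳ q 0≤q (Ex-mono 0≤p 0≤q n (h ∘ (false ∷_))))

module _ {A : Set} (_≟ᴬ_ : DecidableEquality A) where

  chi : (xs : List A) → Vec Bool (length xs) → A → Bool
  chi []       s       y = false
  chi (x ∷ xs) (b ∷ s) y with x ≟ᴬ y
  ... | yes _ = b
  ... | no  _ = chi xs s y

  chi-here : ∀ x xs b s → chi (x ∷ xs) (b ∷ s) x ≡ b
  chi-here x xs b s with x ≟ᴬ x
  ... | yes _   = refl
  ... | no  x≢x = ⊥-elim (x≢x refl)

  chi-there : ∀ x xs b s {y} → x ≢ y → chi (x ∷ xs) (b ∷ s) y ≡ chi xs s y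
  chi-there x xs b s {y} x≢y with x ≟ᴬ y
  ... | yes x≡y = ⊥-elim (x≢y x≡y)
  ... | no  _   = refl

  select : (xs : List A) → Vec Bool (length xs) → List A
  select []       s           = []
  select (x ∷ xs) (true  ∷ s) = x ∷ select xs s
  select (x ∷ xs) (false ∷ s) = select xs s

  select⊆ : ∀ xs s {y} → y ∈ select xs s → y ∈ xs
  select⊆ (x ∷ xs) (true  ∷ s) (here e)  = here e
  select⊆ (x ∷ xs) (true  ∷ s) (there m) = there (select⊆ xs s m)
  select⊆ (x ∷ xs) (false ∷ s) m         = there (select⊆ xs s m)

  ∈select⇒chi : ∀ xs s {y} → Unique xs → y ∈ select xs s → chi xs s y ≡ true
  ∈select⇒chi (x ∷ xs) (true ∷ s) u (here refl) = chi-here x xs true s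
  ∈select⇒chi (x ∷ xs) (true ∷ s) (x∉ ∷ u) (there m) =
    trans (chi-there x xs true s (All.lookup x∉ (select⊆ xs s m))) (∈select⇒chi xs s u m)
  ∈select⇒chi (x ∷ xs) (false ∷ s) (x∉ ∷ u) m =
    trans (chi-there x xs false s (All.lookup x∉ (select⊆ xs s m))) (∈select⇒chi xs s u m)

  chi⇒∈select : ∀ xs s {y} → chi xs s y ≡ true → y ∈ select xs s
  chi⇒∈select (x ∷ xs) (b ∷ s) {y} h with x ≟ᴬ y
  chi⇒∈select (x ∷ xs) (true  ∷ s) h | yes refl = here refl
  chi⇒∈select (x ∷ xs) (true  ∷ s) h | no _     = there (chi⇒∈select xs s h)
  chi⇒∈select (x ∷ xs) (false ∷ s) h | no _     = chi⇒∈select xs s h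

  merge : (A → Bool) → (xs : List A) → (s t : Vec Bool (length xs)) → Vec Bool (length xs)
  merge σ []       s       t       = []
  merge σ (x ∷ xs) (b ∷ s) (c ∷ t) = (if σ x then b else c) ∷ merge σ xs s t

  chi-merge : ∀ σ xs s t y → chi xs (merge σ xs s t) y ≡ (if σ y then chi xs s y else chi xs t y)
  chi-merge σ [] s t y with σ y
  ... | true  = refl
  ... | false = refl
  chi-merge σ (x ∷ xs) (b ∷ s) (c ∷ t) y with x ≟ᴬ y
  ... | yes refl = refl
  ... | no  _    = chi-merge σ xs s t y

  module _ (p : ℚ) where
    open Expectation p

    -- Independence of the coins. Distinctness matters because `chi` gives a repeated entry the coin
    -- of its first occurrence.
    Ex-ΠL : ∀ {xs} → Unique xs → (φ : A → Bool → ℚ) →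
      Ex (length xs) (λ s → ΠL xs (λ x → φ x (chi xs s x))) ≡ ΠL xs (λ x → p * φ x true + q * φ x false)
    Ex-ΠL [] φ = refl
    Ex-ΠL {x ∷ xs} (x∉ ∷ u) φ = trans (cong₂ (λ y z → p * y + q * z) (half true) (half false))
        (e p q (φ x true) (φ x false) (ΠL xs (λ x → p * φ x true + q * φ x false)))
      where
      e : ∀ p q a b c → p * (a * c) + q * (b * c) ≡ (p * a + q * b) * c
      e = solve-∀ ℚ-ring
      half : ∀ b → Ex (length xs) (λ s → ΠL (x ∷ xs) (λ y → φ y (chi (x ∷ xs) (b ∷ s) y)))
        ≡ φ x b * ΠL xs (λ x → p * φ x true + q * φ x false)
      half b = trans (Ex-cong (length xs) (λ s → cong₂ _*_ (cong (φ x) (chi-here x xs b s))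
          (ΠL-cong xs (λ {y} y∈ → cong (φ y) (chi-there x xs b s (All.lookup x∉ y∈))))))
        (trans (Ex-* (length xs) (φ x b) (λ s → ΠL xs (λ x → φ x (chi xs s x)))) (cong (φ x b *_) (Ex-ΠL u φ)))

    -- Resampling the coordinates outside σ does not change the distribution.
    Ex-merge : ∀ σ xs f →
      Ex (length xs) f ≡ Ex (length xs) (λ s → Ex (length xs) (λ t → f (merge σ xs s t)))
    Ex-merge σ []       f = refl
    Ex-merge σ (x ∷ xs) f with σ x
    ... | true  = cong₂ (λ y z → p * y + q * z)
      (trans (Ex-merge σ xs (f ∘ (true ∷_))) (Ex-cong (length xs) (λ s → sym (p+q (Ex (length xs) (λ t → f (true ∷ merge σ xs s t)))))))
      (trans (Ex-merge σ xs (f ∘ (false ∷_))) (Ex-cong (length xs) (λ s → sym (p+q (Ex (length xs) (λ t → f (false ∷ merge σ xs s t)))))))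
    ... | false = trans (cong₂ (λ y z → p * y + q * z) (Ex-merge σ xs (f ∘ (true ∷_))) (Ex-merge σ xs (f ∘ (false ∷_))))
      (trans (sym (trans (Ex-+ (length xs) (λ s → p * F s) (λ s → q * G s))
                    (cong₂ _+_ (Ex-* (length xs) p F) (Ex-* (length xs) q G))))
        (sym (p+q (Ex (length xs) (λ s → p * F s + q * G s)))))
      where
      F G : Vec Bool (length xs) → ℚ
      F s = Ex (length xs) (λ t → f (true ∷ merge σ xs s t))
      G s = Ex (length xs) (λ t → f (false ∷ merge σ xs s t))

    weight : ℕ → List A → ℚ
    weight n S = p ^ length S * q ^ (n ℕ.∸ length S)

    length-sublists : ∀ xs → All (λ S → length S ℕ.≤ length xs) (sublists {A} xs)
    length-sublists []       = ℕ.z≤n ∷ []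
    length-sublists (x ∷ xs) = AllP.++⁺ (AllP.map⁺ (All.map ℕ.s≤s (length-sublists xs)))
      (All.map (λ h → ℕP.≤-trans h (ℕP.n≤1+n _)) (length-sublists xs))

    -- `select` produces the sublists from the vectors of coins, and the weight of a sublist is the
    -- probability of its vector.
    Σ-sublists : ∀ xs (f : List A → ℚ) →
      ΣL (sublists xs) (λ S → f S * weight (length xs) S) ≡ Ex (length xs) (λ s → f (select xs s))
    Σ-sublists []       f = trans (+-identityʳ (f [] * 1ℚ)) (*-identityʳ (f []))
    Σ-sublists (x ∷ xs) f = trans (ΣL-++ (map (x ∷_) (sublists xs)) (sublists xs) _) (cong₂ _+_
        (trans (ΣL-map (x ∷_) (sublists xs) _)
          (trans (ΣL-cong (sublists xs) (λ S → e (f (x ∷ S)) p (p ^ length S) (q ^ (length xs ℕ.∸ length S))))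
            (trans (ΣL-* (sublists xs) p _) (cong (p *_) (Σ-sublists xs (f ∘ (x ∷_)))))))
        (trans (shift (sublists xs) (length-sublists xs))
          (trans (ΣL-* (sublists xs) q _) (cong (q *_) (Σ-sublists xs f)))))
      where
      e : ∀ a p b c → a * ((p * b) * c) ≡ p * (a * (b * c))
      e = solve-∀ ℚ-ring
      e′ : ∀ a q b c → a * (b * (q * c)) ≡ q * (a * (b * c))
      e′ = solve-∀ ℚ-ring
      -- Subtraction is truncated: passing from `length xs` to its successor adds a factor `q` only
      -- because no sublist is longer than `xs`.
      shift : ∀ Ss → All (λ S → length S ℕ.≤ length xs) Ss →
        ΣL Ss (λ S → f S * weight (suc (length xs)) S) ≡ ΣL Ss (λ S → q * (f S * weight (length xs) S))
      shift []       []       = refl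
      shift (S ∷ Ss) (h ∷ hs) = cong₂ _+_
        (trans (cong (λ k → f S * (p ^ length S * q ^ k)) (ℕP.+-∸-assoc 1 h))
          (e′ (f S) q (p ^ length S) (q ^ (length xs ℕ.∸ length S))))
        (shift Ss hs)

    Σ-filter : ∀ {P : Pred (List A) 0ℓ} (P? : Decidable P) Ss (w : List A → ℚ) →
      List.foldr _+_ 0ℚ (map w (filter P? Ss)) ≡ ΣL Ss (λ S → 𝟙 (P? S) * w S)
    Σ-filter P? []       w = refl
    Σ-filter P? (S ∷ Ss) w with does (P? S)
    ... | true  = cong₂ _+_ (sym (*-identityˡ (w S))) (Σ-filter P? Ss w)
    ... | false = trans (Σ-filter P? Ss w) (sym (trans (cong (_+ ΣL Ss (λ S → 𝟙 (P? S) * w S)) (*-zeroˡ (w S))) (+-identityˡ (ΣL Ss (λ S → 𝟙 (P? S) * w S)))))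

-- Counting with Boolean predicates

⟦_⟧ : Bool → ℕ
⟦ true  ⟧ = 1
⟦ false ⟧ = 0

infix 4 _==_
_==_ : ∀ {n} → Fin n → Fin n → Bool
i == j = does (i FinP.≟ j)

==-refl : ∀ {n} (i : Fin n) → (i == i) ≡ true
==-refl i with i FinP.≟ i
... | yes _  = refl
... | no i≢i = ⊥-elim (i≢i refl)

==⇒≡ : ∀ {n} {i j : Fin n} → (i == j) ≡ true → i ≡ j
==⇒≡ {i = i} {j} h with i FinP.≟ j
... | yes i≡j = i≡j

≢⇒== : ∀ {n} {i j : Fin n} → i ≢ j → (i == j) ≡ false
≢⇒== {i = i} {j} i≢j with i FinP.≟ j
... | yes i≡j = ⊥-elim (i≢j i≡j)
... | no _    = refl

true≢false : true ≢ false
true≢false ()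

sum-mono : ∀ {n} {f g : Fin n → ℕ} → (∀ i → f i ℕ.≤ g i) → sum f ℕ.≤ sum g
sum-mono {zero}  h = ℕ.z≤n
sum-mono {suc n} h = ℕP.+-mono-≤ (h zero) (sum-mono (h ∘ suc))

sum-const : ∀ n c → sum {n} (λ _ → c) ≡ n ℕ.* c
sum-const zero    c = refl
sum-const (suc n) c = cong (c ℕ.+_) (sum-const n c)

sum-0 : ∀ {n} {f : Fin n → ℕ} → (∀ i → f i ≡ 0) → sum f ≡ 0
sum-0 {n} h = trans (sum-cong-≗ h) (trans (sum-const n 0) (ℕP.*-zeroʳ n))

# : ∀ {n} → (Fin n → Bool) → ℕ
# B = sum (λ i → ⟦ B i ⟧)

⟦⟧-mono : ∀ {b c} → (b ≡ true → c ≡ true) → ⟦ b ⟧ ℕ.≤ ⟦ c ⟧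
⟦⟧-mono {false} h = ℕ.z≤n
⟦⟧-mono {true}  h rewrite h refl = ℕP.≤-refl

⟦⟧≤1 : ∀ b → ⟦ b ⟧ ℕ.≤ 1
⟦⟧≤1 true  = ℕP.≤-refl
⟦⟧≤1 false = ℕ.z≤n

⟦⟧-cover : ∀ {b c d} → (b ≡ true → c ≡ true ⊎ d ≡ true) → ⟦ b ⟧ ℕ.≤ ⟦ c ⟧ ℕ.+ ⟦ d ⟧
⟦⟧-cover {false} h = ℕ.z≤n
⟦⟧-cover {true} {c} h with h refl
... | inj₁ refl = ℕ.s≤s ℕ.z≤n
... | inj₂ refl = ℕP.m≤n+m 1 ⟦ c ⟧

⟦⟧-disjoint : ∀ {b c d} → (c ≡ true → b ≡ true) → (d ≡ true → b ≡ true) → (c ≡ true → d ≡ true → ⊥) →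
  ⟦ c ⟧ ℕ.+ ⟦ d ⟧ ℕ.≤ ⟦ b ⟧
⟦⟧-disjoint {c = false} {false} h k l = ℕ.z≤n
⟦⟧-disjoint {c = false} {true}  h k l rewrite k refl = ℕP.≤-refl
⟦⟧-disjoint {c = true}  {false} h k l rewrite h refl = ℕP.≤-refl
⟦⟧-disjoint {c = true}  {true}  h k l = ⊥-elim (l refl refl)

module _ {n : ℕ} where

  #-cong : ∀ {B C : Fin n → Bool} → (∀ i → B i ≡ C i) → # B ≡ # C
  #-cong h = sum-cong-≗ (λ i → cong ⟦_⟧ (h i))

  #-mono : ∀ {B C : Fin n → Bool} → (∀ i → B i ≡ true → C i ≡ true) → # B ℕ.≤ # C
  #-mono h = sum-mono (λ i → ⟦⟧-mono (h i))

  #-cover : ∀ {B C D : Fin n → Bool} → (∀ i → B i ≡ true → C i ≡ true ⊎ D i ≡ true) → # B ℕ.≤ # C ℕ.+ # D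
  #-cover {B} {C} {D} h = ℕP.≤-trans (sum-mono (λ i → ⟦⟧-cover (h i)))
    (ℕP.≤-reflexive (∑-distrib-+ (λ i → ⟦ C i ⟧) (λ i → ⟦ D i ⟧)))

  #-disjoint : ∀ {B C D : Fin n → Bool} → (∀ i → C i ≡ true → B i ≡ true) → (∀ i → D i ≡ true → B i ≡ true) →
    (∀ i → C i ≡ true → D i ≡ true → ⊥) → # C ℕ.+ # D ℕ.≤ # B
  #-disjoint {B} {C} {D} h k l = ℕP.≤-trans (ℕP.≤-reflexive (sym (∑-distrib-+ (λ i → ⟦ C i ⟧) (λ i → ⟦ D i ⟧))))
    (sum-mono (λ i → ⟦⟧-disjoint (h i) (k i) (l i)))

  #-all : ∀ {B : Fin n → Bool} → (∀ i → B i ≡ true) → # B ≡ n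
  #-all h = trans (#-cong h) (trans (sum-const n 1) (ℕP.*-identityʳ n))

  #-none : ∀ {B : Fin n → Bool} → (∀ i → B i ≡ false) → # B ≡ 0
  #-none h = sum-0 (λ i → cong ⟦_⟧ (h i))

  #-not : ∀ (B : Fin n → Bool) → # B ℕ.+ # (not ∘ B) ≡ n
  #-not B = trans (sym (∑-distrib-+ (λ i → ⟦ B i ⟧) (λ i → ⟦ not (B i) ⟧)))
    (trans (sum-cong-≗ (λ i → e (B i))) (trans (sum-const n 1) (ℕP.*-identityʳ n)))
    where
    e : ∀ b → ⟦ b ⟧ ℕ.+ ⟦ not b ⟧ ≡ 1
    e true  = refl
    e false = refl

  sum-on-≥ : ∀ (T : Fin n → Bool) (f : Fin n → ℕ) c → (∀ i → T i ≡ true → c ℕ.≤ f i) →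
    # T ℕ.* c ℕ.≤ sum (λ i → ⟦ T i ⟧ ℕ.* f i)
  sum-on-≥ T f c h = ℕP.≤-trans (ℕP.≤-reflexive (trans (ℕP.*-comm (# T) c) (trans (*-distribˡ-sum c (λ i → ⟦ T i ⟧))
      (sum-cong-≗ (λ i → ℕP.*-comm c ⟦ T i ⟧)))))
    (sum-mono (λ i → on (T i) (f i) (h i)))
    where
    on : ∀ b k → (b ≡ true → c ℕ.≤ k) → ⟦ b ⟧ ℕ.* c ℕ.≤ ⟦ b ⟧ ℕ.* k
    on true  k h = ℕP.*-monoʳ-≤ 1 (h refl)
    on false k h = ℕ.z≤n

  sum-on-≤ : ∀ (T : Fin n → Bool) (f : Fin n → ℕ) c → (∀ i → T i ≡ true → f i ℕ.≤ c) →
    sum (λ i → ⟦ T i ⟧ ℕ.* f i) ℕ.≤ # T ℕ.* c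
  sum-on-≤ T f c h = ℕP.≤-trans (sum-mono (λ i → on (T i) (f i) (h i)))
    (ℕP.≤-reflexive (sym (trans (ℕP.*-comm (# T) c) (trans (*-distribˡ-sum c (λ i → ⟦ T i ⟧))
      (sum-cong-≗ (λ i → ℕP.*-comm c ⟦ T i ⟧))))))
    where
    on : ∀ b k → (b ≡ true → k ℕ.≤ c) → ⟦ b ⟧ ℕ.* k ℕ.≤ ⟦ b ⟧ ℕ.* c
    on true  k h = ℕP.*-monoʳ-≤ 1 (h refl)
    on false k h = ℕ.z≤n

#-∃ : ∀ {n} (B : Fin n → Bool) → 1 ℕ.≤ # B → ∃ λ i → B i ≡ true
#-∃ {suc n} B h = go (B zero) refl
  where
  go : ∀ b → B zero ≡ b → ∃ λ i → B i ≡ true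
  go true  e = zero , e
  go false e with #-∃ (B ∘ suc) (ℕP.≤-trans h (ℕP.≤-reflexive (cong (λ b → ⟦ b ⟧ ℕ.+ # (B ∘ suc)) e)))
  ... | i , Bi = suc i , Bi

#-≟ : ∀ {n} (j : Fin n) → # (λ i → i == j) ≡ 1
#-≟ {suc n} zero    = cong suc (sum-0 {n} (λ i → refl))
#-≟ {suc n} (suc j) = trans (#-cong {n} (λ i → e i j)) (#-≟ j)
  where
  e : ∀ i j → (Fin.suc i == suc j) ≡ (i == j)
  e i j with i FinP.≟ j
  ... | yes _ = refl
  ... | no _  = refl

module _ {B : Set} where

  count : List B → (B → Bool) → ℕ
  count []       P = 0
  count (x ∷ xs) P = ⟦ P x ⟧ ℕ.+ count xs P

  count-cong : ∀ xs {P Q : B → Bool} → (∀ {x} → x ∈ xs → P x ≡ Q x) → count xs P ≡ count xs Q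
  count-cong []       h = refl
  count-cong (x ∷ xs) h = cong₂ (λ b k → ⟦ b ⟧ ℕ.+ k) (h (here refl)) (count-cong xs (h ∘ there))

  count-++ : ∀ xs ys (P : B → Bool) → count (xs ++ ys) P ≡ count xs P ℕ.+ count ys P
  count-++ []       ys P = refl
  count-++ (x ∷ xs) ys P = trans (cong (⟦ P x ⟧ ℕ.+_) (count-++ xs ys P)) (sym (ℕP.+-assoc ⟦ P x ⟧ _ _))

  count-filter : ∀ {P : Pred B 0ℓ} (P? : Decidable P) xs (Q : B → Bool) →
    count (filter P? xs) Q ≡ count xs (λ x → does (P? x) ∧ Q x)
  count-filter P? []       Q = refl
  count-filter P? (x ∷ xs) Q with does (P? x)
  ... | true  = cong (⟦ Q x ⟧ ℕ.+_) (count-filter P? xs Q)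
  ... | false = count-filter P? xs Q

  count≤1 : ∀ xs (P : B → Bool) {x y} → count xs P ℕ.≤ 1 → x ∈ xs → y ∈ xs → P x ≡ true → P y ≡ true → x ≡ y
  count≤1 (z ∷ xs) P h (here refl) (here refl) Px Py = refl
  count≤1 (z ∷ xs) P h (here refl) (there y∈) Px Py =
    ⊥-elim (ℕP.<⇒≱ (ℕP.+-mono-≤ {1} (ℕP.≤-reflexive (sym (cong ⟦_⟧ Px))) (∈⇒1≤ y∈ Py)) h)
    where
    ∈⇒1≤ : ∀ {xs y} → y ∈ xs → P y ≡ true → 1 ℕ.≤ count xs P
    ∈⇒1≤ (here refl) e = ℕP.≤-trans (ℕP.≤-reflexive (sym (cong ⟦_⟧ e))) (ℕP.m≤m+n _ _)
    ∈⇒1≤ (there m)   e = ℕP.≤-trans (∈⇒1≤ m e) (ℕP.m≤n+m _ _)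
  count≤1 (z ∷ xs) P h (there x∈) (here refl) Px Py = sym (count≤1 (z ∷ xs) P h (here refl) (there x∈) Py Px)
  count≤1 (z ∷ xs) P h (there x∈) (there y∈) Px Py = count≤1 xs P (ℕP.≤-trans (ℕP.m≤n+m _ ⟦ P z ⟧) h) x∈ y∈ Px Py

count-map : ∀ {B C : Set} (h : B → C) xs (P : C → Bool) → count (map h xs) P ≡ count xs (P ∘ h)
count-map h []       P = refl
count-map h (x ∷ xs) P = cong (⟦ P (h x) ⟧ ℕ.+_) (count-map h xs P)

count-tabulate : ∀ {B : Set} {n} (h : Fin n → B) (P : B → Bool) → count (List.tabulate h) P ≡ # (P ∘ h)
count-tabulate {n = zero}  h P = refl
count-tabulate {n = suc n} h P = cong (⟦ P (h zero) ⟧ ℕ.+_) (count-tabulate (h ∘ suc) P)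

count-product : ∀ {B C : Set} {n} (h : Fin n → B) (ys : List C) (P : B × C → Bool) →
  count (cartesianProduct (List.tabulate h) ys) P ≡ sum (λ i → count ys (λ y → P (h i , y)))
count-product {n = zero}  h ys P = refl
count-product {n = suc n} h ys P = trans (count-++ (map (h zero ,_) ys) (cartesianProduct (List.tabulate (h ∘ suc)) ys) P)
  (cong₂ ℕ._+_ (count-map (h zero ,_) ys P) (count-product (h ∘ suc) ys P))

module _ {n : ℕ} where

  ## : (Fin n → Fin n → Bool) → ℕ
  ## R = sum (λ i → # (R i))

  ##-mono : ∀ {R S : Fin n → Fin n → Bool} → (∀ i j → R i j ≡ true → S i j ≡ true) → ## R ℕ.≤ ## S
  ##-mono h = sum-mono (λ i → #-mono (h i))

  ##-cong : ∀ {R S : Fin n → Fin n → Bool} → (∀ i j → R i j ≡ S i j) → ## R ≡ ## S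
  ##-cong h = sum-cong-≗ (λ i → #-cong (h i))

  ##-transpose : ∀ (R : Fin n → Fin n → Bool) → ## (λ i j → R j i) ≡ ## R
  ##-transpose R = ∑-comm (λ i j → ⟦ R j i ⟧)

  ##-cover : ∀ {R S T : Fin n → Fin n → Bool} → (∀ i j → R i j ≡ true → S i j ≡ true ⊎ T i j ≡ true) →
    ## R ℕ.≤ ## S ℕ.+ ## T
  ##-cover {R} {S} {T} h = ℕP.≤-trans (sum-mono (λ i → #-cover (h i)))
    (ℕP.≤-reflexive (∑-distrib-+ (λ i → # (S i)) (λ i → # (T i))))

  ##-disjoint : ∀ {R S T : Fin n → Fin n → Bool} → (∀ i j → S i j ≡ true → R i j ≡ true) →
    (∀ i j → T i j ≡ true → R i j ≡ true) → (∀ i j → S i j ≡ true → T i j ≡ true → ⊥) →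
    ## S ℕ.+ ## T ℕ.≤ ## R
  ##-disjoint {R} {S} {T} h k l = ℕP.≤-trans (ℕP.≤-reflexive (sym (∑-distrib-+ (λ i → # (S i)) (λ i → # (T i)))))
    (sum-mono (λ i → #-disjoint (h i) (k i) (l i)))

  #-∧ : ∀ b (B : Fin n → Bool) → # (λ j → b ∧ B j) ≡ ⟦ b ⟧ ℕ.* # B
  #-∧ true  B = sym (ℕP.+-identityʳ (# B))
  #-∧ false B = #-none {n} (λ _ → refl)

  ##-on : ∀ (T : Fin n → Bool) (R : Fin n → Fin n → Bool) →
    ## (λ i j → T i ∧ R i j) ≡ sum (λ i → ⟦ T i ⟧ ℕ.* # (R i))
  ##-on T R = sum-cong-≗ (λ i → #-∧ (T i) (R i))

  ##-product : ∀ (S T : Fin n → Bool) → ## (λ i j → S i ∧ T j) ≡ # S ℕ.* # T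
  ##-product S T = trans (##-on S (λ _ → T)) (trans (sum-cong-≗ (λ i → ℕP.*-comm ⟦ S i ⟧ (# T)))
    (trans (sym (*-distribˡ-sum (# T) (λ i → ⟦ S i ⟧))) (ℕP.*-comm (# T) (# S))))

  cnt : (Fin n → Fin n → Bool) → ℕ
  cnt R = count (pairs n) (λ (i , j) → R i j)

  cnt≡ : ∀ R → cnt R ≡ ## (λ i j → does (i FinP.<? j) ∧ R i j)
  cnt≡ R = trans (count-filter (λ (i , j) → i FinP.<? j) (cartesianProduct (allFin n) (allFin n)) (λ (i , j) → R i j))
    (trans (count-product (λ i → i) (allFin n) (λ (i , j) → does (i FinP.<? j) ∧ R i j))
      (sum-cong-≗ (λ i → count-tabulate (λ j → j) (λ j → does (i FinP.<? j) ∧ R i j))))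

  -- `pairs n` lists each unordered pair once, smaller vertex first, whereas `##` runs over ordered
  -- pairs. Doubling removes the order from the later counts of pairs; the factor 2 is cancelled at
  -- the end.
  2cnt : ∀ (R : Fin n → Fin n → Bool) → (∀ i j → R i j ≡ R j i) → (∀ i → R i i ≡ false) → 2 ℕ.* cnt R ≡ ## R
  2cnt R R-sym R-irr = begin
    cnt R ℕ.+ (cnt R ℕ.+ 0)                              ≡⟨ cong (cnt R ℕ.+_) (ℕP.+-identityʳ (cnt R)) ⟩
    cnt R ℕ.+ cnt R                                      ≡⟨ cong₂ ℕ._+_ (cnt≡ R) (trans (cnt≡ R) (sym (##-transpose L))) ⟩
    ## L ℕ.+ ## (λ i j → L j i)                          ≡⟨ ∑-distrib-+ (λ i → # (L i)) (λ i → # (λ j → L j i)) ⟨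
    sum (λ i → # (L i) ℕ.+ # (λ j → L j i))              ≡⟨ sum-cong-≗ (λ i → trans (sym (∑-distrib-+ (λ j → ⟦ L i j ⟧) (λ j → ⟦ L j i ⟧))) (sum-cong-≗ (λ j → split i j))) ⟩
    ## R                                                 ∎
    where
    open ≡-Reasoning
    L : Fin n → Fin n → Bool
    L i j = does (i FinP.<? j) ∧ R i j
    <ᵗ : ∀ {i j : Fin n} → i Fin.< j → does (i FinP.<? j) ≡ true
    <ᵗ {i} {j} h = dec-true (i FinP.<? j) h
    <ᶠ : ∀ {i j : Fin n} → ¬ (i Fin.< j) → does (i FinP.<? j) ≡ false
    <ᶠ {i} {j} ¬h = dec-false (i FinP.<? j) ¬h
    split : ∀ i j → ⟦ L i j ⟧ ℕ.+ ⟦ L j i ⟧ ≡ ⟦ R i j ⟧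
    split i j with FinP.<-cmp i j
    ... | tri< i<j _ j≮i rewrite <ᵗ i<j | <ᶠ j≮i = ℕP.+-identityʳ ⟦ R i j ⟧
    ... | tri≈ i≮j refl _ rewrite <ᶠ i≮j | R-irr i = refl
    ... | tri> i≮j _ j<i rewrite <ᶠ i≮j | <ᵗ j<i = cong ⟦_⟧ (R-sym j i)

-- Sums over all vectors

vecs : ∀ {B : Set} → List B → ∀ m → List (Vec B m)
vecs bs zero    = [] ∷ []
vecs bs (suc m) = cartesianProductWith _∷_ bs (vecs bs m)

∈-vecs : ∀ {B : Set} {bs : List B} → (∀ b → b ∈ bs) → ∀ {m} (v : Vec B m) → v ∈ vecs bs m
∈-vecs all []      = here refl
∈-vecs all (b ∷ v) = ∈-cartesianProductWith⁺ _∷_ (all b) (∈-vecs all v)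

ΠV : ∀ {B : Set} {m} → (Fin m → B → ℚ) → Vec B m → ℚ
ΠV c []      = 1ℚ
ΠV c (b ∷ v) = c zero b * ΠV (c ∘ suc) v

ΠF : ∀ {m} → (Fin m → ℚ) → ℚ
ΠF {zero}  f = 1ℚ
ΠF {suc m} f = f zero * ΠF (f ∘ suc)

ΣL-cartesianProductWith : ∀ {B C D : Set} (h : B → C → D) bs cs f →
  ΣL (cartesianProductWith h bs cs) f ≡ ΣL bs (λ b → ΣL cs (λ c → f (h b c)))
ΣL-cartesianProductWith h []       cs f = refl
ΣL-cartesianProductWith h (b ∷ bs) cs f = trans (ΣL-++ (map (h b) cs) (cartesianProductWith h bs cs) f)
  (cong₂ _+_ (ΣL-map (h b) cs f) (ΣL-cartesianProductWith h bs cs f))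

-- The distributive law. It evaluates a sum over all `2 ^ n` subsets or all `n ^ n` maps in closed
-- form when the summand is a product over the vertices.
Σ-ΠV : ∀ {B : Set} (bs : List B) m (c : Fin m → B → ℚ) → ΣL (vecs bs m) (ΠV c) ≡ ΠF (λ i → ΣL bs (c i))
Σ-ΠV bs zero    c = refl
Σ-ΠV bs (suc m) c = trans (ΣL-cartesianProductWith _∷_ bs (vecs bs m) (ΠV c))
  (trans (ΣL-cong bs (λ b → trans (ΣL-* (vecs bs m) (c zero b) (ΠV (c ∘ suc))) (*-comm (c zero b) _)))
    (trans (ΣL-* bs (ΣL (vecs bs m) (ΠV (c ∘ suc))) (c zero))
      (trans (*-comm _ (ΣL bs (c zero))) (cong (ΣL bs (c zero) *_) (Σ-ΠV bs m (c ∘ suc))))))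

ΠF-const : ∀ m c → ΠF {m} (λ _ → c) ≡ c ^ m
ΠF-const zero    c = refl
ΠF-const (suc m) c = cong (c *_) (ΠF-const m c)

ΠF-mono : ∀ {m} {f g : Fin m → ℚ} → (∀ i → 0ℚ ≤ f i) → (∀ i → f i ≤ g i) → ΠF f ≤ ΠF g
ΠF-mono {zero}  h k = ≤-refl
ΠF-mono {suc m} h k = *-mono₂ (h zero) (nonneg (h ∘ suc)) (k zero) (ΠF-mono (h ∘ suc) (k ∘ suc))
  where
  nonneg : ∀ {m} {f : Fin m → ℚ} → (∀ i → 0ℚ ≤ f i) → 0ℚ ≤ ΠF f
  nonneg {zero}  h = 0≤1
  nonneg {suc m} h = *-nonneg (h zero) (nonneg (h ∘ suc))

ΠV-^ : ∀ {B : Set} {m} w (b : Fin m → B → Bool) (v : Vec B m) →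
  ΠV (λ i a → if b i a then w else 1ℚ) v ≡ w ^ # (λ i → b i (lookup v i))
ΠV-^ w b []      = refl
ΠV-^ w b (a ∷ v) with b zero a
... | true  = cong (w *_) (ΠV-^ w (b ∘ suc) v)
... | false = trans (*-identityˡ _) (ΠV-^ w (b ∘ suc) v)

-- Requirements on the edges of a random graph

data Tag : Set where
  free tilt forb req : Tag

isTilt isForb isReq : Tag → Bool
isTilt tilt = true
isTilt _    = false
isForb forb = true
isForb _    = false
isReq  req  = true
isReq  _    = false

-- `forb` and `req` act as indicators, while `tilt` weighs an edge by `l`, as in an exponential
-- moment: `l` above 1 serves upper tails, `l` below 1 lower tails.
φ : ℚ → Tag → Bool → ℚ
φ l free b     = 1ℚ
φ l tilt true  = l
φ l tilt false = 1ℚ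
φ l forb true  = 0ℚ
φ l forb false = 1ℚ
φ l req  true  = 1ℚ
φ l req  false = 0ℚ

φ-nonneg : ∀ {l} → 0ℚ ≤ l → ∀ t b → 0ℚ ≤ φ l t b
φ-nonneg 0≤l free b     = 0≤1
φ-nonneg 0≤l tilt true  = 0≤l
φ-nonneg 0≤l tilt false = 0≤1
φ-nonneg 0≤l forb true  = ≤-refl
φ-nonneg 0≤l forb false = 0≤1
φ-nonneg 0≤l req  true  = 0≤1
φ-nonneg 0≤l req  false = ≤-refl

module _ {B : Set} where

  ΠL-tag : ∀ (τ : B → Tag) (f : Tag → ℚ) → f free ≡ 1ℚ → ∀ xs →
    ΠL xs (λ x → f (τ x)) ≡ f tilt ^ count xs (isTilt ∘ τ) * (f forb ^ count xs (isForb ∘ τ) * f req ^ count xs (isReq ∘ τ))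
  ΠL-tag τ f f1 []       = refl
  ΠL-tag τ f f1 (x ∷ xs) with τ x | ΠL-tag τ f f1 xs
  ... | free | ih = trans (cong₂ _*_ f1 ih) (*-identityˡ _)
  ... | tilt | ih = trans (cong (f tilt *_) ih) (sym (*-assoc (f tilt) _ _))
  ... | forb | ih = trans (cong (f forb *_) ih) (e (f forb) (f tilt ^ count xs (isTilt ∘ τ)) (f forb ^ count xs (isForb ∘ τ)) (f req ^ count xs (isReq ∘ τ)))
    where
    e : ∀ a b c d → a * (b * (c * d)) ≡ b * ((a * c) * d)
    e = solve-∀ ℚ-ring
  ... | req  | ih = trans (cong (f req *_) ih) (e (f req) (f tilt ^ count xs (isTilt ∘ τ)) (f forb ^ count xs (isForb ∘ τ)) (f req ^ count xs (isReq ∘ τ)))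
    where
    e : ∀ a b c d → a * (b * (c * d)) ≡ b * (c * (a * d))
    e = solve-∀ ℚ-ring

  ΠL-φ : ∀ l (τ : B → Tag) (g : B → Bool) → (∀ x → τ x ≡ forb → g x ≡ false) → (∀ x → τ x ≡ req → g x ≡ true) →
    ∀ xs → ΠL xs (λ x → φ l (τ x) (g x)) ≡ l ^ count xs (λ x → isTilt (τ x) ∧ g x)
  ΠL-φ l τ g hf hr []       = refl
  ΠL-φ l τ g hf hr (x ∷ xs) = step (τ x) (g x) refl refl
    where
    ih = ΠL-φ l τ g hf hr xs
    c = count xs (λ x → isTilt (τ x) ∧ g x)
    step : ∀ t b → τ x ≡ t → g x ≡ b →
      φ l (τ x) (g x) * ΠL xs (λ x → φ l (τ x) (g x)) ≡ l ^ (⟦ isTilt (τ x) ∧ g x ⟧ ℕ.+ c)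
    step free b e e′ rewrite e = trans (*-identityˡ _) ih
    step tilt true  e e′ rewrite e | e′ = cong (l *_) ih
    step tilt false e e′ rewrite e | e′ = trans (*-identityˡ _) ih
    step forb true  e e′ = ⊥-elim (true≢false (trans (sym e′) (hf x e)))
    step forb false e e′ rewrite e | e′ = trans (*-identityˡ _) ih
    step req  true  e e′ rewrite e | e′ = trans (*-identityˡ _) ih
    step req  false e e′ = ⊥-elim (true≢false (trans (sym (hr x e)) e′))

-- The random graph and bounds on outer probabilities

∈pairs⇒< : ∀ {n} {i j : Fin n} → (i , j) ∈ pairs n → i Fin.< j
∈pairs⇒< {n} m = proj₂ (∈-filter⁻ (λ (i , j) → i FinP.<? j) {xs = cartesianProduct (allFin n) (allFin n)} m)

<⇒∈pairs : ∀ {n} {i j : Fin n} → i Fin.< j → (i , j) ∈ pairs n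
<⇒∈pairs {n} {i} {j} i<j = ∈-filter⁺ (λ (i , j) → i FinP.<? j) (∈-cartesianProduct⁺ (∈-allFin i) (∈-allFin j)) i<j

pairs-unique : ∀ n → Unique (pairs n)
pairs-unique n = UniqueP.filter⁺ _ (UniqueP.cartesianProduct⁺ (UniqueP.allFin⁺ n) (UniqueP.allFin⁺ n))

module Sample (n : ℕ) where

  Coins : Set
  Coins = Vec Bool (length (pairs n))

  _≟ᴾ_ : DecidableEquality (Fin n × Fin n)
  _≟ᴾ_ = ≡-dec FinP._≟_ FinP._≟_

  edge : Fin n → Fin n → Fin n × Fin n
  edge i j = if does (i FinP.<? j) then (i , j) else (j , i)

  edge-< : ∀ {i j} → i Fin.< j → edge i j ≡ (i , j)
  edge-< {i} {j} h = cong (λ b → if b then (i , j) else (j , i)) (dec-true (i FinP.<? j) h)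

  edge-≮ : ∀ {i j} → ¬ i Fin.< j → edge i j ≡ (j , i)
  edge-≮ {i} {j} h = cong (λ b → if b then (i , j) else (j , i)) (dec-false (i FinP.<? j) h)

  edge-sym : ∀ {i j} → i ≢ j → edge i j ≡ edge j i
  edge-sym {i} {j} i≢j with FinP.<-cmp i j
  ... | tri< i<j _ j≮i = trans (edge-< i<j) (sym (edge-≮ j≮i))
  ... | tri≈ _ i≡j _   = ⊥-elim (i≢j i≡j)
  ... | tri> i≮j _ j<i = trans (edge-≮ i≮j) (sym (edge-< j<i))

  edge-∈ : ∀ {i j} → i ≢ j → edge i j ∈ pairs n
  edge-∈ {i} {j} i≢j with FinP.<-cmp i j
  ... | tri< i<j _ j≮i = subst (_∈ pairs n) (sym (edge-< i<j)) (<⇒∈pairs i<j)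
  ... | tri≈ _ i≡j _   = ⊥-elim (i≢j i≡j)
  ... | tri> i≮j _ j<i = subst (_∈ pairs n) (sym (edge-≮ i≮j)) (<⇒∈pairs j<i)

  on-edge : ∀ {C : Set} (f : Fin n → Fin n → C) → (∀ i j → f i j ≡ f j i) →
    ∀ i j → f (proj₁ (edge i j)) (proj₂ (edge i j)) ≡ f i j
  on-edge f f-sym i j with does (i FinP.<? j)
  ... | true  = refl
  ... | false = f-sym j i

  adj : Coins → Fin n → Fin n → Bool
  adj s i j = not (i == j) ∧ chi _≟ᴾ_ (pairs n) s (edge i j)

  adj-≢ : ∀ s {i j} → i ≢ j → adj s i j ≡ chi _≟ᴾ_ (pairs n) s (edge i j)
  adj-≢ s {i} {j} i≢j = cong (λ b → not b ∧ chi _≟ᴾ_ (pairs n) s (edge i j)) (≢⇒== i≢j)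

  adj-irr : ∀ s i → adj s i i ≡ false
  adj-irr s i = cong (λ b → not b ∧ chi _≟ᴾ_ (pairs n) s (edge i i)) (==-refl i)

  adj⇒≢ : ∀ s {i j} → adj s i j ≡ true → i ≢ j
  adj⇒≢ s {i} h refl = true≢false (trans (sym h) (adj-irr s i))

  adj-sym : ∀ s i j → adj s i j ≡ adj s j i
  adj-sym s i j with i FinP.≟ j
  ... | yes refl = sym (adj-irr s i)
  ... | no  i≢j  = trans (cong (chi _≟ᴾ_ (pairs n) s) (edge-sym i≢j)) (sym (adj-≢ s (i≢j ∘ sym)))

  adj-pairs : ∀ s {i j} → (i , j) ∈ pairs n → adj s i j ≡ chi _≟ᴾ_ (pairs n) s (i , j)
  adj-pairs s m = trans (adj-≢ s (FinP.<⇒≢ (∈pairs⇒< m))) (cong (chi _≟ᴾ_ (pairs n) s) (edge-< (∈pairs⇒< m)))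

  mergeOn : (Fin n → Fin n → Bool) → Coins → Coins → Coins
  mergeOn σ = merge _≟ᴾ_ (λ (i , j) → σ i j) (pairs n)

  adj-merge : ∀ σ → (∀ i j → σ i j ≡ σ j i) → ∀ s t i j →
    adj (mergeOn σ s t) i j ≡ (if σ i j then adj s i j else adj t i j)
  adj-merge σ σ-sym s t i j = trans (cong (not (i == j) ∧_)
      (trans (chi-merge _≟ᴾ_ (λ (i , j) → σ i j) (pairs n) s t (edge i j))
        (cong (λ b → if b then chi _≟ᴾ_ (pairs n) s (edge i j) else chi _≟ᴾ_ (pairs n) t (edge i j)) (on-edge σ σ-sym i j))))
    (e (σ i j) (not (i == j)))
    where
    e : ∀ b c {x y} → c ∧ (if b then x else y) ≡ (if b then c ∧ x else c ∧ y)
    e true  c = refl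
    e false c = refl

  Tags : Set
  Tags = Fin n → Fin n → Tag

  tilts forbs reqs : Tags → ℕ
  tilts τ = cnt (λ i j → isTilt (τ i j))
  forbs τ = cnt (λ i j → isForb (τ i j))
  reqs  τ = cnt (λ i j → isReq (τ i j))

  tilted : Tags → Coins → ℕ
  tilted τ s = cnt (λ i j → isTilt (τ i j) ∧ adj s i j)

  Φ : ℚ → Tags → Coins → ℚ
  Φ l τ s = ΠL (pairs n) (λ (i , j) → φ l (τ i j) (adj s i j))

  Φ-nonneg : ∀ {l} → 0ℚ ≤ l → ∀ τ s → 0ℚ ≤ Φ l τ s
  Φ-nonneg 0≤l τ s = ΠL-nonneg (pairs n) (λ (i , j) → φ-nonneg 0≤l (τ i j) (adj s i j))

  Φ-value : ∀ l τ s → (∀ i j → τ i j ≡ forb → adj s i j ≡ false) → (∀ i j → τ i j ≡ req → adj s i j ≡ true) →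
    Φ l τ s ≡ l ^ tilted τ s
  Φ-value l τ s hf hr = ΠL-φ l (λ (i , j) → τ i j) (λ (i , j) → adj s i j) (λ (i , j) → hf i j) (λ (i , j) → hr i j) (pairs n)

  module Prob (p : ℚ) (0≤p : 0ℚ ≤ p) (p≤1 : p ≤ 1ℚ) where
    open Expectation p public

    0≤q : 0ℚ ≤ q
    0≤q = 0≤-diff p≤1

    q≤1 : q ≤ 1ℚ
    q≤1 = by-diff p 0≤p (e p)
      where
      e : ∀ p → 1ℚ - p + p ≡ 1ℚ
      e = solve-∀ ℚ-ring

    E : (Coins → ℚ) → ℚ
    E = Ex (length (pairs n))

    E-mono : ∀ {f g} → (∀ s → f s ≤ g s) → E f ≤ E g
    E-mono = Ex-mono 0≤p 0≤q (length (pairs n))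

    tagged : ℚ → Tags → ℚ
    tagged l τ = (q + l * p) ^ tilts τ * (q ^ forbs τ * p ^ reqs τ)

    -- Each pair has its own coin, so the expectation factorises and depends only on how many pairs
    -- carry each tag.
    E-Φ : ∀ l τ → E (Φ l τ) ≡ tagged l τ
    E-Φ l τ = trans (Ex-cong (length (pairs n)) (λ s → ΠL-cong (pairs n) (λ {(i , j)} m → cong (φ l (τ i j)) (adj-pairs s m))))
      (trans (Ex-ΠL _≟ᴾ_ p (pairs-unique n) (λ (i , j) → φ l (τ i j)))
        (trans (ΠL-tag (λ (i , j) → τ i j) (λ t → p * φ l t true + q * φ l t false) (p+q 1ℚ) (pairs n))
          (cong₂ _*_ (cong (_^ tilts τ) (e₁ p l)) (cong₂ _*_ (cong (_^ forbs τ) (e₂ p)) (cong (_^ reqs τ) (e₃ p))))))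
      where
      e₁ : ∀ p l → p * l + (1ℚ - p) * 1ℚ ≡ (1ℚ - p) + l * p
      e₁ = solve-∀ ℚ-ring
      e₂ : ∀ p → p * 0ℚ + (1ℚ - p) * 1ℚ ≡ 1ℚ - p
      e₂ = solve-∀ ℚ-ring
      e₃ : ∀ p → p * 1ℚ + (1ℚ - p) * 0ℚ ≡ p
      e₃ = solve-∀ ℚ-ring

    -- The outer probability of P is at most ε.
    record Small (P : Coins → Set) (ε : ℚ) : Set where
      constructor small
      field
        f      : Coins → ℚ
        0≤f    : ∀ s → 0ℚ ≤ f s
        covers : ∀ s → P s → 1ℚ ≤ f s
        Ef≤ε   : E f ≤ ε

    small-mono : ∀ {P Q ε δ} → (∀ s → Q s → P s) → ε ≤ δ → Small P ε → Small Q δ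
    small-mono h ε≤δ (small f a b c) = small f a (λ s Qs → b s (h s Qs)) (≤-trans c ε≤δ)

    small-⊎ : ∀ {P Q ε δ} → Small P ε → Small Q δ → Small (λ s → P s ⊎ Q s) (ε + δ)
    small-⊎ {P} {Q} {ε} {δ} (small f a b c) (small f′ a′ b′ c′) = small (λ s → f s + f′ s) (λ s → +-nonneg (a s) (a′ s))
      (λ { s (inj₁ Ps) → ≤-trans (b s Ps) (by-diff (f′ s) (a′ s) refl)
         ; s (inj₂ Qs) → ≤-trans (b′ s Qs) (by-diff (f s) (a s) (+-comm (f′ s) (f s))) })
      (subst (_≤ ε + δ) (sym (Ex-+ (length (pairs n)) f f′)) (+-mono-≤ c c′))

    small-∃ : ∀ {B : Set} {P : B → Coins → Set} {ε : B → ℚ} (xs : List B) → (∀ x → Small (P x) (ε x)) →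
      Small (λ s → ∃ λ x → x ∈ xs × P x s) (ΣL xs ε)
    small-∃ {B} {P} {ε} xs h = small (λ s → ΣL xs (λ x → Small.f (h x) s)) (λ s → ΣL-nonneg xs (λ x → Small.0≤f (h x) s))
      (λ s (x , x∈ , Ps) → ≤-trans (Small.covers (h x) s Ps) (ΣL-∈ {f = λ x → Small.f (h x) s} (λ x → Small.0≤f (h x) s) x∈))
      (subst (_≤ ΣL xs ε) (sym (Ex-ΣL (length (pairs n)) xs (λ x → Small.f (h x)))) (ΣL-mono xs (λ x → Small.Ef≤ε (h x))))

    small-𝟙 : ∀ {P ε} (P? : ∀ s → Dec (P s)) → Small P ε → E (λ s → 𝟙 (P? s)) ≤ ε
    small-𝟙 P? (small f a b c) = ≤-trans (E-mono (λ s → le s (P? s))) c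
      where
      le : ∀ s (d : Dec _) → 𝟙 d ≤ f s
      le s (yes Ps) = b s Ps
      le s (no _)   = a s

    -- Markov's inequality for `c * Φ l τ`. On the event the forbidden and required pairs are as
    -- prescribed, so `Φ` is a power of `l`, and `c` is the normalisation that lifts it to at least
    -- 1.
    small-tagged : ∀ {P : Coins → Set} c l τ → 0ℚ ≤ c → 0ℚ ≤ l →
      (∀ s → P s → (∀ i j → τ i j ≡ forb → adj s i j ≡ false) × (∀ i j → τ i j ≡ req → adj s i j ≡ true) ×
        1ℚ ≤ c * l ^ tilted τ s) →
      Small P (c * tagged l τ)
    small-tagged c l τ 0≤c 0≤l h = small (λ s → c * Φ l τ s) (λ s → *-nonneg 0≤c (Φ-nonneg 0≤l τ s))
      (λ s Ps → let (hf , hr , le) = h s Ps in subst (λ z → 1ℚ ≤ c * z) (sym (Φ-value l τ s hf hr)) le)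
      (≤-reflexive (trans (Ex-* (length (pairs n)) c (Φ l τ)) (cong (c *_) (E-Φ l τ))))

    -- Here the tags may depend on the coins in σ, which themselves carry no tag.
    small-exposed : ∀ {P : Coins → Set} c l Q F (σ : Fin n → Fin n → Bool) (τ : Coins → Tags) →
      0ℚ ≤ c → 1ℚ ≤ l → (∀ i j → σ i j ≡ σ j i) →
      (∀ s i j → σ i j ≡ true → τ s i j ≡ free) →
      (∀ s t i j → τ (mergeOn σ s t) i j ≡ τ s i j) →
      (∀ s i j → τ s i j ≢ req) →
      (∀ s → P s → (∀ i j → τ s i j ≡ forb → adj s i j ≡ false) × 1ℚ ≤ c * l ^ tilted (τ s) s ×
        tilts (τ s) ℕ.≤ Q × F ℕ.≤ forbs (τ s)) →
      Small P (c * ((q + l * p) ^ Q * q ^ F))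
    small-exposed {P} c l Q F σ τ 0≤c 1≤l σ-sym τ-σ τ-merge τ-req h =
        small (λ s → f s s) (λ s → f-nonneg s s) f-covers Ef≤
      where
      N = length (pairs n)
      0≤l = ≤-trans 0≤1 1≤l
      -- Exposures whose tag counts violate the bounds `Q` and `F` are discarded, so that the inner
      -- expectation is at most `B` for every `s`.
      guard : ∀ s → Dec (tilts (τ s) ℕ.≤ Q × F ℕ.≤ forbs (τ s))
      guard s = (tilts (τ s) ℕP.≤? Q) ×-dec (F ℕP.≤? forbs (τ s))
      -- The first argument determines the tags, the second is weighed by them. The event sees the
      -- diagonal `f s s`; by `Ex-merge` its expectation is that of `f s t` for independent `s` and
      -- `t`.
      f : Coins → Coins → ℚ
      f s t = 𝟙 (guard s) * (c * Φ l (τ s) t)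
      𝟙-nonneg : ∀ {X : Set} (d : Dec X) → 0ℚ ≤ 𝟙 d
      𝟙-nonneg (yes _) = 0≤1
      𝟙-nonneg (no _)  = ≤-refl
      f-nonneg : ∀ s t → 0ℚ ≤ f s t
      f-nonneg s t = *-nonneg (𝟙-nonneg (guard s)) (*-nonneg 0≤c (Φ-nonneg 0≤l (τ s) t))
      f-covers : ∀ s → P s → 1ℚ ≤ f s s
      f-covers s Ps with h s Ps
      ... | hf , le , g₁ , g₂ = subst (1ℚ ≤_) (sym (trans (cong (λ b → (if b then 1ℚ else 0ℚ) * (c * Φ l (τ s) s)) (dec-true (guard s) (g₁ , g₂)))
            (trans (*-identityˡ _) (cong (c *_) (Φ-value l (τ s) s hf (λ i j e → ⊥-elim (τ-req s i j e))))))) le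
      guard-cong : ∀ s s′ → (∀ i j → τ s i j ≡ τ s′ i j) → 𝟙 (guard s) ≡ 𝟙 (guard s′)
      guard-cong s s′ e = cong₂ (λ a b → 𝟙 ((a ℕP.≤? Q) ×-dec (F ℕP.≤? b)))
        (count-cong (pairs n) (λ {(i , j)} _ → cong isTilt (e i j))) (count-cong (pairs n) (λ {(i , j)} _ → cong isForb (e i j)))
      -- Pairs in `σ` are free, hence insensitive to their coins. All other pairs take their coins
      -- from `t`, and the tags depend on `s` alone.
      f-merge : ∀ s t → f (mergeOn σ s t) (mergeOn σ s t) ≡ f s t
      f-merge s t = cong₂ (λ a b → a * (c * b)) (guard-cong (mergeOn σ s t) s (τ-merge s t))
          (ΠL-cong (pairs n) (λ {(i , j)} _ → factor i j (σ i j) refl))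
        where
        factor : ∀ i j b → σ i j ≡ b →
          φ l (τ (mergeOn σ s t) i j) (adj (mergeOn σ s t) i j) ≡ φ l (τ s i j) (adj t i j)
        factor i j true  e rewrite τ-merge s t i j | τ-σ s i j e = refl
        factor i j false e = cong₂ (φ l) (τ-merge s t i j)
          (trans (adj-merge σ σ-sym s t i j) (cong (λ b → if b then adj s i j else adj t i j) e))
      B = c * ((q + l * p) ^ Q * q ^ F)
      1≤q+lp : 1ℚ ≤ q + l * p
      1≤q+lp = by-diff ((l - 1ℚ) * p) (*-nonneg (0≤-diff 1≤l) 0≤p) (e p l)
        where
        e : ∀ p l → 1ℚ + (l - 1ℚ) * p ≡ (1ℚ - p) + l * p
        e = solve-∀ ℚ-ring
      0≤B : 0ℚ ≤ B
      0≤B = *-nonneg 0≤c (*-nonneg (^-nonneg Q (≤-trans 0≤1 1≤q+lp)) (^-nonneg F 0≤q))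
      inner : ∀ s → E (f s) ≤ B
      inner s = subst (_≤ B) (sym (trans (Ex-* N (𝟙 (guard s)) (λ t → c * Φ l (τ s) t))
            (cong (𝟙 (guard s) *_) (trans (Ex-* N c (Φ l (τ s))) (cong (c *_) (E-Φ l (τ s)))))))
          (go (guard s))
        where
        go : (d : Dec (tilts (τ s) ℕ.≤ Q × F ℕ.≤ forbs (τ s))) → 𝟙 d * (c * tagged l (τ s)) ≤ B
        go (no _) = ≤-trans (≤-reflexive (*-zeroˡ (c * tagged l (τ s)))) 0≤B
        go (yes (g₁ , g₂)) = ≤-trans (≤-reflexive (*-identityˡ (c * tagged l (τ s))))
          (*-monoʳ c 0≤c (*-mono₂ (^-nonneg (tilts (τ s)) (≤-trans 0≤1 1≤q+lp))
              (*-nonneg (^-nonneg (forbs (τ s)) 0≤q) (^-nonneg (reqs (τ s)) 0≤p)) (^-monoʳ 1≤q+lp g₁)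
              (≤-trans (*-mono₂ (^-nonneg (forbs (τ s)) 0≤q) (^-nonneg (reqs (τ s)) 0≤p) (^-antiʳ 0≤q q≤1 g₂) (^≤1 (reqs (τ s)) 0≤p p≤1))
                (≤-reflexive (*-identityʳ (q ^ F))))))
      Ef≤ : E (λ s → f s s) ≤ B
      Ef≤ = subst (_≤ B) (sym (trans (Ex-merge _≟ᴾ_ p (λ (i , j) → σ i j) (pairs n) (λ s → f s s))
              (Ex-cong N (λ s → Ex-cong N (λ t → f-merge s t)))))
            (subst (E (λ s → E (f s)) ≤_) (Ex-const N B) (E-mono inner))

-- Folding graphs

iter : ∀ {A : Set} → (A → A) → ℕ → A → A
iter f zero    x = x
iter f (suc k) x = f (iter f k x)

iter-+ : ∀ {A : Set} (f : A → A) j k x → iter f (j ℕ.+ k) x ≡ iter f j (iter f k x)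
iter-+ f zero    k x = refl
iter-+ f (suc j) k x = cong f (iter-+ f j k x)

-- Among `n ^ n + 1` iterates two coincide, so the iterates are periodic from some index `i` on.
-- Every positive multiple of the period that is at least `i` is an idempotent exponent; `suc i`
-- times the period is one.
idempotent-power : ∀ {n} (f : Fin n → Fin n) →
  ∃ λ k → ∀ x → iter f (suc k) (iter f (suc k) x) ≡ iter f (suc k) x
idempotent-power {n} f with FinP.pigeonhole (ℕP.n<1+n (n ℕ.^ n)) (λ i → funToFin (iter f (Fin.toℕ i)))
... | a , b , a<b , e = K , idem
  where
  i = Fin.toℕ a
  d′ = Fin.toℕ b ℕ.∸ suc i
  b≡ : Fin.toℕ b ≡ suc d′ ℕ.+ i
  b≡ = trans (sym (ℕP.m∸n+n≡m a<b)) (ℕP.+-suc d′ i)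
  period : ∀ x → iter f (suc d′ ℕ.+ i) x ≡ iter f i x
  period x = trans (cong (λ m → iter f m x) (sym b≡))
    (trans (sym (FinP.finToFun-funToFin (iter f (Fin.toℕ b)) x))
      (trans (cong (λ m → finToFun m x) (sym e)) (FinP.finToFun-funToFin (iter f i) x)))
  period₁ : ∀ l x → iter f (suc d′ ℕ.+ (l ℕ.+ i)) x ≡ iter f (l ℕ.+ i) x
  period₁ l x = trans (cong (λ m → iter f m x) (rearrange (suc d′) l i))
      (trans (iter-+ f l (suc d′ ℕ.+ i) x) (trans (cong (iter f l) (period x)) (sym (iter-+ f l i x))))
    where
    rearrange : ∀ d l i → d ℕ.+ (l ℕ.+ i) ≡ l ℕ.+ (d ℕ.+ i)
    rearrange d l i = trans (sym (ℕP.+-assoc d l i)) (trans (cong (ℕ._+ i) (ℕP.+-comm d l)) (ℕP.+-assoc l d i))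
  periods : ∀ c l x → iter f (c ℕ.* suc d′ ℕ.+ (l ℕ.+ i)) x ≡ iter f (l ℕ.+ i) x
  periods zero    l x = refl
  periods (suc c) l x = trans (cong (λ m → iter f m x) (ℕP.+-assoc (suc d′) (c ℕ.* suc d′) (l ℕ.+ i)))
    (trans (cong (λ m → iter f (suc d′ ℕ.+ m) x) (sym (ℕP.+-assoc (c ℕ.* suc d′) l i)))
      (trans (period₁ (c ℕ.* suc d′ ℕ.+ l) x)
        (trans (cong (λ m → iter f m x) (ℕP.+-assoc (c ℕ.* suc d′) l i)) (periods c l x))))
  K = d′ ℕ.+ i ℕ.* suc d′
  i≤K : i ℕ.≤ suc K
  i≤K = ℕP.≤-trans (ℕP.m≤m*n i (suc d′)) (ℕP.m≤n+m (i ℕ.* suc d′) (suc d′))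
  idem : ∀ x → iter f (suc K) (iter f (suc K) x) ≡ iter f (suc K) x
  idem x = trans (sym (iter-+ f (suc K) (suc K) x))
    (subst (λ m → iter f (suc i ℕ.* suc d′ ℕ.+ m) x ≡ iter f m x) (ℕP.m∸n+n≡m i≤K) (periods (suc i) (suc K ℕ.∸ i) x))

third : ∀ {n} → 3 ℕ.≤ n → ∀ (v c : Fin n) → ∃ λ z → v ≢ z × c ≢ z
third {n} 3≤n v c with FinP.any? (λ w → ¬? (v FinP.≟ w) ×-dec ¬? (c FinP.≟ w))
... | yes o = o
... | no ¬o = ⊥-elim (ℕP.<⇒≱ 3≤n (ℕP.≤-trans (ℕP.≤-reflexive (sym (#-all {n} {λ _ → true} (λ _ → refl))))
    (ℕP.≤-trans (#-cover {n} {λ _ → true} {λ w → w == v} {λ w → w == c} (λ w _ → cover w))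
      (ℕP.≤-reflexive (cong₂ ℕ._+_ (#-≟ v) (#-≟ c))))))
  where
  cover : ∀ w → (w == v) ≡ true ⊎ (w == c) ≡ true
  cover w with v FinP.≟ w | c FinP.≟ w
  ... | yes refl | _        = inj₁ (==-refl w)
  ... | no _     | yes refl = inj₂ (==-refl w)
  ... | no v≢w   | no c≢w   = ⊥-elim (¬o (w , v≢w , c≢w))

module _ {n : ℕ} (G : Graph n) where
  open Graph G

  iter-endo : ∀ {f} → IsEndomorphism G f → ∀ k → IsEndomorphism G (iter f k)
  iter-endo fe zero    x y xy = xy
  iter-endo fe (suc k) x y xy = fe _ _ (iter-endo fe k x y xy)

  -- Some power of an endomorphism is idempotent, hence the identity. The preceding power is then an
  -- inverse, and since it is itself an endomorphism, adjacency is reflected.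
  core-if : (∀ r → IsEndomorphism G r → (∀ x → r (r x) ≡ r x) → ∀ x → r x ≡ x) → IsCore G
  core-if h f fe with idempotent-power f
  ... | k , idem = ((λ {x} {y} fx≡fy → trans (sym (id x)) (trans (back x y fx≡fy) (id y))) ,
        (λ y → iter f k y , λ {z} z≡ → trans (cong f z≡) (id y))) ,
      (λ x y → mk⇔ (fe x y) (λ fxy → subst₂ Adj (trans (comm k x) (id x)) (trans (comm k y) (id y)) (iter-endo fe k _ _ fxy)))
    where
    id : ∀ x → iter f (suc k) x ≡ x
    id = h (iter f (suc k)) (iter-endo fe (suc k)) idem
    comm : ∀ k x → iter f k (f x) ≡ iter f (suc k) x
    comm zero    x = refl
    comm (suc k) x = cong f (comm k x)
    back : ∀ x y → f x ≡ f y → iter f (suc k) x ≡ iter f (suc k) y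
    back x y e = trans (sym (comm k x)) (trans (cong (iter f k) e) (comm k y))

  not-injective⇒¬core : ∀ f → IsEndomorphism G f → ∀ x y → x ≢ y → f x ≡ f y → ¬ IsCore G
  not-injective⇒¬core f fe x y x≢y fx≡fy core = x≢y (proj₁ (proj₁ (core f fe)) fx≡fy)

  fold : Fin n → Fin n → Fin n → Fin n
  fold v w x with x FinP.≟ v
  ... | yes _ = w
  ... | no _  = x

  fold-at : ∀ v w → fold v w v ≡ w
  fold-at v w with v FinP.≟ v
  ... | yes _  = refl
  ... | no v≢v = ⊥-elim (v≢v refl)

  fold-off : ∀ v w {x} → x ≢ v → fold v w x ≡ x
  fold-off v w {x} x≢v with x FinP.≟ v
  ... | yes x≡v = ⊥-elim (x≢v x≡v)
  ... | no _    = refl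

  dominated⇒¬core : ∀ v w → v ≢ w → (∀ y → Adj v y → Adj w y) → ¬ IsCore G
  dominated⇒¬core v w v≢w dom = not-injective⇒¬core (fold v w) endo v w v≢w
      (trans (fold-at v w) (sym (fold-off v w (v≢w ∘ sym))))
    where
    endo : IsEndomorphism G (fold v w)
    endo x y xy with x FinP.≟ v | y FinP.≟ v
    ... | yes refl | yes refl = ⊥-elim (irrefl refl xy)
    ... | yes refl | no _     = dom y xy
    ... | no _     | yes refl = symm (dom x (symm xy))
    ... | no _     | no _     = xy

  -- A vertex with at most one neighbour can be folded, unless its component is a
  -- single edge, which can be folded onto another edge or another vertex folded onto it.
  pendant⇒¬core : 3 ℕ.≤ n → ∀ v c → (∀ y → Adj v y → y ≡ c) → ¬ IsCore G
  pendant⇒¬core 3≤n v c only with adj? v c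
  ... | no ¬vc = dominated⇒¬core v w v≢w (λ y vy → ⊥-elim (¬vc (subst (Adj v) (only y vy) vy)))
    where
    other = third 3≤n v c
    w = proj₁ other
    v≢w = proj₁ (proj₂ other)
  ... | yes vc with FinP.any? (λ w → adj? c w ×-dec ¬? (v FinP.≟ w))
  ... | yes (w , cw , v≢w) = dominated⇒¬core v w v≢w (λ y vy → subst (Adj w) (sym (only y vy)) (symm cw))
  ... | no ¬w = go (third 3≤n v c)
    where
    only′ : ∀ y → Adj c y → y ≡ v
    only′ y cy with v FinP.≟ y
    ... | yes v≡y = sym v≡y
    ... | no  v≢y = ⊥-elim (¬w (y , cy , v≢y))
    v≢c : v ≢ c
    v≢c v≡c = irrefl v≡c vc
    go : (∃ λ z → v ≢ z × c ≢ z) → ¬ IsCore G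
    go (z , v≢z , c≢z) with FinP.any? (λ y → adj? z y)
    ... | no ¬y = dominated⇒¬core z v (v≢z ∘ sym) (λ y zy → ⊥-elim (¬y (y , zy)))
    ... | yes (y , zy) = not-injective⇒¬core r endo v z v≢z (trans r-v (sym (r-off v≢z c≢z)))
      where
      r : Fin n → Fin n
      r x = fold v z (fold c y x)
      v≢y : v ≢ y
      v≢y refl = c≢z (sym (only z (symm zy)))
      r-c : r c ≡ y
      r-c = trans (cong (fold v z) (fold-at c y)) (fold-off v z (v≢y ∘ sym))
      r-v : r v ≡ z
      r-v = trans (cong (fold v z) (fold-off c y v≢c)) (fold-at v z)
      r-off : ∀ {x} → v ≢ x → c ≢ x → r x ≡ x
      r-off v≢x c≢x = trans (cong (fold v z) (fold-off c y (c≢x ∘ sym))) (fold-off v z (v≢x ∘ sym))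
      endo : IsEndomorphism G r
      endo a b ab with v FinP.≟ a | c FinP.≟ a
      ... | yes refl | _ = subst₂ Adj (sym r-v) (sym (trans (cong r (only b ab)) r-c)) zy
      ... | no _ | yes refl = subst₂ Adj (sym r-c) (sym (trans (cong r (only′ b ab)) r-v)) (symm zy)
      ... | no v≢a | no c≢a = subst₂ Adj (sym (r-off v≢a c≢a)) (sym (r-off (λ { refl → c≢a (sym (only a (symm ab))) }) (λ { refl → v≢a (sym (only′ a (symm ab))) }))) ab

module _ (n : ℕ) where
  open Sample n

  graph : Coins → Graph n
  graph s = fromEdges (select _≟ᴾ_ (pairs n) s)

  adj⇒Adj : ∀ s {i j} → adj s i j ≡ true → Graph.Adj (graph s) i j
  adj⇒Adj s {i} {j} h = i≢j , either (does (i FinP.<? j)) refl (chi⇒∈select _≟ᴾ_ (pairs n) s (trans (sym (adj-≢ s i≢j)) h))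
    where
    i≢j = adj⇒≢ s h
    S = select _≟ᴾ_ (pairs n) s
    either : ∀ b → does (i FinP.<? j) ≡ b → edge i j ∈ S → (i , j) ∈ S ⊎ (j , i) ∈ S
    either true  e m = inj₁ (subst (λ b → (if b then (i , j) else (j , i)) ∈ S) e m)
    either false e m = inj₂ (subst (λ b → (if b then (i , j) else (j , i)) ∈ S) e m)

  Adj⇒adj : ∀ s {i j} → Graph.Adj (graph s) i j → adj s i j ≡ true
  Adj⇒adj s {i} {j} (i≢j , inj₁ m) = trans (adj-pairs s (select⊆ _≟ᴾ_ (pairs n) s m)) (∈select⇒chi _≟ᴾ_ (pairs n) s (pairs-unique n) m)
  Adj⇒adj s {i} {j} (i≢j , inj₂ m) = trans (adj-sym s i j)
    (trans (adj-pairs s (select⊆ _≟ᴾ_ (pairs n) s m)) (∈select⇒chi _≟ᴾ_ (pairs n) s (pairs-unique n) m))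

  record Folding (s : Coins) (r : Fin n → Fin n) : Set where
    constructor folding
    field
      endo : ∀ x y → adj s x y ≡ true → adj s (r x) (r y) ≡ true
      idem : ∀ x → r (r x) ≡ r x

  folding? : ∀ s r → Dec (Folding s r)
  folding? s r = map′ (λ (e , i) → folding e i) (λ (folding e i) → e , i)
    ((FinP.all? λ x → FinP.all? λ y → (adj s x y BoolP.≟ true) →-dec (adj s (r x) (r y) BoolP.≟ true))
      ×-dec (FinP.all? λ x → r (r x) FinP.≟ r x))

  moved : Vec (Fin n) n → Fin n → Bool
  moved v x = not (lookup v x == x)

  -- Maps written as vectors can be enumerated, and being a folding is decidable, so the witness
  -- comes from a finite search. If the search fails, every idempotent endomorphism is the identity
  -- and `core-if` applies.
  ¬core⇒folding : ∀ s → ¬ IsCore (graph s) → ∃ λ v → Folding s (lookup v) × 1 ℕ.≤ # (moved v)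
  ¬core⇒folding s ¬core with Any.any? (λ v → folding? s (lookup v) ×-dec (1 ℕP.≤? # (moved v))) (vecs (List.allFin n) n)
  ... | yes some = Any.satisfied some
  ... | no none  = ⊥-elim (fixed⇒core λ v fv x → fixed v fv x)
    where
    fixed : ∀ v → Folding s (lookup v) → ∀ x → lookup v x ≡ x
    fixed v fv x with lookup v x FinP.≟ x
    ... | yes e = e
    ... | no ne = ⊥-elim (none (lose (∈-vecs ∈-allFin v) (fv , ℕP.≤-trans (ℕP.≤-reflexive (sym (#-≟ x)))
      (#-mono {n} {λ i → i == x} {moved v} (λ i e → cong not (≢⇒== (λ e′ → ne (subst (λ j → lookup v j ≡ j) (==⇒≡ e) e′))))))))
    fixed⇒core : ¬ (∀ (v : Vec (Fin n) n) → Folding s (lookup v) → ∀ x → lookup v x ≡ x)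
    fixed⇒core h = ¬core (core-if (graph s) λ r endo idem x →
        let v = Vec.tabulate r ; l = VecP.lookup∘tabulate r in
        trans (sym (l x)) (h v (folding
          (λ a b ab → subst₂ (λ y z → adj s y z ≡ true) (sym (l a)) (sym (l b)) (Adj⇒adj s (endo a b (adj⇒Adj s ab))))
          (λ y → trans (cong (lookup v) (l y)) (trans (l (r y)) (trans (idem y) (sym (l y)))))) x))

  module _ (p : ℚ) where
    open Expectation p

    probability : ∀ {P : Pred (Graph n) _} (P? : Decidable P) →
      List.foldr _+_ 0ℚ (map (weight _≟ᴾ_ p (length (pairs n))) (filter (P? ∘ fromEdges) (sublists (pairs n))))
      ≡ Ex (length (pairs n)) (λ s → 𝟙 (P? (graph s)))
    probability P? = trans (Σ-filter _≟ᴾ_ p (P? ∘ fromEdges) (sublists (pairs n)) (weight _≟ᴾ_ p (length (pairs n))))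
      (Σ-sublists _≟ᴾ_ p (pairs n) (λ S → 𝟙 (P? (fromEdges S))))

∧-true : ∀ {b c} → b ∧ c ≡ true → b ≡ true × c ≡ true
∧-true {true} {true} _ = refl , refl

∧-intro : ∀ {b c} → b ≡ true → c ≡ true → b ∧ c ≡ true
∧-intro refl refl = refl

∨-true : ∀ {b c} → b ∨ c ≡ true → b ≡ true ⊎ c ≡ true
∨-true {true}  _ = inj₁ refl
∨-true {false} e = inj₂ e

∨-introˡ : ∀ {b c} → b ≡ true → b ∨ c ≡ true
∨-introˡ refl = refl

∨-introʳ : ∀ {b c} → c ≡ true → b ∨ c ≡ true
∨-introʳ {true}  _ = refl
∨-introʳ {false} e = e

not-true : ∀ {b} → not b ≡ true → b ≡ false
not-true {false} _ = refl

not-intro : ∀ {b} → b ≡ false → not b ≡ true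
not-intro refl = refl

-- Pairs of vertices constrained by a folding

module _ {n : ℕ} (R : Fin n → Fin n → Bool) where

  deg : Fin n → ℕ
  deg i = # (R i)

module Move (n : ℕ) (r : Fin n → Fin n) where
  open Sample n

  T : Fin n → Bool
  T x = not (r x == x)

  touch : Fin n → Fin n → Bool
  touch i j = T i ∨ T j

  touch-sym : ∀ i j → touch i j ≡ touch j i
  touch-sym i j = BoolP.∨-comm (T i) (T j)

  tag : (same touching allowed : Bool) → Tag
  tag true  _     _     = free
  tag false false _     = free
  tag false true  true  = tilt
  tag false true  false = forb

  -- Edges go to edges, so a pair over a non-edge is forbidden, while a pair over an edge is merely
  -- weighed. Pairs of two fixed vertices stay free: these are the exposed ones. The tags consult
  -- the graph only at pairs of images, which are of this kind when `r` is idempotent.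
  τ : Coins → Tags
  τ s i j = tag (i == j) (touch i j) (adj s (r i) (r j))

  τ-≡forb : ∀ s i j → τ s i j ≡ forb → i ≢ j × touch i j ≡ true × adj s (r i) (r j) ≡ false
  τ-≡forb s i j e with i FinP.≟ j | touch i j | adj s (r i) (r j)
  τ-≡forb s i j () | yes _ | _ | _
  τ-≡forb s i j () | no _ | false | _
  τ-≡forb s i j () | no _ | true | true
  τ-≡forb s i j e  | no i≢j | true | false = i≢j , refl , refl

  τ-isTilt : ∀ s i j → isTilt (τ s i j) ≡ touch i j ∧ adj s (r i) (r j)
  τ-isTilt s i j with i FinP.≟ j | touch i j
  ... | yes refl | b rewrite adj-irr s (r i) = sym (BoolP.∧-zeroʳ b)
  ... | no _ | false = refl
  ... | no _ | true with adj s (r i) (r j)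
  ...   | true  = refl
  ...   | false = refl

  τ-isForb : ∀ s i j → isForb (τ s i j) ≡ not (i == j) ∧ (touch i j ∧ not (adj s (r i) (r j)))
  τ-isForb s i j with i FinP.≟ j | touch i j
  ... | yes refl | b = refl
  ... | no _ | false = refl
  ... | no _ | true with adj s (r i) (r j)
  ...   | true  = refl
  ...   | false = refl

  module _ (s : Coins) where

    private R = adj s

    allowed-sym : ∀ i j → touch i j ∧ R (r i) (r j) ≡ touch j i ∧ R (r j) (r i)
    allowed-sym i j = cong₂ _∧_ (touch-sym i j) (adj-sym s (r i) (r j))

    ==-sym : ∀ (i j : Fin n) → (i == j) ≡ (j == i)
    ==-sym i j with i FinP.≟ j
    ... | yes refl = sym (==-refl i)
    ... | no i≢j   = sym (≢⇒== (i≢j ∘ sym))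

    2tilts : 2 ℕ.* tilts (τ s) ≡ ## (λ i j → touch i j ∧ R (r i) (r j))
    2tilts = trans (2cnt (λ i j → isTilt (τ s i j))
        (λ i j → trans (τ-isTilt s i j) (trans (allowed-sym i j) (sym (τ-isTilt s j i))))
        (λ i → trans (τ-isTilt s i i) (trans (cong (touch i i ∧_) (adj-irr s (r i))) (BoolP.∧-zeroʳ (touch i i)))))
      (##-cong {n} (τ-isTilt s))

    2forbs : 2 ℕ.* forbs (τ s) ≡ ## (λ i j → not (i == j) ∧ (touch i j ∧ not (R (r i) (r j))))
    2forbs = trans (2cnt (λ i j → isForb (τ s i j))
        (λ i j → trans (τ-isForb s i j) (trans (cong₂ _∧_ (cong not (==-sym i j))
          (cong₂ _∧_ (touch-sym i j) (cong not (adj-sym s (r i) (r j))))) (sym (τ-isForb s j i))))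
        (λ i → trans (τ-isForb s i i) (cong (λ b → not b ∧ (touch i i ∧ not (R (r i) (r i)))) (==-refl i))))
      (##-cong {n} (τ-isForb s))

    tilts≤ : tilts (τ s) ℕ.≤ sum (λ x → ⟦ T x ⟧ ℕ.* # (λ y → R (r x) (r y)))
    tilts≤ = ℕP.*-cancelˡ-≤ 2 (ℕP.≤-trans (ℕP.≤-reflexive 2tilts) (ℕP.≤-trans
        (##-cover {n} {λ i j → touch i j ∧ R (r i) (r j)} {λ i j → T i ∧ R (r i) (r j)} {λ i j → T j ∧ R (r j) (r i)} cover)
        (ℕP.≤-reflexive (trans (cong (## (λ i j → T i ∧ R (r i) (r j)) ℕ.+_) (##-transpose (λ i j → T i ∧ R (r i) (r j))))
          (trans (cong (λ m → m ℕ.+ m) (##-on T (λ x y → R (r x) (r y)))) (cong (sum (λ x → ⟦ T x ⟧ ℕ.* # (λ y → R (r x) (r y))) ℕ.+_) (sym (ℕP.+-identityʳ _))))))))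
      where
      cover : ∀ i j → touch i j ∧ R (r i) (r j) ≡ true → T i ∧ R (r i) (r j) ≡ true ⊎ T j ∧ R (r j) (r i) ≡ true
      cover i j e with ∧-true {touch i j} e
      ... | t , a with ∨-true {T i} t
      ...   | inj₁ ti = inj₁ (∧-intro ti a)
      ...   | inj₂ tj = inj₂ (∧-intro tj (trans (adj-sym s (r j) (r i)) a))

    forbs≥₁ : sum (λ x → ⟦ T x ⟧ ℕ.* # (λ y → not (x == y) ∧ not (R (r x) (r y)))) ℕ.≤ 2 ℕ.* forbs (τ s)
    forbs≥₁ = ℕP.≤-trans (ℕP.≤-reflexive (sym (##-on T (λ x y → not (x == y) ∧ not (R (r x) (r y))))))
      (ℕP.≤-trans (##-mono {n} {λ x y → T x ∧ (not (x == y) ∧ not (R (r x) (r y)))} {λ i j → not (i == j) ∧ (touch i j ∧ not (R (r i) (r j)))} incl)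
        (ℕP.≤-reflexive (sym 2forbs)))
      where
      incl : ∀ x y → T x ∧ (not (x == y) ∧ not (R (r x) (r y))) ≡ true → not (x == y) ∧ (touch x y ∧ not (R (r x) (r y))) ≡ true
      incl x y e with ∧-true {T x} e
      ... | tx , e′ with ∧-true {not (x == y)} e′
      ...   | ne , nr = ∧-intro ne (∧-intro (∨-introˡ {T x} tx) nr)

    -- With `x` moved and `y` fixed, each pair is reached from one end only, so nothing is lost to
    -- double counting, unlike in `forbs≥₁`.
    forbs≥₂ : sum (λ x → ⟦ T x ⟧ ℕ.* # (λ y → not (T y) ∧ not (R (r x) (r y)))) ℕ.≤ forbs (τ s)
    forbs≥₂ = ℕP.*-cancelˡ-≤ 2 (ℕP.≤-trans (ℕP.≤-reflexive (cong₂ ℕ._+_ (sym on) (trans (ℕP.+-identityʳ _) (trans (sym on) (sym (##-transpose F))))))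
        (ℕP.≤-trans (##-disjoint {n} {λ i j → not (i == j) ∧ (touch i j ∧ not (R (r i) (r j)))} {F} {λ i j → F j i} incl
            (λ i j e → subst (_≡ true) (cong₂ _∧_ (cong not (==-sym j i)) (cong₂ _∧_ (touch-sym j i) (cong not (adj-sym s (r j) (r i))))) (incl j i e))
            (λ i j e e′ → true≢false (trans (sym (proj₁ (∧-true {T i} e))) (not-true (proj₁ (∧-true {not (T i)} (proj₂ (∧-true {T j} e′))))))))
          (ℕP.≤-reflexive (sym 2forbs))))
      where
      F : Fin n → Fin n → Bool
      F x y = T x ∧ (not (T y) ∧ not (R (r x) (r y)))
      on : ## F ≡ sum (λ x → ⟦ T x ⟧ ℕ.* # (λ y → not (T y) ∧ not (R (r x) (r y))))
      on = ##-on T (λ x y → not (T y) ∧ not (R (r x) (r y)))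
      incl : ∀ x y → F x y ≡ true → not (x == y) ∧ (touch x y ∧ not (R (r x) (r y))) ≡ true
      incl x y e with ∧-true {T x} e
      ... | tx , e′ with ∧-true {not (T y)} e′
      ...   | ty , nr = ∧-intro (not-intro (≢⇒== {i = x} {y} (λ { refl → true≢false (trans (sym tx) (not-true ty)) })))
              (∧-intro (∨-introˡ {T x} tx) nr)

    module _ (endo : ∀ x y → R x y ≡ true → R (r x) (r y) ≡ true) where

      τ-forb : ∀ i j → τ s i j ≡ forb → R i j ≡ false
      τ-forb i j e with τ-≡forb s i j e
      ... | _ , _ , no-edge with R i j | endo i j
      ...   | true  | h = trans (sym (h refl)) no-edge
      ...   | false | _ = refl

      -- An endomorphism places every edge over an edge, so all edges that touch a moved vertex
      -- carry the tag `tilt`.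
      2tilted : 2 ℕ.* tilted (τ s) s ≡ ## (λ i j → touch i j ∧ R i j)
      2tilted = trans (2cnt (λ i j → isTilt (τ s i j) ∧ R i j)
          (λ i j → cong₂ _∧_ (trans (τ-isTilt s i j) (trans (allowed-sym i j) (sym (τ-isTilt s j i)))) (adj-sym s i j))
          (λ i → trans (cong (isTilt (τ s i i) ∧_) (adj-irr s i)) (BoolP.∧-zeroʳ (isTilt (τ s i i)))))
        (##-cong {n} (λ i j → trans (cong (_∧ R i j) (τ-isTilt s i j)) (drop (touch i j) (R (r i) (r j)) (R i j) (endo i j))))
        where
        drop : ∀ t a b → (b ≡ true → a ≡ true) → (t ∧ a) ∧ b ≡ t ∧ b
        drop false a     b     h = refl
        drop true  true  b     h = refl
        drop true  false false h = refl
        drop true  false true  h = h refl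

      tilted≥ : sum (λ x → ⟦ T x ⟧ ℕ.* deg R x) ℕ.≤ 2 ℕ.* tilted (τ s) s
      tilted≥ = ℕP.≤-trans (ℕP.≤-reflexive (sym (##-on T R)))
        (ℕP.≤-trans (##-mono {n} {λ i j → T i ∧ R i j} {λ i j → touch i j ∧ R i j}
            (λ i j e → ∧-intro (∨-introˡ {T i} (proj₁ (∧-true {T i} e))) (proj₂ (∧-true {T i} e))))
          (ℕP.≤-reflexive (sym 2tilted)))

      -- The edges at L are counted from both sides; every other moved vertex
      -- keeps at least 5 - 1 edges that avoid L.
      tilted≥4 : ∀ (L : Fin n → Bool) → (∀ x → 2 ℕ.≤ deg R x) → (∀ x → L x ≡ false → 5 ℕ.≤ deg R x) →
        (∀ x y → L x ≡ true → L y ≡ true → R x y ≡ false) →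
        (∀ x → # (λ y → L y ∧ R x y) ℕ.≤ 1) →
        # T ℕ.* 4 ℕ.≤ 2 ℕ.* tilted (τ s) s
      tilted≥4 L min2 min5 indep one = ℕP.≤-trans
          (ℕP.≤-trans (ℕP.≤-reflexive split) (ℕP.+-mono-≤ (ℕP.+-mono-≤ f₁ f₁) f₃))
          (ℕP.≤-trans (ℕP.≤-trans
            (ℕP.+-monoˡ-≤ (## F₃) (ℕP.≤-trans (ℕP.≤-reflexive (cong (## F₁ ℕ.+_) (sym (##-transpose F₁))))
              (##-disjoint {n} {F₁₂} {F₁} {λ i j → F₁ j i}
                (λ i j → ∨-introˡ {F₁ i j}) (λ i j → ∨-introʳ {F₁ i j}) disj₁₂)))
            (##-disjoint {n} {λ i j → touch i j ∧ R i j} {F₁₂} {F₃} incl₁₂ incl₃ disj₃))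
          (ℕP.≤-reflexive (sym 2tilted)))
        where
        TL TB : Fin n → Bool
        TL i = T i ∧ L i
        TB i = T i ∧ not (L i)
        F₁ F₁₂ F₃ : Fin n → Fin n → Bool
        F₁ i j = TL i ∧ R i j
        F₁₂ i j = F₁ i j ∨ F₁ j i
        F₃ i j = TB i ∧ (not (L j) ∧ R i j)
        f₁ : # TL ℕ.* 2 ℕ.≤ ## F₁
        f₁ = ℕP.≤-trans (sum-on-≥ TL (deg R) 2 (λ i _ → min2 i)) (ℕP.≤-reflexive (sym (##-on TL R)))
        f₃ : # TB ℕ.* 4 ℕ.≤ ## F₃
        f₃ = ℕP.≤-trans (sum-on-≥ TB (λ i → # (λ j → not (L j) ∧ R i j)) 4 (λ i e → four i (not-true (proj₂ (∧-true {T i} e)))))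
          (ℕP.≤-reflexive (sym (##-on TB (λ i j → not (L j) ∧ R i j))))
          where
          four : ∀ i → L i ≡ false → 4 ℕ.≤ # (λ j → not (L j) ∧ R i j)
          four i e = ℕP.+-cancelˡ-≤ 1 4 _ (ℕP.≤-trans (min5 i e) (ℕP.≤-trans
            (#-cover {n} {R i} {λ y → L y ∧ R i y} {λ j → not (L j) ∧ R i j} cov) (ℕP.+-monoˡ-≤ _ (one i))))
            where
            cov : ∀ j → R i j ≡ true → L j ∧ R i j ≡ true ⊎ not (L j) ∧ R i j ≡ true
            cov j h with L j
            ... | true  = inj₁ h
            ... | false = inj₂ h
        split : # T ℕ.* 4 ≡ (# TL ℕ.* 2 ℕ.+ # TL ℕ.* 2) ℕ.+ # TB ℕ.* 4
        split = trans (cong (ℕ._* 4) (trans (sum-cong-≗ (λ i → e (T i) (L i))) (∑-distrib-+ (λ i → ⟦ TL i ⟧) (λ i → ⟦ TB i ⟧))))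
          (trans (ℕP.*-distribʳ-+ 4 (# TL) (# TB)) (cong (ℕ._+ # TB ℕ.* 4) (ℕP.*-distribˡ-+ (# TL) 2 2)))
          where
          e : ∀ t l → ⟦ t ⟧ ≡ ⟦ t ∧ l ⟧ ℕ.+ ⟦ t ∧ not l ⟧
          e false l     = refl
          e true  true  = refl
          e true  false = refl
        disj₁₂ : ∀ i j → F₁ i j ≡ true → F₁ j i ≡ true → ⊥
        disj₁₂ i j e e′ = true≢false (trans (sym (proj₂ (∧-true {TL i} e)))
          (indep i j (proj₂ (∧-true {T i} (proj₁ (∧-true {TL i} e)))) (proj₂ (∧-true {T j} (proj₁ (∧-true {TL j} e′))))))
        incl₁₂ : ∀ i j → F₁₂ i j ≡ true → touch i j ∧ R i j ≡ true
        incl₁₂ i j e with ∨-true {F₁ i j} e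
        ... | inj₁ h = ∧-intro (∨-introˡ {T i} (proj₁ (∧-true {T i} (proj₁ (∧-true {TL i} h))))) (proj₂ (∧-true {TL i} h))
        ... | inj₂ h = ∧-intro (∨-introʳ {T i} (proj₁ (∧-true {T j} (proj₁ (∧-true {TL j} h)))))
            (trans (adj-sym s i j) (proj₂ (∧-true {TL j} h)))
        incl₃ : ∀ i j → F₃ i j ≡ true → touch i j ∧ R i j ≡ true
        incl₃ i j h = ∧-intro (∨-introˡ {T i} (proj₁ (∧-true {T i} (proj₁ (∧-true {TB i} h)))))
          (proj₂ (∧-true {not (L j)} (proj₂ (∧-true {TB i} h))))
        disj₃ : ∀ i j → F₁₂ i j ≡ true → F₃ i j ≡ true → ⊥
        disj₃ i j e h with ∨-true {F₁ i j} e
        ... | inj₁ e₁ = true≢false (trans (sym (proj₂ (∧-true {T i} (proj₁ (∧-true {TL i} e₁)))))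
            (not-true (proj₂ (∧-true {T i} (proj₁ (∧-true {TB i} h))))))
        ... | inj₂ e₂ = true≢false (trans (sym (proj₂ (∧-true {T j} (proj₁ (∧-true {TL j} e₂)))))
            (not-true (proj₁ (∧-true {not (L j)} (proj₂ (∧-true {TB i} h))))))

  module _ (p : ℚ) (0≤p : 0ℚ ≤ p) (p≤1 : p ≤ 1ℚ) where
    open Prob p 0≤p p≤1

    -- This is `small-exposed` with the pairs of fixed vertices exposed. If `r` is not idempotent,
    -- it is never a folding and the event is empty.
    small-folding : ∀ (P : Coins → Set) c l Q F → 0ℚ ≤ c → 1ℚ ≤ l →
      (∀ s → P s → Folding n s r → 1ℚ ≤ c * l ^ tilted (τ s) s × tilts (τ s) ℕ.≤ Q × F ℕ.≤ forbs (τ s)) →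
      Small (λ s → P s × Folding n s r) (c * ((q + l * p) ^ Q * q ^ F))
    small-folding P c l Q F 0≤c 1≤l h with FinP.all? (λ x → r (r x) FinP.≟ r x)
    ... | no ¬idem = small (λ _ → 0ℚ) (λ _ → ≤-refl) (λ s (_ , fo) → ⊥-elim (¬idem (Folding.idem fo)))
        (subst (_≤ c * ((q + l * p) ^ Q * q ^ F)) (sym (Ex-const (length (pairs n)) 0ℚ))
          (*-nonneg 0≤c (*-nonneg (^-nonneg Q (+-nonneg 0≤q (*-nonneg (≤-trans 0≤1 1≤l) 0≤p))) (^-nonneg F 0≤q))))
    ... | yes idem = small-exposed c l Q F (λ i j → not (touch i j)) τ 0≤c 1≤l
        (λ i j → cong not (touch-sym i j)) τ-σ τ-merge τ-req
        (λ s (Ps , fo) → τ-forb s (Folding.endo fo) , h s Ps fo)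
      where
      T-r : ∀ i → T (r i) ≡ false
      T-r i = cong not (trans (cong (_== r i) (idem i)) (==-refl (r i)))
      τ-σ : ∀ s i j → not (touch i j) ≡ true → τ s i j ≡ free
      τ-σ s i j e with i == j | touch i j
      ... | true  | _     = refl
      ... | false | false = refl
      τ-req : ∀ s i j → τ s i j ≢ req
      τ-req s i j e with i == j | touch i j | adj s (r i) (r j)
      τ-req s i j () | true  | _     | _
      τ-req s i j () | false | false | _
      τ-req s i j () | false | true  | true
      τ-req s i j () | false | true  | false
      -- Images under `r` are fixed vertices, so the adjacency that a tag consults belongs to an
      -- exposed pair.
      τ-merge : ∀ s t i j → τ (mergeOn (λ i j → not (touch i j)) s t) i j ≡ τ s i j
      τ-merge s t i j = cong (tag (i == j) (touch i j))
        (trans (adj-merge (λ i j → not (touch i j)) (λ i j → cong not (touch-sym i j)) s t (r i) (r j))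
          (cong (λ b → if not b then adj s (r i) (r j) else adj t (r i) (r j)) (cong₂ _∨_ (T-r i) (T-r j))))

-- Degrees, subsets and union bounds

sum-point : ∀ {n} (x : Fin n) (f : Fin n → ℕ) → sum (λ i → ⟦ i == x ⟧ ℕ.* f i) ≡ f x
sum-point {n} x f = trans (sum-cong-≗ {n} (λ i → e i)) (trans (sum-on-const (f x)) (trans (cong (ℕ._* f x) (#-≟ x)) (ℕP.+-identityʳ (f x))))
  where
  e : ∀ i → ⟦ i == x ⟧ ℕ.* f i ≡ ⟦ i == x ⟧ ℕ.* f x
  e i with i FinP.≟ x
  ... | yes refl = refl
  ... | no _     = refl
  sum-on-const : ∀ c → sum (λ i → ⟦ i == x ⟧ ℕ.* c) ≡ # (λ i → i == x) ℕ.* c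
  sum-on-const c = ℕP.≤-antisym (sum-on-≤ (_== x) (λ _ → c) c (λ _ _ → ℕP.≤-refl)) (sum-on-≥ (_== x) (λ _ → c) c (λ _ _ → ℕP.≤-refl))

#-≢ : ∀ {n} (x : Fin n) → # (λ j → not (j == x)) ≡ n ℕ.∸ 1
#-≢ {suc n} x = ℕP.suc-injective (trans (cong (ℕ._+ # (λ j → not (j == x))) (sym (#-≟ x))) (#-not (_== x)))

==-comm : ∀ {n} (i j : Fin n) → (i == j) ≡ (j == i)
==-comm i j with i FinP.≟ j
... | yes refl = sym (==-refl i)
... | no i≢j   = sym (≢⇒== (i≢j ∘ sym))

module Star {n : ℕ} (x : Fin n) where

  star : Fin n → Fin n → Bool
  star i j = (i == x) ∨ (j == x)

  star-sym : ∀ i j → star i j ≡ star j i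
  star-sym i j = BoolP.∨-comm (i == x) (j == x)

  module _ (R : Fin n → Fin n → Bool) (R-sym : ∀ i j → R i j ≡ R j i) (R-irr : ∀ i → R i i ≡ false) where

    private
      F : Fin n → Fin n → Bool
      F i j = (i == x) ∧ R i j
      ##F : ## F ≡ # (R x)
      ##F = trans (##-on (_== x) R) (sum-point x (λ i → # (R i)))
      2F : ## F ℕ.+ ## (λ i j → F j i) ≡ 2 ℕ.* # (R x)
      2F = cong₂ ℕ._+_ ##F (trans (##-transpose F) (trans ##F (sym (ℕP.+-identityʳ (# (R x))))))

    ##-star : ## (λ i j → star i j ∧ R i j) ≡ 2 ℕ.* # (R x)
    ##-star = trans (ℕP.≤-antisym
        (##-cover {n} {λ i j → star i j ∧ R i j} {F} {λ i j → F j i} cov)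
        (##-disjoint {n} {λ i j → star i j ∧ R i j} {F} {λ i j → F j i}
          (λ i j e → ∧-intro (∨-introˡ (proj₁ (∧-true {i == x} e))) (proj₂ (∧-true {i == x} e)))
          (λ i j e → ∧-intro (∨-introʳ {i == x} (proj₁ (∧-true {j == x} e))) (trans (R-sym i j) (proj₂ (∧-true {j == x} e))))
          dis)) 2F
      where
      cov : ∀ i j → star i j ∧ R i j ≡ true → F i j ≡ true ⊎ F j i ≡ true
      cov i j e with ∧-true {star i j} e
      ... | st , r with ∨-true {i == x} st
      ...   | inj₁ a = inj₁ (∧-intro a r)
      ...   | inj₂ b = inj₂ (∧-intro b (trans (R-sym j i) r))
      dis : ∀ i j → F i j ≡ true → F j i ≡ true → ⊥
      dis i j e e′ with ==⇒≡ {i = i} {x} (proj₁ (∧-true {i == x} e)) | ==⇒≡ {i = j} {x} (proj₁ (∧-true {j == x} e′))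
      ... | refl | refl = true≢false (trans (sym (proj₂ (∧-true {i == i} e))) (R-irr i))

    cnt-star : cnt (λ i j → star i j ∧ R i j) ≡ # (R x)
    cnt-star = ℕP.*-cancelˡ-≡ _ _ 2 (trans (2cnt (λ i j → star i j ∧ R i j) (λ i j → cong₂ _∧_ (star-sym i j) (R-sym i j))
      (λ i → trans (cong (star i i ∧_) (R-irr i)) (BoolP.∧-zeroʳ (star i i)))) ##-star)

  starTag : Fin n → Fin n → Tag
  starTag i j = if star i j ∧ not (i == j) then tilt else free

  isTilt-star : ∀ i j → isTilt (starTag i j) ≡ star i j ∧ not (i == j)
  isTilt-star i j with star i j ∧ not (i == j)
  ... | true  = refl
  ... | false = refl

  open Sample n

  star-tilts : tilts starTag ≡ n ℕ.∸ 1
  star-tilts = trans (count-cong (pairs n) (λ {(i , j)} _ → isTilt-star i j))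
    (trans (cnt-star (λ i j → not (i == j)) (λ i j → cong not (==-comm i j)) (λ i → cong not (==-refl i)))
      (trans (#-cong {n} (λ j → cong not (==-comm x j))) (#-≢ x)))

  star-tilted : ∀ s → tilted starTag s ≡ deg (adj s) x
  star-tilted s = trans (count-cong (pairs n) (λ {(i , j)} _ → trans (cong (_∧ adj s i j) (isTilt-star i j)) (drop i j)))
    (cnt-star (adj s) (adj-sym s) (adj-irr s))
    where
    drop : ∀ i j → (star i j ∧ not (i == j)) ∧ adj s i j ≡ star i j ∧ adj s i j
    drop i j with i FinP.≟ j | star i j
    ... | yes refl | b     = trans (BoolP.∧-zeroʳ (b ∧ false)) (sym (BoolP.∧-zeroʳ b))
    ... | no _ | true  = refl
    ... | no _ | false = refl

  star-forbs : forbs starTag ≡ 0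
  star-forbs = trans (count-cong (pairs n) (λ {(i , j)} _ → e i j)) (zeros (pairs n))
    where
    e : ∀ i j → isForb (starTag i j) ≡ false
    e i j with star i j ∧ not (i == j)
    ... | true  = refl
    ... | false = refl
    zeros : ∀ (xs : List (Fin n × Fin n)) → count xs (λ _ → false) ≡ 0
    zeros []       = refl
    zeros (x ∷ xs) = zeros xs

  star-reqs : reqs starTag ≡ 0
  star-reqs = trans (count-cong (pairs n) (λ {(i , j)} _ → e i j)) (zeros (pairs n))
    where
    e : ∀ i j → isReq (starTag i j) ≡ false
    e i j with star i j ∧ not (i == j)
    ... | true  = refl
    ... | false = refl
    zeros : ∀ (xs : List (Fin n × Fin n)) → count xs (λ _ → false) ≡ 0
    zeros []       = refl
    zeros (x ∷ xs) = zeros xs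

  star≢forb : ∀ i j → starTag i j ≢ forb
  star≢forb i j e with star i j ∧ not (i == j)
  star≢forb i j () | true
  star≢forb i j () | false

  star≢req : ∀ i j → starTag i j ≢ req
  star≢req i j e with star i j ∧ not (i == j)
  star≢req i j () | true
  star≢req i j () | false

module Inside {n : ℕ} (A : Fin n → Bool) where

  inside : Fin n → Fin n → Bool
  inside i j = not (i == j) ∧ (A i ∧ A j)

  -- Each vertex of `A` has `# A - 1` partners in `A`; the lower bound `m` for this number avoids a
  -- truncated subtraction.
  cnt-inside : ∀ m → m ℕ.< # A → # A ℕ.* m ℕ.≤ 2 ℕ.* cnt inside
  cnt-inside m m<A = ℕP.≤-trans (ℕP.≤-trans
      (sum-on-≥ A (λ i → # (λ j → not (i == j) ∧ A j)) m rest)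
      (ℕP.≤-reflexive (trans (sym (##-on A (λ i j → not (i == j) ∧ A j))) (##-cong {n} (λ i j → e (A i) (not (i == j)) (A j))))))
    (ℕP.≤-reflexive (sym (2cnt inside (λ i j → cong₂ _∧_ (cong not (==-comm i j)) (BoolP.∧-comm (A i) (A j)))
      (λ i → cong (λ b → not b ∧ (A i ∧ A i)) (==-refl i)))))
    where
    e : ∀ a b c → a ∧ (b ∧ c) ≡ b ∧ (a ∧ c)
    e true  b c = refl
    e false b c = sym (BoolP.∧-zeroʳ b)
    rest : ∀ i → A i ≡ true → m ℕ.≤ # (λ j → not (i == j) ∧ A j)
    rest i _ = ℕP.≤-pred (ℕP.≤-trans m<A (ℕP.≤-trans
      (#-cover {n} {A} {λ j → j == i} {λ j → not (i == j) ∧ A j} cov)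
      (ℕP.≤-reflexive (cong (ℕ._+ # (λ j → not (i == j) ∧ A j)) (#-≟ i)))))
      where
      cov : ∀ j → A j ≡ true → (j == i) ≡ true ⊎ not (i == j) ∧ A j ≡ true
      cov j a with i FinP.≟ j
      ... | yes refl = inj₁ (==-refl i)
      ... | no _     = inj₂ a

module More (n : ℕ) (p : ℚ) (0≤p : 0ℚ ≤ p) (p≤1 : p ≤ 1ℚ) where
  open Sample n
  open Prob p 0≤p p≤1

  q+p : q + 1ℚ * p ≡ 1ℚ
  q+p = e p
    where
    e : ∀ p → (1ℚ - p) + 1ℚ * p ≡ 1ℚ
    e = solve-∀ ℚ-ring

  small-pattern : ∀ {P : Coins → Set} τ →
    (∀ s → P s → (∀ i j → τ i j ≡ forb → adj s i j ≡ false) × (∀ i j → τ i j ≡ req → adj s i j ≡ true)) →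
    Small P (q ^ forbs τ * p ^ reqs τ)
  small-pattern {P} τ h = subst (Small P) eq (small-tagged 1ℚ 1ℚ τ 0≤1 0≤1
      (λ s Ps → proj₁ (h s Ps) , proj₂ (h s Ps) , ≤-reflexive (sym (trans (*-identityˡ _) (1^ (tilted τ s))))))
    where
    eq : 1ℚ * tagged 1ℚ τ ≡ q ^ forbs τ * p ^ reqs τ
    eq = trans (*-identityˡ (tagged 1ℚ τ)) (trans (cong (_* (q ^ forbs τ * p ^ reqs τ)) (trans (cong (_^ tilts τ) q+p) (1^ (tilts τ)))) (*-identityˡ _))

  -- The exponential moment of a degree: the `n - 1` pairs at `x` are tilted and all others free.
  small-star : ∀ {P : Coins → Set} x c l → 0ℚ ≤ c → 0ℚ ≤ l → (∀ s → P s → 1ℚ ≤ c * l ^ deg (adj s) x) →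
    Small P (c * (q + l * p) ^ (n ℕ.∸ 1))
  small-star {P} x c l 0≤c 0≤l h = subst (Small P) (cong (c *_) eq) (small-tagged c l starTag 0≤c 0≤l
      (λ s Ps → (λ i j e → ⊥-elim (star≢forb i j e)) , (λ i j e → ⊥-elim (star≢req i j e)) ,
        subst (λ m → 1ℚ ≤ c * l ^ m) (sym (star-tilted s)) (h s Ps)))
    where
    open Star x
    eq : tagged l starTag ≡ (q + l * p) ^ (n ℕ.∸ 1)
    eq = trans (cong₂ _*_ (cong ((q + l * p) ^_) star-tilts) (cong₂ (λ a b → q ^ a * p ^ b) star-forbs star-reqs))
      (*-identityʳ ((q + l * p) ^ (n ℕ.∸ 1)))

  small-∃Fin : ∀ {P : Fin n → Coins → Set} {ε} → (∀ x → Small (P x) ε) → Small (λ s → ∃ λ x → P x s) (fromℕℚ n * ε)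
  small-∃Fin {P} {ε} h = subst (Small (λ s → ∃ λ x → P x s))
    (trans (ΣL-const (allFin n) ε) (cong (λ m → fromℕℚ m * ε) (ListP.length-tabulate {n = n} (λ i → i))))
    (small-mono (λ s (x , Px) → x , ∈-allFin x , Px) ≤-refl (small-∃ {ε = λ _ → ε} (allFin n) h))

  -- Markov's inequality for the number of vertices with `P`. Since `P` is not assumed decidable,
  -- the count is that of a Boolean predicate implying it.
  small-markov : ∀ {P : Fin n → Coins → Set} {ε} m → (∀ x → Small (P x) ε) →
    Small (λ s → ∃ λ (B : Fin n → Bool) → (∀ x → B x ≡ true → P x s) × suc m ℕ.≤ # B)
      (recip (fromℕℚ (suc m)) * (fromℕℚ n * ε))
  small-markov {P} {ε} m h = small (λ s → r * ΣL (allFin n) (λ x → F x s))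
      (λ s → *-nonneg 0≤r (ΣL-nonneg (allFin n) (λ x → Small.0≤f (h x) s)))
      covers
      (≤-trans (≤-reflexive (Ex-* N r (λ s → ΣL (allFin n) (λ x → F x s))))
        (*-monoʳ r 0≤r (≤-trans (≤-reflexive (Ex-ΣL N (allFin n) F))
          (≤-trans (ΣL-mono (allFin n) (λ x → Small.Ef≤ε (h x)))
            (≤-reflexive (trans (ΣL-const (allFin n) ε) (cong (λ m → fromℕℚ m * ε) (ListP.length-tabulate {n = n} (λ i → i)))))))))
    where
    N = length (pairs n)
    F : Fin n → Coins → ℚ
    F x s = Small.f (h x) s
    r = recip (fromℕℚ (suc m))
    0<m = fromℕℚ-pos m
    0≤r = <⇒≤ (recip-pos 0<m)
    sum≤ : ∀ {k} (g : Fin k → Fin n) (B : Fin n → Bool) s → (∀ x → B x ≡ true → P x s) →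
      fromℕℚ (# (B ∘ g)) ≤ ΣL (List.tabulate g) (λ x → F x s)
    sum≤ {zero}  g B s hB = ≤-refl
    sum≤ {suc k} g B s hB = ≤-trans (≤-reflexive (fromℕℚ-+ ⟦ B (g zero) ⟧ (# (B ∘ g ∘ suc))))
        (+-mono-≤ (bit (B (g zero)) refl) (sum≤ (g ∘ suc) B s hB))
      where
      bit : ∀ b → B (g zero) ≡ b → fromℕℚ ⟦ b ⟧ ≤ F (g zero) s
      bit true  e = Small.covers (h (g zero)) s (hB (g zero) e)
      bit false e = Small.0≤f (h (g zero)) s
    covers : ∀ s → (∃ λ (B : Fin n → Bool) → (∀ x → B x ≡ true → P x s) × suc m ℕ.≤ # B) → 1ℚ ≤ r * ΣL (allFin n) (λ x → F x s)
    covers s (B , hB , m<) = ≤-trans (≤-reflexive (trans (sym (*-recip 0<m)) (*-comm (fromℕℚ (suc m)) r)))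
      (*-monoʳ r 0≤r (≤-trans (fromℕℚ-mono m<) (sum≤ (λ i → i) B s hB)))

  -- Writing the bound for each set as η^|A| W^|A| ≤ η W^|A| disposes of the empty set.
  small-subsets : ∀ {P : Vec Bool n → Coins → Set} η W → 0ℚ ≤ η → η ≤ 1ℚ → 0ℚ ≤ W → 2ℚ * (fromℕℚ n * W) ≤ 1ℚ →
    (∀ A → 1 ℕ.≤ # (lookup A) → Small (P A) ((η * W) ^ # (lookup A))) →
    Small (λ s → ∃ λ A → 1 ℕ.≤ # (lookup A) × P A s) (η * 2ℚ)
  small-subsets {P} η W 0≤η η≤1 0≤W 2nW h =
      small-mono (λ s (A , A≥1 , PA) → A , ∈-vecs bools A , A≥1 , PA) bound
        (small-∃ {ε = λ A → η * W ^ # (lookup A)} (vecs bs n) each)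
    where
    bs = true ∷ false ∷ []
    bools : ∀ b → b ∈ bs
    bools true  = here refl
    bools false = there (here refl)
    each : ∀ A → Small (λ s → 1 ℕ.≤ # (lookup A) × P A s) (η * W ^ # (lookup A))
    each A with 1 ℕP.≤? # (lookup A)
    ... | no  A<1 = small (λ _ → 0ℚ) (λ _ → ≤-refl) (λ s (A≥1 , _) → ⊥-elim (A<1 A≥1))
      (≤-trans (≤-reflexive (Ex-const (length (pairs n)) 0ℚ)) (*-nonneg 0≤η (^-nonneg (# (lookup A)) 0≤W)))
    ... | yes A≥1 = small-mono (λ s (_ , PA) → PA) (power (# (lookup A)) A≥1) (h A A≥1)
      where
      power : ∀ m → 1 ℕ.≤ m → (η * W) ^ m ≤ η * W ^ m
      power (suc m) _ = ≤-trans (≤-reflexive (^-distrib-* η W (suc m)))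
        (*-monoˡ (W ^ suc m) (^-nonneg (suc m) 0≤W) (≤-trans (*-monoʳ η 0≤η (^≤1 m 0≤η η≤1)) (≤-reflexive (*-identityʳ η))))
    total≤ : ΣL (vecs bs n) (λ A → W ^ # (lookup A)) ≤ 2ℚ
    total≤ = ≤-trans (≤-reflexive (trans (ΣL-cong (vecs bs n) (λ A → sym (ΠV-^ W (λ _ b → b) A)))
        (trans (Σ-ΠV bs n (λ _ b → if b then W else 1ℚ)) (trans (ΠF-const n (W + (1ℚ + 0ℚ))) (cong (_^ n) (+-comm W 1ℚ))))))
      (≤-trans (1+^≤ n 0≤W 2nW) (+-monoʳ-≤ 1ℚ 2nW))
    bound : ΣL (vecs bs n) (λ A → η * W ^ # (lookup A)) ≤ η * 2ℚ
    bound = ≤-trans (≤-reflexive (ΣL-* (vecs bs n) η (λ A → W ^ # (lookup A)))) (*-monoʳ η 0≤η total≤)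

  -- The sum over maps factorises over the vertices: staying put contributes 1 and moving at most
  -- `n * W`, in total at most `(1 + n * W) ^ n ≤ 2`. The factor `η` is split off as in
  -- `small-subsets`, as at least one vertex moves.
  small-foldings : ∀ {P : Coins → Set} η W → 0ℚ ≤ η → η ≤ 1ℚ → 0ℚ ≤ W → 2ℚ * (fromℕℚ n * (fromℕℚ n * W)) ≤ 1ℚ →
    (∀ v → 1 ℕ.≤ # (moved n v) → Small (λ s → P s × Folding n s (lookup v)) ((η * W) ^ # (moved n v))) →
    Small (λ s → P s × ∃ λ v → Folding n s (lookup v) × 1 ℕ.≤ # (moved n v)) (η * 2ℚ)
  small-foldings {P} η W 0≤η η≤1 0≤W 2nW h =
      small-mono (λ s (Ps , v , fo , v≥1) → v , ∈-vecs ∈-allFin v , v≥1 , Ps , fo) bound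
        (small-∃ {ε = λ v → η * W ^ # (moved n v)} (vecs (allFin n) n) each)
    where
    each : ∀ v → Small (λ s → 1 ℕ.≤ # (moved n v) × P s × Folding n s (lookup v)) (η * W ^ # (moved n v))
    each v with 1 ℕP.≤? # (moved n v)
    ... | no  v<1 = small (λ _ → 0ℚ) (λ _ → ≤-refl) (λ s (v≥1 , _) → ⊥-elim (v<1 v≥1))
      (≤-trans (≤-reflexive (Ex-const (length (pairs n)) 0ℚ)) (*-nonneg 0≤η (^-nonneg (# (moved n v)) 0≤W)))
    ... | yes v≥1 = small-mono (λ s (_ , PA) → PA) (power (# (moved n v)) v≥1) (h v v≥1)
      where
      power : ∀ m → 1 ℕ.≤ m → (η * W) ^ m ≤ η * W ^ m
      power (suc m) _ = ≤-trans (≤-reflexive (^-distrib-* η W (suc m)))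
        (*-monoˡ (W ^ suc m) (^-nonneg (suc m) 0≤W) (≤-trans (*-monoʳ η 0≤η (^≤1 m 0≤η η≤1)) (≤-reflexive (*-identityʳ η))))
    c : Fin n → Fin n → ℚ
    c i a = if not (a == i) then W else 1ℚ
    column : ∀ i → ΣL (allFin n) (c i) ≤ 1ℚ + fromℕℚ n * W
    column i = ≤-trans (go (λ a → a)) (≤-reflexive (trans (cong (λ a → fromℕℚ a * 1ℚ + fromℕℚ n * W) (#-≟ i)) refl))
      where
      go : ∀ {k} (g : Fin k → Fin n) → ΣL (List.tabulate g) (c i) ≤ fromℕℚ (# (λ a → g a == i)) * 1ℚ + fromℕℚ k * W
      go {zero}  g = ≤-reflexive (sym (trans (cong₂ _+_ (*-zeroˡ 1ℚ) (*-zeroˡ W)) (+-identityˡ 0ℚ)))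
      go {suc k} g = ≤-trans (+-mono-≤ (bit (g zero == i)) (go (g ∘ suc)))
          (≤-reflexive (trans (e (fromℕℚ ⟦ g zero == i ⟧) W (fromℕℚ (# (λ a → g (suc a) == i))) (fromℕℚ k))
            (cong₂ (λ a b → a * 1ℚ + b * W) (sym (fromℕℚ-+ ⟦ g zero == i ⟧ (# (λ a → g (suc a) == i)))) (sym (fromℕℚ-suc k)))))
        where
        bit : ∀ b → (if not b then W else 1ℚ) ≤ fromℕℚ ⟦ b ⟧ * 1ℚ + W
        bit true  = by-diff W 0≤W refl
        bit false = ≤-reflexive (sym (trans (cong (_+ W) (*-zeroˡ 1ℚ)) (+-identityˡ W)))
        e : ∀ b W x k → b * 1ℚ + W + (x * 1ℚ + k * W) ≡ (b + x) * 1ℚ + (1ℚ + k) * W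
        e = solve-∀ ℚ-ring
    0≤c : ∀ i → 0ℚ ≤ ΣL (allFin n) (c i)
    0≤c i = ΣL-nonneg (allFin n) (λ a → nn (a == i))
      where
      nn : ∀ b → 0ℚ ≤ (if not b then W else 1ℚ)
      nn true  = 0≤1
      nn false = 0≤W
    total≤ : ΣL (vecs (allFin n) n) (λ v → W ^ # (moved n v)) ≤ 2ℚ
    total≤ = ≤-trans (≤-reflexive (trans (ΣL-cong (vecs (allFin n) n) (λ v → sym (ΠV-^ W (λ i a → not (a == i)) v)))
        (Σ-ΠV (allFin n) n c)))
      (≤-trans (ΠF-mono 0≤c column) (≤-trans (≤-reflexive (ΠF-const n (1ℚ + fromℕℚ n * W)))
        (≤-trans (1+^≤ n (*-nonneg (0≤fromℕℚ n) 0≤W) 2nW) (+-monoʳ-≤ 1ℚ 2nW))))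
    bound : ΣL (vecs (allFin n) n) (λ v → η * W ^ # (moved n v)) ≤ η * 2ℚ
    bound = ≤-trans (≤-reflexive (ΣL-* (vecs (allFin n) n) η (λ v → W ^ # (moved n v)))) (*-monoʳ η 0≤η total≤)

-- Cliques among the images of moved vertices

does⇒ : ∀ {P : Set} (d : Dec P) → does d ≡ true → P
does⇒ (yes p) _ = p

does⇒¬ : ∀ {P : Set} (d : Dec P) → does d ≡ false → ¬ P
does⇒¬ (no ¬p) _ = ¬p

count≤length : ∀ {B : Set} (xs : List B) P → count xs P ℕ.≤ length xs
count≤length []       P = ℕ.z≤n
count≤length (x ∷ xs) P = ℕP.+-mono-≤ (⟦⟧≤1 (P x)) (count≤length xs P)

module _ {n : ℕ} (R : Fin n → Fin n → Bool) where

  Clique : (Fin n → Bool) → Set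
  Clique A = ∀ i j → A i ≡ true → A j ≡ true → i ≢ j → R i j ≡ true

  module _ (R-sym : ∀ i j → R i j ≡ R j i) (R-irr : ∀ i → R i i ≡ false) (r : Fin n → Fin n) where

    -- Pick `x` in `X` and keep only those `y` for which `r y` is adjacent to `r x`. Each pick
    -- removes at most `θ` elements, `x` among them because no vertex is adjacent to itself. The
    -- images of the picked vertices are distinct and pairwise adjacent.
    greedy-clique : ∀ θ → 1 ℕ.≤ θ → ∀ j (X : Fin n → Bool) →
      (∀ x → X x ≡ true → # (λ y → not (R (r x) (r y))) ℕ.≤ θ) → j ℕ.* θ ℕ.≤ # X →
      ∃ λ A → Clique A × j ℕ.≤ # A × (∀ a → A a ≡ true → ∃ λ x → X x ≡ true × r x ≡ a)
    greedy-clique θ 1≤θ zero X few le = (λ _ → false) , (λ i j ()) , ℕ.z≤n , (λ a ())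
    greedy-clique θ 1≤θ (suc j) X few le with #-∃ X (ℕP.≤-trans 1≤θ (ℕP.≤-trans (ℕP.m≤m+n θ (j ℕ.* θ)) le))
    ... | x , Xx with greedy-clique θ 1≤θ j (λ y → X y ∧ R (r x) (r y)) (λ y e → few y (proj₁ (∧-true {X y} e)))
           (ℕP.+-cancelˡ-≤ θ _ _ (ℕP.≤-trans le (ℕP.≤-trans
             (#-cover {n} {X} {λ y → not (R (r x) (r y))} {λ y → X y ∧ R (r x) (r y)} cov) (ℕP.+-monoˡ-≤ _ (few x Xx)))))
      where
      cov : ∀ y → X y ≡ true → not (R (r x) (r y)) ≡ true ⊎ X y ∧ R (r x) (r y) ≡ true
      cov y e with R (r x) (r y)
      ... | true  = inj₂ (∧-intro e refl)
      ... | false = inj₁ refl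
    ...   | A , cl , j≤ , im = A′ , cl′ ,
        ℕP.≤-trans (ℕP.≤-trans (ℕP.+-monoʳ-≤ 1 j≤) (ℕP.≤-reflexive (cong (ℕ._+ # A) (sym (#-≟ (r x))))))
          (#-disjoint {n} {A′} {_== r x} {A} (λ i e → ∨-introˡ e) (λ i e → ∨-introʳ {i == r x} e)
            (λ i e a → true≢false (trans (sym (adjacent i a)) (trans (cong (R (r x)) (==⇒≡ {i = i} e)) (R-irr (r x)))))) ,
        im′
      where
      A′ : Fin n → Bool
      A′ i = (i == r x) ∨ A i
      adjacent : ∀ a → A a ≡ true → R (r x) a ≡ true
      adjacent a Aa with im a Aa
      ... | y , Xy , refl = proj₂ (∧-true {X y} Xy)
      cl′ : Clique A′
      cl′ i j A′i A′j i≢j with ∨-true {i == r x} A′i | ∨-true {j == r x} A′j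
      ... | inj₁ e  | inj₁ e′ = ⊥-elim (i≢j (trans (==⇒≡ {i = i} e) (sym (==⇒≡ {i = j} e′))))
      ... | inj₁ e  | inj₂ Aj = subst (λ z → R z j ≡ true) (sym (==⇒≡ {i = i} e)) (adjacent j Aj)
      ... | inj₂ Ai | inj₁ e′ = subst (λ z → R i z ≡ true) (sym (==⇒≡ {i = j} e′)) (trans (R-sym i (r x)) (adjacent i Ai))
      ... | inj₂ Ai | inj₂ Aj = cl i j Ai Aj i≢j
      im′ : ∀ a → A′ a ≡ true → ∃ λ y → X y ≡ true × r y ≡ a
      im′ a e with ∨-true {a == r x} e
      ... | inj₁ e′ = x , Xx , sym (==⇒≡ {i = a} e′)
      ... | inj₂ Aa with im a Aa
      ...   | y , Xy , ry = y , proj₁ (∧-true {X y} Xy) , ry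

    shifted : Fin n → Bool
    shifted x = not (r x == x)

    apart : Fin n → ℕ
    apart x = # (λ y → not (x == y) ∧ not (R (r x) (r y)))

    apart+1 : ∀ x → # (λ y → not (R (r x) (r y))) ℕ.≤ suc (apart x)
    apart+1 x = ℕP.≤-trans (#-cover {n} {λ y → not (R (r x) (r y))} {λ y → y == x} {λ y → not (x == y) ∧ not (R (r x) (r y))} cov)
      (ℕP.≤-reflexive (cong (ℕ._+ apart x) (#-≟ x)))
      where
      cov : ∀ y → not (R (r x) (r y)) ≡ true → (y == x) ≡ true ⊎ not (x == y) ∧ not (R (r x) (r y)) ≡ true
      cov y e with x FinP.≟ y
      ... | yes refl = inj₁ (==-refl x)
      ... | no _     = inj₂ e

    -- If at most `n / 8` vertices move, `r x` has at least `n / 4` non-neighbours, and at least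
    -- `n / 8` of them are fixed, which makes `apart x` large. Otherwise fewer than `k * θ` moved
    -- vertices have `apart x < θ`, since `greedy-clique` would find a clique of size `k` among
    -- their images. That is less than half of the moved vertices, and the others suffice.
    dense-apart : ∀ k θ → 1 ℕ.≤ θ → 16 ℕ.* (k ℕ.* θ) ℕ.≤ n → (∀ A → Clique A → # A ℕ.< k) →
      (∀ x → n ℕ.≤ 4 ℕ.* # (λ y → not (R x y))) →
      # shifted ℕ.* θ ℕ.≤ 2 ℕ.* sum (λ x → ⟦ shifted x ⟧ ℕ.* apart x)
    dense-apart k θ 1≤θ kθ no-clique non-nbr with 8 ℕ.* # shifted ℕP.≤? n
    ... | yes 8t≤n = ℕP.≤-trans (sum-on-≥ shifted apart θ (λ x Tx → many x Tx)) (ℕP.m≤n*m (sum (λ x → ⟦ shifted x ⟧ ℕ.* apart x)) 2)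
      where
      1≤k : 1 ℕ.≤ k
      1≤k = ℕP.≤-trans (ℕ.s≤s ℕ.z≤n) (no-clique (λ _ → false) (λ i j ()))
      cov : ∀ x → shifted x ≡ true → ∀ y → not (R (r x) y) ≡ true → shifted y ≡ true ⊎ not (x == y) ∧ not (R (r x) (r y)) ≡ true
      cov x Tx y e with r y FinP.≟ y
      ... | no _ = inj₁ refl
      ... | yes ry≡y = inj₂ (∧-intro (not-intro (≢⇒== {i = x} {y} (λ { refl → true≢false (trans (sym Tx) (cong not (trans (cong (_== x) ry≡y) (==-refl x)))) })))
            (trans (cong (λ z → not (R (r x) z)) ry≡y) e))
      many : ∀ x → shifted x ≡ true → θ ℕ.≤ apart x
      many x Tx = ℕP.*-cancelˡ-≤ 8 (ℕP.≤-trans (ℕP.≤-trans (ℕP.≤-trans (ℕP.*-monoˡ-≤ θ {8} {16} (ℕP.m≤m+n 8 8))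
          (ℕP.*-monoʳ-≤ 16 (ℕP.≤-trans (ℕP.≤-reflexive (sym (ℕP.*-identityˡ θ))) (ℕP.*-monoˡ-≤ θ 1≤k)))) kθ) 8c)
        where
        n≤ : n ℕ.≤ 4 ℕ.* (# shifted ℕ.+ apart x)
        n≤ = ℕP.≤-trans (non-nbr (r x)) (ℕP.*-monoʳ-≤ 4 (#-cover {n} {λ y → not (R (r x) y)} {shifted} (cov x Tx)))
        8c : n ℕ.≤ 8 ℕ.* apart x
        8c = ℕP.+-cancelˡ-≤ n _ _ (ℕP.≤-trans (ℕP.≤-trans (ℕP.+-mono-≤ n≤ n≤) (ℕP.≤-reflexive (e (# shifted) (apart x)))) (ℕP.+-monoˡ-≤ _ 8t≤n))
          where
          e : ∀ t c → 4 ℕ.* (t ℕ.+ c) ℕ.+ 4 ℕ.* (t ℕ.+ c) ≡ 8 ℕ.* t ℕ.+ 8 ℕ.* c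
          e = ℕSolver.solve-∀
    ... | no 8t≰n with k ℕ.* θ ℕP.≤? # (λ x → shifted x ∧ does (apart x ℕP.<? θ))
    ...   | yes many = ⊥-elim (ℕP.<⇒≱ (no-clique (proj₁ found) (proj₁ (proj₂ found))) (proj₁ (proj₂ (proj₂ found))))
      where
      found = greedy-clique θ 1≤θ k (λ x → shifted x ∧ does (apart x ℕP.<? θ))
        (λ x e → ℕP.≤-trans (apart+1 x) (does⇒ (apart x ℕP.<? θ) (proj₂ (∧-true {shifted x} e)))) many
    ...   | no few = ℕP.≤-trans (ℕP.≤-trans (ℕP.*-monoˡ-≤ θ t≤2g) (ℕP.≤-reflexive (ℕP.*-assoc 2 (# good) θ)))
        (ℕP.*-monoʳ-≤ 2 (ℕP.≤-trans (sum-on-≥ good apart θ (λ x e → ℕP.≮⇒≥ (does⇒¬ (apart x ℕP.<? θ) (not-true (proj₂ (∧-true {shifted x} e))))))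
          (sum-mono (λ x → ℕP.*-monoˡ-≤ (apart x) (⟦⟧-mono {good x} {shifted x} (λ e → proj₁ (∧-true {shifted x} e)))))))
      where
      bad good : Fin n → Bool
      bad x = shifted x ∧ does (apart x ℕP.<? θ)
      good x = shifted x ∧ not (does (apart x ℕP.<? θ))
      t≤ : # shifted ℕ.≤ # bad ℕ.+ # good
      t≤ = #-cover {n} {shifted} {bad} {good} cov
        where
        cov : ∀ x → shifted x ≡ true → bad x ≡ true ⊎ good x ≡ true
        cov x Tx with does (apart x ℕP.<? θ)
        ... | true  = inj₁ (∧-intro Tx refl)
        ... | false = inj₂ (∧-intro Tx refl)
      2bad≤t : 2 ℕ.* # bad ℕ.≤ # shifted
      2bad≤t = ℕP.*-cancelˡ-≤ 8 (ℕP.≤-trans (ℕP.≤-trans (ℕP.≤-reflexive (sym (ℕP.*-assoc 8 2 (# bad))))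
        (ℕP.≤-trans (ℕP.*-monoʳ-≤ 16 (ℕP.<⇒≤ (ℕP.≰⇒> few))) kθ)) (ℕP.<⇒≤ (ℕP.≰⇒> 8t≰n)))
      t≤2g : # shifted ℕ.≤ 2 ℕ.* # good
      t≤2g = ℕP.+-cancelˡ-≤ (# shifted) _ _ (ℕP.≤-trans (ℕP.+-mono-≤ t≤ t≤) (ℕP.≤-trans (ℕP.≤-reflexive (e (# bad) (# good)))
        (ℕP.+-monoˡ-≤ (2 ℕ.* # good) 2bad≤t)))
        where
        e : ∀ b g → b ℕ.+ g ℕ.+ (b ℕ.+ g) ≡ 2 ℕ.* b ℕ.+ 2 ℕ.* g
        e = ℕSolver.solve-∀

2^ℚ : ∀ m → fromℕℚ (2 ℕ.^ m) ≡ 2ℚ ^ m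
2^ℚ m = fromℕℚ-^ 2 m

2^*½^≤ : ∀ a b → a ℕ.≤ b → 2ℚ ^ a * ½ ^ b ≡ ½ ^ (b ℕ.∸ a)
2^*½^≤ a b a≤b = trans (cong (λ c → 2ℚ ^ a * ½ ^ c) (sym (ℕP.m+[n∸m]≡n a≤b)))
  (trans (cong (2ℚ ^ a *_) (^-homo-* ½ a (b ℕ.∸ a))) (trans (sym (*-assoc (2ℚ ^ a) (½ ^ a) (½ ^ (b ℕ.∸ a))))
    (trans (cong (_* ½ ^ (b ℕ.∸ a)) (2^*½^ a)) (*-identityˡ _))))

½^≤1 : ∀ m → ½ ^ m ≤ 1ℚ
½^≤1 m = ^≤1 m 0≤½ ½≤1

bools : List Bool
bools = true ∷ false ∷ []

∈-bools : ∀ b → b ∈ bools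
∈-bools true  = here refl
∈-bools false = there (here refl)

-- Many edges

module Dense (n : ℕ) (p : ℚ) (0≤p : 0ℚ ≤ p) (p≤½ : p ≤ ½) (e : ℕ)
  (n≤ : n ℕ.≤ 2 ℕ.^ (16 ℕ.* e ℕ.+ 16)) where
  private p≤1 = ≤-trans p≤½ ½≤1
  open Sample n
  open Prob p 0≤p p≤1
  open More n p 0≤p p≤1

  -- At the intended scale, with `e` about a sixteenth of the binary logarithm of `n`, this is about
  -- `n ^ (-1/16)`, the unit in which failure probabilities are measured.
  η : ℚ
  η = ½ ^ e

  n≤2^ : fromℕℚ n ≤ 2ℚ ^ (16 ℕ.* e ℕ.+ 16)
  n≤2^ = ≤-trans (fromℕℚ-mono n≤) (≤-reflexive (2^ℚ (16 ℕ.* e ℕ.+ 16)))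

  2n²W≤1 : 2ℚ * (fromℕℚ n * (fromℕℚ n * ½ ^ (32 ℕ.* e ℕ.+ 34))) ≤ 1ℚ
  2n²W≤1 = ≤-trans (*-monoʳ 2ℚ 0≤2 (*-mono₂ (0≤fromℕℚ n) (*-nonneg (0≤fromℕℚ n) (0≤½^′ w)) n≤2^ (*-monoˡ (½ ^ w) (0≤½^′ w) n≤2^)))
    (≤-trans (≤-reflexive (trans (cong (2ℚ *_) (trans (sym (*-assoc (2ℚ ^ m) (2ℚ ^ m) (½ ^ w))) (cong (_* ½ ^ w) (sym (^-homo-* 2ℚ m m)))))
      (trans (sym (*-assoc 2ℚ (2ℚ ^ (m ℕ.+ m)) (½ ^ w))) (2^*½^≤ (suc (m ℕ.+ m)) w sm≤w))))
      (½^≤1 (w ℕ.∸ suc (m ℕ.+ m))))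
    where
    m = 16 ℕ.* e ℕ.+ 16
    w = 32 ℕ.* e ℕ.+ 34
    sm≤w : suc (m ℕ.+ m) ℕ.≤ w
    sm≤w = ℕP.≤-trans (ℕP.n≤1+n (suc (m ℕ.+ m))) (ℕP.≤-reflexive (eq e))
      where
      eq : ∀ e → suc (suc (16 ℕ.* e ℕ.+ 16 ℕ.+ (16 ℕ.* e ℕ.+ 16))) ≡ 32 ℕ.* e ℕ.+ 34
      eq = ℕSolver.solve-∀

  2nW≤1 : 2ℚ * (fromℕℚ n * ½ ^ (16 ℕ.* e ℕ.+ 17)) ≤ 1ℚ
  2nW≤1 = ≤-trans (*-monoʳ 2ℚ 0≤2 (*-monoˡ (½ ^ w) (0≤½^′ w) n≤2^))
    (≤-trans (≤-reflexive (trans (sym (*-assoc 2ℚ (2ℚ ^ m) (½ ^ w))) (2^*½^≤ (suc m) w (ℕP.≤-reflexive (eq e)))))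
      (½^≤1 (w ℕ.∸ suc m)))
    where
    m = 16 ℕ.* e ℕ.+ 16
    w = 16 ℕ.* e ℕ.+ 17
    eq : ∀ e → suc (16 ℕ.* e ℕ.+ 16) ≡ 16 ℕ.* e ℕ.+ 17
    eq = ℕSolver.solve-∀

  -- A clique on `a > 34 (e + 1)` vertices needs at least `17 (e + 1) a` edges, each of probability
  -- at most `½`. The exponent `17 (e + 1) = e + (16 e + 17)` splits into `η` and a weight `W` with
  -- `2 n W ≤ 1`.
  small-clique : Small (λ s → ∃ λ A → 1 ℕ.≤ # (lookup A) × Clique (adj s) (lookup A) × 34 ℕ.* suc e ℕ.< # (lookup A)) (η * 2ℚ)
  small-clique = small-subsets {P = P} η (½ ^ (16 ℕ.* e ℕ.+ 17)) (0≤½^′ e) (½^≤1 e) (0≤½^′ (16 ℕ.* e ℕ.+ 17)) 2nW≤1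
    (λ A _ → subst (λ z → Small (P A) (z ^ # (lookup A))) (sym ηW) (each A))
    where
    P : Vec Bool n → Coins → Set
    P A s = Clique (adj s) (lookup A) × 34 ℕ.* suc e ℕ.< # (lookup A)
    m = 17 ℕ.* suc e
    ηW : η * ½ ^ (16 ℕ.* e ℕ.+ 17) ≡ ½ ^ m
    ηW = trans (sym (^-homo-* ½ e (16 ℕ.* e ℕ.+ 17))) (cong (½ ^_) (eq e))
      where
      eq : ∀ e → e ℕ.+ (16 ℕ.* e ℕ.+ 17) ≡ 17 ℕ.* suc e
      eq = ℕSolver.solve-∀
    each : ∀ A → Small (P A) ((½ ^ m) ^ # (lookup A))
    each A with 34 ℕ.* suc e ℕP.<? # (lookup A)
    ... | no ¬big = small (λ _ → 0ℚ) (λ _ → ≤-refl) (λ s (_ , big) → ⊥-elim (¬big big))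
      (≤-trans (≤-reflexive (Ex-const (length (pairs n)) 0ℚ)) (^-nonneg (# (lookup A)) (0≤½^′ m)))
    ... | yes big = small-mono (λ s h → h) bound (small-pattern τ
        (λ s (cl , _) → (λ i j e → ⊥-elim (τ-forb i j e)) , (λ i j e → let (i≢j , Ai , Aj) = τ-req i j e in cl i j Ai Aj i≢j)))
      where
      open Inside (lookup A)
      τ : Tags
      τ i j = if inside i j then req else free
      τ-forb : ∀ i j → τ i j ≢ forb
      τ-forb i j e with inside i j
      τ-forb i j () | true
      τ-forb i j () | false
      τ-req : ∀ i j → τ i j ≡ req → i ≢ j × lookup A i ≡ true × lookup A j ≡ true
      τ-req i j e with i FinP.≟ j | lookup A i | lookup A j
      τ-req i j ()   | yes _  | _ | _
      τ-req i j e    | no i≢j | true | true = i≢j , refl , refl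
      τ-req i j ()   | no i≢j | true | false
      τ-req i j ()   | no i≢j | false | _
      isReq-τ : ∀ i j → isReq (τ i j) ≡ inside i j
      isReq-τ i j with inside i j
      ... | true  = refl
      ... | false = refl
      reqs≥ : # (lookup A) ℕ.* m ℕ.≤ reqs τ
      reqs≥ = ℕP.*-cancelˡ-≤ 2 (ℕP.≤-trans (ℕP.≤-reflexive (eq (# (lookup A)) e))
        (ℕP.≤-trans (cnt-inside (34 ℕ.* suc e) big) (ℕP.≤-reflexive (cong (2 ℕ.*_) (sym (count-cong (pairs n) (λ {(i , j)} _ → isReq-τ i j)))))))
        where
        eq : ∀ a e → 2 ℕ.* (a ℕ.* (17 ℕ.* suc e)) ≡ a ℕ.* (34 ℕ.* suc e)
        eq = ℕSolver.solve-∀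
      bound : q ^ forbs τ * p ^ reqs τ ≤ (½ ^ m) ^ # (lookup A)
      bound = ≤-trans (*-mono₂ (^-nonneg (forbs τ) 0≤q) (^-nonneg (reqs τ) 0≤p) (^≤1 (forbs τ) 0≤q q≤1)
            (≤-trans (^-mono (reqs τ) 0≤p p≤½) (^-antiʳ 0≤½ ½≤1 reqs≥)))
          (≤-reflexive (trans (*-identityˡ _) (trans (cong (½ ^_) (ℕP.*-comm (# (lookup A)) m)) (sym (^-assocʳ ½ m (# (lookup A)))))))

  3/2 2/3 : ℚ
  3/2 = 1ℚ + ½
  2/3 = recip 3/2

  -- A Chernoff bound for degrees above `3 n / 4`. Taking the tilt as a fourth power of `3/2` keeps
  -- the exponents integral. In the worst case `p = ½` the base is `(2/3)³ (1 + 65/32) = 97/108`,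
  -- just below `9/10`.
  small-non-neighbours : ∀ j → 10 ℕ.* j ℕ.≤ n →
    Small (λ s → ∃ λ x → 4 ℕ.* # (λ y → not (adj s x y)) ℕ.< n) (fromℕℚ n * ½ ^ j)
  small-non-neighbours j 10j≤n = small-∃Fin (λ x → small-mono (λ s h → h) bound
      (small-star x (2/3 ^ (3 ℕ.* n)) (3/2 ^ 4) (^-nonneg (3 ℕ.* n) (nonNegative⁻¹ 2/3)) (nonNegative⁻¹ (3/2 ^ 4)) (event x)))
    where
    event : ∀ x s → 4 ℕ.* # (λ y → not (adj s x y)) ℕ.< n → 1ℚ ≤ 2/3 ^ (3 ℕ.* n) * (3/2 ^ 4) ^ deg (adj s) x
    event x s h = ≤-trans (≤-reflexive (sym (trans (sym (^-distrib-* 2/3 3/2 (3 ℕ.* n))) (1^ (3 ℕ.* n)))))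
      (*-monoʳ (2/3 ^ (3 ℕ.* n)) (^-nonneg (3 ℕ.* n) (nonNegative⁻¹ 2/3))
        (≤-trans (^-monoʳ (by-diff ½ 0≤½ refl) 3n≤4d) (≤-reflexive (sym (^-assocʳ 3/2 4 (deg (adj s) x))))))
      where
      d = deg (adj s) x
      c = # (λ y → not (adj s x y))
      3n≤4d : 3 ℕ.* n ℕ.≤ 4 ℕ.* d
      3n≤4d = ℕP.+-cancelˡ-≤ n _ _ (ℕP.≤-trans (ℕP.≤-reflexive (trans (cong (4 ℕ.*_) (sym (#-not (adj s x)))) (eq d c)))
        (ℕP.+-monoˡ-≤ (4 ℕ.* d) (ℕP.<⇒≤ h)))
        where
        eq : ∀ d c → 4 ℕ.* (d ℕ.+ c) ≡ 4 ℕ.* c ℕ.+ 4 ℕ.* d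
        eq = ℕSolver.solve-∀
    base : ℚ
    base = q + 3/2 ^ 4 * p
    1≤base : 1ℚ ≤ base
    1≤base = by-diff ((3/2 ^ 4 - 1ℚ) * p) (*-nonneg (nonNegative⁻¹ (3/2 ^ 4 - 1ℚ)) 0≤p) (eq p)
      where
      eq : ∀ p → 1ℚ + (3/2 ^ 4 - 1ℚ) * p ≡ (1ℚ - p) + 3/2 ^ 4 * p
      eq = solve-∀ ℚ-ring
    base≤ : 2/3 ^ 3 * base ≤ 1ℚ - recip (fromℕℚ 10)
    base≤ = ≤-trans (*-monoʳ (2/3 ^ 3) (nonNegative⁻¹ (2/3 ^ 3)) (by-diff {base} {1ℚ + (3/2 ^ 4 - 1ℚ) * ½} ((3/2 ^ 4 - 1ℚ) * (½ - p))
        (*-nonneg (nonNegative⁻¹ (3/2 ^ 4 - 1ℚ)) (0≤-diff p≤½)) (eq p)))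
        (≤ᵇ⇒≤ _)
      where
      eq : ∀ p → (1ℚ - p) + 3/2 ^ 4 * p + (3/2 ^ 4 - 1ℚ) * (½ - p) ≡ 1ℚ + (3/2 ^ 4 - 1ℚ) * ½
      eq = solve-∀ ℚ-ring
    0≤9/10 : 0ℚ ≤ 1ℚ - recip (fromℕℚ 10)
    0≤9/10 = nonNegative⁻¹ (1ℚ - recip (fromℕℚ 10))
    bound : 2/3 ^ (3 ℕ.* n) * base ^ (n ℕ.∸ 1) ≤ ½ ^ j
    bound = ≤-trans (*-monoʳ (2/3 ^ (3 ℕ.* n)) (^-nonneg (3 ℕ.* n) (nonNegative⁻¹ 2/3)) (^-monoʳ 1≤base (ℕP.m∸n≤m n 1)))
      (≤-trans (≤-reflexive (trans (cong (_* base ^ n) (sym (^-assocʳ 2/3 3 n))) (sym (^-distrib-* (2/3 ^ 3) base n))))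
        (≤-trans (^-mono n (*-nonneg (nonNegative⁻¹ (2/3 ^ 3)) (≤-trans 0≤1 1≤base)) base≤)
          (decay⇒≤½^ j (^-nonneg n 0≤9/10) j≤ (decay-^ n 0≤9/10 (decay-1- (nonNegative⁻¹ (recip (fromℕℚ 10)) , ≤ᵇ⇒≤ _))))))
      where
      j≤ : fromℕℚ j ≤ fromℕℚ n * recip (fromℕℚ 10)
      j≤ = ≤-trans (≤-reflexive (trans (sym (*-recip-assoc (fromℕℚ 10) (fromℕℚ j) (fromℕℚ-pos 9)))
            (trans (sym (*-assoc (fromℕℚ 10) (fromℕℚ j) (recip (fromℕℚ 10)))) (cong (_* recip (fromℕℚ 10)) (sym (fromℕℚ-* 10 j))))))
          (*-monoˡ (recip (fromℕℚ 10)) (nonNegative⁻¹ (recip (fromℕℚ 10))) (fromℕℚ-mono 10j≤n))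

  module _ (D : ℕ) (D≤np : fromℕℚ D ≤ fromℕℚ n * p) (D-large : 80640 ℕ.* (suc e ℕ.* suc e) ℕ.≤ D) where

    -- `dense-apart` is applied with `k = 34 (e + 1) + 1`, at most `35 (e + 1)`, and with `4 θ`, so
    -- it asks for `16 k (4 θ) ≤ n`: hence `K`. The exponent `j = e + (32 e + 34)` pays for `η` and
    -- for the factor `n²` of the union bound over maps. The lower bound on `D` is chosen to exceed
    -- `K * suc j`.
    K j θ : ℕ
    K = 64 ℕ.* (35 ℕ.* suc e)
    j = 33 ℕ.* e ℕ.+ 34
    θ = n DivMod./ K

    Kj≤D : K ℕ.* suc j ℕ.≤ D
    Kj≤D = ℕP.≤-trans (ℕP.≤-trans (ℕP.*-monoʳ-≤ K j≤) (ℕP.≤-reflexive (eq e))) (ℕP.≤-trans (ℕP.*-monoˡ-≤ (suc e ℕ.* suc e) (ℕP.m≤m+n 78400 2240)) D-large)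
      where
      j≤ : suc j ℕ.≤ 35 ℕ.* suc e
      j≤ = ℕP.≤-trans (ℕP.m≤m+n (suc j) (2 ℕ.* e)) (ℕP.≤-reflexive (eq′ e))
        where
        eq′ : ∀ e → suc (33 ℕ.* e ℕ.+ 34) ℕ.+ 2 ℕ.* e ≡ 35 ℕ.* suc e
        eq′ = ℕSolver.solve-∀
      eq : ∀ e → 64 ℕ.* (35 ℕ.* suc e) ℕ.* (35 ℕ.* suc e) ≡ 78400 ℕ.* (suc e ℕ.* suc e)
      eq = ℕSolver.solve-∀

    Kθ≤n : K ℕ.* θ ℕ.≤ n
    Kθ≤n = ℕP.≤-trans (ℕP.≤-reflexive (ℕP.*-comm K θ)) (DivMod.m/n*n≤m n K)

    -- From `n ≤ K (θ + 1)` it follows that `K (j + 1) ≤ n p ≤ K (θ p + 1)`: the successor of `j`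
    -- absorbs the rounding of `θ`.
    j≤θp : fromℕℚ j ≤ fromℕℚ θ * p
    j≤θp = ≤-diff (subst (0ℚ ≤_) (eq′ (fromℕℚ θ * p) (fromℕℚ j)) (0≤-diff (*-cancelˡ {1ℚ + fromℕℚ j} {fromℕℚ θ * p + 1ℚ} (fromℕℚ K) (fromℕℚ-pos _)
        (≤-trans (≤-reflexive (sym (trans (fromℕℚ-* K (suc j)) (cong (fromℕℚ K *_) (fromℕℚ-suc j)))))
          (≤-trans (fromℕℚ-mono Kj≤D) (≤-trans D≤np (≤-trans (*-monoˡ p 0≤p (fromℕℚ-mono n≤Kθ))
            (≤-trans (≤-reflexive (trans (cong (_* p) (trans (fromℕℚ-* K (suc θ)) (cong (fromℕℚ K *_) (fromℕℚ-suc θ)))) (eq (fromℕℚ K) (fromℕℚ θ) p)))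
              (*-monoʳ (fromℕℚ K) (0≤fromℕℚ K) (+-monoʳ-≤ (fromℕℚ θ * p) p≤1)))))))))) 
      where
      n≤Kθ : n ℕ.≤ K ℕ.* suc θ
      n≤Kθ = ℕP.≤-trans (ℕP.≤-reflexive (DivMod.m≡m%n+[m/n]*n n K)) (ℕP.≤-trans (ℕP.+-monoˡ-≤ (θ ℕ.* K) (ℕP.<⇒≤ (DivMod.m%n<n n K)))
        (ℕP.≤-reflexive (ℕP.*-comm (suc θ) K)))
      eq : ∀ K t p → K * (1ℚ + t) * p ≡ K * (t * p + p)
      eq = solve-∀ ℚ-ring
      eq′ : ∀ x j → x + 1ℚ - (1ℚ + j) ≡ x - j
      eq′ = solve-∀ ℚ-ring

    1≤θ : 1 ℕ.≤ θ
    1≤θ = fromℕℚ-cancel-≤ (≤-trans (≤-trans (fromℕℚ-mono {1} {j} (ℕP.≤-trans (ℕ.s≤s ℕ.z≤n) (ℕP.m≤n+m 34 (33 ℕ.* e)))) j≤θp)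
      (≤-trans (*-monoʳ (fromℕℚ θ) (0≤fromℕℚ θ) p≤1) (≤-reflexive (*-identityʳ (fromℕℚ θ)))))

    Good : Coins → Set
    Good s = (∀ A → Clique (adj s) (lookup A) → # (lookup A) ℕ.≤ 34 ℕ.* suc e) × (∀ x → n ℕ.≤ 4 ℕ.* # (λ y → not (adj s x y)))

    qθ≤ : q ^ θ ≤ ½ ^ j
    qθ≤ = decay⇒≤½^ j (^-nonneg θ 0≤q) j≤θp (decay-^ θ 0≤q (decay-1- (0≤p , p≤1)))

    small-folds : Small (λ s → Good s × ∃ λ v → Folding n s (lookup v) × 1 ℕ.≤ # (moved n v)) (η * 2ℚ)
    small-folds = small-foldings η W (0≤½^′ e) (½^≤1 e) (0≤½^′ (32 ℕ.* e ℕ.+ 34)) 2n²W≤1 each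
      where
      W = ½ ^ (32 ℕ.* e ℕ.+ 34)
      ηW : ½ ^ j ≡ η * W
      ηW = trans (cong (½ ^_) (eq e)) (^-homo-* ½ e (32 ℕ.* e ℕ.+ 34))
        where
        eq : ∀ e → 33 ℕ.* e ℕ.+ 34 ≡ e ℕ.+ (32 ℕ.* e ℕ.+ 34)
        eq = ℕSolver.solve-∀
      N = length (pairs n)
      each : ∀ v → 1 ℕ.≤ # (moved n v) → Small (λ s → Good s × Folding n s (lookup v)) ((η * W) ^ # (moved n v))
      -- With `l = 1` the tilts weigh nothing, and their number is bounded trivially by that of all
      -- pairs. The forbidden pairs alone pay for the union bound.
      each v _ = small-mono (λ s h → h) bound (small-folding p 0≤p p≤1 Good 1ℚ 1ℚ N (θ ℕ.* # T′) 0≤1 ≤-refl conditions)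
        where
        open Move n (lookup v) renaming (T to T′)
        bound : 1ℚ * ((q + 1ℚ * p) ^ N * q ^ (θ ℕ.* # T′)) ≤ (η * W) ^ # T′
        bound = ≤-trans (≤-reflexive (trans (*-identityˡ _) (trans (cong (_* q ^ (θ ℕ.* # T′)) (trans (cong (_^ N) q+p) (1^ N)))
            (trans (*-identityˡ _) (sym (^-assocʳ q θ (# T′)))))))
          (≤-trans (^-mono (# T′) (^-nonneg θ 0≤q) qθ≤) (≤-reflexive (cong (_^ # T′) ηW)))
        conditions : ∀ s → Good s → Folding n s (lookup v) →
          1ℚ ≤ 1ℚ * 1ℚ ^ tilted (τ s) s × tilts (τ s) ℕ.≤ N × θ ℕ.* # T′ ℕ.≤ forbs (τ s)
        conditions s (no-clique , non-nbr) fo =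
            ≤-reflexive (sym (trans (*-identityˡ _) (1^ (tilted (τ s) s)))) ,
            count≤length (pairs n) (λ (i , j) → isTilt (τ s i j)) ,
            ℕP.*-cancelˡ-≤ 4 (ℕP.≤-trans (ℕP.≤-reflexive (eq θ (# T′)))
              (ℕP.≤-trans (dense-apart (adj s) (adj-sym s) (adj-irr s) (lookup v) (suc (34 ℕ.* suc e)) (4 ℕ.* θ)
                  (ℕP.≤-trans 1≤θ (ℕP.m≤n*m θ 4)) θ-small no-clique′ non-nbr)
                (ℕP.≤-trans (ℕP.*-monoʳ-≤ 2 (forbs≥₁ s)) (ℕP.≤-reflexive (sym (ℕP.*-assoc 2 2 (forbs (τ s))))))))
          where
          eq : ∀ a b → 4 ℕ.* (a ℕ.* b) ≡ b ℕ.* (4 ℕ.* a)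
          eq = ℕSolver.solve-∀
          θ-small : 16 ℕ.* (suc (34 ℕ.* suc e) ℕ.* (4 ℕ.* θ)) ℕ.≤ n
          θ-small = ℕP.≤-trans (ℕP.≤-trans (ℕP.m≤m+n _ (64 ℕ.* e ℕ.* θ)) (ℕP.≤-reflexive (eq₂ e θ))) Kθ≤n
            where
            eq₂ : ∀ e t → 16 ℕ.* (suc (34 ℕ.* suc e) ℕ.* (4 ℕ.* t)) ℕ.+ 64 ℕ.* e ℕ.* t ≡ 64 ℕ.* (35 ℕ.* suc e) ℕ.* t
            eq₂ = ℕSolver.solve-∀
          no-clique′ : ∀ A → Clique (adj s) A → # A ℕ.< suc (34 ℕ.* suc e)
          no-clique′ A cl = ℕ.s≤s (ℕP.≤-trans (ℕP.≤-reflexive (#-cong {n} (λ i → sym (VecP.lookup∘tabulate A i))))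
            (no-clique (tabulate A) (λ i j Ai Aj → cl i j (trans (sym (VecP.lookup∘tabulate A i)) Ai) (trans (sym (VecP.lookup∘tabulate A j)) Aj))))

    clique? : ∀ s (A : Fin n → Bool) → Dec (Clique (adj s) A)
    clique? s A = FinP.all? λ i → FinP.all? λ j →
      (A i BoolP.≟ true) →-dec ((A j BoolP.≟ true) →-dec (¬? (i FinP.≟ j) →-dec (adj s i j BoolP.≟ true)))

    dense-core : Small (λ s → ¬ IsCore (graph n s)) (fromℕℚ 5 * η)
    dense-core = small-mono split (≤-trans (+-mono-≤ (≤-refl {η * 2ℚ}) (+-mono-≤ n½≤η (≤-refl {η * 2ℚ}))) (≤-reflexive (eq η)))
        (small-⊎ small-clique (small-⊎ (small-non-neighbours (17 ℕ.* suc e) 10j≤n) small-folds))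
      where
      eq : ∀ η → η * 2ℚ + (η + η * 2ℚ) ≡ fromℕℚ 5 * η
      eq = solve-∀ ℚ-ring
      n½≤η : fromℕℚ n * ½ ^ (17 ℕ.* suc e) ≤ η
      n½≤η = ≤-trans (*-monoˡ (½ ^ (17 ℕ.* suc e)) (0≤½^′ (17 ℕ.* suc e)) n≤2^)
        (≤-trans (≤-reflexive (2^*½^≤ (16 ℕ.* e ℕ.+ 16) (17 ℕ.* suc e) le))
          (^-antiʳ 0≤½ ½≤1 (ℕP.m+n≤o⇒m≤o∸n e (ℕP.≤-trans (ℕP.n≤1+n _) (ℕP.≤-reflexive (eq₂ e))))))
        where
        eq₂ : ∀ e → suc (e ℕ.+ (16 ℕ.* e ℕ.+ 16)) ≡ 17 ℕ.* suc e
        eq₂ = ℕSolver.solve-∀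
        le : 16 ℕ.* e ℕ.+ 16 ℕ.≤ 17 ℕ.* suc e
        le = ℕP.≤-trans (ℕP.m≤n+m (16 ℕ.* e ℕ.+ 16) (suc e)) (ℕP.≤-reflexive (eq₂ e))
      10j≤n : 10 ℕ.* (17 ℕ.* suc e) ℕ.≤ n
      10j≤n = ℕP.≤-trans (ℕP.≤-trans (ℕP.≤-reflexive (sym (ℕP.*-assoc 10 17 (suc e))))
          (ℕP.*-mono-≤ {170} {80640} {suc e} {suc e ℕ.* suc e} (ℕP.m≤m+n 170 80470) (ℕP.m≤m*n (suc e) (suc e))))
        (ℕP.≤-trans D-large (fromℕℚ-cancel-≤ (≤-trans D≤np (≤-trans (*-monoʳ (fromℕℚ n) (0≤fromℕℚ n) p≤1) (≤-reflexive (*-identityʳ (fromℕℚ n)))))))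
      Bad : Coins → Set
      Bad s = (∃ λ A → 1 ℕ.≤ # (lookup A) × Clique (adj s) (lookup A) × 34 ℕ.* suc e ℕ.< # (lookup A)) ⊎
        (∃ λ x → 4 ℕ.* # (λ y → not (adj s x y)) ℕ.< n) ⊎
        (Good s × ∃ λ v → Folding n s (lookup v) × 1 ℕ.≤ # (moved n v))
      BigClique : Coins → Vec Bool n → Set
      BigClique s A = Clique (adj s) (lookup A) × 34 ℕ.* suc e ℕ.< # (lookup A)
      FewNon : Coins → Fin n → Set
      FewNon s x = 4 ℕ.* # (λ y → not (adj s x y)) ℕ.< n
      decide : ∀ s → ¬ IsCore (graph n s) → Dec (Any.Any (BigClique s) (vecs bools n)) → Dec (∃ (FewNon s)) → Bad s
      decide s ¬core (yes some) _          = let (A , cl , big) = Any.satisfied some in inj₁ (A , ℕP.≤-trans (ℕ.s≤s ℕ.z≤n) big , cl , big)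
      decide s ¬core (no _)     (yes some) = inj₂ (inj₁ some)
      decide s ¬core (no none)  (no none′) = inj₂ (inj₂
        (((λ A cl → ℕP.≮⇒≥ (λ big → none (lose (∈-vecs ∈-bools A) (cl , big)))) , (λ x → ℕP.≮⇒≥ (λ few → none′ (x , few)))) ,
         ¬core⇒folding n s ¬core))
      split : ∀ s → ¬ IsCore (graph n s) → Bad s
      split s ¬core = decide s ¬core
        (Any.any? (λ A → clique? s (lookup A) ×-dec (34 ℕ.* suc e ℕP.<? # (lookup A))) (vecs bools n))
        (FinP.any? (λ x → 4 ℕ.* # (λ y → not (adj s x y)) ℕP.<? n))

1+^≤2^ : ∀ {y} m j → 0ℚ ≤ y → fromℕℚ m * y ≤ fromℕℚ j * ½ → (1ℚ + y) ^ m ≤ 2ℚ ^ j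
1+^≤2^ m j 0≤y h = grow⇒≤2^ j h (grow-^ m (+-nonneg 0≤1 0≤y) (grow-1+ 0≤y))

1≤2^ : ∀ m → 1ℚ ≤ 2ℚ ^ m
1≤2^ m = 1≤^ m (by-diff 1ℚ 0≤1 refl)

2^*½^≥ : ∀ a b → b ℕ.≤ a → 2ℚ ^ a * ½ ^ b ≡ 2ℚ ^ (a ℕ.∸ b)
2^*½^≥ a b b≤a = trans (cong (λ c → 2ℚ ^ c * ½ ^ b) (sym (ℕP.m∸n+n≡m b≤a)))
  (trans (cong (_* ½ ^ b) (^-homo-* 2ℚ (a ℕ.∸ b) b)) (trans (*-assoc (2ℚ ^ (a ℕ.∸ b)) (2ℚ ^ b) (½ ^ b))
    (trans (cong (2ℚ ^ (a ℕ.∸ b) *_) (2^*½^ b)) (*-identityʳ _))))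

≤2^⇒½^ : ∀ {x} a b → x * 2ℚ ^ a ≤ 2ℚ ^ b → b ℕ.≤ a → x ≤ ½ ^ (a ℕ.∸ b)
≤2^⇒½^ {x} a b h b≤a = ≤-trans (≤-reflexive (sym (trans (*-assoc x (2ℚ ^ a) (½ ^ a)) (trans (cong (x *_) (2^*½^ a)) (*-identityʳ x)))))
  (≤-trans (*-monoˡ (½ ^ a) (0≤½^′ a) h) (≤-reflexive (2^*½^≤ b a b≤a)))

-- Few edges

-- `a` and `b` stand for approximations of `log n` and `log (log n)`, accessible only through lower
-- bounds on their exponentials. `M` is the excess of `n p` over their sum. `X` is an integer above
-- `n p`, and its bound keeps `n p` below about `n ^ (1/16)`.
record Regime : Set where
  field
    n      : ℕ
    p      : ℚ
    0≤p    : 0ℚ ≤ p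
    p≤½    : p ≤ ½
    e X    : ℕ
    ≤n     : 2 ℕ.^ (16 ℕ.* e) ℕ.≤ n
    n≤     : n ℕ.≤ 2 ℕ.^ (16 ℕ.* e ℕ.+ 16)
    11≤e   : 11 ℕ.≤ e
    32X≤   : 32 ℕ.* X ℕ.≤ 2 ℕ.^ e
    np≤X   : fromℕℚ n * p ≤ fromℕℚ X
    a b M  : ℚ
    grow-a : Grow a (½ * fromℕℚ n)
    grow-b : Grow b (½ * a)
    1≤a    : 1ℚ ≤ a
    b≤a    : b ≤ a
    8≤M    : fromℕℚ 8 ≤ M
    ab≤    : a + b + M ≤ fromℕℚ n * p

  p≤1 : p ≤ 1ℚ
  p≤1 = ≤-trans p≤½ ½≤1

module Numbers (regime : Regime) where

  open Regime regime

  -- `κ` is the factor `q + l p` of a pair tilted by `l = recip y`: as `y = n p`, the product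
  -- `recip y * p` is `r`. This tilt, the reciprocal of the approximate mean degree, is used for
  -- degrees bounded by a constant.
  N y r κ q η : ℚ
  N = fromℕℚ n
  y = N * p
  r = recip N
  q = 1ℚ - p
  κ = 1ℚ - (p - r)
  η = ½ ^ e

  0≤N : 0ℚ ≤ N
  0≤N = 0≤fromℕℚ n

  2^≤N : 2ℚ ^ (16 ℕ.* e) ≤ N
  2^≤N = ≤-trans (≤-reflexive (sym (2^ℚ (16 ℕ.* e)))) (fromℕℚ-mono ≤n)

  N≤2^ : N ≤ 2ℚ ^ (16 ℕ.* e ℕ.+ 16)
  N≤2^ = ≤-trans (fromℕℚ-mono n≤) (≤-reflexive (2^ℚ (16 ℕ.* e ℕ.+ 16)))

  0<N : 0ℚ < N
  0<N = <-≤-trans (positive⁻¹ 1ℚ) (≤-trans (1≤2^ (16 ℕ.* e)) 2^≤N)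

  Nr : N * r ≡ 1ℚ
  Nr = *-recip 0<N

  0≤r : 0ℚ ≤ r
  0≤r = <⇒≤ (recip-pos 0<N)

  0≤b : 0ℚ ≤ b
  0≤b = grow-nonneg grow-b

  0≤a : 0ℚ ≤ a
  0≤a = ≤-trans 0≤1 1≤a

  M≤y : M ≤ y
  M≤y = ≤-trans (by-diff (a + b) (+-nonneg 0≤a 0≤b) (+-comm M (a + b))) ab≤

  8≤y : fromℕℚ 8 ≤ y
  8≤y = ≤-trans 8≤M M≤y

  0<y : 0ℚ < y
  0<y = <-≤-trans (positive⁻¹ (fromℕℚ 8)) 8≤y

  32y≤2^e : fromℕℚ 32 * y ≤ 2ℚ ^ e
  32y≤2^e = ≤-trans (*-monoʳ (fromℕℚ 32) (0≤fromℕℚ 32) np≤X)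
    (≤-trans (≤-reflexive (sym (fromℕℚ-* 32 X))) (≤-trans (fromℕℚ-mono 32X≤) (≤-reflexive (2^ℚ e))))

  y≤2^e : y ≤ 2ℚ ^ e
  y≤2^e = ≤-trans (≤-trans (≤-reflexive (sym (*-identityˡ y))) (*-monoˡ y (<⇒≤ 0<y) (≤ᵇ⇒≤ {1ℚ} {fromℕℚ 32} _))) 32y≤2^e

  -- Divide `n p ≤ 2 ^ e / 32` by `n ≥ 2 ^ (16 e)`.
  p≤½^ : p ≤ ½ ^ (15 ℕ.* e ℕ.+ 5)
  p≤½^ = ≤-trans (≤2^⇒½^ {p} (16 ℕ.* e ℕ.+ 5) e
      (≤-trans (≤-reflexive (trans (cong (p *_) (^-homo-* 2ℚ (16 ℕ.* e) 5)) (eq p (2ℚ ^ (16 ℕ.* e)))))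
        (≤-trans (*-monoʳ (fromℕℚ 32) (0≤fromℕℚ 32) (*-monoˡ p 0≤p 2^≤N)) 32y≤2^e))
      (ℕP.≤-trans (ℕP.m≤m+n e (15 ℕ.* e ℕ.+ 5)) (ℕP.≤-reflexive (eq′ e))))
    (≤-reflexive (cong (½ ^_) (trans (cong (ℕ._∸ e) (sym (eq′ e))) (ℕP.m+n∸m≡n e (15 ℕ.* e ℕ.+ 5)))))
    where
    eq : ∀ p x → p * (x * fromℕℚ 32) ≡ fromℕℚ 32 * (x * p)
    eq = solve-∀ ℚ-ring
    eq′ : ∀ e → e ℕ.+ (15 ℕ.* e ℕ.+ 5) ≡ 16 ℕ.* e ℕ.+ 5
    eq′ = ℕSolver.solve-∀

  2^p≤ : ∀ m → m ℕ.≤ 15 ℕ.* e ℕ.+ 5 → 2ℚ ^ m * p ≤ ½ ^ (15 ℕ.* e ℕ.+ 5 ℕ.∸ m)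
  2^p≤ m h = ≤-trans (*-monoʳ (2ℚ ^ m) (0≤2^ m) p≤½^) (≤-reflexive (2^*½^≤ m (15 ℕ.* e ℕ.+ 5) h))

  r≤p : r ≤ p
  r≤p = *-cancelˡ {r} {p} N 0<N (≤-trans (≤-reflexive Nr) (≤-trans (≤ᵇ⇒≤ {1ℚ} {fromℕℚ 8} _) 8≤y))

  0≤κ : 0ℚ ≤ κ
  0≤κ = 0≤-diff (≤-trans (by-diff {p - r} r 0≤r (eq p r)) p≤1)
    where
    eq : ∀ p r → p - r + r ≡ p
    eq = solve-∀ ℚ-ring

  μp : recip y * p ≡ r
  μp = trans (sym (*-identityʳ (recip y * p))) (trans (cong (recip y * p *_) (sym Nr))
    (trans (eq (recip y) p N r) (trans (cong (_* r) (*-recip 0<y)) (*-identityˡ r))))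
    where
    eq : ∀ u p N r → u * p * (N * r) ≡ N * p * u * r
    eq = solve-∀ ℚ-ring

  q+μp : q + recip y * p ≡ κ
  q+μp = trans (cong (q +_) μp) (eq p r)
    where
    eq : ∀ p r → 1ℚ - p + r ≡ 1ℚ - (p - r)
    eq = solve-∀ ℚ-ring

  N∸ : ∀ m → m ℕ.≤ n → fromℕℚ (n ℕ.∸ m) ≡ N - fromℕℚ m
  N∸ m m≤n = trans (eq (fromℕℚ (n ℕ.∸ m)) (fromℕℚ m)) (cong (_- fromℕℚ m)
    (trans (sym (fromℕℚ-+ (n ℕ.∸ m) m)) (cong fromℕℚ (ℕP.m∸n+n≡m m≤n))))
    where
    eq : ∀ x m → x ≡ x + m - m
    eq = solve-∀ ℚ-ring

  frac-κ : Frac (p - r)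
  frac-κ = 0≤-diff r≤p , ≤-trans (by-diff {p - r} r 0≤r (eq p r)) p≤1
    where
    eq : ∀ p r → p - r + r ≡ p
    eq = solve-∀ ℚ-ring

  decay-κ : ∀ m → m ℕ.≤ n → Decay (y - 1ℚ - fromℕℚ m) (κ ^ (n ℕ.∸ m))
  decay-κ m m≤n = decay-mono bound ≤-refl (decay-^ (n ℕ.∸ m) 0≤κ (decay-1- frac-κ))
    where
    M′ = fromℕℚ m
    bound : y - 1ℚ - M′ ≤ fromℕℚ (n ℕ.∸ m) * (p - r)
    bound = by-diff (M′ * (1ℚ - p) + M′ * r) (+-nonneg (*-nonneg (0≤fromℕℚ m) (0≤-diff p≤1)) (*-nonneg (0≤fromℕℚ m) 0≤r))
      (trans (cong (λ z → N * p - z - M′ + (M′ * (1ℚ - p) + M′ * r)) (sym Nr)) (trans (eq N p r M′) (cong (_* (p - r)) (sym (N∸ m m≤n)))))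
      where
      eq : ∀ N p r m → N * p - N * r - m + (m * (1ℚ - p) + m * r) ≡ (N - m) * (p - r)
      eq = solve-∀ ℚ-ring

  1≤n : 1 ℕ.≤ n
  1≤n = ℕP.≤-trans (ℕP.m^n>0 2 (16 ℕ.* e)) ≤n

  2^11≤n : 2 ℕ.^ 11 ℕ.≤ n
  2^11≤n = ℕP.≤-trans (ℕP.^-monoʳ-≤ 2 (ℕP.≤-trans 11≤e (ℕP.m≤n*m e 16))) ≤n

  -- `N * (y * κ ^ (n - 1))` bounds the expected number of vertices of degree at most 1. Write
  -- `n p = a + b + 2 + R`. The certificates of `a` and `b` absorb `n` and a factor `a`, and `exp R`
  -- is at least `h²` for `h = 1 + R / 2`: one `h` is spent on `y ≤ 4 a h`, the other on `M ≤ 2 h`.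
  few-ones : N * (y * κ ^ (n ℕ.∸ 1)) * M ≤ fromℕℚ 32
  few-ones = ≤-trans (*-mono₂ {N * (y * w)} {N * (fromℕℚ 4 * (a * h) * w)} (*-nonneg 0≤N (*-nonneg (<⇒≤ 0<y) 0≤w)) (≤-trans (0≤fromℕℚ 8) 8≤M)
        (*-monoʳ N 0≤N (*-monoˡ w 0≤w y≤)) M≤)
      (≤-trans (≤-reflexive (eq N a h w)) (*-monoʳ (fromℕℚ 32) (0≤fromℕℚ 32) main))
    where
    w = κ ^ (n ℕ.∸ 1)
    0≤w = ^-nonneg (n ℕ.∸ 1) 0≤κ
    R = y - a - b - 2ℚ
    h = 1ℚ + ½ * R
    M-2≤R : M - 2ℚ ≤ R
    M-2≤R = ≤-diff (subst (0ℚ ≤_) (eq₁ y a b M) (0≤-diff ab≤))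
      where
      eq₁ : ∀ y a b M → y - (a + b + M) ≡ y - a - b - 2ℚ - (M - 2ℚ)
      eq₁ = solve-∀ ℚ-ring
    0≤R : 0ℚ ≤ R
    0≤R = ≤-trans (0≤-diff (≤-trans (≤ᵇ⇒≤ {2ℚ} {fromℕℚ 8} _) 8≤M)) M-2≤R
    0≤½R : 0ℚ ≤ ½ * R
    0≤½R = *-nonneg 0≤½ 0≤R
    0≤h : 0ℚ ≤ h
    0≤h = +-nonneg 0≤1 0≤½R
    M≤ : M ≤ 2ℚ * h
    M≤ = by-diff (R - (M - 2ℚ)) (0≤-diff M-2≤R) (eq₁ M R)
      where
      eq₁ : ∀ M R → M + (R - (M - 2ℚ)) ≡ 2ℚ * (1ℚ + ½ * R)
      eq₁ = solve-∀ ℚ-ring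
    y≤ : y ≤ fromℕℚ 4 * (a * h)
    y≤ = by-diff ((a - b) + (a - 1ℚ) * (2ℚ + R) + a * R) (+-nonneg (+-nonneg (0≤-diff b≤a) (*-nonneg (0≤-diff 1≤a) (+-nonneg 0≤2 0≤R))) (*-nonneg 0≤a 0≤R))
      (eq₁ y a b)
      where
      eq₁ : ∀ y a b → y + ((a - b) + (a - 1ℚ) * (2ℚ + (y - a - b - 2ℚ)) + a * (y - a - b - 2ℚ)) ≡ fromℕℚ 4 * (a * (1ℚ + ½ * (y - a - b - 2ℚ)))
      eq₁ = solve-∀ ℚ-ring
    main : ½ * N * (½ * a) * (h * h) * w ≤ 1ℚ
    main = grow*decay≤1 (grow-* (*-nonneg (*-nonneg 0≤½ 0≤N) (*-nonneg 0≤½ 0≤a)) (*-nonneg 0≤h 0≤h)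
        (grow-* (*-nonneg 0≤½ 0≤N) (*-nonneg 0≤½ 0≤a) grow-a grow-b) (grow-* 0≤h 0≤h (grow-1+ 0≤½R) (grow-1+ 0≤½R)))
      (decay-mono (≤-reflexive (eq₁ y a b)) ≤-refl (decay-κ 1 1≤n)) 0≤w
      where
      eq₁ : ∀ y a b → a + b + (½ * (y - a - b - 2ℚ) + ½ * (y - a - b - 2ℚ)) ≡ y - 1ℚ - fromℕℚ 1
      eq₁ = solve-∀ ℚ-ring
    eq : ∀ N a h w → N * (fromℕℚ 4 * (a * h) * w) * (2ℚ * h) ≡ fromℕℚ 32 * (½ * N * (½ * a) * (h * h) * w)
    eq = solve-∀ ℚ-ring

  Nκ≤2 : N * κ ^ (n ℕ.∸ 3) ≤ 2ℚ
  Nκ≤2 = ≤-trans (≤-reflexive (eq N w)) (*-monoʳ 2ℚ 0≤2 (grow*decay≤1 grow-a (decay-mono a≤ ≤-refl (decay-κ 3 3≤n)) (^-nonneg (n ℕ.∸ 3) 0≤κ)))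
    where
    w = κ ^ (n ℕ.∸ 3)
    eq : ∀ N w → N * w ≡ 2ℚ * (½ * N * w)
    eq = solve-∀ ℚ-ring
    3≤n : 3 ℕ.≤ n
    3≤n = ℕP.≤-trans (ℕP.m≤m+n 3 2045) 2^11≤n
    a≤ : a ≤ y - 1ℚ - fromℕℚ 3
    a≤ = ≤-diff (subst (0ℚ ≤_) (eq₁ a b M y) (+-nonneg (+-nonneg 0≤b (0≤-diff (≤-trans (≤ᵇ⇒≤ {fromℕℚ 4} {fromℕℚ 8} _) 8≤M))) (0≤-diff ab≤)))
      where
      eq₁ : ∀ a b M y → b + (M - fromℕℚ 4) + (y - (a + b + M)) ≡ y - 1ℚ - fromℕℚ 3 - a
      eq₁ = solve-∀ ℚ-ring

  -- Dropping `m` pairs lowers the exponent by `m p ≤ 1`, which the slack `M` absorbs.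
  Nq≤2 : ∀ m → m ℕ.≤ n → fromℕℚ m * p ≤ 1ℚ → N * q ^ (n ℕ.∸ m) ≤ 2ℚ
  Nq≤2 m m≤n mp≤1 = ≤-trans (≤-reflexive (eq N w)) (*-monoʳ 2ℚ 0≤2 (grow*decay≤1 grow-a
      (decay-mono a≤ ≤-refl (decay-^ (n ℕ.∸ m) 0≤q (decay-1- (0≤p , p≤1)))) (^-nonneg (n ℕ.∸ m) 0≤q)))
    where
    0≤q : 0ℚ ≤ q
    0≤q = 0≤-diff p≤1
    w = q ^ (n ℕ.∸ m)
    eq : ∀ N w → N * w ≡ 2ℚ * (½ * N * w)
    eq = solve-∀ ℚ-ring
    a≤ : a ≤ fromℕℚ (n ℕ.∸ m) * p
    a≤ = ≤-trans (by-diff {a} {N * p - fromℕℚ m * p} (b + (M - 1ℚ) + (1ℚ - fromℕℚ m * p) + (y - (a + b + M)))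
        (+-nonneg (+-nonneg (+-nonneg 0≤b (0≤-diff (≤-trans (≤ᵇ⇒≤ {1ℚ} {fromℕℚ 8} _) 8≤M))) (0≤-diff mp≤1)) (0≤-diff ab≤))
        (eq₁ a b M N p (fromℕℚ m)))
      (≤-reflexive (trans (eq₂ N p (fromℕℚ m)) (cong (_* p) (sym (N∸ m m≤n)))))
      where
      eq₁ : ∀ a b M N p m → a + (b + (M - 1ℚ) + (1ℚ - m * p) + (N * p - (a + b + M))) ≡ N * p - m * p
      eq₁ = solve-∀ ℚ-ring
      eq₂ : ∀ N p m → N * p - m * p ≡ (N - m) * p
      eq₂ = solve-∀ ℚ-ring

  -- `X` is at least of order `log n`, since `n p` exceeds `a`. The crude `exp ½ ≤ 2` turns
  -- `n ≤ 2 exp a` into `2 ^ (16 e) ≤ 2 ^ (2 X + 1)`.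
  8e≤X+1 : 8 ℕ.* e ℕ.≤ suc X
  8e≤X+1 = ℕP.*-cancelˡ-≤ 2 (ℕP.≤-trans (ℕP.≤-reflexive (sym (ℕP.*-assoc 2 8 e))) (ℕP.≤-trans (≮-log (16 ℕ.* e) (suc (2 ℕ.* X)) N≤)
      (ℕP.≤-trans (ℕP.n≤1+n _) (ℕP.≤-reflexive (eq X)))))
    where
    eq : ∀ X → suc (suc (2 ℕ.* X)) ≡ 2 ℕ.* suc X
    eq = ℕSolver.solve-∀
    N≤ : 2ℚ ^ (16 ℕ.* e) ≤ 2ℚ ^ suc (2 ℕ.* X)
    N≤ = ≤-trans 2^≤N (≤-trans (≤-reflexive (eq₁ N)) (*-monoʳ 2ℚ 0≤2 (grow⇒≤2^ (2 ℕ.* X) a≤ grow-a)))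
      where
      eq₁ : ∀ N → N ≡ 2ℚ * (½ * N)
      eq₁ = solve-∀ ℚ-ring
      a≤ : a ≤ fromℕℚ (2 ℕ.* X) * ½
      a≤ = ≤-trans (≤-trans (by-diff (b + M) (+-nonneg 0≤b (≤-trans (0≤fromℕℚ 8) 8≤M)) (sym (+-assoc a b M))) (≤-trans ab≤ np≤X))
        (≤-reflexive (trans (eq₂ (fromℕℚ X)) (cong (_* ½) (sym (fromℕℚ-* 2 X)))))
        where
        eq₂ : ∀ x → x ≡ fromℕℚ 2 * x * ½
        eq₂ = solve-∀ ℚ-ring
    ≮-log : ∀ u v → 2ℚ ^ u ≤ 2ℚ ^ v → u ℕ.≤ v
    ≮-log u v h with u ℕP.≤? v
    ... | yes u≤v = u≤v
    ... | no  u≰v = ⊥-elim (<-irrefl refl (<-≤-trans lt h))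
      where
      lt : 2ℚ ^ v < 2ℚ ^ u
      lt = <-≤-trans (subst₂ _<_ (+-identityʳ (2ℚ ^ v)) (eq₁ (2ℚ ^ v)) (+-monoʳ-< (2ℚ ^ v) (<-≤-trans (positive⁻¹ 1ℚ) (1≤2^ v))))
        (^-monoʳ {2ℚ} {suc v} {u} (≤ᵇ⇒≤ {1ℚ} {2ℚ} _) (ℕP.≰⇒> u≰v))
        where
        eq₁ : ∀ x → x + x ≡ 2ℚ * x
        eq₁ = solve-∀ ℚ-ring

-- Typical properties of a sparse random graph

Independent : ∀ {n} → (Fin n → Fin n → Bool) → (Fin n → Bool) → Set
Independent R A = ∀ i j → A i ≡ true → A j ≡ true → R i j ≡ false

module Sparse (regime : Regime) where

  open Regime regime
  open Numbers regime hiding (q) public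
  open Sample n
  open Prob p 0≤p p≤1
  open More n p 0≤p p≤1

  0≤μ : 0ℚ ≤ recip y
  0≤μ = <⇒≤ (recip-pos 0<y)

  1≤y : 1ℚ ≤ y
  1≤y = ≤-trans (≤ᵇ⇒≤ {1ℚ} {fromℕℚ 8} _) 8≤y

  yμ^≥1 : ∀ m k → k ℕ.≤ m → 1ℚ ≤ y ^ m * recip y ^ k
  yμ^≥1 m k k≤m = subst (1ℚ ≤_) (sym (trans (cong (_* recip y ^ k) (trans (cong (y ^_) (sym (ℕP.m∸n+n≡m k≤m))) (^-homo-* y (m ℕ.∸ k) k)))
      (trans (*-assoc (y ^ (m ℕ.∸ k)) (y ^ k) (recip y ^ k))
        (trans (cong (y ^ (m ℕ.∸ k) *_) (trans (sym (^-distrib-* y (recip y) k)) (trans (cong (_^ k) (*-recip 0<y)) (1^ k))))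
          (*-identityʳ (y ^ (m ℕ.∸ k)))))))
    (1≤^ (m ℕ.∸ k) 1≤y)

  small-leaf : Small (λ s → ∃ λ x → deg (adj s) x ℕ.≤ 1) (N * (y * κ ^ (n ℕ.∸ 1)))
  small-leaf = small-∃Fin (λ x → small-mono (λ s h → h)
    (≤-reflexive (cong₂ (λ u v → u * v ^ (n ℕ.∸ 1)) (*-identityʳ y) q+μp))
    (small-star {P = λ s → deg (adj s) x ℕ.≤ 1} x (y ^ 1) (recip y) (^-nonneg 1 (<⇒≤ 0<y)) 0≤μ (λ s h → yμ^≥1 1 (deg (adj s) x) h)))

  -- A cap on the degrees, of order `n ^ (1/8)`: small enough for `τ * τ * p` to be tiny, and twice
  -- the number `2 ^ (2 * e)` of vertices of low degree that will be tolerated.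
  τ : ℕ
  τ = 2 ℕ.^ suc (2 ℕ.* e)

  1≤X : 1 ℕ.≤ X
  1≤X = ℕP.≤-pred (ℕP.≤-trans (ℕP.≤-trans (ℕP.m≤m+n 2 86) (ℕP.*-monoʳ-≤ 8 11≤e)) 8e≤X+1)

  e≤X : e ℕ.≤ X
  e≤X = ℕP.≤-pred (ℕP.≤-trans (ℕP.≤-trans (ℕP.≤-reflexive (ℕP.+-comm 1 e)) (ℕP.+-monoʳ-≤ e 1≤7e)) 8e≤X+1)
    where
    1≤7e : 1 ℕ.≤ 7 ℕ.* e
    1≤7e = ℕP.≤-trans (ℕP.≤-trans (ℕP.m≤m+n 1 10) 11≤e) (ℕP.m≤n*m e 7)

  τ-large : e ℕ.+ (16 ℕ.* e ℕ.+ 16 ℕ.+ 2 ℕ.* X) ℕ.≤ τ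
  τ-large = ℕP.≤-trans (ℕP.≤-trans (ℕP.+-mono-≤ e≤X (ℕP.+-monoˡ-≤ (2 ℕ.* X) (ℕP.+-mono-≤ (ℕP.*-monoʳ-≤ 16 e≤X) (ℕP.*-monoʳ-≤ 16 1≤X))))
      (ℕP.≤-trans (ℕP.m≤m+n _ (29 ℕ.* X)) (ℕP.≤-reflexive (eq X))))
    (ℕP.*-monoʳ-≤ 2 (ℕP.≤-trans 32X≤ (ℕP.^-monoʳ-≤ 2 (ℕP.m≤n*m e 2))))
    where
    eq : ∀ X → X ℕ.+ (16 ℕ.* X ℕ.+ 16 ℕ.* X ℕ.+ 2 ℕ.* X) ℕ.+ 29 ℕ.* X ≡ 2 ℕ.* (32 ℕ.* X)
    eq = ℕSolver.solve-∀

  1≤2ℚ : 1ℚ ≤ 2ℚ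
  1≤2ℚ = ≤ᵇ⇒≤ {1ℚ} {2ℚ} _

  -- At tilt 2 the moment of a degree is at most `(1 + p) ^ n ≤ 2 ^ (2 X)`, and `τ` exceeds `2 X` by
  -- enough to pay for `n` and `η`.
  small-hub : Small (λ s → ∃ λ x → τ ℕ.≤ deg (adj s) x) η
  small-hub = small-mono (λ s h → h) bound (small-∃Fin (λ x →
      small-star {P = λ s → τ ℕ.≤ deg (adj s) x} x (½ ^ τ) 2ℚ (0≤½^′ τ) 0≤2 (λ s h →
        ≤-trans (≤-reflexive (sym (trans (*-comm (½ ^ τ) (2ℚ ^ τ)) (2^*½^ τ)))) (*-monoʳ (½ ^ τ) (0≤½^′ τ) (^-monoʳ 1≤2ℚ h)))))
    where
    q+2p : q + 2ℚ * p ≡ 1ℚ + p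
    q+2p = eq p
      where
      eq : ∀ p → (1ℚ - p) + 2ℚ * p ≡ 1ℚ + p
      eq = solve-∀ ℚ-ring
    w≤ : (q + 2ℚ * p) ^ (n ℕ.∸ 1) ≤ 2ℚ ^ (2 ℕ.* X)
    w≤ = ≤-trans (≤-reflexive (cong (_^ (n ℕ.∸ 1)) q+2p)) (≤-trans (^-monoʳ (by-diff p 0≤p refl) (ℕP.m∸n≤m n 1))
      (1+^≤2^ n (2 ℕ.* X) 0≤p (≤-trans np≤X (≤-reflexive (trans (eq (fromℕℚ X)) (cong (_* ½) (sym (fromℕℚ-* 2 X))))))))
      where
      eq : ∀ x → x ≡ fromℕℚ 2 * x * ½
      eq = solve-∀ ℚ-ring
    u = 16 ℕ.* e ℕ.+ 16
    bound : N * (½ ^ τ * (q + 2ℚ * p) ^ (n ℕ.∸ 1)) ≤ η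
    bound = ≤-trans (*-mono₂ 0≤N (*-nonneg (0≤½^′ τ) (^-nonneg (n ℕ.∸ 1) (+-nonneg 0≤q (*-nonneg 0≤2 0≤p)))) N≤2^ (*-monoʳ (½ ^ τ) (0≤½^′ τ) w≤))
      (≤-trans (≤-reflexive (trans (eq (2ℚ ^ u) (½ ^ τ) (2ℚ ^ (2 ℕ.* X))) (trans (cong (_* ½ ^ τ) (sym (^-homo-* 2ℚ u (2 ℕ.* X))))
          (2^*½^≤ (u ℕ.+ 2 ℕ.* X) τ (ℕP.m+n≤o⇒n≤o e τ-large)))))
        (^-antiʳ 0≤½ ½≤1 (ℕP.m+n≤o⇒m≤o∸n e τ-large)))
      where
      eq : ∀ a b c → a * (b * c) ≡ a * c * b
      eq = solve-∀ ℚ-ring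

  module _ (d : ℕ) (192d≤y : fromℕℚ (192 ℕ.* d) ≤ y) where

    private
      w ε₃ δ : ℚ
      δ = p - ½ ^ 6 * p
      w = (q + ½ ^ 6 * p) ^ (n ℕ.∸ 1)
      ε₃ = 2ℚ ^ (6 ℕ.* d) * w

    frac-δ : Frac δ
    frac-δ = subst (0ℚ ≤_) (eq p) (*-nonneg (nonNegative⁻¹ (1ℚ - ½ ^ 6)) 0≤p) ,
        ≤-trans (by-diff {δ} (½ ^ 6 * p) (*-nonneg (nonNegative⁻¹ (½ ^ 6)) 0≤p) (eq′ p)) p≤1
      where
      eq : ∀ p → (1ℚ - ½ ^ 6) * p ≡ p - ½ ^ 6 * p
      eq = solve-∀ ℚ-ring
      eq′ : ∀ p → p - ½ ^ 6 * p + ½ ^ 6 * p ≡ p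
      eq′ = solve-∀ ℚ-ring

    -- The expected number of vertices of degree below `d` is at most of order `n ^ (1/16)`. At tilt
    -- `2 ^ (-6)` one vertex has exponent about `(63/64) y - 6 d`. Sixteen of these make
    -- `15¾ y - 96 d`, while `96 d ≤ y / 2` and `a ≤ y` leave it above `15 a`; the spare quarter of
    -- `y` covers the step from `n` to `n - 1`. Taking sixteenth powers avoids roots.
    few-low : N * ε₃ ≤ 2ℚ ^ (e ℕ.+ 2)
    few-low = ^-cancel 15 (*-nonneg 0≤N 0≤ε) (0≤2^ (e ℕ.+ 2)) (≤-trans (≤-reflexive (^-distrib-* N ε₃ 16))
        (≤-trans (≤-reflexive (eq₁ N (ε₃ ^ 16))) (≤-trans (*-monoʳ (2ℚ ^ 15 * N) (*-nonneg (0≤2^ 15) 0≤N) main)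
          (≤-trans (≤-reflexive (*-identityʳ (2ℚ ^ 15 * N))) (≤-trans (*-monoʳ (2ℚ ^ 15) (0≤2^ 15) N≤2^)
            (≤-trans (≤-reflexive (sym (^-homo-* 2ℚ 15 (16 ℕ.* e ℕ.+ 16)))) (≤-trans (^-monoʳ 1≤2ℚ (ℕP.≤-trans (ℕP.n≤1+n _) (ℕP.≤-reflexive (eq₂ e))))
              (≤-reflexive (sym (^-assocʳ 2ℚ (e ℕ.+ 2) 16))))))))))
      where
      0≤base : 0ℚ ≤ q + ½ ^ 6 * p
      0≤base = +-nonneg 0≤q (*-nonneg (nonNegative⁻¹ (½ ^ 6)) 0≤p)
      0≤w = ^-nonneg (n ℕ.∸ 1) 0≤base
      0≤ε : 0ℚ ≤ ε₃
      0≤ε = *-nonneg (0≤2^ (6 ℕ.* d)) 0≤w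
      eq₁ : ∀ N u → N ^ 16 * u ≡ 2ℚ ^ 15 * N * ((½ * N) ^ 15 * u)
      eq₁ N u = trans (eq′ N (N ^ 15) u) (cong (λ z → 2ℚ ^ 15 * N * (z * u)) (sym (^-distrib-* ½ N 15)))
        where
        eq′ : ∀ N m u → N * m * u ≡ 2ℚ ^ 15 * N * (½ ^ 15 * m * u)
        eq′ = solve-∀ ℚ-ring
      eq₂ : ∀ e → suc (15 ℕ.+ (16 ℕ.* e ℕ.+ 16)) ≡ (e ℕ.+ 2) ℕ.* 16
      eq₂ = ℕSolver.solve-∀
      main : (½ * N) ^ 15 * ε₃ ^ 16 ≤ 1ℚ
      main = ≤-trans (≤-reflexive (trans (cong ((½ * N) ^ 15 *_) (^-distrib-* (2ℚ ^ (6 ℕ.* d)) w 16))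
          (sym (*-assoc ((½ * N) ^ 15) ((2ℚ ^ (6 ℕ.* d)) ^ 16) (w ^ 16)))))
        (grow*decay≤1 (grow-* (^-nonneg 15 0≤½N) (^-nonneg 16 (0≤2^ (6 ℕ.* d))) (grow-^ 15 0≤½N grow-a) (grow-^ 16 (0≤2^ (6 ℕ.* d)) (grow-2^ (6 ℕ.* d))))
          (decay-mono le ≤-refl (decay-^ 16 0≤w (decay-^ (n ℕ.∸ 1) 0≤base (subst (Decay δ) (eq₃ p) (decay-1- frac-δ))))) (^-nonneg 16 0≤w))
        where
        0≤½N = *-nonneg 0≤½ 0≤N
        eq₃ : ∀ p → 1ℚ - (p - ½ ^ 6 * p) ≡ (1ℚ - p) + ½ ^ 6 * p
        eq₃ = solve-∀ ℚ-ring
        p≤½⁵ : p ≤ ½ ^ 5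
        p≤½⁵ = ≤-trans p≤½^ (^-antiʳ 0≤½ ½≤1 (ℕP.m≤n+m 5 (15 ℕ.* e)))
        a≤y : a ≤ y
        a≤y = ≤-trans (by-diff (b + M) (+-nonneg 0≤b (≤-trans (0≤fromℕℚ 8) 8≤M)) (sym (+-assoc a b M))) ab≤
        le : fromℕℚ 15 * a + fromℕℚ 16 * fromℕℚ (6 ℕ.* d) ≤ fromℕℚ 16 * (fromℕℚ (n ℕ.∸ 1) * δ)
        le = ≤-trans (≤-trans (+-mono-≤ (*-monoʳ (fromℕℚ 15) (0≤fromℕℚ 15) a≤y)
              (≤-trans (≤-reflexive (trans (sym (fromℕℚ-* 16 (6 ℕ.* d))) (trans (eq₄ (fromℕℚ (16 ℕ.* (6 ℕ.* d))))
                (cong (½ *_) (trans (sym (fromℕℚ-* 2 (16 ℕ.* (6 ℕ.* d)))) (cong fromℕℚ (eq₅ d))))))) (*-monoʳ ½ 0≤½ 192d≤y)))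
            (by-diff ((fromℕℚ 15 + ½ + ½ * ½) * (½ ^ 5 - p) + ½ * ½ * (y - fromℕℚ 8) + (½ * ½ * fromℕℚ 8 - (fromℕℚ 15 + ½ + ½ * ½) * ½ ^ 5))
              (+-nonneg (+-nonneg (*-nonneg (nonNegative⁻¹ (fromℕℚ 15 + ½ + ½ * ½)) (0≤-diff p≤½⁵)) (*-nonneg (nonNegative⁻¹ (½ * ½)) (0≤-diff 8≤y)))
                (nonNegative⁻¹ (½ * ½ * fromℕℚ 8 - (fromℕℚ 15 + ½ + ½ * ½) * ½ ^ 5)))
              (eq₆ N p)))
          (≤-reflexive (cong (λ z → fromℕℚ 16 * (z * δ)) (sym (N∸ 1 1≤n))))
          where
          eq₄ : ∀ x → x ≡ ½ * (fromℕℚ 2 * x)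
          eq₄ = solve-∀ ℚ-ring
          eq₅ : ∀ d → 2 ℕ.* (16 ℕ.* (6 ℕ.* d)) ≡ 192 ℕ.* d
          eq₅ = ℕSolver.solve-∀
          eq₆ : ∀ N p → fromℕℚ 15 * (N * p) + ½ * (N * p) +
            ((fromℕℚ 15 + ½ + ½ * ½) * (½ ^ 5 - p) + ½ * ½ * (N * p - fromℕℚ 8) + (½ * ½ * fromℕℚ 8 - (fromℕℚ 15 + ½ + ½ * ½) * ½ ^ 5))
            ≡ fromℕℚ 16 * ((N - fromℕℚ 1) * (p - ½ ^ 6 * p))
          eq₆ = solve-∀ ℚ-ring

    small-low : Small (λ s → 2 ℕ.^ (2 ℕ.* e) ℕ.≤ # (λ x → does (deg (adj s) x ℕP.<? d))) (fromℕℚ 4 * η)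
    small-low = small-mono (λ s h → (λ x → does (deg (adj s) x ℕP.<? d)) , (λ x → does⇒ (deg (adj s) x ℕP.<? d)) ,
          ℕP.≤-trans (ℕP.≤-reflexive (ℕP.suc-pred (2 ℕ.^ (2 ℕ.* e)) {{ℕ.>-nonZero 0<m}})) h) bound
        (small-markov {P = λ x s → deg (adj s) x ℕ.< d} (ℕ.pred (2 ℕ.^ (2 ℕ.* e))) (λ x →
          small-star {P = λ s → deg (adj s) x ℕ.< d} x (2ℚ ^ (6 ℕ.* d)) (½ ^ 6) (0≤2^ (6 ℕ.* d)) (nonNegative⁻¹ (½ ^ 6)) (event x)))
      where
      0<m : 0 ℕ.< 2 ℕ.^ (2 ℕ.* e)
      0<m = ℕP.m^n>0 2 (2 ℕ.* e)
      event : ∀ x s → deg (adj s) x ℕ.< d → 1ℚ ≤ 2ℚ ^ (6 ℕ.* d) * (½ ^ 6) ^ deg (adj s) x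
      event x s h = subst (1ℚ ≤_) (sym (trans (cong (2ℚ ^ (6 ℕ.* d) *_) (^-assocʳ ½ 6 (deg (adj s) x)))
          (2^*½^≥ (6 ℕ.* d) (6 ℕ.* deg (adj s) x) (ℕP.*-monoʳ-≤ 6 (ℕP.<⇒≤ h)))))
        (1≤2^ (6 ℕ.* d ℕ.∸ 6 ℕ.* deg (adj s) x))
      0≤r′ : ∀ k → 0ℚ ≤ recip (fromℕℚ (suc k))
      0≤r′ k = <⇒≤ (recip-pos (fromℕℚ-pos k))
      bound : recip (fromℕℚ (suc (ℕ.pred (2 ℕ.^ (2 ℕ.* e))))) * (N * ε₃) ≤ fromℕℚ 4 * η
      bound = ≤-trans (*-monoʳ (recip (fromℕℚ (suc m))) (0≤r′ m) few-low)
        scaled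
        where
        m = ℕ.pred (2 ℕ.^ (2 ℕ.* e))
        sm : fromℕℚ (suc m) ≡ 2ℚ ^ (2 ℕ.* e)
        sm = trans (cong fromℕℚ (ℕP.suc-pred (2 ℕ.^ (2 ℕ.* e)) {{ℕ.>-nonZero 0<m}})) (2^ℚ (2 ℕ.* e))
        rm : recip (fromℕℚ (suc m)) ≡ ½ ^ (2 ℕ.* e)
        rm = trans (sym (*-identityʳ _)) (trans (cong (recip (fromℕℚ (suc m)) *_) (sym (2^*½^ (2 ℕ.* e))))
          (trans (sym (*-assoc (recip (fromℕℚ (suc m))) (2ℚ ^ (2 ℕ.* e)) (½ ^ (2 ℕ.* e))))
            (trans (cong (_* ½ ^ (2 ℕ.* e)) (trans (cong (recip (fromℕℚ (suc m)) *_) (sym sm)) (trans (*-comm (recip (fromℕℚ (suc m))) (fromℕℚ (suc m))) (*-recip (fromℕℚ-pos m)))))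
              (*-identityˡ _))))
        scaled : recip (fromℕℚ (suc m)) * 2ℚ ^ (e ℕ.+ 2) ≤ fromℕℚ 4 * η
        scaled = ≤-reflexive (trans (cong (_* 2ℚ ^ (e ℕ.+ 2)) rm) (trans (cong (λ k → ½ ^ k * 2ℚ ^ (e ℕ.+ 2)) (cong (e ℕ.+_) (ℕP.+-identityʳ e)))
          (trans (cong₂ _*_ (^-homo-* ½ e e) (^-homo-* 2ℚ e 2)) (trans (eq (½ ^ e) (2ℚ ^ e)) (trans (cong (λ z → fromℕℚ 4 * η * z) (2^*½^ e)) (*-identityʳ _))))))
          where
          eq : ∀ h t → h * h * (t * fromℕℚ 4) ≡ fromℕℚ 4 * h * (t * h)
          eq = solve-∀ ℚ-ring

  link : Coins → Fin n → Fin n → Fin n → Bool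
  link s x i j = (adj s x i ∧ adj s x j) ∧ adj s i j

  -- With the star of `x` exposed, at most `τ²` pairs of neighbours remain, two of which must be
  -- edges. The tilt `2 ^ (10 e)` keeps `τ² l p ≤ ½`, so the moment is at most 2, while two edges
  -- weigh `2 ^ (20 e)`, enough for both `n` and `η`.
  small-links : Small (λ s → ∃ λ x → deg (adj s) x ℕ.≤ τ × 2 ℕ.≤ cnt (link s x)) η
  small-links = small-mono (λ s h → h) bound (small-∃Fin (λ x →
      small-exposed {P = λ s → deg (adj s) x ℕ.≤ τ × 2 ℕ.≤ cnt (link s x)} (½ ^ (20 ℕ.* e)) l (τ ℕ.* τ) 0 (Star.star x) (tags x) (0≤½^′ (20 ℕ.* e)) (1≤2^ (10 ℕ.* e))
        (Star.star-sym x) (tags-star x) (tags-merge x) (tags-req x) (conditions x)))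
    where
    l : ℚ
    l = 2ℚ ^ (10 ℕ.* e)
    tags : Fin n → Coins → Tags
    tags x s i j = if (adj s x i ∧ adj s x j) ∧ not (i == j) then tilt else free
    tags-star : ∀ x s i j → Star.star x i j ≡ true → tags x s i j ≡ free
    tags-star x s i j st = cong (λ b → if b ∧ not (i == j) then tilt else free) (Sum.[ left , right ] (∨-true {i == x} st))
      where
      left : (i == x) ≡ true → adj s x i ∧ adj s x j ≡ false
      left h = cong (_∧ adj s x j) (trans (cong (adj s x) (==⇒≡ {i = i} h)) (adj-irr s x))
      right : (j == x) ≡ true → adj s x i ∧ adj s x j ≡ false
      right h = trans (cong (adj s x i ∧_) (trans (cong (adj s x) (==⇒≡ {i = j} h)) (adj-irr s x))) (BoolP.∧-zeroʳ (adj s x i))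
    tags-merge : ∀ x s t i j → tags x (mergeOn (Star.star x) s t) i j ≡ tags x s i j
    tags-merge x s t i j = cong (λ b → if b ∧ not (i == j) then tilt else free) (cong₂ _∧_ (same i) (same j))
      where
      same : ∀ k → adj (mergeOn (Star.star x) s t) x k ≡ adj s x k
      same k = trans (adj-merge (Star.star x) (Star.star-sym x) s t x k)
        (cong (λ b → if b ∨ (k == x) then adj s x k else adj t x k) (==-refl x))
    tags-req : ∀ x s i j → tags x s i j ≢ req
    tags-req x s i j h with (adj s x i ∧ adj s x j) ∧ not (i == j)
    tags-req x s i j () | true
    tags-req x s i j () | false
    tags-forb : ∀ x s i j → tags x s i j ≢ forb
    tags-forb x s i j h with (adj s x i ∧ adj s x j) ∧ not (i == j)
    tags-forb x s i j () | true
    tags-forb x s i j () | false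
    isTilt-tags : ∀ x s i j → isTilt (tags x s i j) ≡ (adj s x i ∧ adj s x j) ∧ not (i == j)
    isTilt-tags x s i j with (adj s x i ∧ adj s x j) ∧ not (i == j)
    ... | true  = refl
    ... | false = refl
    conditions : ∀ x s → deg (adj s) x ℕ.≤ τ × 2 ℕ.≤ cnt (link s x) →
      (∀ i j → tags x s i j ≡ forb → adj s i j ≡ false) × 1ℚ ≤ ½ ^ (20 ℕ.* e) * l ^ tilted (tags x s) s ×
      tilts (tags x s) ℕ.≤ τ ℕ.* τ × 0 ℕ.≤ forbs (tags x s)
    conditions x s (deg≤τ , 2≤) = (λ i j h → ⊥-elim (tags-forb x s i j h)) ,
        subst (1ℚ ≤_) (sym (trans (cong (½ ^ (20 ℕ.* e) *_) (^-assocʳ 2ℚ (10 ℕ.* e) (tilted (tags x s) s))) (trans (*-comm (½ ^ (20 ℕ.* e)) _) (2^*½^≥ _ (20 ℕ.* e) 20e≤))))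
          (1≤2^ (10 ℕ.* e ℕ.* tilted (tags x s) s ℕ.∸ 20 ℕ.* e)) ,
        tilts≤ , ℕ.z≤n
      where
      tilted≡ : tilted (tags x s) s ≡ cnt (link s x)
      tilted≡ = count-cong (pairs n) (λ {(i , j)} _ → trans (cong (_∧ adj s i j) (isTilt-tags x s i j)) (drop i j))
        where
        drop : ∀ i j → ((adj s x i ∧ adj s x j) ∧ not (i == j)) ∧ adj s i j ≡ link s x i j
        drop i j = trans (BoolP.∧-assoc (adj s x i ∧ adj s x j) (not (i == j)) (adj s i j)) (cong ((adj s x i ∧ adj s x j) ∧_) (idem (not (i == j)) _))
          where
          idem : ∀ b c → b ∧ (b ∧ c) ≡ b ∧ c
          idem true  c = refl
          idem false c = refl
      20e≤ : 20 ℕ.* e ℕ.≤ 10 ℕ.* e ℕ.* tilted (tags x s) s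
      20e≤ = ℕP.≤-trans (ℕP.≤-reflexive (eq e)) (ℕP.*-monoʳ-≤ (10 ℕ.* e) (ℕP.≤-trans 2≤ (ℕP.≤-reflexive (sym tilted≡))))
        where
        eq : ∀ e → 20 ℕ.* e ≡ 10 ℕ.* e ℕ.* 2
        eq = ℕSolver.solve-∀
      tilts≤ : tilts (tags x s) ℕ.≤ τ ℕ.* τ
      tilts≤ = ℕP.≤-trans (ℕP.≤-trans (ℕP.m≤n*m (tilts (tags x s)) 2) (ℕP.≤-trans (ℕP.≤-reflexive
          (2cnt (λ i j → isTilt (tags x s i j)) (λ i j → trans (isTilt-tags x s i j) (trans (cong₂ _∧_ (BoolP.∧-comm (adj s x i) (adj s x j)) (cong not (==-comm i j))) (sym (isTilt-tags x s j i))))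
            (λ i → trans (isTilt-tags x s i i) (trans (cong (λ b → (adj s x i ∧ adj s x i) ∧ not b) (==-refl i)) (BoolP.∧-zeroʳ (adj s x i ∧ adj s x i))))))
          (ℕP.≤-trans (##-mono {n} {λ i j → isTilt (tags x s i j)} {λ i j → adj s x i ∧ adj s x j} (λ i j h → proj₁ (∧-true {adj s x i ∧ adj s x j} (trans (sym (isTilt-tags x s i j)) h))))
            (ℕP.≤-reflexive (##-product {n} (adj s x) (adj s x))))))
        (ℕP.*-mono-≤ deg≤τ deg≤τ)
    Q = τ ℕ.* τ
    τ²≡ : Q ≡ 2 ℕ.^ (4 ℕ.* e ℕ.+ 2)
    τ²≡ = trans (sym (ℕP.^-distribˡ-+-* 2 (suc (2 ℕ.* e)) (suc (2 ℕ.* e)))) (cong (2 ℕ.^_) (eq e))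
      where
      eq : ∀ e → suc (2 ℕ.* e) ℕ.+ suc (2 ℕ.* e) ≡ 4 ℕ.* e ℕ.+ 2
      eq = ℕSolver.solve-∀
    Qlp≤½ : fromℕℚ Q * (l * p) ≤ fromℕℚ 1 * ½
    Qlp≤½ = ≤-trans (≤-reflexive (trans (cong (λ k → fromℕℚ k * (l * p)) τ²≡) (trans (cong (_* (l * p)) (2^ℚ (4 ℕ.* e ℕ.+ 2)))
        (trans (sym (*-assoc (2ℚ ^ (4 ℕ.* e ℕ.+ 2)) l p)) (cong (_* p) (sym (^-homo-* 2ℚ (4 ℕ.* e ℕ.+ 2) (10 ℕ.* e))))))))
      (≤-trans (2^p≤ (4 ℕ.* e ℕ.+ 2 ℕ.+ 10 ℕ.* e) (ℕP.m+n≤o⇒n≤o 1 le)) (^-antiʳ {½} {1} 0≤½ ½≤1 (ℕP.m+n≤o⇒m≤o∸n 1 le)))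
      where
      le : 1 ℕ.+ (4 ℕ.* e ℕ.+ 2 ℕ.+ 10 ℕ.* e) ℕ.≤ 15 ℕ.* e ℕ.+ 5
      le = ℕP.≤-trans (ℕP.m≤m+n _ (e ℕ.+ 2)) (ℕP.≤-reflexive (eq e))
        where
        eq : ∀ e → 1 ℕ.+ (4 ℕ.* e ℕ.+ 2 ℕ.+ 10 ℕ.* e) ℕ.+ (e ℕ.+ 2) ≡ 15 ℕ.* e ℕ.+ 5
        eq = ℕSolver.solve-∀
    0≤lp : 0ℚ ≤ l * p
    0≤lp = *-nonneg (0≤2^ (10 ℕ.* e)) 0≤p
    w≤2 : (q + l * p) ^ Q ≤ 2ℚ ^ 1
    w≤2 = ≤-trans (^-mono Q (+-nonneg 0≤q 0≤lp) (+-monoˡ-≤ (l * p) q≤1)) (1+^≤2^ Q 1 0≤lp Qlp≤½)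
    bound : N * (½ ^ (20 ℕ.* e) * ((q + l * p) ^ Q * q ^ 0)) ≤ η
    bound = ≤-trans (*-mono₂ 0≤N (*-nonneg (0≤½^′ (20 ℕ.* e)) (*-nonneg (^-nonneg Q (+-nonneg 0≤q 0≤lp)) 0≤1)) N≤2^
        (*-monoʳ (½ ^ (20 ℕ.* e)) (0≤½^′ (20 ℕ.* e)) (*-monoˡ 1ℚ 0≤1 w≤2)))
      (≤-trans (≤-reflexive (trans (eq (2ℚ ^ u) (½ ^ (20 ℕ.* e))) (trans (cong (_* ½ ^ (20 ℕ.* e)) (sym (^-homo-* 2ℚ 1 u))) (2^*½^≤ (1 ℕ.+ u) (20 ℕ.* e) (ℕP.m+n≤o⇒n≤o e le)))))
        (^-antiʳ 0≤½ ½≤1 (ℕP.m+n≤o⇒m≤o∸n e le)))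
      where
      u = 16 ℕ.* e ℕ.+ 16
      eq : ∀ a b → a * (b * (2ℚ ^ 1 * 1ℚ)) ≡ 2ℚ ^ 1 * a * b
      eq = solve-∀ ℚ-ring
      le : e ℕ.+ (1 ℕ.+ u) ℕ.≤ 20 ℕ.* e
      le = ℕP.≤-trans (ℕP.+-monoʳ-≤ e (ℕP.+-monoʳ-≤ 1 (ℕP.+-monoʳ-≤ (16 ℕ.* e) (ℕP.m≤m+n 16 6))))
          (ℕP.≤-trans (ℕP.≤-reflexive (eq₁ e)) (ℕP.≤-trans (ℕP.+-monoʳ-≤ (17 ℕ.* e) (ℕP.≤-trans (ℕP.m≤m+n 23 10) (ℕP.*-monoʳ-≤ 3 11≤e))) (ℕP.≤-reflexive (eq₂ e))))
        where
        eq₁ : ∀ e → e ℕ.+ (1 ℕ.+ (16 ℕ.* e ℕ.+ 22)) ≡ 17 ℕ.* e ℕ.+ 23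
        eq₁ = ℕSolver.solve-∀
        eq₂ : ∀ e → 17 ℕ.* e ℕ.+ 3 ℕ.* e ≡ 20 ℕ.* e
        eq₂ = ℕSolver.solve-∀

  module _ (u v w : Fin n) (S : Fin n → Bool) (S⊆ : ∀ i → S i ≡ true → (i == u) ∨ (i == v) ≡ true) (w∉S : S w ≡ false) where

    private
      U Out : Fin n → Bool
      U i = (i == u) ∨ (i == v)
      Out j = not (U j) ∧ not (j == w)
      required near : Fin n → Fin n → Bool
      required i j = (S i ∧ (j == w)) ∨ ((i == w) ∧ S j)
      near i j = not (i == j) ∧ (U i ∨ U j)
      choose : Bool → Bool → Tag
      choose true  _     = req
      choose false true  = tilt
      choose false false = free
      tags : Tags
      tags i j = choose (required i j) (near i j)

      required-sym : ∀ i j → required i j ≡ required j i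
      required-sym i j = trans (BoolP.∨-comm (S i ∧ (j == w)) ((i == w) ∧ S j)) (cong₂ _∨_ (BoolP.∧-comm (i == w) (S j)) (BoolP.∧-comm (S i) (j == w)))

      required-irr : ∀ i → required i i ≡ false
      required-irr i with i FinP.≟ w
      ... | yes refl rewrite w∉S = refl
      ... | no _ rewrite BoolP.∧-zeroʳ (S i) = refl

      near-sym : ∀ i j → near i j ≡ near j i
      near-sym i j = cong₂ _∧_ (cong not (==-comm i j)) (BoolP.∨-comm (U i) (U j))

      near-irr : ∀ i → near i i ≡ false
      near-irr i = cong (λ b → not b ∧ (U i ∨ U i)) (==-refl i)

      isReq-tags : ∀ i j → isReq (tags i j) ≡ required i j
      isReq-tags i j with required i j | near i j
      ... | true  | _     = refl
      ... | false | true  = refl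
      ... | false | false = refl

      isTilt-tags : ∀ i j → isTilt (tags i j) ≡ near i j ∧ not (required i j)
      isTilt-tags i j with required i j | near i j
      ... | true  | b     = sym (BoolP.∧-zeroʳ b)
      ... | false | true  = refl
      ... | false | false = refl

      tags-forb : ∀ i j → tags i j ≢ forb
      tags-forb i j h with required i j | near i j
      tags-forb i j () | true  | _
      tags-forb i j () | false | true
      tags-forb i j () | false | false

      tags-req : ∀ i j → tags i j ≡ req → required i j ≡ true
      tags-req i j h = trans (sym (isReq-tags i j)) (cong isReq h)

      reqs≥ : # S ℕ.≤ reqs tags
      reqs≥ = ℕP.*-cancelˡ-≤ 2 (ℕP.≤-trans (ℕP.≤-trans (ℕP.≤-reflexive (trans (cong (# S ℕ.+_) (ℕP.+-identityʳ (# S)))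
            (sym (cong₂ ℕ._+_ ##F (trans (##-transpose F) ##F)))))
          (##-disjoint {n} {required} {F} {λ i j → F j i} (λ i j h → ∨-introˡ h)
            (λ i j h → ∨-introʳ {S i ∧ (j == w)} (trans (BoolP.∧-comm (i == w) (S j)) h))
            (λ i j h h′ → true≢false (trans (sym (proj₁ (∧-true {S i} h))) (trans (cong S (==⇒≡ {i = i} (proj₂ (∧-true {S j} h′)))) w∉S)))))
        (ℕP.≤-reflexive (sym (trans (cong (2 ℕ.*_) (count-cong (pairs n) (λ {(i , j)} _ → isReq-tags i j))) (2cnt required required-sym required-irr)))))
        where
        F : Fin n → Fin n → Bool
        F i j = S i ∧ (j == w)
        ##F : ## F ≡ # S
        ##F = trans (##-product S (_== w)) (trans (cong (# S ℕ.*_) (#-≟ w)) (ℕP.*-identityʳ (# S)))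

      2tilts : 2 ℕ.* tilts tags ≡ ## (λ i j → near i j ∧ not (required i j))
      2tilts = trans (cong (2 ℕ.*_) (count-cong (pairs n) (λ {(i , j)} _ → isTilt-tags i j)))
        (2cnt (λ i j → near i j ∧ not (required i j)) (λ i j → cong₂ _∧_ (near-sym i j) (cong not (required-sym i j)))
          (λ i → cong (_∧ not (required i i)) (near-irr i)))

      #Out : n ℕ.≤ # Out ℕ.+ 3
      #Out = ℕP.≤-trans (ℕP.≤-reflexive (sym (#-not Out))) (ℕP.+-monoʳ-≤ (# Out) (ℕP.≤-trans
          (#-cover {n} {not ∘ Out} {U} {_== w} cov) (ℕP.+-mono-≤ (ℕP.≤-trans (#-cover {n} {U} {_== u} {_== v} (λ i → ∨-true {i == u})) (ℕP.≤-reflexive (cong₂ ℕ._+_ (#-≟ u) (#-≟ v)))) (ℕP.≤-reflexive (#-≟ w)))))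
        where
        cov : ∀ i → not (Out i) ≡ true → U i ≡ true ⊎ (i == w) ≡ true
        cov i h with U i | i == w
        ... | true  | _    = inj₁ refl
        ... | false | true = inj₂ refl

    tilts≥ : u ≢ v → 2 ℕ.* (n ℕ.∸ 3) ℕ.≤ tilts tags
    tilts≥ u≢v = ℕP.*-cancelˡ-≤ 2 (ℕP.≤-trans (ℕP.≤-trans (ℕP.*-monoʳ-≤ 2 (ℕP.≤-trans (ℕP.*-monoʳ-≤ 2 n-3≤) (ℕP.≤-trans (ℕP.*-monoˡ-≤ (# Out) 2≤U) (ℕP.≤-reflexive (sym (##-product U Out))))))
          (ℕP.≤-trans (ℕP.≤-reflexive (cong (## F ℕ.+_) (trans (ℕP.+-identityʳ (## F)) (sym (##-transpose F)))))
            (##-disjoint {n} {λ i j → near i j ∧ not (required i j)} {F} {λ i j → F j i} incl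
              (λ i j h → trans (cong₂ _∧_ (near-sym i j) (cong not (required-sym i j))) (incl j i h))
              (λ i j h h′ → true≢false (trans (sym (proj₁ (∧-true {U i} h))) (not-true (proj₁ (∧-true {not (U i)} (proj₂ (∧-true {U j} h′))))))))))
        (ℕP.≤-reflexive (sym 2tilts)))
      where
      F : Fin n → Fin n → Bool
      F i j = U i ∧ Out j
      n-3≤ : n ℕ.∸ 3 ℕ.≤ # Out
      n-3≤ = ℕP.m≤n+o⇒m∸n≤o n 3 (ℕP.≤-trans #Out (ℕP.≤-reflexive (ℕP.+-comm (# Out) 3)))
      2≤U : 2 ℕ.≤ # U
      2≤U = ℕP.≤-trans (ℕP.≤-reflexive (sym (cong₂ ℕ._+_ (#-≟ u) (#-≟ v))))
        (#-disjoint {n} {U} {_== u} {_== v} (λ i h → ∨-introˡ h) (λ i h → ∨-introʳ {i == u} h)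
          (λ i h h′ → u≢v (trans (sym (==⇒≡ {i = i} h)) (==⇒≡ {i = i} h′))))
      incl : ∀ i j → F i j ≡ true → near i j ∧ not (required i j) ≡ true
      incl i j h = ∧-intro (∧-intro (not-intro (≢⇒== i≢j)) (∨-introˡ Ui)) (not-intro req-false)
        where
        Ui = proj₁ (∧-true {U i} h)
        ¬Uj = not-true (proj₁ (∧-true {not (U j)} (proj₂ (∧-true {U i} h))))
        j≢w = not-true (proj₂ (∧-true {not (U j)} (proj₂ (∧-true {U i} h))))
        i≢j : i ≢ j
        i≢j i≡j = true≢false (trans (sym (subst (λ k → U k ≡ true) i≡j Ui)) ¬Uj)
        Sj : S j ≡ false
        Sj with S j | S⊆ j
        ... | true  | f = ⊥-elim (true≢false (trans (sym (f refl)) ¬Uj))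
        ... | false | _ = refl
        req-false : required i j ≡ false
        req-false = trans (cong₂ (λ a b → (S i ∧ a) ∨ ((i == w) ∧ b)) j≢w Sj) (cong₂ _∨_ (BoolP.∧-zeroʳ (S i)) (BoolP.∧-zeroʳ (i == w)))

    tilted≤8 : ∀ s → deg (adj s) u ℕ.≤ 4 → deg (adj s) v ℕ.≤ 4 → tilted tags s ℕ.≤ 8
    tilted≤8 s u≤ v≤ = ℕP.≤-trans (ℕP.*-cancelˡ-≤ 2 (ℕP.≤-trans (ℕP.≤-reflexive (2cnt (λ i j → isTilt (tags i j) ∧ adj s i j)
          (λ i j → cong₂ _∧_ (trans (isTilt-tags i j) (trans (cong₂ _∧_ (near-sym i j) (cong not (required-sym i j))) (sym (isTilt-tags j i)))) (adj-sym s i j))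
          (λ i → trans (cong (isTilt (tags i i) ∧_) (adj-irr s i)) (BoolP.∧-zeroʳ (isTilt (tags i i))))))
        (ℕP.≤-trans (##-cover {n} {λ i j → isTilt (tags i j) ∧ adj s i j} {λ i j → Star.star u i j ∧ adj s i j} {λ i j → Star.star v i j ∧ adj s i j} cov)
          (ℕP.≤-reflexive (trans (cong₂ ℕ._+_ (Star.##-star u (adj s) (adj-sym s) (adj-irr s)) (Star.##-star v (adj s) (adj-sym s) (adj-irr s)))
            (sym (ℕP.*-distribˡ-+ 2 (deg (adj s) u) (deg (adj s) v))))))))
      (ℕP.+-mono-≤ u≤ v≤)
      where
      cov : ∀ i j → isTilt (tags i j) ∧ adj s i j ≡ true → Star.star u i j ∧ adj s i j ≡ true ⊎ Star.star v i j ∧ adj s i j ≡ true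
      cov i j h with ∧-true {isTilt (tags i j)} h
      ... | t , a with ∧-true {not (i == j)} (proj₁ (∧-true {near i j} (trans (sym (isTilt-tags i j)) t)))
      ...   | _ , UU with ∨-true {U i} UU
      ...     | inj₁ Ui = Sum.map (λ x → ∧-intro (∨-introˡ x) a) (λ x → ∧-intro (∨-introˡ x) a) (∨-true {i == u} Ui)
      ...     | inj₂ Uj = Sum.map (λ x → ∧-intro (∨-introʳ {i == u} x) a) (λ x → ∧-intro (∨-introʳ {i == v} x) a) (∨-true {j == u} Uj)

    -- At most eight tilted edges occur, which `y ^ 8` normalises at tilt `recip y`. The tilted
    -- pairs at `u` and `v` contribute `κ` each, as for two nearly independent vertices, and each
    -- required edge contributes `p`.
    small-joined : ∀ m → m ℕ.≤ # S → u ≢ v →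
      Small (λ s → deg (adj s) u ℕ.≤ 4 × deg (adj s) v ℕ.≤ 4 × (∀ i → S i ≡ true → adj s i w ≡ true))
        (y ^ 8 * (κ ^ (2 ℕ.* (n ℕ.∸ 3)) * p ^ m))
    small-joined m m≤ u≢v = small-mono (λ s h → h) bound (small-tagged (y ^ 8) (recip y) tags (^-nonneg 8 (<⇒≤ 0<y)) 0≤μ
        (λ s (u≤ , v≤ , joined) → (λ i j h → ⊥-elim (tags-forb i j h)) , (λ i j h → edges s joined i j (tags-req i j h)) ,
          yμ^≥1 8 (tilted tags s) (tilted≤8 s u≤ v≤)))
      where
      edges : ∀ s → (∀ i → S i ≡ true → adj s i w ≡ true) → ∀ i j → required i j ≡ true → adj s i j ≡ true
      edges s joined i j h with ∨-true {S i ∧ (j == w)} h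
      ... | inj₁ h₁ = subst (λ k → adj s i k ≡ true) (sym (==⇒≡ {i = j} (proj₂ (∧-true {S i} h₁)))) (joined i (proj₁ (∧-true {S i} h₁)))
      ... | inj₂ h₂ = trans (adj-sym s i j) (subst (λ k → adj s j k ≡ true) (sym (==⇒≡ {i = i} (proj₁ (∧-true {i == w} h₂)))) (joined j (proj₂ (∧-true {i == w} h₂))))
      κ≤1 : κ ≤ 1ℚ
      κ≤1 = by-diff {κ} (p - r) (proj₁ frac-κ) (eq p r)
        where
        eq : ∀ p r → 1ℚ - (p - r) + (p - r) ≡ 1ℚ
        eq = solve-∀ ℚ-ring
      bound : y ^ 8 * tagged (recip y) tags ≤ y ^ 8 * (κ ^ (2 ℕ.* (n ℕ.∸ 3)) * p ^ m)
      bound = *-monoʳ (y ^ 8) (^-nonneg 8 (<⇒≤ 0<y)) (≤-trans (≤-reflexive (cong (λ z → z ^ tilts tags * (q ^ forbs tags * p ^ reqs tags)) q+μp))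
        (*-mono₂ (^-nonneg (tilts tags) 0≤κ) (*-nonneg (^-nonneg (forbs tags) 0≤q) (^-nonneg (reqs tags) 0≤p))
          (^-antiʳ 0≤κ κ≤1 (tilts≥ u≢v))
          (≤-trans (*-mono₂ (^-nonneg (forbs tags) 0≤q) (^-nonneg (reqs tags) 0≤p) (^≤1 (forbs tags) 0≤q q≤1) (^-antiʳ 0≤p p≤1 (ℕP.≤-trans m≤ reqs≥)))
            (≤-reflexive (*-identityˡ (p ^ m))))))

  small-empty : ∀ {P : Coins → Set} {ε} → 0ℚ ≤ ε → (∀ s → ¬ P s) → Small P ε
  small-empty 0≤ε ¬P = small (λ _ → 0ℚ) (λ _ → ≤-refl) (λ s Ps → ⊥-elim (¬P s Ps))
    (≤-trans (≤-reflexive (Ex-const (length (pairs n)) 0ℚ)) 0≤ε)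

  y^≤ : ∀ m → y ^ m ≤ 2ℚ ^ (e ℕ.* m)
  y^≤ m = ≤-trans (^-mono m (<⇒≤ 0<y) y≤2^e) (≤-reflexive (^-assocʳ 2ℚ e m))

  κ² : ℚ
  κ² = κ ^ (2 ℕ.* (n ℕ.∸ 3))

  0≤κ² : 0ℚ ≤ κ²
  0≤κ² = ^-nonneg (2 ℕ.* (n ℕ.∸ 3)) 0≤κ

  NNκ²≤4 : N * (N * κ²) ≤ 2ℚ ^ 2
  NNκ²≤4 = ≤-trans (≤-reflexive (trans (cong (λ z → N * (N * z)) (trans (cong (κ ^_) (cong (n ℕ.∸ 3 ℕ.+_) (ℕP.+-identityʳ (n ℕ.∸ 3)))) (^-homo-* κ (n ℕ.∸ 3) (n ℕ.∸ 3))))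
      (eq N (κ ^ (n ℕ.∸ 3)))))
    (*-mono₂ (*-nonneg 0≤N (^-nonneg (n ℕ.∸ 3) 0≤κ)) (*-nonneg 0≤N (^-nonneg (n ℕ.∸ 3) 0≤κ)) Nκ≤2 Nκ≤2)
    where
    eq : ∀ N w → N * (N * (w * w)) ≡ N * w * (N * w)
    eq = solve-∀ ℚ-ring

  -- As `y ≤ 2 ^ e` and `p ≤ 2 ^ (- 15 e - 5)`, even nine factors `y` leave about `2 ^ (- 6 e)`.
  4y^mp≤η : ∀ m → m ℕ.≤ 9 → 2ℚ ^ 2 * (y ^ m * p) ≤ η
  4y^mp≤η m m≤9 = ≤-trans (*-monoʳ (2ℚ ^ 2) (0≤2^ 2) (*-monoˡ p 0≤p (≤-trans (y^≤ m) (^-monoʳ 1≤2ℚ (ℕP.*-monoʳ-≤ e m≤9)))))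
    (≤-trans (≤-reflexive (trans (sym (*-assoc (2ℚ ^ 2) (2ℚ ^ (e ℕ.* 9)) p)) (cong (_* p) (sym (^-homo-* 2ℚ 2 (e ℕ.* 9))))))
      (≤-trans (2^p≤ (2 ℕ.+ e ℕ.* 9) (ℕP.m+n≤o⇒n≤o e le)) (^-antiʳ 0≤½ ½≤1 (ℕP.m+n≤o⇒m≤o∸n e le))))
    where
    le : e ℕ.+ (2 ℕ.+ e ℕ.* 9) ℕ.≤ 15 ℕ.* e ℕ.+ 5
    le = ℕP.≤-trans (ℕP.m≤m+n _ (5 ℕ.* e ℕ.+ 3)) (ℕP.≤-reflexive (eq e))
      where
      eq : ∀ e → e ℕ.+ (2 ℕ.+ e ℕ.* 9) ℕ.+ (5 ℕ.* e ℕ.+ 3) ≡ 15 ℕ.* e ℕ.+ 5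
      eq = ℕSolver.solve-∀

  Low : Coins → Fin n → Fin n → Set
  Low s u v = u ≢ v × deg (adj s) u ℕ.≤ 4 × deg (adj s) v ℕ.≤ 4

  -- The choice of `u` and `v` is paid for by `κ²`, so the required edge leaves a bound of order
  -- `y ^ 8 * p`.
  small-adjacent : Small (λ s → ∃ λ u → ∃ λ v → Low s u v × adj s u v ≡ true) η
  small-adjacent = small-mono (λ s h → h) bound (small-∃Fin (λ u → small-∃Fin (λ v → each u v (u FinP.≟ v))))
    where
    B = y ^ 8 * (κ² * p ^ 1)
    0≤B : 0ℚ ≤ B
    0≤B = *-nonneg (^-nonneg 8 (<⇒≤ 0<y)) (*-nonneg 0≤κ² (^-nonneg 1 0≤p))
    each : ∀ u v → Dec (u ≡ v) → Small (λ s → Low s u v × adj s u v ≡ true) B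
    each u v (yes u≡v) = small-empty 0≤B (λ s h → proj₁ (proj₁ h) u≡v)
    each u v (no u≢v)  = small-mono (λ s ((_ , u≤ , v≤) , uv) → u≤ , v≤ , λ i h → subst (λ k → adj s k v ≡ true) (sym (==⇒≡ {i = i} h)) uv) ≤-refl
      (small-joined u v v (_== u) (λ i h → ∨-introˡ h) (≢⇒== (u≢v ∘ sym)) 1 (ℕP.≤-reflexive (sym (#-≟ u))) u≢v)
    bound : N * (N * B) ≤ η
    bound = ≤-trans (≤-trans (≤-reflexive (eq N (y ^ 8) κ² p)) (*-monoˡ (y ^ 8 * p) (*-nonneg (^-nonneg 8 (<⇒≤ 0<y)) 0≤p) NNκ²≤4)) (4y^mp≤η 8 (ℕP.m≤m+n 8 1))
      where
      eq : ∀ N y k p → N * (N * (y * (k * (p * 1ℚ)))) ≡ N * (N * k) * (y * p)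
      eq = solve-∀ ℚ-ring

  -- Compared with `small-adjacent`, the third vertex costs `N` and brings a second required edge;
  -- `N * p = y` only raises the power of `y` to nine.
  small-cherry : Small (λ s → ∃ λ u → ∃ λ v → ∃ λ w → Low s u v × adj s u w ≡ true × adj s v w ≡ true) η
  small-cherry = small-mono (λ s h → h) bound (small-∃Fin (λ u → small-∃Fin (λ v → small-∃Fin (λ w → each u v w (u FinP.≟ v) (w FinP.≟ u) (w FinP.≟ v)))))
    where
    B = y ^ 8 * (κ² * p ^ 2)
    0≤B : 0ℚ ≤ B
    0≤B = *-nonneg (^-nonneg 8 (<⇒≤ 0<y)) (*-nonneg 0≤κ² (^-nonneg 2 0≤p))
    each : ∀ u v w → Dec (u ≡ v) → Dec (w ≡ u) → Dec (w ≡ v) → Small (λ s → Low s u v × adj s u w ≡ true × adj s v w ≡ true) B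
    each u v w (yes u≡v) _ _ = small-empty 0≤B (λ s h → proj₁ (proj₁ h) u≡v)
    each u v w (no _) (yes refl) _ = small-empty 0≤B (λ s h → adj⇒≢ s (proj₁ (proj₂ h)) refl)
    each u v w (no _) (no _) (yes refl) = small-empty 0≤B (λ s h → adj⇒≢ s (proj₂ (proj₂ h)) refl)
    each u v w (no u≢v) (no w≢u) (no w≢v) = small-mono (λ s ((_ , u≤ , v≤) , uw , vw) → u≤ , v≤ , λ i h → joined s uw vw i h) ≤-refl
      (small-joined u v w (λ i → (i == u) ∨ (i == v)) (λ i h → h) (cong₂ _∨_ (≢⇒== w≢u) (≢⇒== w≢v)) 2 2≤ u≢v)
      where
      joined : ∀ s → adj s u w ≡ true → adj s v w ≡ true → ∀ i → (i == u) ∨ (i == v) ≡ true → adj s i w ≡ true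
      joined s uw vw i h with ∨-true {i == u} h
      ... | inj₁ e = subst (λ k → adj s k w ≡ true) (sym (==⇒≡ {i = i} e)) uw
      ... | inj₂ e = subst (λ k → adj s k w ≡ true) (sym (==⇒≡ {i = i} e)) vw
      2≤ : 2 ℕ.≤ # (λ i → (i == u) ∨ (i == v))
      2≤ = ℕP.≤-trans (ℕP.≤-reflexive (sym (cong₂ ℕ._+_ (#-≟ u) (#-≟ v))))
        (#-disjoint {n} {λ i → (i == u) ∨ (i == v)} {_== u} {_== v} (λ i h → ∨-introˡ h) (λ i h → ∨-introʳ {i == u} h)
          (λ i h h′ → u≢v (trans (sym (==⇒≡ {i = i} h)) (==⇒≡ {i = i} h′))))
    bound : N * (N * (N * B)) ≤ η
    bound = ≤-trans (≤-trans (≤-reflexive (eq N (y ^ 8) κ² p)) (*-monoˡ (y ^ 9 * p) (*-nonneg (^-nonneg 9 (<⇒≤ 0<y)) 0≤p) NNκ²≤4)) (4y^mp≤η 9 ℕP.≤-refl)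
      where
      eq : ∀ N z k p → N * (N * (N * (z * (k * (p * (p * 1ℚ)))))) ≡ N * (N * k) * ((N * p * z) * p)
      eq = solve-∀ ℚ-ring

  module _ (h : ℕ) (4N≤h²p : fromℕℚ 4 * N ≤ fromℕℚ (h ℕ.* h) * p) where

    -- Independence forbids at least `h² / 2` pairs, so a given set of more than `h` vertices has
    -- probability at most `exp (- h² p / 2) ≤ 4 ^ (-n)`, against only `2 ^ n` sets.
    small-independent : Small (λ s → ∃ λ A → Independent (adj s) (lookup A) × h ℕ.< # (lookup A)) η
    small-independent = small-mono (λ s (A , PA) → A , ∈-vecs ∈-bools A , PA) bound (small-∃ {P = P} {ε = λ A → (½ ^ 2) ^ # (λ i → bit (lookup A i))} (vecs bools n) each)
      where
      P : Vec Bool n → Coins → Set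
      P A s = Independent (adj s) (lookup A) × h ℕ.< # (lookup A)
      -- A predicate that always holds, so its count is `n`. This writes the constant bound
      -- `4 ^ (-n)` as a product over the vertices, to which `Σ-ΠV` applies.
      bit : Bool → Bool
      bit _ = true
      bound : ΣL (vecs bools n) (λ A → (½ ^ 2) ^ # (λ i → bit (lookup A i))) ≤ η
      bound = ≤-trans (≤-reflexive (trans (ΣL-cong (vecs bools n) (λ A → sym (ΠV-^ (½ ^ 2) (λ i b → bit b) A)))
          (trans (Σ-ΠV bools n (λ _ _ → ½ ^ 2)) (ΠF-const n (½ ^ 2 + (½ ^ 2 + 0ℚ))))))
        (^-antiʳ 0≤½ ½≤1 e≤n)
        where
        e≤n : e ℕ.≤ n
        e≤n = ℕP.≤-trans e≤X (ℕP.≤-trans (ℕP.m≤n*m X 32) (ℕP.≤-trans 32X≤ (ℕP.≤-trans (ℕP.^-monoʳ-≤ 2 (ℕP.m≤n*m e 16)) ≤n)))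
      each : ∀ A → Small (P A) ((½ ^ 2) ^ # (λ i → bit (lookup A i)))
      each A with h ℕP.<? # (lookup A)
      ... | no ¬big = small-empty (^-nonneg (# (λ i → bit (lookup A i))) (0≤½^′ 2)) (λ s (_ , big) → ¬big big)
      ... | yes big = small-mono (λ s h → h) small-enough (small-pattern tags
          (λ s (ind , _) → (λ i j t → let (Ai , Aj) = tags-forb i j t in ind i j Ai Aj) , (λ i j t → ⊥-elim (tags-req i j t))))
        where
        open Inside (lookup A)
        tags : Tags
        tags i j = if inside i j then forb else free
        tags-req : ∀ i j → tags i j ≢ req
        tags-req i j t with inside i j
        tags-req i j () | true
        tags-req i j () | false
        isForb-tags : ∀ i j → isForb (tags i j) ≡ inside i j
        isForb-tags i j with inside i j
        ... | true  = refl
        ... | false = refl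
        tags-forb : ∀ i j → tags i j ≡ forb → lookup A i ≡ true × lookup A j ≡ true
        tags-forb i j t = ∧-true {lookup A i} (proj₂ (∧-true {not (i == j)} (trans (sym (isForb-tags i j)) (cong isForb t))))
        F = forbs tags
        h²≤2F : h ℕ.* h ℕ.≤ 2 ℕ.* F
        h²≤2F = ℕP.≤-trans (ℕP.*-monoˡ-≤ h (ℕP.<⇒≤ big)) (ℕP.≤-trans (cnt-inside h big)
          (ℕP.≤-reflexive (cong (2 ℕ.*_) (sym (count-cong (pairs n) (λ {(i , j)} _ → isForb-tags i j))))))
        2n≤Fp : fromℕℚ (2 ℕ.* n) ≤ fromℕℚ F * p
        2n≤Fp = *-cancelˡ {fromℕℚ (2 ℕ.* n)} {fromℕℚ F * p} (fromℕℚ 2) (fromℕℚ-pos 1)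
          (≤-trans (≤-reflexive (trans (cong (fromℕℚ 2 *_) (fromℕℚ-* 2 n)) (eq N)))
            (≤-trans 4N≤h²p (≤-trans (*-monoˡ p 0≤p (fromℕℚ-mono h²≤2F)) (≤-reflexive (trans (cong (_* p) (fromℕℚ-* 2 F)) (*-assoc (fromℕℚ 2) (fromℕℚ F) p))))))
          where
          eq : ∀ N → fromℕℚ 2 * (fromℕℚ 2 * N) ≡ fromℕℚ 4 * N
          eq = solve-∀ ℚ-ring
        small-enough : q ^ forbs tags * p ^ reqs tags ≤ (½ ^ 2) ^ # (λ i → bit (lookup A i))
        small-enough = ≤-trans (*-mono₂ (^-nonneg F 0≤q) (^-nonneg (reqs tags) 0≤p)
            (decay⇒≤½^ (2 ℕ.* n) (^-nonneg F 0≤q) 2n≤Fp (decay-^ F 0≤q (decay-1- (0≤p , p≤1)))) (^≤1 (reqs tags) 0≤p p≤1))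
          (≤-reflexive (trans (*-identityʳ _) (trans (sym (^-assocʳ ½ 2 n)) (cong ((½ ^ 2) ^_) (sym (#-all {n} {λ i → bit (lookup A i)} (λ i → refl)))))))

-- Foldings of a typical sparse graph

#≤1 : ∀ {n} (B : Fin n → Bool) → (∀ i j → B i ≡ true → B j ≡ true → i ≡ j) → # B ℕ.≤ 1
#≤1 B h with 1 ℕP.≤? # B
... | no ¬1  = ℕP.<⇒≤ (ℕP.≰⇒> ¬1)
... | yes 1≤ = let (i , Bi) = #-∃ B 1≤ in ℕP.≤-trans
  (#-mono {B = B} {_== i} (λ j Bj → trans (cong (_== i) (h j i Bj Bi)) (==-refl i))) (ℕP.≤-reflexive (#-≟ i))

infixr 1 _or-else_
_or-else_ : ∀ {P Q : Set} → Dec P → (¬ P → Q) → P ⊎ Q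
yes p or-else _ = inj₁ p
no ¬p or-else f = inj₂ (f ¬p)

any-subset? : ∀ {n} {P : Vec Bool n → Set} → (∀ A → Dec (P A)) → Dec (∃ P)
any-subset? {n} P? = map′ Any.satisfied (λ (A , PA) → lose (∈-vecs ∈-bools A) PA) (Any.any? P? (vecs bools n))

-- `d` is a degree reached by nearly all vertices, `h` bounds the independent sets, and
-- `2 ^ (4 * c)` is the tilt used when many vertices move. `cd-large` lets the weight of `d` edges
-- beat the union bound, and `4hl≤n` limits the cost of the pairs over a neighbourhood.
record FoldRegime : Set where
  field
    regime   : Regime
  open Regime regime public
  field
    d c h    : ℕ
    192d≤y   : fromℕℚ (192 ℕ.* d) ≤ fromℕℚ n * p
    cd-large : X ℕ.+ (33 ℕ.* e ℕ.+ 34) ℕ.≤ c ℕ.* d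
    4hl≤n    : 4 ℕ.* (h ℕ.* 2 ℕ.^ (4 ℕ.* c)) ℕ.≤ n
    4N≤h²p   : fromℕℚ 4 * fromℕℚ n ≤ fromℕℚ (h ℕ.* h) * p

module Folds (setting : FoldRegime) where

  open FoldRegime setting
  open Sparse regime
  open Sample n
  open Prob p 0≤p p≤1
  open More n p 0≤p p≤1

  record Good (s : Coins) : Set where
    field
      min2        : ∀ x → 2 ℕ.≤ deg (adj s) x
      max         : ∀ x → deg (adj s) x ℕ.≤ τ
      few         : # (λ x → does (deg (adj s) x ℕP.<? d)) ℕ.≤ 2 ℕ.^ (2 ℕ.* e)
      links       : ∀ x → cnt (link s x) ℕ.≤ 1
      adjacent    : ∀ u v → Low s u v → adj s u v ≡ true → ⊥
      cherry      : ∀ u v w → Low s u v → adj s u w ≡ true → adj s v w ≡ true → ⊥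
      independent : ∀ A → Independent (adj s) (lookup A) → # (lookup A) ℕ.≤ h

  module _ (r : Fin n → Fin n) where
    open Move n r hiding (τ)

    module _ (s : Coins) (good : Good s) (fold : Folding n s r) where
      open Good good
      open Folding fold

      private R = adj s

      fixed : ∀ y → T y ≡ false → r y ≡ y
      fixed y Ty with r y FinP.≟ y
      ... | yes ry≡y = ry≡y

      α : Fin n → ℕ
      α x = # (λ y → R (r x) (r y))

      α≤ : ∀ x → α x ℕ.≤ # T ℕ.+ τ
      α≤ x = ℕP.≤-trans (#-cover {n} {λ y → R (r x) (r y)} {T} {R (r x)} cov) (ℕP.+-monoʳ-≤ (# T) (max (r x)))
        where
        cov : ∀ y → R (r x) (r y) ≡ true → T y ≡ true ⊎ R (r x) y ≡ true
        cov y ry = by (T y) refl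
          where
          by : ∀ b → T y ≡ b → T y ≡ true ⊎ R (r x) y ≡ true
          by true  Ty = inj₁ Ty
          by false Ty = inj₂ (subst (λ z → R (r x) z ≡ true) (fixed y Ty) ry)

      apart≥ : ∀ x → n ℕ.∸ (# T ℕ.+ τ) ℕ.≤ # (λ y → not (T y) ∧ not (R (r x) (r y)))
      apart≥ x = ℕP.m≤n+o⇒m∸n≤o n (# T ℕ.+ τ) (ℕP.≤-trans (ℕP.≤-reflexive (sym (#-all {n} {λ _ → true} (λ _ → refl))))
        (ℕP.≤-trans (#-cover {n} {λ _ → true} {λ y → T y ∨ R (r x) y} {λ y → not (T y) ∧ not (R (r x) (r y))} cov)
          (ℕP.+-monoˡ-≤ _ (ℕP.≤-trans (#-cover {n} {λ y → T y ∨ R (r x) y} {T} {R (r x)} (λ y → ∨-true {T y})) (ℕP.+-monoʳ-≤ (# T) (max (r x)))))))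
        where
        cov : ∀ y → true ≡ true → (T y ∨ R (r x) y ≡ true) ⊎ (not (T y) ∧ not (R (r x) (r y)) ≡ true)
        cov y _ = by (T y) (R (r x) (r y)) refl refl
          where
          by : ∀ b c → T y ≡ b → R (r x) (r y) ≡ c → (T y ∨ R (r x) y ≡ true) ⊎ (not (T y) ∧ not (R (r x) (r y)) ≡ true)
          by true  c     Ty e = inj₁ (∨-introˡ Ty)
          by false true  Ty e = inj₁ (∨-introʳ {T y} (subst (λ z → R (r x) z ≡ true) (fixed y Ty) e))
          by false false Ty e = inj₂ (∧-intro (not-intro Ty) (not-intro e))

      -- Vertices of degree at most 4 are pairwise non-adjacent and without common neighbours by
      -- `adjacent` and `cherry`, so `tilted≥4` applies with these as `L`.
      2t≤tilted : 2 ℕ.* # T ℕ.≤ tilted (Move.τ n r s) s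
      2t≤tilted = ℕP.*-cancelˡ-≤ 2 (ℕP.≤-trans (ℕP.≤-reflexive (eq (# T)))
          (tilted≥4 s endo L min2 (λ x Lx → ℕP.≰⇒> (does⇒¬ (R# x ℕP.≤? 4) Lx)) indep one))
        where
        eq : ∀ t → 2 ℕ.* (2 ℕ.* t) ≡ t ℕ.* 4
        eq = ℕSolver.solve-∀
        R# : Fin n → ℕ
        R# = deg R
        L : Fin n → Bool
        L x = does (R# x ℕP.≤? 4)
        L≤ : ∀ x → L x ≡ true → R# x ℕ.≤ 4
        L≤ x = does⇒ (R# x ℕP.≤? 4)
        indep : ∀ u v → L u ≡ true → L v ≡ true → R u v ≡ false
        indep u v Lu Lv = by (R u v) refl
          where
          by : ∀ b → R u v ≡ b → R u v ≡ false
          by false uv = uv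
          by true  uv = ⊥-elim (adjacent u v (adj⇒≢ s uv , L≤ u Lu , L≤ v Lv) uv)
        one : ∀ w → # (λ y → L y ∧ R w y) ℕ.≤ 1
        one w = #≤1 (λ y → L y ∧ R w y) same
          where
          same : ∀ u v → L u ∧ R w u ≡ true → L v ∧ R w v ≡ true → u ≡ v
          same u v hu hv with u FinP.≟ v
          ... | yes u≡v = u≡v
          ... | no u≢v = ⊥-elim (cherry u v w (u≢v , L≤ u (proj₁ (∧-true {L u} hu)) , L≤ v (proj₁ (∧-true {L v} hv)))
                (trans (adj-sym s u w) (proj₂ (∧-true {L u} hu))) (trans (adj-sym s v w) (proj₂ (∧-true {L v} hv))))

      -- Since `τ` is at least twice the number of vertices of degree below `d`, at least half of
      -- the moved vertices have degree at least `d`. Summing degrees counts each edge at most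
      -- twice.
      td≤4tilted : τ ℕ.≤ # T → # T ℕ.* d ℕ.≤ 4 ℕ.* tilted (Move.τ n r s) s
      td≤4tilted τ≤t = ℕP.≤-trans (ℕP.*-monoˡ-≤ d t≤2g) (ℕP.≤-trans (ℕP.≤-reflexive (ℕP.*-assoc 2 (# g) d))
          (ℕP.≤-trans (ℕP.*-monoʳ-≤ 2 (ℕP.≤-trans (sum-on-≥ g (deg R) d (λ x gx → ℕP.≮⇒≥ (does⇒¬ (deg R x ℕP.<? d) (not-true (proj₂ (∧-true {T x} gx))))))
              (ℕP.≤-trans (sum-mono (λ x → ℕP.*-monoˡ-≤ (deg R x) (⟦⟧-mono {g x} {T x} (λ gx → proj₁ (∧-true {T x} gx))))) (tilted≥ s endo))))
            (ℕP.≤-reflexive (sym (ℕP.*-assoc 2 2 (tilted (Move.τ n r s) s))))))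
        where
        low g : Fin n → Bool
        low x = does (deg R x ℕP.<? d)
        g x = T x ∧ not (low x)
        t≤ : # T ℕ.≤ # low ℕ.+ # g
        t≤ = #-cover {n} {T} {low} {g} cov
          where
          cov : ∀ x → T x ≡ true → low x ≡ true ⊎ g x ≡ true
          cov x Tx = by (low x) refl
            where
            by : ∀ b → low x ≡ b → low x ≡ true ⊎ g x ≡ true
            by true  l = inj₁ l
            by false l = inj₂ (∧-intro Tx (not-intro l))
        t≤2g : # T ℕ.≤ 2 ℕ.* # g
        t≤2g = ℕP.+-cancelˡ-≤ (# T) _ _ (ℕP.≤-trans (ℕP.+-mono-≤ t≤ t≤) (ℕP.≤-trans (ℕP.≤-reflexive (eq (# low) (# g)))
          (ℕP.+-monoˡ-≤ (2 ℕ.* # g) (ℕP.≤-trans (ℕP.*-monoʳ-≤ 2 few) τ≤t))))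
          where
          eq : ∀ l g → l ℕ.+ g ℕ.+ (l ℕ.+ g) ≡ 2 ℕ.* l ℕ.+ 2 ℕ.* g
          eq = ℕSolver.solve-∀

      ind≤h : ∀ A → Independent R A → # A ℕ.≤ h
      ind≤h A ind = ℕP.≤-trans (ℕP.≤-reflexive (#-cong {n} (λ i → sym (VecP.lookup∘tabulate A i))))
        (independent (tabulate A) (λ i j Ai Aj → ind i j (trans (sym (VecP.lookup∘tabulate A i)) Ai) (trans (sym (VecP.lookup∘tabulate A j)) Aj)))

      -- The neighbourhood of a vertex spans at most one edge, so its preimage is
      -- the union of two independent sets.
      α≤2h : ∀ x → α x ℕ.≤ 2 ℕ.* h
      α≤2h x = go (FinP.any? (λ b → FinP.any? (λ c → link s (r x) b c BoolP.≟ true)))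
        where
        z = r x
        go : Dec (∃ λ b → ∃ λ c → link s z b c ≡ true) → α x ℕ.≤ 2 ℕ.* h
        go (no none) = ℕP.≤-trans (ind≤h (λ y → R z (r y)) ind) (ℕP.m≤n*m h 2)
          where
          ind : Independent R (λ y → R z (r y))
          ind i j zi zj = by (R i j) refl
            where
            by : ∀ b → R i j ≡ b → R i j ≡ false
            by false ij = ij
            by true  ij = ⊥-elim (none (r i , r j , ∧-intro (∧-intro zi zj) (endo i j ij)))
        go (yes (b , c , bc)) = ℕP.≤-trans (#-cover {n} {λ y → R z (r y)} {λ y → r y == b} {λ y → R z (r y) ∧ not (r y == b)} cov)
            (ℕP.≤-trans (ℕP.+-mono-≤ (ind≤h (λ y → r y == b) ind₁) (ind≤h (λ y → R z (r y) ∧ not (r y == b)) ind₂)) (ℕP.≤-reflexive (cong (h ℕ.+_) (sym (ℕP.+-identityʳ h)))))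
          where
          cov : ∀ y → R z (r y) ≡ true → (r y == b) ≡ true ⊎ R z (r y) ∧ not (r y == b) ≡ true
          cov y zy = by (r y == b) refl
            where
            by : ∀ t → (r y == b) ≡ t → (r y == b) ≡ true ⊎ R z (r y) ∧ not (r y == b) ≡ true
            by true  e = inj₁ e
            by false e = inj₂ (∧-intro zy (not-intro e))
          ind₁ : Independent R (λ y → r y == b)
          ind₁ i j ib jb = by (R i j) refl
            where
            by : ∀ t → R i j ≡ t → R i j ≡ false
            by false ij = ij
            by true  ij = ⊥-elim (adj⇒≢ s (endo i j ij) (trans (==⇒≡ {i = r i} ib) (sym (==⇒≡ {i = r j} jb))))
          edge-cases : ∀ {i j k l} → edge i j ≡ edge k l → i ≡ k ⊎ j ≡ k
          edge-cases {i} {j} {k} {l} eq with does (i FinP.<? j) | does (k FinP.<? l)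
          ... | true  | true  = inj₁ (,-injectiveˡ eq)
          ... | true  | false = inj₂ (,-injectiveʳ eq)
          ... | false | true  = inj₂ (,-injectiveˡ eq)
          ... | false | false = inj₁ (,-injectiveʳ eq)
          link-sym : ∀ i j → link s z i j ≡ link s z j i
          link-sym i j = cong₂ _∧_ (BoolP.∧-comm (R z i) (R z j)) (adj-sym s i j)
          link⇒≢ : ∀ {i j} → link s z i j ≡ true → i ≢ j
          link⇒≢ {i} {j} l = adj⇒≢ s (proj₂ (∧-true {R z i ∧ R z j} l))
          -- An edge inside this set would go to a link at `z` that avoids `b`, whereas the link
          -- from `b` to `c` is the only one.
          ind₂ : Independent R (λ y → R z (r y) ∧ not (r y == b))
          ind₂ i j zi zj = by (R i j) refl
            where
            by : ∀ t → R i j ≡ t → R i j ≡ false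
            by false ij = ij
            by true  ij = ⊥-elim (Sum.[ (λ e → true≢false (trans (sym (trans (cong (_== b) e) (==-refl b))) (not-true (proj₂ (∧-true {R z (r i)} zi)))))
                                      , (λ e → true≢false (trans (sym (trans (cong (_== b) e) (==-refl b))) (not-true (proj₂ (∧-true {R z (r j)} zj))))) ]
                (edge-cases (count≤1 (pairs n) (λ (i , j) → link s z i j) (links z) (edge-∈ (link⇒≢ l)) (edge-∈ (link⇒≢ bc))
                  (trans (on-edge (link s z) link-sym (r i) (r j)) l) (trans (on-edge (link s z) link-sym b c) bc))))
              where
              l : link s z (r i) (r j) ≡ true
              l = ∧-intro (∧-intro (proj₁ (∧-true {R z (r i)} zi)) (proj₁ (∧-true {R z (r j)} zj))) (endo i j ij)

    private t = # T

    ^-regroup : ∀ x u v i j k → x ^ (i ℕ.* k) * (u ^ (k ℕ.* j) * v) ≡ (x ^ i * u ^ j) ^ k * v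
    ^-regroup x u v i j k = trans (sym (*-assoc (x ^ (i ℕ.* k)) (u ^ (k ℕ.* j)) v)) (cong (_* v)
      (trans (cong₂ _*_ (sym (^-assocʳ x i k)) (trans (cong (u ^_) (ℕP.*-comm k j)) (sym (^-assocʳ u j k)))) (sym (^-distrib-* (x ^ i) (u ^ j) k))))

    -- The exponent is `e + (32 e + 34)`: the first part is `η`, the second beats the factor `n²`
    -- per moved vertex in the sum over maps.
    W : ℚ
    W = ½ ^ (33 ℕ.* e ℕ.+ 34)

    -- Per moved vertex, the forbidden pairs give `q ^ (n - 2 τ)`, at most `2 ^ (1 - 16 e)`; two
    -- edges at tilt `2 ^ (13 e)` give `2 ^ (- 26 e)`; and the at most `2 τ` pairs over edges cost a
    -- factor 2, as `2 τ l p ≤ ½`. The product `2 ^ (2 - 42 e)` is below `W`.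
    small-few : t ℕ.≤ τ → Small (λ s → Good s × Folding n s r) (W ^ t)
    small-few t≤τ = small-mono (λ s x → x) bound (small-folding p 0≤p p≤1 Good (½ ^ (26 ℕ.* e ℕ.* t)) l (t ℕ.* (τ ℕ.+ τ)) (t ℕ.* (n ℕ.∸ (τ ℕ.+ τ)))
        (0≤½^′ (26 ℕ.* e ℕ.* t)) (1≤2^ (13 ℕ.* e)) (λ s good fo → tilt-ok s good fo ,
          ℕP.≤-trans (tilts≤ s) (sum-on-≤ T (α s good fo) (τ ℕ.+ τ) (λ x _ → ℕP.≤-trans (α≤ s good fo x) (ℕP.+-monoˡ-≤ τ t≤τ))) ,
          ℕP.≤-trans (sum-on-≥ T _ (n ℕ.∸ (τ ℕ.+ τ)) (λ x _ → ℕP.≤-trans (ℕP.∸-monoʳ-≤ n (ℕP.+-monoˡ-≤ τ t≤τ)) (apart≥ s good fo x))) (forbs≥₂ s)))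
      where
      l = 2ℚ ^ (13 ℕ.* e)
      tilt-ok : ∀ s → Good s → Folding n s r → 1ℚ ≤ ½ ^ (26 ℕ.* e ℕ.* t) * l ^ tilted (Move.τ n r s) s
      tilt-ok s good fo = subst (1ℚ ≤_) (sym (trans (cong (½ ^ (26 ℕ.* e ℕ.* t) *_) (^-assocʳ 2ℚ (13 ℕ.* e) m)) (trans (*-comm (½ ^ (26 ℕ.* e ℕ.* t)) _) (2^*½^≥ (13 ℕ.* e ℕ.* m) (26 ℕ.* e ℕ.* t) le))))
          (1≤2^ (13 ℕ.* e ℕ.* m ℕ.∸ 26 ℕ.* e ℕ.* t))
        where
        m = tilted (Move.τ n r s) s
        le : 26 ℕ.* e ℕ.* t ℕ.≤ 13 ℕ.* e ℕ.* m
        le = ℕP.≤-trans (ℕP.≤-reflexive (eq e t)) (ℕP.*-monoʳ-≤ (13 ℕ.* e) (2t≤tilted s good fo))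
          where
          eq : ∀ e t → 26 ℕ.* e ℕ.* t ≡ 13 ℕ.* e ℕ.* (2 ℕ.* t)
          eq = ℕSolver.solve-∀
      0≤lp : 0ℚ ≤ l * p
      0≤lp = *-nonneg (0≤2^ (13 ℕ.* e)) 0≤p
      2τ≡ : τ ℕ.+ τ ≡ 2 ℕ.^ (2 ℕ.* e ℕ.+ 2)
      2τ≡ = trans (cong (τ ℕ.+_) (sym (ℕP.+-identityʳ τ))) (cong (2 ℕ.^_) (eq e))
        where
        eq : ∀ e → suc (suc (2 ℕ.* e)) ≡ 2 ℕ.* e ℕ.+ 2
        eq = ℕSolver.solve-∀
      2τℚ : fromℕℚ (τ ℕ.+ τ) ≡ 2ℚ ^ (2 ℕ.* e ℕ.+ 2)
      2τℚ = trans (cong fromℕℚ 2τ≡) (2^ℚ (2 ℕ.* e ℕ.+ 2))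
      2τlp : fromℕℚ (τ ℕ.+ τ) * (l * p) ≤ fromℕℚ 1 * ½
      2τlp = ≤-trans (≤-reflexive (trans (cong (_* (l * p)) 2τℚ) (trans (sym (*-assoc (2ℚ ^ (2 ℕ.* e ℕ.+ 2)) l p)) (cong (_* p) (sym (^-homo-* 2ℚ (2 ℕ.* e ℕ.+ 2) (13 ℕ.* e)))))))
        (≤-trans (2^p≤ (2 ℕ.* e ℕ.+ 2 ℕ.+ 13 ℕ.* e) (ℕP.m+n≤o⇒n≤o 1 le)) (^-antiʳ {½} {1} 0≤½ ½≤1 (ℕP.m+n≤o⇒m≤o∸n 1 le)))
        where
        le : 1 ℕ.+ (2 ℕ.* e ℕ.+ 2 ℕ.+ 13 ℕ.* e) ℕ.≤ 15 ℕ.* e ℕ.+ 5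
        le = ℕP.≤-trans (ℕP.m≤m+n _ 2) (ℕP.≤-reflexive (eq e))
          where
          eq : ∀ e → 1 ℕ.+ (2 ℕ.* e ℕ.+ 2 ℕ.+ 13 ℕ.* e) ℕ.+ 2 ≡ 15 ℕ.* e ℕ.+ 5
          eq = ℕSolver.solve-∀
      w≤ : (q + l * p) ^ (τ ℕ.+ τ) ≤ 2ℚ ^ 1
      w≤ = ≤-trans (^-mono (τ ℕ.+ τ) (+-nonneg 0≤q 0≤lp) (+-monoˡ-≤ (l * p) q≤1)) (1+^≤2^ (τ ℕ.+ τ) 1 0≤lp 2τlp)
      2τ≤n : τ ℕ.+ τ ℕ.≤ n
      2τ≤n = ℕP.≤-trans (ℕP.≤-reflexive 2τ≡) (ℕP.≤-trans (ℕP.^-monoʳ-≤ 2 (ℕP.≤-trans (ℕP.+-monoʳ-≤ (2 ℕ.* e) (ℕP.≤-trans (ℕP.m≤m+n 2 9) (ℕP.≤-trans 11≤e (ℕP.m≤n*m e 14)))) (ℕP.≤-reflexive (eq e)))) ≤n)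
        where
        eq : ∀ e → 2 ℕ.* e ℕ.+ 14 ℕ.* e ≡ 16 ℕ.* e
        eq = ℕSolver.solve-∀
      2τp≤1 : fromℕℚ (τ ℕ.+ τ) * p ≤ 1ℚ
      2τp≤1 = ≤-trans (≤-reflexive (cong (_* p) 2τℚ)) (≤-trans (2^p≤ (2 ℕ.* e ℕ.+ 2) (ℕP.+-mono-≤ (ℕP.*-monoˡ-≤ e {2} {15} (ℕP.m≤m+n 2 13)) (ℕP.m≤m+n 2 3))) (½^≤1 (15 ℕ.* e ℕ.+ 5 ℕ.∸ (2 ℕ.* e ℕ.+ 2))))
      g = q ^ (n ℕ.∸ (τ ℕ.+ τ))
      0≤g = ^-nonneg (n ℕ.∸ (τ ℕ.+ τ)) 0≤q
      1≤16e : 1 ℕ.≤ 16 ℕ.* e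
      1≤16e = ℕP.≤-trans (ℕP.≤-trans (ℕP.m≤m+n 1 10) 11≤e) (ℕP.m≤n*m e 16)
      g≤ : g ≤ ½ ^ (16 ℕ.* e ℕ.∸ 1)
      g≤ = ≤2^⇒½^ {g} (16 ℕ.* e) 1 (≤-trans (≤-reflexive (*-comm g (2ℚ ^ (16 ℕ.* e)))) (≤-trans (*-monoˡ g 0≤g 2^≤N) (Nq≤2 (τ ℕ.+ τ) 2τ≤n 2τp≤1))) 1≤16e
      base : ½ ^ (26 ℕ.* e) * (q + l * p) ^ (τ ℕ.+ τ) * g ≤ W
      base = ≤-trans (*-mono₂ (*-nonneg (0≤½^′ (26 ℕ.* e)) (^-nonneg (τ ℕ.+ τ) (+-nonneg 0≤q 0≤lp))) 0≤g (*-monoʳ (½ ^ (26 ℕ.* e)) (0≤½^′ (26 ℕ.* e)) w≤) g≤)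
        (≤-trans (≤-reflexive (trans (eq (½ ^ (26 ℕ.* e)) (2ℚ ^ 1) (½ ^ m)) (trans (cong (2ℚ ^ 1 *_) (sym (^-homo-* ½ (26 ℕ.* e) m)))
            (2^*½^≤ 1 (26 ℕ.* e ℕ.+ m) (ℕP.m+n≤o⇒n≤o (33 ℕ.* e ℕ.+ 34) le)))))
          (^-antiʳ 0≤½ ½≤1 (ℕP.m+n≤o⇒m≤o∸n (33 ℕ.* e ℕ.+ 34) le)))
        where
        m = 16 ℕ.* e ℕ.∸ 1
        eq : ∀ a b c → a * b * c ≡ b * (a * c)
        eq = solve-∀ ℚ-ring
        le : 33 ℕ.* e ℕ.+ 34 ℕ.+ 1 ℕ.≤ 26 ℕ.* e ℕ.+ m
        le = ℕP.≤-pred (ℕP.≤-trans (ℕP.≤-trans (ℕP.≤-reflexive (eq₁ e)) (ℕP.≤-trans (ℕP.+-monoʳ-≤ (33 ℕ.* e) (ℕP.≤-trans (ℕP.m≤m+n 36 63) (ℕP.*-monoʳ-≤ 9 11≤e))) (ℕP.≤-reflexive (eq₂ e))))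
          (ℕP.≤-reflexive (trans (cong (26 ℕ.* e ℕ.+_) (sym (ℕP.m+[n∸m]≡n 1≤16e))) (ℕP.+-suc (26 ℕ.* e) m))))
          where
          eq₁ : ∀ e → suc (33 ℕ.* e ℕ.+ 34 ℕ.+ 1) ≡ 33 ℕ.* e ℕ.+ 36
          eq₁ = ℕSolver.solve-∀
          eq₂ : ∀ e → 33 ℕ.* e ℕ.+ 9 ℕ.* e ≡ 26 ℕ.* e ℕ.+ 16 ℕ.* e
          eq₂ = ℕSolver.solve-∀
      bound : ½ ^ (26 ℕ.* e ℕ.* t) * ((q + l * p) ^ (t ℕ.* (τ ℕ.+ τ)) * q ^ (t ℕ.* (n ℕ.∸ (τ ℕ.+ τ)))) ≤ W ^ t
      bound = ≤-trans (≤-reflexive (trans (^-regroup ½ (q + l * p) (q ^ (t ℕ.* (n ℕ.∸ (τ ℕ.+ τ)))) (26 ℕ.* e) (τ ℕ.+ τ) t)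
          (trans (cong ((½ ^ (26 ℕ.* e) * (q + l * p) ^ (τ ℕ.+ τ)) ^ t *_) (trans (cong (q ^_) (ℕP.*-comm t (n ℕ.∸ (τ ℕ.+ τ)))) (sym (^-assocʳ q (n ℕ.∸ (τ ℕ.+ τ)) t))))
            (sym (^-distrib-* (½ ^ (26 ℕ.* e) * (q + l * p) ^ (τ ℕ.+ τ)) g t)))))
        (^-mono t (*-nonneg (*-nonneg (0≤½^′ (26 ℕ.* e)) (^-nonneg (τ ℕ.+ τ) (+-nonneg 0≤q 0≤lp))) 0≤g) base)

    -- Here the edges alone pay. On average a moved vertex has at least `d / 4` tilted edges, worth
    -- `2 ^ (- c d)`, while its at most `2 h` pairs over edges cost `(1 + l p) ^ (2 h) ≤ 2 ^ X`.
    small-many : τ ℕ.≤ t → Small (λ s → Good s × Folding n s r) (W ^ t)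
    small-many τ≤t = small-mono (λ s x → x) bound (small-folding p 0≤p p≤1 Good (½ ^ (c ℕ.* d ℕ.* t)) l (t ℕ.* (2 ℕ.* h)) 0
        (0≤½^′ (c ℕ.* d ℕ.* t)) (1≤2^ (4 ℕ.* c)) (λ s good fo → tilt-ok s good fo ,
          ℕP.≤-trans (tilts≤ s) (sum-on-≤ T (α s good fo) (2 ℕ.* h) (λ x _ → α≤2h s good fo x)) , ℕ.z≤n))
      where
      l = 2ℚ ^ (4 ℕ.* c)
      tilt-ok : ∀ s → Good s → Folding n s r → 1ℚ ≤ ½ ^ (c ℕ.* d ℕ.* t) * l ^ tilted (Move.τ n r s) s
      tilt-ok s good fo = subst (1ℚ ≤_) (sym (trans (cong (½ ^ (c ℕ.* d ℕ.* t) *_) (^-assocʳ 2ℚ (4 ℕ.* c) m)) (trans (*-comm (½ ^ (c ℕ.* d ℕ.* t)) _) (2^*½^≥ (4 ℕ.* c ℕ.* m) (c ℕ.* d ℕ.* t) le))))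
          (1≤2^ (4 ℕ.* c ℕ.* m ℕ.∸ c ℕ.* d ℕ.* t))
        where
        m = tilted (Move.τ n r s) s
        le : c ℕ.* d ℕ.* t ℕ.≤ 4 ℕ.* c ℕ.* m
        le = ℕP.≤-trans (ℕP.≤-reflexive (eq c d t)) (ℕP.≤-trans (ℕP.*-monoʳ-≤ c (td≤4tilted s good fo τ≤t)) (ℕP.≤-reflexive (eq′ c m)))
          where
          eq : ∀ c d t → c ℕ.* d ℕ.* t ≡ c ℕ.* (t ℕ.* d)
          eq = ℕSolver.solve-∀
          eq′ : ∀ c m → c ℕ.* (4 ℕ.* m) ≡ 4 ℕ.* c ℕ.* m
          eq′ = ℕSolver.solve-∀
      0≤lp : 0ℚ ≤ l * p
      0≤lp = *-nonneg (0≤2^ (4 ℕ.* c)) 0≤p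
      2hlp : fromℕℚ (2 ℕ.* h) * (l * p) ≤ fromℕℚ X * ½
      2hlp = ≤-trans (≤-reflexive (trans (cong (λ z → fromℕℚ (2 ℕ.* h) * (z * p)) (sym (2^ℚ (4 ℕ.* c)))) (trans (eq (fromℕℚ (2 ℕ.* h)) (fromℕℚ (2 ℕ.^ (4 ℕ.* c))) p)
          (cong (λ z → z * p * ½) (trans (cong (fromℕℚ 2 *_) (sym (fromℕℚ-* (2 ℕ.* h) (2 ℕ.^ (4 ℕ.* c))))) (trans (sym (fromℕℚ-* 2 (2 ℕ.* h ℕ.* 2 ℕ.^ (4 ℕ.* c)))) (cong fromℕℚ (eq′ h (2 ℕ.^ (4 ℕ.* c))))))))))
        (*-monoˡ ½ 0≤½ (≤-trans (*-monoˡ p 0≤p (fromℕℚ-mono 4hl≤n)) np≤X))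
        where
        eq : ∀ h l p → h * (l * p) ≡ fromℕℚ 2 * (h * l) * p * ½
        eq = solve-∀ ℚ-ring
        eq′ : ∀ h l → 2 ℕ.* (2 ℕ.* h ℕ.* l) ≡ 4 ℕ.* (h ℕ.* l)
        eq′ = ℕSolver.solve-∀
      w≤ : (q + l * p) ^ (2 ℕ.* h) ≤ 2ℚ ^ X
      w≤ = ≤-trans (^-mono (2 ℕ.* h) (+-nonneg 0≤q 0≤lp) (+-monoˡ-≤ (l * p) q≤1)) (1+^≤2^ (2 ℕ.* h) X 0≤lp 2hlp)
      base : ½ ^ (c ℕ.* d) * (q + l * p) ^ (2 ℕ.* h) ≤ W
      base = ≤-trans (*-monoʳ (½ ^ (c ℕ.* d)) (0≤½^′ (c ℕ.* d)) w≤)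
        (≤-trans (≤-reflexive (trans (*-comm (½ ^ (c ℕ.* d)) (2ℚ ^ X)) (2^*½^≤ X (c ℕ.* d) (ℕP.m+n≤o⇒m≤o X cd-large))))
          (^-antiʳ 0≤½ ½≤1 (ℕP.m+n≤o⇒m≤o∸n (33 ℕ.* e ℕ.+ 34) (ℕP.≤-trans (ℕP.≤-reflexive (ℕP.+-comm (33 ℕ.* e ℕ.+ 34) X)) cd-large))))
      bound : ½ ^ (c ℕ.* d ℕ.* t) * ((q + l * p) ^ (t ℕ.* (2 ℕ.* h)) * q ^ 0) ≤ W ^ t
      bound = ≤-trans (≤-reflexive (trans (^-regroup ½ (q + l * p) 1ℚ (c ℕ.* d) (2 ℕ.* h) t) (*-identityʳ _)))
        (^-mono t (*-nonneg (0≤½^′ (c ℕ.* d)) (^-nonneg (2 ℕ.* h) (+-nonneg 0≤q 0≤lp))) base)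

  open Dense n p 0≤p p≤½ e n≤ using (2n²W≤1)

  small-folds : Small (λ s → Good s × ∃ λ v → Folding n s (lookup v) × 1 ℕ.≤ # (moved n v)) (η * 2ℚ)
  small-folds = small-foldings {P = Good} η (½ ^ (32 ℕ.* e ℕ.+ 34)) (0≤½^′ e) (½^≤1 e) (0≤½^′ (32 ℕ.* e ℕ.+ 34)) 2n²W≤1
    (λ v _ → subst (λ z → Small (λ s → Good s × Folding n s (lookup v)) (z ^ # (moved n v))) ηW (each v (# (moved n v) ℕP.≤? τ)))
    where
    ηW : ½ ^ (33 ℕ.* e ℕ.+ 34) ≡ η * ½ ^ (32 ℕ.* e ℕ.+ 34)
    ηW = trans (cong (½ ^_) (eq e)) (^-homo-* ½ e (32 ℕ.* e ℕ.+ 34))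
      where
      eq : ∀ e → 33 ℕ.* e ℕ.+ 34 ≡ e ℕ.+ (32 ℕ.* e ℕ.+ 34)
      eq = ℕSolver.solve-∀
    each : ∀ v → Dec (# (moved n v) ℕ.≤ τ) → Small (λ s → Good s × Folding n s (lookup v)) ((½ ^ (33 ℕ.* e ℕ.+ 34)) ^ # (moved n v))
    each v (yes t≤τ) = small-few (lookup v) t≤τ
    each v (no t≰τ)  = small-many (lookup v) (ℕP.<⇒≤ (ℕP.≰⇒> t≰τ))

  independent? : ∀ s (A : Fin n → Bool) → Dec (Independent (adj s) A)
  independent? s A = FinP.all? λ i → FinP.all? λ j →
    (A i BoolP.≟ true) →-dec ((A j BoolP.≟ true) →-dec (adj s i j BoolP.≟ false))

  low? : ∀ s u v → Dec (Low s u v)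
  low? s u v = ¬? (u FinP.≟ v) ×-dec ((deg (adj s) u ℕP.≤? 4) ×-dec (deg (adj s) v ℕP.≤? 4))

  ε₁ : ℚ
  ε₁ = N * (y * κ ^ (n ℕ.∸ 1))

  sparse-core : Small (λ s → ¬ IsCore (graph n s)) (ε₁ + fromℕℚ 11 * η)
  sparse-core = small-mono split (≤-reflexive (eq ε₁ η))
      (small-⊎ small-leaf (small-⊎ small-hub (small-⊎ (small-low d 192d≤y) (small-⊎ small-links (small-⊎ small-adjacent
        (small-⊎ small-cherry (small-⊎ (small-independent h 4N≤h²p) small-folds)))))))
    where
    eq : ∀ ε η → ε + (η + (fromℕℚ 4 * η + (η + (η + (η + (η + η * 2ℚ)))))) ≡ ε + fromℕℚ 11 * η
    eq = solve-∀ ℚ-ring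
    split : ∀ s → ¬ IsCore (graph n s) → _
    split s ¬core =
      FinP.any? (λ x → deg (adj s) x ℕP.≤? 1) or-else λ min →
      FinP.any? (λ x → τ ℕP.≤? deg (adj s) x) or-else λ max →
      (2 ℕ.^ (2 ℕ.* e) ℕP.≤? # (λ x → does (deg (adj s) x ℕP.<? d))) or-else λ few →
      FinP.any? (λ x → (deg (adj s) x ℕP.≤? τ) ×-dec (2 ℕP.≤? cnt (link s x))) or-else λ links →
      FinP.any? (λ u → FinP.any? (λ v → low? s u v ×-dec (adj s u v BoolP.≟ true))) or-else λ adjacent →
      FinP.any? (λ u → FinP.any? (λ v → FinP.any? (λ w →
        low? s u v ×-dec ((adj s u w BoolP.≟ true) ×-dec (adj s v w BoolP.≟ true))))) or-else λ cherry →
      any-subset? (λ A → independent? s (lookup A) ×-dec (h ℕP.<? # (lookup A))) or-else λ ind →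
      (record
        { min2        = λ x → ℕP.≰⇒> (λ h → min (x , h))
        ; max         = λ x → ℕP.≰⇒≥ (λ h → max (x , h))
        ; few         = ℕP.≰⇒≥ few
        ; links       = λ x → ℕP.≤-pred (ℕP.≰⇒> (λ h → links (x , ℕP.≰⇒≥ (λ h → max (x , h)) , h)))
        ; adjacent    = λ u v l h → adjacent (u , v , l , h)
        ; cherry      = λ u v w l h h′ → cherry (u , v , w , l , h , h′)
        ; independent = λ A i → ℕP.≮⇒≥ (λ big → ind (A , i , big))
        } , ¬core⇒folding n s ¬core)

ΠL-zero : ∀ {B : Set} {xs : List B} {f x} → x ∈ xs → f x ≡ 0ℚ → ΠL xs f ≡ 0ℚ
ΠL-zero {xs = y ∷ xs} {f} (here refl) e = trans (cong (_* ΠL xs f) e) (*-zeroˡ (ΠL xs f))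
ΠL-zero {xs = y ∷ xs} {f} (there m)   e = trans (cong (f y *_) (ΠL-zero m e)) (*-zeroʳ (f y))

ΠL-mono : ∀ {B : Set} (xs : List B) {f g} → (∀ x → 0ℚ ≤ f x) → (∀ {x} → x ∈ xs → f x ≤ g x) → ΠL xs f ≤ ΠL xs g
ΠL-mono []       h k = ≤-refl
ΠL-mono (x ∷ xs) h k = *-mono₂ (h x) (ΠL-nonneg xs h) (k (here refl)) (ΠL-mono xs h (k ∘ there))

ΠL-if : ∀ {B : Set} (xs : List B) (P : B → Bool) u → ΠL xs (λ x → if P x then u else 1ℚ) ≡ u ^ count xs P
ΠL-if []       P u = refl
ΠL-if (x ∷ xs) P u with P x
... | true  = cong (u *_) (ΠL-if xs P u)
... | false = trans (*-identityˡ _) (ΠL-if xs P u)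

ΣL-indicator : ∀ {B : Set} {k} (g : Fin k → B) (P : B → Bool) → ΣL (List.tabulate g) (λ x → fromℕℚ ⟦ P x ⟧) ≡ fromℕℚ (# (P ∘ g))
ΣL-indicator {k = zero}  g P = refl
ΣL-indicator {k = suc k} g P = trans (cong (fromℕℚ ⟦ P (g zero) ⟧ +_) (ΣL-indicator (g ∘ suc) P)) (sym (fromℕℚ-+ ⟦ P (g zero) ⟧ (# (P ∘ g ∘ suc))))

ΣL-*ʳ : ∀ {B : Set} (xs : List B) f c → ΣL xs (λ x → f x * c) ≡ ΣL xs f * c
ΣL-*ʳ xs f c = trans (ΣL-cong xs (λ x → *-comm (f x) c)) (trans (ΣL-* xs c f) (*-comm c (ΣL xs f)))

-- Isolated vertices and leaves

module Pendant (n : ℕ) (p : ℚ) (0≤p : 0ℚ ≤ p) (p≤½ : p ≤ ½) (3≤n : 3 ℕ.≤ n) where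
  p≤1 : p ≤ 1ℚ
  p≤1 = ≤-trans p≤½ ½≤1
  open Sample n
  open Prob p 0≤p p≤1
  open Star hiding (star≢forb)

  0<q : 0ℚ < q
  0<q = <-≤-trans (positive⁻¹ ½) (by-diff {½} (½ - p) (0≤-diff p≤½) (eq p))
    where
    eq : ∀ p → ½ + (½ - p) ≡ 1ℚ - p
    eq = solve-∀ ℚ-ring

  u : ℚ
  u = recip q

  qu : q * u ≡ 1ℚ
  qu = *-recip 0<q

  0≤u : 0ℚ ≤ u
  0≤u = <⇒≤ (recip-pos 0<q)

  -- The certificate that v has no neighbour other than c, and is isolated if c = v.
  leaf : Fin n × Fin n → Tags
  leaf (v , c) i j = if star v i j ∧ not (i == j) then (if not (c == v) ∧ star c i j then req else forb) else free

  Z : Fin n × Fin n → Coins → ℚ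
  Z a = Φ 1ℚ (leaf a)

  leaf-sym : ∀ a i j → leaf a i j ≡ leaf a j i
  leaf-sym (v , c) i j = cong₂ (λ b b′ → if b then (if not (c == v) ∧ b′ then req else forb) else free)
    (cong₂ _∧_ (star-sym v i j) (cong not (==-comm i j))) (star-sym c i j)

  φ-leaf : ∀ a s i j → φ 1ℚ (leaf a i j) (adj s i j) ≡ φ 1ℚ (leaf a j i) (adj s j i)
  φ-leaf a s i j = cong₂ (φ 1ℚ) (leaf-sym a i j) (adj-sym s i j)

  leaf-at : ∀ v c {y} → v ≢ y → leaf (v , c) v y ≡ (if not (c == v) ∧ (y == c) then req else forb)
  leaf-at v c {y} v≢y rewrite ==-refl v | ≢⇒== v≢y = cong (λ b → if b then req else forb) (e (c FinP.≟ v))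
    where
    e : (d : Dec (c ≡ v)) → not (c == v) ∧ ((v == c) ∨ (y == c)) ≡ not (c == v) ∧ (y == c)
    e (yes refl) rewrite ==-refl c = refl
    e (no c≢v) rewrite ≢⇒== c≢v | ≢⇒== (c≢v ∘ sym) = refl

  Z-zero : ∀ a s {i j} → i ≢ j → φ 1ℚ (leaf a i j) (adj s i j) ≡ 0ℚ → Z a s ≡ 0ℚ
  Z-zero a s {i} {j} i≢j e = ΠL-zero (edge-∈ i≢j) (trans (on-edge (λ i j → φ 1ℚ (leaf a i j) (adj s i j)) (φ-leaf a s) i j) e)

  Z-core : ∀ a s → IsCore (graph n s) → Z a s ≡ 0ℚ
  Z-core (v , c) s core with FinP.any? (λ y → (adj s v y BoolP.≟ true) ×-dec ¬? (y FinP.≟ c))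
  ... | no none = ⊥-elim (pendant⇒¬core (graph n s) 3≤n v c only core)
    where
    only : ∀ y → Graph.Adj (graph n s) v y → y ≡ c
    only y vy with y FinP.≟ c
    ... | yes y≡c = y≡c
    ... | no y≢c  = ⊥-elim (none (y , Adj⇒adj n s vy , y≢c))
  ... | yes (y , vy , y≢c) = Z-zero (v , c) s (adj⇒≢ s vy) (cong₂ (φ 1ℚ) (trans (leaf-at v c (adj⇒≢ s vy))
        (cong (λ b → if b then req else forb) (trans (cong (not (c == v) ∧_) (≢⇒== y≢c)) (BoolP.∧-zeroʳ (not (c == v)))))) vy)

  0≤Z : ∀ a s → 0ℚ ≤ Z a s
  0≤Z a s = Φ-nonneg 0≤1 (leaf a) s

  Z≤1 : ∀ a s → Z a s ≤ 1ℚ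
  Z≤1 a s = ≤-trans (ΠL-mono (pairs n) (λ (i , j) → φ-nonneg 0≤1 (leaf a i j) (adj s i j)) (λ {(i , j)} _ → φ≤1 (leaf a i j) (adj s i j)))
    (≤-reflexive (one (pairs n)))
    where
    φ≤1 : ∀ t b → φ 1ℚ t b ≤ 1ℚ
    φ≤1 free b     = ≤-refl
    φ≤1 tilt true  = ≤-refl
    φ≤1 tilt false = ≤-refl
    φ≤1 forb true  = 0≤1
    φ≤1 forb false = ≤-refl
    φ≤1 req  true  = ≤-refl
    φ≤1 req  false = 0≤1
    one : ∀ {B : Set} (xs : List B) → ΠL xs (λ _ → 1ℚ) ≡ 1ℚ
    one []       = refl
    one (x ∷ xs) = trans (*-identityˡ _) (one xs)

  ez : Fin n × Fin n → ℚ
  ez (v , c) = if c == v then q ^ (n ℕ.∸ 1) else p * q ^ (n ℕ.∸ 2)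

  E-Z : ∀ a → E (Z a) ≡ ez a
  E-Z (v , c) = trans (E-Φ 1ℚ (leaf (v , c))) (trans (cong (_* (q ^ forbs (leaf (v , c)) * p ^ reqs (leaf (v , c)))) (trans (cong (_^ tilts (leaf (v , c))) q+1p) (1^ (tilts (leaf (v , c))))))
      (trans (*-identityˡ _) (value (c FinP.≟ v))))
    where
    q+1p : q + 1ℚ * p ≡ 1ℚ
    q+1p = e p
      where
      e : ∀ p → (1ℚ - p) + 1ℚ * p ≡ 1ℚ
      e = solve-∀ ℚ-ring
    second : Fin n → Fin n → Bool
    second i j = not (c == v) ∧ (star c i j ∧ not (i == j))
    isReq-leaf : ∀ i j → isReq (leaf (v , c) i j) ≡ star v i j ∧ second i j
    isReq-leaf i j with star v i j | i == j | not (c == v) | star c i j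
    ... | false | _     | _     | _     = refl
    ... | true  | true  | false | _     = refl
    ... | true  | true  | true  | true  = refl
    ... | true  | true  | true  | false = refl
    ... | true  | false | false | _     = refl
    ... | true  | false | true  | true  = refl
    ... | true  | false | true  | false = refl
    reqs≡ : reqs (leaf (v , c)) ≡ # (second v)
    reqs≡ = trans (count-cong (pairs n) (λ {(i , j)} _ → isReq-leaf i j))
      (cnt-star v second (λ i j → cong (not (c == v) ∧_) (cong₂ _∧_ (star-sym c i j) (cong not (==-comm i j))))
        (λ i → trans (cong (λ b → not (c == v) ∧ (star c i i ∧ not b)) (==-refl i)) (trans (cong (not (c == v) ∧_) (BoolP.∧-zeroʳ (star c i i))) (BoolP.∧-zeroʳ (not (c == v))))))
    sum≡ : forbs (leaf (v , c)) ℕ.+ reqs (leaf (v , c)) ≡ n ℕ.∸ 1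
    sum≡ = trans (add (pairs n)) (trans (count-cong (pairs n) (λ {(i , j)} _ → refl))
      (trans (cnt-star v (λ i j → not (i == j)) (λ i j → cong not (==-comm i j)) (λ i → cong not (==-refl i)))
        (trans (#-cong {n} (λ j → cong not (==-comm v j))) (#-≢ v))))
      where
      bit : ∀ i j → ⟦ isForb (leaf (v , c) i j) ⟧ ℕ.+ ⟦ isReq (leaf (v , c) i j) ⟧ ≡ ⟦ star v i j ∧ not (i == j) ⟧
      bit i j with star v i j ∧ not (i == j) | not (c == v) ∧ star c i j
      ... | true  | true  = refl
      ... | true  | false = refl
      ... | false | _     = refl
      add : ∀ xs → count xs (λ (i , j) → isForb (leaf (v , c) i j)) ℕ.+ count xs (λ (i , j) → isReq (leaf (v , c) i j)) ≡ count xs (λ (i , j) → star v i j ∧ not (i == j))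
      add []             = refl
      add ((i , j) ∷ xs) = trans (shuffle ⟦ isForb (leaf (v , c) i j) ⟧ _ ⟦ isReq (leaf (v , c) i j) ⟧ _) (cong₂ ℕ._+_ (bit i j) (add xs))
        where
        shuffle : ∀ a b c d → (a ℕ.+ b) ℕ.+ (c ℕ.+ d) ≡ (a ℕ.+ c) ℕ.+ (b ℕ.+ d)
        shuffle a b c d = trans (ℕP.+-assoc a b (c ℕ.+ d)) (trans (cong (a ℕ.+_) (trans (sym (ℕP.+-assoc b c d)) (trans (cong (ℕ._+ d) (ℕP.+-comm b c)) (ℕP.+-assoc c b d)))) (sym (ℕP.+-assoc a c (b ℕ.+ d))))
    value : Dec (c ≡ v) → q ^ forbs (leaf (v , c)) * p ^ reqs (leaf (v , c)) ≡ ez (v , c)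
    value (yes c≡v) = trans (cong₂ (λ k l → q ^ k * p ^ l) forbs≡ reqs0) (trans (*-identityʳ _) (cong (λ b → if b then q ^ (n ℕ.∸ 1) else p * q ^ (n ℕ.∸ 2)) (sym c==v)))
      where
      c==v : (c == v) ≡ true
      c==v = trans (cong (_== v) c≡v) (==-refl v)
      reqs0 : reqs (leaf (v , c)) ≡ 0
      reqs0 = trans reqs≡ (#-none {n} (λ j → cong (λ b → not b ∧ (star c v j ∧ not (v == j))) c==v))
      forbs≡ : forbs (leaf (v , c)) ≡ n ℕ.∸ 1
      forbs≡ = trans (sym (ℕP.+-identityʳ _)) (trans (cong (forbs (leaf (v , c)) ℕ.+_) (sym reqs0)) sum≡)
    value (no c≢v) = trans (cong₂ (λ k l → q ^ k * p ^ l) forbs≡ reqs1) (trans (*-comm (q ^ (n ℕ.∸ 2)) (p ^ 1)) (trans (cong (_* q ^ (n ℕ.∸ 2)) (*-identityʳ p))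
        (cong (λ b → if b then q ^ (n ℕ.∸ 1) else p * q ^ (n ℕ.∸ 2)) (sym (≢⇒== c≢v)))))
      where
      reqs1 : reqs (leaf (v , c)) ≡ 1
      reqs1 = trans reqs≡ (trans (#-cong {n} same) (#-≟ c))
        where
        same : ∀ j → second v j ≡ (j == c)
        same j rewrite ≢⇒== c≢v | ≢⇒== (c≢v ∘ sym) with j FinP.≟ c
        ... | yes refl = cong not (≢⇒== (c≢v ∘ sym))
        ... | no _     = refl
      forbs≡ : forbs (leaf (v , c)) ≡ n ℕ.∸ 2
      forbs≡ = ℕP.suc-injective (trans (ℕP.+-comm 1 _) (trans (cong (forbs (leaf (v , c)) ℕ.+_) (sym reqs1)) (trans sum≡ (ℕP.+-∸-assoc 1 {n} {2} (ℕP.≤-trans (ℕP.m≤m+n 2 1) 3≤n)))))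

  factor : Tag → ℚ
  factor t = p * φ 1ℚ t true + q * φ 1ℚ t false

  factor₂ : Tag → Tag → ℚ
  factor₂ t t′ = p * (φ 1ℚ t true * φ 1ℚ t′ true) + q * (φ 1ℚ t false * φ 1ℚ t′ false)

  on-pairs : (Tag → ℚ) → Tags → ℚ
  on-pairs f τ = ΠL (pairs n) (λ (i , j) → f (τ i j))

  E-Z′ : ∀ a → E (Z a) ≡ on-pairs factor (leaf a)
  E-Z′ a = trans (Ex-cong (length (pairs n)) (λ s → ΠL-cong (pairs n) (λ {(i , j)} m → cong (φ 1ℚ (leaf a i j)) (adj-pairs s m))))
    (Ex-ΠL _≟ᴾ_ p (pairs-unique n) (λ (i , j) → φ 1ℚ (leaf a i j)))

  E-ZZ : ∀ a b → E (λ s → Z a s * Z b s) ≡ ΠL (pairs n) (λ (i , j) → factor₂ (leaf a i j) (leaf b i j))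
  E-ZZ a b = trans (Ex-cong (length (pairs n)) (λ s → trans (sym (ΠL-* (pairs n) (λ (i , j) → φ 1ℚ (leaf a i j) (adj s i j)) (λ (i , j) → φ 1ℚ (leaf b i j) (adj s i j))))
      (ΠL-cong (pairs n) (λ {(i , j)} m → cong (λ t → φ 1ℚ (leaf a i j) t * φ 1ℚ (leaf b i j) t) (adj-pairs s m)))))
    (Ex-ΠL _≟ᴾ_ p (pairs-unique n) (λ (i , j) t → φ 1ℚ (leaf a i j) t * φ 1ℚ (leaf b i j) t))

  factor-free : factor free ≡ 1ℚ
  factor-free = e p
    where
    e : ∀ p → p * 1ℚ + (1ℚ - p) * 1ℚ ≡ 1ℚ
    e = solve-∀ ℚ-ring

  factor₂-freeˡ : ∀ t → factor₂ free t ≡ factor free * factor t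
  factor₂-freeˡ t = trans (cong₂ (λ a b → p * a + q * b) (*-identityˡ _) (*-identityˡ _)) (sym (trans (cong (_* factor t) factor-free) (*-identityˡ (factor t))))

  factor₂-freeʳ : ∀ t → factor₂ t free ≡ factor t * factor free
  factor₂-freeʳ t = trans (cong₂ (λ a b → p * a + q * b) (*-identityʳ _) (*-identityʳ _)) (sym (trans (cong (factor t *_) factor-free) (*-identityʳ (factor t))))

  module _ (v v′ : Fin n) (v≢v′ : v ≢ v′) where

    both : Fin n → Fin n → Bool
    both i j = star v i j ∧ (star v′ i j ∧ not (i == j))

    cnt-both : cnt both ≡ 1
    cnt-both = trans (cnt-star v (λ i j → star v′ i j ∧ not (i == j)) (λ i j → cong₂ _∧_ (star-sym v′ i j) (cong not (==-comm i j)))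
        (λ i → trans (cong (λ b → star v′ i i ∧ not b) (==-refl i)) (BoolP.∧-zeroʳ (star v′ i i))))
      (trans (#-cong {n} same) (#-≟ v′))
      where
      same : ∀ j → star v′ v j ∧ not (v == j) ≡ (j == v′)
      same j rewrite ≢⇒== v≢v′ with j FinP.≟ v′
      ... | yes refl = cong not (≢⇒== v≢v′)
      ... | no _     = refl

    not-both : ∀ c c′ i j → both i j ≡ false → leaf (v , c) i j ≡ free ⊎ leaf (v′ , c′) i j ≡ free
    not-both c c′ i j e with star v i j | star v′ i j | i == j
    ... | false | _     | _     = inj₁ refl
    ... | true  | false | _     = inj₂ refl
    ... | true  | true  | true  = inj₁ refl
    not-both c c′ i j () | true | true | false

    data At : Fin n → Fin n → Set where
      vv′ : At v v′
      v′v : At v′ v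

    at-both : ∀ i j → both i j ≡ true → At i j
    at-both i j e with ∧-true {star v i j} e
    ... | sv , e′ with ∧-true {star v′ i j} e′
    ...   | sv′ , ne with ∨-true {i == v} sv | ∨-true {i == v′} sv′
    ...     | inj₁ a | inj₁ b = ⊥-elim (v≢v′ (trans (sym (==⇒≡ {i = i} a)) (==⇒≡ {i = i} b)))
    ...     | inj₁ a | inj₂ b rewrite ==⇒≡ {i = i} {v} a | ==⇒≡ {i = j} {v′} b = vv′
    ...     | inj₂ a | inj₁ b rewrite ==⇒≡ {i = j} {v} a | ==⇒≡ {i = i} {v′} b = v′v
    ...     | inj₂ a | inj₂ b = ⊥-elim (v≢v′ (trans (sym (==⇒≡ {i = j} a)) (==⇒≡ {i = j} b)))

    leaf-vv′ : ∀ c → leaf (v , c) v v′ ≡ (if v′ == c then req else forb)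
    leaf-vv′ c = trans (leaf-at v c v≢v′) (cong (λ b → if b then req else forb) (e (v′ FinP.≟ c)))
      where
      e : Dec (v′ ≡ c) → not (c == v) ∧ (v′ == c) ≡ (v′ == c)
      e (yes refl) rewrite ≢⇒== (v≢v′ ∘ sym) = refl
      e (no v′≢c) rewrite ≢⇒== v′≢c = BoolP.∧-zeroʳ (not (c == v))

    leaf-v′v : ∀ c → leaf (v′ , c) v v′ ≡ (if v == c then req else forb)
    leaf-v′v c = trans (leaf-sym (v′ , c) v v′) (trans (leaf-at v′ c (v≢v′ ∘ sym)) (cong (λ b → if b then req else forb) (e (v FinP.≟ c))))
      where
      e : Dec (v ≡ c) → not (c == v′) ∧ (v == c) ≡ (v == c)
      e (yes refl) rewrite ≢⇒== v≢v′ = refl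
      e (no v≢c) rewrite ≢⇒== v≢c = BoolP.∧-zeroʳ (not (c == v′))

    at-value : ∀ {C : Set} (F : Tag → Tag → C) c c′ i j → At i j →
      F (leaf (v , c) i j) (leaf (v′ , c′) i j) ≡ F (if v′ == c then req else forb) (if v == c′ then req else forb)
    at-value F c c′ _ _ vv′ = cong₂ F (leaf-vv′ c) (leaf-v′v c′)
    at-value F c c′ _ _ v′v = cong₂ F (trans (leaf-sym (v , c) v′ v) (leaf-vv′ c)) (trans (leaf-sym (v′ , c′) v′ v) (leaf-v′v c′))

    0≤factor₂ : ∀ t t′ → 0ℚ ≤ factor₂ t t′
    0≤factor₂ t t′ = +-nonneg (*-nonneg 0≤p (*-nonneg (φ-nonneg 0≤1 t true) (φ-nonneg 0≤1 t′ true))) (*-nonneg 0≤q (*-nonneg (φ-nonneg 0≤1 t false) (φ-nonneg 0≤1 t′ false)))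

    -- Only the pair {v , v′} makes the two certificates dependent.
    E-ZZ-κ : ∀ c c′ d d′ k k′ → 0ℚ ≤ k →
      (∀ i j → both i j ≡ false → leaf (v , c) i j ≡ leaf (v , d) i j × leaf (v′ , c′) i j ≡ leaf (v′ , d′) i j) →
      factor₂ (if v′ == c then req else forb) (if v == c′ then req else forb) * k ≤
        k′ * (factor (if v′ == d then req else forb) * factor (if v == d′ then req else forb)) →
      E (λ s → Z (v , c) s * Z (v′ , c′) s) * k ≤ k′ * (ez (v , d) * ez (v′ , d′))
    E-ZZ-κ c c′ d d′ k k′ 0≤k same h = subst₂ _≤_ lhs rhs (ΠL-mono (pairs n) (λ (i , j) → *-nonneg (0≤factor₂ (leaf (v , c) i j) (leaf (v′ , c′) i j)) (0≤if (both i j) 0≤k)) (λ {(i , j)} _ → pointwise i j (both i j) refl))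
      where
      0≤if : ∀ b {x} → 0ℚ ≤ x → 0ℚ ≤ (if b then x else 1ℚ)
      0≤if true  h = h
      0≤if false h = 0≤1
      f g : Fin n × Fin n → ℚ
      f (i , j) = factor₂ (leaf (v , c) i j) (leaf (v′ , c′) i j)
      g (i , j) = factor (leaf (v , d) i j) * factor (leaf (v′ , d′) i j)
      once : ∀ x → ΠL (pairs n) (λ (i , j) → if both i j then x else 1ℚ) ≡ x
      once x = trans (ΠL-if (pairs n) (λ (i , j) → both i j) x) (trans (cong (x ^_) cnt-both) (*-identityʳ x))
      -- Away from the one pair common to both stars, one of the two tags is `free` and the joint
      -- factor splits.
      pointwise : ∀ i j b → both i j ≡ b → f (i , j) * (if both i j then k else 1ℚ) ≤ (if both i j then k′ else 1ℚ) * g (i , j)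
      pointwise i j true e rewrite e = subst₂ (λ x y → x * k ≤ k′ * y) (sym (at-value factor₂ c c′ i j (at-both i j e)))
        (sym (at-value (λ t t′ → factor t * factor t′) d d′ i j (at-both i j e))) h
      pointwise i j false e rewrite e with same i j e | not-both c c′ i j e
      ... | e₁ , e₂ | inj₁ fr = ≤-reflexive (trans (*-identityʳ (f (i , j))) (trans (cong (λ t → factor₂ t (leaf (v′ , c′) i j)) fr)
            (trans (factor₂-freeˡ (leaf (v′ , c′) i j)) (trans (cong₂ (λ t t′ → factor t * factor t′) (trans (sym fr) e₁) e₂) (sym (*-identityˡ (g (i , j))))))))
      ... | e₁ , e₂ | inj₂ fr = ≤-reflexive (trans (*-identityʳ (f (i , j))) (trans (cong (factor₂ (leaf (v , c) i j)) fr)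
            (trans (factor₂-freeʳ (leaf (v , c) i j)) (trans (cong₂ (λ t t′ → factor t * factor t′) e₁ (trans (sym fr) e₂)) (sym (*-identityˡ (g (i , j))))))))
      lhs : ΠL (pairs n) (λ (i , j) → f (i , j) * (if both i j then k else 1ℚ)) ≡ E (λ s → Z (v , c) s * Z (v′ , c′) s) * k
      lhs = trans (ΠL-* (pairs n) f (λ (i , j) → if both i j then k else 1ℚ)) (cong₂ _*_ (sym (E-ZZ (v , c) (v′ , c′))) (once k))
      rhs : ΠL (pairs n) (λ (i , j) → (if both i j then k′ else 1ℚ) * g (i , j)) ≡ k′ * (ez (v , d) * ez (v′ , d′))
      rhs = trans (ΠL-* (pairs n) (λ (i , j) → if both i j then k′ else 1ℚ) g) (cong₂ _*_ (once k′)
        (trans (ΠL-* (pairs n) (λ (i , j) → factor (leaf (v , d) i j)) (λ (i , j) → factor (leaf (v′ , d′) i j)))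
          (cong₂ _*_ (trans (sym (E-Z′ (v , d))) (E-Z (v , d))) (trans (sym (E-Z′ (v′ , d′))) (E-Z (v′ , d′))))))

    -- Only the pair of `v` and `v′` matters. If both certificates forbid it, the joint factor is
    -- `q` instead of `q * q`; if exactly one forbids it, they contradict each other. The excluded
    -- case, in which both require it, is a component consisting of a single edge.
    E-ZZ≤ : ∀ c c′ → ¬ (v′ ≡ c × v ≡ c′) → E (λ s → Z (v , c) s * Z (v′ , c′) s) * q ≤ 1ℚ * (ez (v , c) * ez (v′ , c′))
    E-ZZ≤ c c′ ne = E-ZZ-κ c c′ c c′ q 1ℚ 0≤q (λ i j _ → refl , refl) (by (v′ FinP.≟ c) (v FinP.≟ c′))
      where
      e₁ : ∀ p → (p * (0ℚ * 0ℚ) + (1ℚ - p) * (1ℚ * 1ℚ)) * (1ℚ - p) ≡ 1ℚ * ((p * 0ℚ + (1ℚ - p) * 1ℚ) * (p * 0ℚ + (1ℚ - p) * 1ℚ))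
      e₁ = solve-∀ ℚ-ring
      e₂ : ∀ p → (p * (1ℚ * 0ℚ) + (1ℚ - p) * (0ℚ * 1ℚ)) * (1ℚ - p) ≡ 0ℚ
      e₂ = solve-∀ ℚ-ring
      e₃ : ∀ p → (p * (0ℚ * 1ℚ) + (1ℚ - p) * (1ℚ * 0ℚ)) * (1ℚ - p) ≡ 0ℚ
      e₃ = solve-∀ ℚ-ring
      0≤factor : ∀ t → 0ℚ ≤ factor t
      0≤factor t = +-nonneg (*-nonneg 0≤p (φ-nonneg 0≤1 t true)) (*-nonneg 0≤q (φ-nonneg 0≤1 t false))
      by : (x : Dec (v′ ≡ c)) (y : Dec (v ≡ c′)) → factor₂ (if does x then req else forb) (if does y then req else forb) * q ≤
        1ℚ * (factor (if does x then req else forb) * factor (if does y then req else forb))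
      by (yes a) (yes b) = ⊥-elim (ne (a , b))
      by (yes _) (no _)  = ≤-trans (≤-reflexive (e₂ p)) (*-nonneg 0≤1 (*-nonneg (0≤factor req) (0≤factor forb)))
      by (no _)  (yes _) = ≤-trans (≤-reflexive (e₃ p)) (*-nonneg 0≤1 (*-nonneg (0≤factor forb) (0≤factor req)))
      by (no _)  (no _)  = ≤-reflexive (e₁ p)

    -- A component consisting of one edge is compared with two isolated vertices. All other pairs
    -- are treated alike, and the common pair contributes `p` against `q * q`.
    E-ZZ-edge : E (λ s → Z (v , v′) s * Z (v′ , v) s) * (q * q) ≤ p * (ez (v , v) * ez (v′ , v′))
    E-ZZ-edge = E-ZZ-κ v′ v v v′ (q * q) p (*-nonneg 0≤q 0≤q) same at
      where
      e : ∀ p → (p * (1ℚ * 1ℚ) + (1ℚ - p) * (0ℚ * 0ℚ)) * ((1ℚ - p) * (1ℚ - p)) ≡ p * ((p * 0ℚ + (1ℚ - p) * 1ℚ) * (p * 0ℚ + (1ℚ - p) * 1ℚ))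
      e = solve-∀ ℚ-ring
      at : factor₂ (if v′ == v′ then req else forb) (if v == v then req else forb) * (q * q) ≤
        p * (factor (if v′ == v then req else forb) * factor (if v == v′ then req else forb))
      at rewrite ==-refl v | ==-refl v′ | ≢⇒== v≢v′ | ≢⇒== (v≢v′ ∘ sym) = ≤-reflexive (e p)
      one : ∀ x y → x ≢ y → ∀ i j → star x i j ∧ (star y i j ∧ not (i == j)) ≡ false → leaf (x , y) i j ≡ leaf (x , x) i j
      one x y x≢y i j h rewrite ==-refl x | ≢⇒== (x≢y ∘ sym) with star x i j | star y i j | i == j
      ... | false | _     | _     = refl
      ... | true  | _     | true  = refl
      ... | true  | false | false = refl
      one x y x≢y i j () | true | true | false
      same : ∀ i j → both i j ≡ false → leaf (v , v′) i j ≡ leaf (v , v) i j × leaf (v′ , v) i j ≡ leaf (v′ , v′) i j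
      same i j h = one v v′ v≢v′ i j h , one v′ v (v≢v′ ∘ sym) i j
        (trans (swap (star v′ i j) (star v i j) (not (i == j))) h)
        where
        swap : ∀ a b c → a ∧ (b ∧ c) ≡ b ∧ (a ∧ c)
        swap true  b c = refl
        swap false b c = sym (BoolP.∧-zeroʳ b)

  Z-exclusive : ∀ v c c′ s → c ≢ c′ → Z (v , c) s * Z (v , c′) s ≡ 0ℚ
  Z-exclusive v c c′ s c≢c′ = by (c FinP.≟ v)
    where
    other : ∀ {v c c′} → v ≢ c → c ≢ c′ → Z (v , c) s ≡ 0ℚ ⊎ Z (v , c′) s ≡ 0ℚ
    other {v} {c} {c′} v≢c c≢c′ = go (adj s v c) refl
      where
      go : ∀ b → adj s v c ≡ b → Z (v , c) s ≡ 0ℚ ⊎ Z (v , c′) s ≡ 0ℚ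
      go false e = inj₁ (Z-zero (v , c) s v≢c (cong₂ (φ 1ℚ) (trans (leaf-at v c v≢c)
        (cong₂ (λ a b → if not a ∧ b then req else forb) (≢⇒== (v≢c ∘ sym)) (==-refl c))) e))
      go true e = inj₂ (Z-zero (v , c′) s v≢c (cong₂ (φ 1ℚ) (trans (leaf-at v c′ v≢c)
        (cong (λ b → if b then req else forb) (trans (cong (not (c′ == v) ∧_) (≢⇒== c≢c′)) (BoolP.∧-zeroʳ (not (c′ == v)))))) e))
    z  = Z (v , c) s
    z′ = Z (v , c′) s
    zeroˡ : z ≡ 0ℚ → z * z′ ≡ 0ℚ
    zeroˡ e = trans (cong (_* z′) e) (*-zeroˡ z′)
    zeroʳ : z′ ≡ 0ℚ → z * z′ ≡ 0ℚ
    zeroʳ e = trans (cong (z *_) e) (*-zeroʳ z)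
    by : Dec (c ≡ v) → Z (v , c) s * Z (v , c′) s ≡ 0ℚ
    by (no c≢v) = Sum.[ zeroˡ , zeroʳ ] (other (c≢v ∘ sym) c≢c′)
    by (yes refl) = Sum.[ zeroʳ , zeroˡ ] (other c≢c′ (c≢c′ ∘ sym))

  A : ℚ
  A = q ^ (n ℕ.∸ 1)

  ⟪_⟫ : Bool → ℚ
  ⟪ b ⟫ = fromℕℚ ⟦ b ⟧

  0≤⟪⟫ : ∀ b → 0ℚ ≤ ⟪ b ⟫
  0≤⟪⟫ b = 0≤fromℕℚ ⟦ b ⟧

  0≤ez : ∀ a → 0ℚ ≤ ez a
  0≤ez (v , c) with c == v
  ... | true  = ^-nonneg (n ℕ.∸ 1) 0≤q
  ... | false = *-nonneg 0≤p (^-nonneg (n ℕ.∸ 2) 0≤q)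

  ez-refl : ∀ v → ez (v , v) ≡ A
  ez-refl v = cong (λ b → if b then q ^ (n ℕ.∸ 1) else p * q ^ (n ℕ.∸ 2)) (==-refl v)

  divide : ∀ {x y} k r → k * r ≡ 1ℚ → 0ℚ ≤ r → x * k ≤ y → x ≤ y * r
  divide {x} {y} k r kr 0≤r h = ≤-trans (≤-reflexive (sym (trans (*-assoc x k r) (trans (cong (x *_) kr) (*-identityʳ x))))) (*-monoˡ r 0≤r h)

  -- The summands answer to equal certificates, generic pairs and single-edge components. Indicators
  -- in the first and last give one expression for all cases, which can be summed over all pairs of
  -- certificates.
  pair≤ : ∀ v c v′ c′ → E (λ s → Z (v , c) s * Z (v′ , c′) s) ≤
    ⟪ v′ == v ⟫ * ⟪ c′ == c ⟫ * ez (v , c) + (u * (ez (v , c) * ez (v′ , c′)) + ⟪ v′ == c ⟫ * ⟪ c′ == v ⟫ * (p * (A * A) * (u * u)))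
  pair≤ v c v′ c′ = by (v′ FinP.≟ v) (c′ FinP.≟ c) (v′ FinP.≟ c) (c′ FinP.≟ v)
    where
    N = length (pairs n)
    B₁ = ez (v , c)
    B₂ = u * (ez (v , c) * ez (v′ , c′))
    B₃ = p * (A * A) * (u * u)
    0≤B₂ : 0ℚ ≤ B₂
    0≤B₂ = *-nonneg 0≤u (*-nonneg (0≤ez (v , c)) (0≤ez (v′ , c′)))
    0≤B₃ : 0ℚ ≤ B₃
    0≤B₃ = *-nonneg (*-nonneg 0≤p (*-nonneg (^-nonneg (n ℕ.∸ 1) 0≤q) (^-nonneg (n ℕ.∸ 1) 0≤q))) (*-nonneg 0≤u 0≤u)
    0≤t : ∀ b c {x} → 0ℚ ≤ x → 0ℚ ≤ ⟪ b ⟫ * ⟪ c ⟫ * x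
    0≤t b c h = *-nonneg (*-nonneg (0≤⟪⟫ b) (0≤⟪⟫ c)) h
    total-≥ : ∀ {x y z} → 0ℚ ≤ x → 0ℚ ≤ y → 0ℚ ≤ z → 0ℚ ≤ x + (y + z)
    total-≥ a b c = +-nonneg a (+-nonneg b c)
    ≥₁ : ∀ {x y z} → 0ℚ ≤ y → 0ℚ ≤ z → x ≤ x + (y + z)
    ≥₁ {x} {y} {z} a b = by-diff (y + z) (+-nonneg a b) refl
    ≥₂ : ∀ {x y z} → 0ℚ ≤ x → 0ℚ ≤ z → y ≤ x + (y + z)
    ≥₂ {x} {y} {z} a b = by-diff (x + z) (+-nonneg a b) (e x y z)
      where
      e : ∀ x y z → y + (x + z) ≡ x + (y + z)
      e = solve-∀ ℚ-ring
    ≥₃ : ∀ {x y z} → 0ℚ ≤ x → 0ℚ ≤ y → z ≤ x + (y + z)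
    ≥₃ {x} {y} {z} a b = by-diff (x + y) (+-nonneg a b) (e x y z)
      where
      e : ∀ x y z → z + (x + y) ≡ x + (y + z)
      e = solve-∀ ℚ-ring
    generic : (d₂ : Dec (c′ ≡ c)) (d₃ : Dec (v′ ≡ c)) (d₄ : Dec (c′ ≡ v)) → v′ ≢ v → ¬ (v′ ≡ c × v ≡ c′) →
      E (λ s → Z (v , c) s * Z (v′ , c′) s) ≤ ⟪ false ⟫ * ⟪ does d₂ ⟫ * B₁ + (B₂ + ⟪ does d₃ ⟫ * ⟪ does d₄ ⟫ * B₃)
    generic d₂ d₃ d₄ v′≢v ne = ≤-trans
      (divide {E (λ s → Z (v , c) s * Z (v′ , c′) s)} {1ℚ * (ez (v , c) * ez (v′ , c′))} q u qu 0≤u (E-ZZ≤ v v′ (v′≢v ∘ sym) c c′ ne))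
      (≤-trans (≤-reflexive (trans (cong (_* u) (*-identityˡ (ez (v , c) * ez (v′ , c′)))) (*-comm (ez (v , c) * ez (v′ , c′)) u)))
        (≥₂ {⟪ false ⟫ * ⟪ does d₂ ⟫ * B₁} {B₂} (0≤t false (does d₂) (0≤ez (v , c))) (0≤t (does d₃) (does d₄) 0≤B₃)))
    by : (d₁ : Dec (v′ ≡ v)) (d₂ : Dec (c′ ≡ c)) (d₃ : Dec (v′ ≡ c)) (d₄ : Dec (c′ ≡ v)) → E (λ s → Z (v , c) s * Z (v′ , c′) s) ≤
      ⟪ does d₁ ⟫ * ⟪ does d₂ ⟫ * B₁ + (B₂ + ⟪ does d₃ ⟫ * ⟪ does d₄ ⟫ * B₃)
    by (yes refl) (yes refl) d₃ d₄ = ≤-trans (E-mono (λ s → ≤-trans (*-monoʳ (Z (v , c) s) (0≤Z (v , c) s) (Z≤1 (v , c) s)) (≤-reflexive (*-identityʳ (Z (v , c) s)))))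
      (≤-trans (≤-reflexive (trans (E-Z (v , c)) (sym (e B₁)))) (≥₁ {1ℚ * 1ℚ * B₁} 0≤B₂ (0≤t (does d₃) (does d₄) 0≤B₃)))
      where
      e : ∀ x → 1ℚ * 1ℚ * x ≡ x
      e = solve-∀ ℚ-ring
    by (yes refl) (no c′≢c) d₃ d₄ = ≤-trans (≤-reflexive (trans (Ex-cong N (λ s → Z-exclusive v c c′ s (c′≢c ∘ sym))) (Ex-const N 0ℚ)))
      (total-≥ (0≤t true false (0≤ez (v , c))) 0≤B₂ (0≤t (does d₃) (does d₄) 0≤B₃))
    by (no v′≢v) d₂ (yes refl) (yes refl) = ≤-trans (divide {E (λ s → Z (v , v′) s * Z (v′ , v) s)} {p * (ez (v , v) * ez (v′ , v′))} (q * q) (u * u) quqq (*-nonneg 0≤u 0≤u) (E-ZZ-edge v v′ (v′≢v ∘ sym)))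
      (≤-trans (≤-reflexive (trans (cong (λ z → p * z * (u * u)) (cong₂ _*_ (ez-refl v) (ez-refl v′))) (sym (e B₃)))) (≥₃ {⟪ false ⟫ * ⟪ does d₂ ⟫ * B₁} {B₂} {1ℚ * 1ℚ * B₃} (0≤t false (does d₂) (0≤ez (v , c))) 0≤B₂))
      where
      e : ∀ x → 1ℚ * 1ℚ * x ≡ x
      e = solve-∀ ℚ-ring
      quqq : q * q * (u * u) ≡ 1ℚ
      quqq = trans (e′ q u) (trans (cong₂ _*_ qu qu) refl)
        where
        e′ : ∀ q u → q * q * (u * u) ≡ q * u * (q * u)
        e′ = solve-∀ ℚ-ring
    by (no v′≢v) d₂ (no ne) d₄ = generic d₂ (no ne) d₄ v′≢v (λ h → ne (proj₁ h))
    by (no v′≢v) d₂ (yes e) (no ne) = generic d₂ (yes e) (no ne) v′≢v (λ h → ne (sym (proj₂ h)))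

  pts : List (Fin n × Fin n)
  pts = cartesianProduct (allFin n) (allFin n)

  N μ : ℚ
  N = fromℕℚ n
  μ = ΣL pts ez

  ΣL-pts : ∀ f → ΣL pts f ≡ ΣL (allFin n) (λ v → ΣL (allFin n) (λ c → f (v , c)))
  ΣL-pts f = ΣL-cartesianProductWith _,_ (allFin n) (allFin n) f

  ΣL-allFin : ∀ c → ΣL (allFin n) (λ _ → c) ≡ N * c
  ΣL-allFin c = trans (ΣL-const (allFin n) c) (cong (λ m → fromℕℚ m * c) (ListP.length-tabulate {n = n} (λ i → i)))

  ΣL-delta : ∀ x y → ΣL pts (λ (v , c) → ⟪ v == x ⟫ * ⟪ c == y ⟫) ≡ 1ℚ
  ΣL-delta x y = trans (ΣL-pts (λ (v , c) → ⟪ v == x ⟫ * ⟪ c == y ⟫))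
    (trans (ΣL-cong (allFin n) (λ v → trans (ΣL-* (allFin n) ⟪ v == x ⟫ (λ c → ⟪ c == y ⟫)) (trans (cong (⟪ v == x ⟫ *_) (point y)) (*-identityʳ ⟪ v == x ⟫)))) (point x))
    where
    point : ∀ y → ΣL (allFin n) (λ c → ⟪ c == y ⟫) ≡ 1ℚ
    point y = trans (ΣL-indicator (λ i → i) (_== y)) (cong fromℕℚ (#-≟ y))

  μ≡ : μ ≡ N * (A + fromℕℚ (n ℕ.∸ 1) * (p * q ^ (n ℕ.∸ 2)))
  μ≡ = trans (ΣL-pts ez) (trans (ΣL-cong (allFin n) row) (ΣL-allFin _))
    where
    B = p * q ^ (n ℕ.∸ 2)
    row : ∀ v → ΣL (allFin n) (λ c → ez (v , c)) ≡ A + fromℕℚ (n ℕ.∸ 1) * B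
    row v = trans (ΣL-cong (allFin n) (λ c → e (c == v))) (trans (ΣL-+ (allFin n) (λ c → ⟪ c == v ⟫ * A) (λ c → ⟪ not (c == v) ⟫ * B))
        (cong₂ _+_ (trans (ΣL-*ʳ (allFin n) (λ c → ⟪ c == v ⟫) A) (trans (cong (_* A) (trans (ΣL-indicator (λ i → i) (_== v)) (cong fromℕℚ (#-≟ v)))) (*-identityˡ A)))
          (trans (ΣL-*ʳ (allFin n) (λ c → ⟪ not (c == v) ⟫) B) (cong (_* B) (trans (ΣL-indicator (λ i → i) (λ c → not (c == v))) (cong fromℕℚ (#-≢ v)))))))
      where
      e : ∀ b → (if b then A else B) ≡ ⟪ b ⟫ * A + ⟪ not b ⟫ * B
      e true  = sym (trans (cong₂ _+_ (*-identityˡ A) (*-zeroˡ B)) (+-identityʳ A))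
      e false = sym (trans (cong₂ _+_ (*-zeroˡ A) (*-identityˡ B)) (+-identityˡ B))

  0≤A : 0ℚ ≤ A
  0≤A = ^-nonneg (n ℕ.∸ 1) 0≤q

  NA≤μ : N * A ≤ μ
  NA≤μ = ≤-trans (*-monoʳ N (0≤fromℕℚ n) (by-diff {A} (fromℕℚ (n ℕ.∸ 1) * (p * q ^ (n ℕ.∸ 2)))
    (*-nonneg (0≤fromℕℚ (n ℕ.∸ 1)) (*-nonneg 0≤p (^-nonneg (n ℕ.∸ 2) 0≤q))) refl)) (≤-reflexive (sym μ≡))

  0<μ : 0ℚ < μ
  0<μ = <-≤-trans (*-pos (<-≤-trans (fromℕℚ-pos 2) (fromℕℚ-mono 3≤n)) (^-pos (n ℕ.∸ 1) 0<q)) NA≤μ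

  X : Coins → ℚ
  X s = ΣL pts (λ a → Z a s)

  private L = length (pairs n)

  E-X : E X ≡ μ
  E-X = trans (Ex-ΣL L pts Z) (ΣL-cong pts E-Z)

  -- In the single-edge case each certificate has exactly one partner, so these terms number `n²`,
  -- and `N * A ≤ μ` bounds their sum.
  E-X² : E (λ s → X s * X s) ≤ μ + (u * (μ * μ) + p * (μ * μ) * (u * u))
  E-X² = ≤-trans (≤-reflexive (trans (Ex-cong L square) expand))
    (≤-trans (ΣL-mono pts (λ (v , c) → ΣL-mono pts (λ (v′ , c′) → pair≤ v c v′ c′)))
      (≤-trans (≤-reflexive (trans (ΣL-cong pts inner) outer)) (+-monoʳ-≤ μ (+-monoʳ-≤ (u * (μ * μ)) K≤))))
    where
    K = p * (A * A) * (u * u)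
    expand : E (λ s → ΣL pts (λ a → ΣL pts (λ b → Z a s * Z b s))) ≡ ΣL pts (λ a → ΣL pts (λ b → E (λ s → Z a s * Z b s)))
    expand = trans (Ex-ΣL L pts (λ a s → ΣL pts (λ b → Z a s * Z b s))) (ΣL-cong pts (λ a → Ex-ΣL L pts (λ b s → Z a s * Z b s)))
    outer : ΣL pts (λ a → ez a + (u * (ez a * μ) + K)) ≡ μ + (u * (μ * μ) + N * (N * K))
    outer = trans (ΣL-+ pts ez (λ a → u * (ez a * μ) + K)) (cong (μ +_)
      (trans (ΣL-+ pts (λ a → u * (ez a * μ)) (λ _ → K)) (cong₂ _+_
        (trans (ΣL-* pts u (λ a → ez a * μ)) (cong (u *_) (ΣL-*ʳ pts ez μ)))
        (trans (ΣL-pts (λ _ → K)) (trans (ΣL-cong (allFin n) (λ _ → ΣL-allFin K)) (ΣL-allFin (N * K)))))))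
    square : ∀ s → X s * X s ≡ ΣL pts (λ a → ΣL pts (λ b → Z a s * Z b s))
    square s = trans (sym (ΣL-*ʳ pts (λ a → Z a s) (X s))) (ΣL-cong pts (λ a → sym (ΣL-* pts (Z a s) (λ b → Z b s))))
    inner : ∀ a → ΣL pts (λ b → ⟪ proj₁ b == proj₁ a ⟫ * ⟪ proj₂ b == proj₂ a ⟫ * ez a + (u * (ez a * ez b) + ⟪ proj₁ b == proj₂ a ⟫ * ⟪ proj₂ b == proj₁ a ⟫ * K))
      ≡ ez a + (u * (ez a * μ) + K)
    inner a@(v , c) = trans (ΣL-+ pts (λ b → ⟪ proj₁ b == v ⟫ * ⟪ proj₂ b == c ⟫ * ez a) (λ b → u * (ez a * ez b) + ⟪ proj₁ b == c ⟫ * ⟪ proj₂ b == v ⟫ * K))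
      (cong₂ _+_ (trans (ΣL-*ʳ pts (λ b → ⟪ proj₁ b == v ⟫ * ⟪ proj₂ b == c ⟫) (ez a)) (trans (cong (_* ez a) (ΣL-delta v c)) (*-identityˡ (ez a))))
        (trans (ΣL-+ pts (λ b → u * (ez a * ez b)) (λ b → ⟪ proj₁ b == c ⟫ * ⟪ proj₂ b == v ⟫ * K))
          (cong₂ _+_ (trans (ΣL-* pts u (λ b → ez a * ez b)) (cong (u *_) (ΣL-* pts (ez a) ez)))
            (trans (ΣL-*ʳ pts (λ b → ⟪ proj₁ b == c ⟫ * ⟪ proj₂ b == v ⟫) K) (trans (cong (_* K) (ΣL-delta c v)) (*-identityˡ K))))))
    K≤ : N * (N * K) ≤ p * (μ * μ) * (u * u)
    K≤ = ≤-trans (≤-reflexive (e N p A u)) (*-monoˡ (u * u) (*-nonneg 0≤u 0≤u) (*-monoʳ p 0≤p (*-mono₂ (*-nonneg (0≤fromℕℚ n) 0≤A) (*-nonneg (0≤fromℕℚ n) 0≤A) NA≤μ NA≤μ)))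
      where
      e : ∀ N p A u → N * (N * (p * (A * A) * (u * u))) ≡ p * (N * A * (N * A)) * (u * u)
      e = solve-∀ ℚ-ring

  u≤2 : u ≤ 2ℚ
  u≤2 = *-cancelˡ {u} {2ℚ} q 0<q (≤-trans (≤-reflexive qu) (by-diff {1ℚ} (2ℚ * (½ - p)) (*-nonneg 0≤2 (0≤-diff p≤½)) (e p)))
    where
    e : ∀ p → 1ℚ + 2ℚ * (½ - p) ≡ (1ℚ - p) * 2ℚ
    e = solve-∀ ℚ-ring

  -- Chebyshev's inequality for the number of isolated vertices and leaves.
  small-core : Small (λ s → IsCore (graph n s)) (recip μ + fromℕℚ 6 * p)
  small-core = small f 0≤f covers Ef
    where
    m = recip μ
    mμ : m * μ ≡ 1ℚ
    mμ = trans (*-comm m μ) (*-recip 0<μ)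
    -- This is `(1 - X / μ)²` written out; it equals 1 where `X` vanishes.
    f : Coins → ℚ
    f s = 1ℚ + ((- (2ℚ * m)) * X s + m * m * (X s * X s))
    0≤f : ∀ s → 0ℚ ≤ f s
    0≤f s = subst (0ℚ ≤_) (e m (X s)) (square (1ℚ - m * X s))
      where
      e : ∀ m x → (1ℚ - m * x) * (1ℚ - m * x) ≡ 1ℚ + ((- (2ℚ * m)) * x + m * m * (x * x))
      e = solve-∀ ℚ-ring
      square : ∀ x → 0ℚ ≤ x * x
      square x with ≤-total 0ℚ x
      ... | inj₁ 0≤x = *-nonneg 0≤x 0≤x
      ... | inj₂ x≤0 = subst (0ℚ ≤_) (e′ x) (*-nonneg (0≤-diff x≤0) (0≤-diff x≤0))
        where
        e′ : ∀ x → (0ℚ - x) * (0ℚ - x) ≡ x * x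
        e′ = solve-∀ ℚ-ring
    covers : ∀ s → IsCore (graph n s) → 1ℚ ≤ f s
    covers s core = ≤-reflexive (sym (trans (cong (λ x → 1ℚ + ((- (2ℚ * m)) * x + m * m * (x * x))) X≡0) (e m)))
      where
      X≡0 : X s ≡ 0ℚ
      X≡0 = trans (ΣL-cong pts (λ a → Z-core a s core)) (trans (ΣL-const pts 0ℚ) (*-zeroʳ (fromℕℚ (length pts))))
      e : ∀ m → 1ℚ + ((- (2ℚ * m)) * 0ℚ + m * m * (0ℚ * 0ℚ)) ≡ 1ℚ
      e = solve-∀ ℚ-ring
    Ef : E f ≤ m + fromℕℚ 6 * p
    Ef = ≤-trans (≤-reflexive (trans (Ex-+ L (λ _ → 1ℚ) (λ s → (- (2ℚ * m)) * X s + m * m * (X s * X s))) (cong₂ _+_ (Ex-const L 1ℚ)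
          (trans (Ex-+ L (λ s → (- (2ℚ * m)) * X s) (λ s → m * m * (X s * X s))) (cong₂ _+_ (trans (Ex-* L (- (2ℚ * m)) X) (cong ((- (2ℚ * m)) *_) E-X)) (Ex-* L (m * m) (λ s → X s * X s)))))))
        (≤-trans (+-monoʳ-≤ 1ℚ (+-monoʳ-≤ ((- (2ℚ * m)) * μ) (*-monoʳ (m * m) (*-nonneg 0≤m 0≤m) E-X²)))
          (≤-trans (≤-reflexive (trans (e₁ m μ u p) (cong (λ z → 1ℚ + ((- (2ℚ * z)) + (m * z + (u * (z * z) + p * (z * z) * (u * u))))) mμ)))
            -- The excess `u - 1` equals `p * u` because `q * u = 1`; with `u ≤ 2`, everything
            -- beyond `m` is a multiple of `p`.
            (≤-trans (≤-reflexive (trans (e₂ m u p) (trans (cong (λ z → m + ((u - z) + p * (u * u))) (sym qu)) (e₃ m p u))))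
              (+-monoʳ-≤ m (≤-trans (+-mono-≤ (*-monoʳ p 0≤p u≤2) (*-monoʳ p 0≤p (*-mono₂ 0≤u 0≤u u≤2 u≤2))) (≤-reflexive (e₄ p)))))))
      where
      0≤m = <⇒≤ (recip-pos 0<μ)
      e₁ : ∀ m x u p → 1ℚ + ((- (2ℚ * m)) * x + m * m * (x + (u * (x * x) + p * (x * x) * (u * u))))
        ≡ 1ℚ + ((- (2ℚ * (m * x))) + (m * (m * x) + (u * ((m * x) * (m * x)) + p * ((m * x) * (m * x)) * (u * u))))
      e₁ = solve-∀ ℚ-ring
      e₂ : ∀ m u p → 1ℚ + ((- (2ℚ * 1ℚ)) + (m * 1ℚ + (u * (1ℚ * 1ℚ) + p * (1ℚ * 1ℚ) * (u * u)))) ≡ m + ((u - 1ℚ) + p * (u * u))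
      e₂ = solve-∀ ℚ-ring
      e₃ : ∀ m p u → m + ((u - (1ℚ - p) * u) + p * (u * u)) ≡ m + (p * u + p * (u * u))
      e₃ = solve-∀ ℚ-ring
      e₄ : ∀ p → p * 2ℚ + p * (2ℚ * 2ℚ) ≡ fromℕℚ 6 * p
      e₄ = solve-∀ ℚ-ring

  w y : ℚ
  w = q ^ n
  y = N * p

  0≤w : 0ℚ ≤ w
  0≤w = ^-nonneg n 0≤q

  -- All exponents of `q` are raised to `n`, and `1 + (n - 1) p` is at least `½ + y` because
  -- `p ≤ ½`.
  μ≥ : N * (w * (½ + y)) ≤ μ
  μ≥ = ≤-trans (*-monoʳ N (0≤fromℕℚ n) (≤-trans (≤-trans (*-monoʳ w 0≤w ½+y≤) (≤-reflexive (e w (fromℕℚ (n ℕ.∸ 1)) p)))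
      (+-mono-≤ (^-antiʳ 0≤q q≤1 (ℕP.m∸n≤m n 1)) (*-monoʳ (fromℕℚ (n ℕ.∸ 1)) (0≤fromℕℚ (n ℕ.∸ 1)) (*-monoʳ p 0≤p (^-antiʳ 0≤q q≤1 (ℕP.m∸n≤m n 2)))))))
    (≤-reflexive (sym μ≡))
    where
    e : ∀ w m p → w * (1ℚ + m * p) ≡ w + m * (p * w)
    e = solve-∀ ℚ-ring
    N-1 : fromℕℚ (n ℕ.∸ 1) + 1ℚ ≡ N
    N-1 = trans (sym (fromℕℚ-+ (n ℕ.∸ 1) 1)) (cong fromℕℚ (ℕP.m∸n+n≡m (ℕP.≤-trans (ℕP.m≤m+n 1 2) 3≤n)))
    ½+y≤ : ½ + y ≤ 1ℚ + fromℕℚ (n ℕ.∸ 1) * p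
    ½+y≤ = by-diff (½ - p) (0≤-diff p≤½) (trans (cong (λ z → ½ + z * p + (½ - p)) (sym N-1)) (e′ (fromℕℚ (n ℕ.∸ 1)) p))
      where
      e′ : ∀ m p → ½ + (m + 1ℚ) * p + (½ - p) ≡ 1ℚ + m * p
      e′ = solve-∀ ℚ-ring

  uw : u ^ n * w ≡ 1ℚ
  uw = trans (sym (^-distrib-* u q n)) (trans (cong (_^ n) (trans (*-comm u q) qu)) (1^ n))

  -- 1 / q = 1 + p u
  grow-u : Grow (N * (p * u)) (u ^ n)
  grow-u = subst (λ z → Grow (N * (p * u)) (z ^ n)) 1+pu (grow-^ n (+-nonneg 0≤1 (*-nonneg 0≤p 0≤u)) (grow-1+ (*-nonneg 0≤p 0≤u)))
    where
    1+pu : 1ℚ + p * u ≡ u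
    1+pu = trans (cong (_+ p * u) (sym qu)) (e p u)
      where
      e : ∀ p u → (1ℚ - p) * u + p * u ≡ u
      e = solve-∀ ℚ-ring

  -- Certificates bound `z` and `w` from above, so a lower bound on `q ^ n` has to pass through its
  -- reciprocal `u ^ n`, for which there is `grow-u`.
  from-w : ∀ {x z} → 0ℚ ≤ z → u ^ n * z * x ≤ 1ℚ → z * x ≤ w
  from-w {x} {z} 0≤z h = ≤-trans (≤-reflexive (sym (trans (cong (_* (z * x)) (trans (*-comm w (u ^ n)) uw)) (*-identityˡ (z * x)))))
    (≤-trans (≤-reflexive (e w (u ^ n) z x)) (≤-trans (*-monoʳ w 0≤w h) (≤-reflexive (*-identityʳ w))))
    where
    e : ∀ w v z x → w * v * (z * x) ≡ w * (v * z * x)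
    e = solve-∀ ℚ-ring

  module _ (a b M : ℚ) (decay-a : Decay a (recip N)) (decay-b : Decay b (recip a)) (1≤a : 1ℚ ≤ a) (b≤a : b ≤ a) (0≤M : 0ℚ ≤ M)
    (np≤ : y + (M + 1ℚ) ≤ a + b) (n-large : 16384 ℕ.≤ n) where

    0<N : 0ℚ < N
    0<N = <-≤-trans (fromℕℚ-pos 2) (fromℕℚ-mono 3≤n)

    0≤a : 0ℚ ≤ a
    0≤a = ≤-trans 0≤1 1≤a

    0≤y : 0ℚ ≤ y
    0≤y = *-nonneg (0≤fromℕℚ n) 0≤p

    -- A polynomial bound on the logarithm, from `(1 + a / 4) ^ 4 ≤ exp a ≤ n`.
    a⁴≤ : a ^ 4 ≤ fromℕℚ 256 * N
    a⁴≤ = ≤-trans (≤-reflexive (e a)) (*-monoʳ (fromℕℚ 256) (0≤fromℕℚ 256)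
      (≤-trans (^-mono 4 (*-nonneg (nonNegative⁻¹ (½ ^ 2)) 0≤a) (by-diff {½ ^ 2 * a} 1ℚ 0≤1 (+-comm (½ ^ 2 * a) 1ℚ))) 1+a/4))
      where
      e : ∀ a → a * (a * (a * (a * 1ℚ))) ≡ fromℕℚ 256 * ((½ ^ 2 * a) * ((½ ^ 2 * a) * ((½ ^ 2 * a) * ((½ ^ 2 * a) * 1ℚ))))
      e = solve-∀ ℚ-ring
      e′ : ∀ a → fromℕℚ 4 * (½ ^ 2 * a) ≡ a
      e′ = solve-∀ ℚ-ring
      1+a/4 : (1ℚ + ½ ^ 2 * a) ^ 4 ≤ N
      1+a/4 = z*w≤1⇒w≤ r z N (0≤fromℕℚ n) (trans (*-comm r N) (*-recip 0<N))
          (≤-trans (≤-reflexive (*-comm r z)) (grow*decay≤1 (subst (λ x → Grow x z) (e′ a) (grow-^ 4 (+-nonneg 0≤1 0≤¼a) (grow-1+ 0≤¼a))) decay-a (<⇒≤ (recip-pos 0<N))))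
        where
        r = recip N
        z = (1ℚ + ½ ^ 2 * a) ^ 4
        0≤¼a : 0ℚ ≤ ½ ^ 2 * a
        0≤¼a = *-nonneg (nonNegative⁻¹ (½ ^ 2)) 0≤a

    y≤2a : y ≤ 2ℚ * a
    y≤2a = ≤-trans (by-diff {y} (M + 1ℚ) (+-nonneg 0≤M 0≤1) refl) (≤-trans np≤ (≤-trans (+-monoʳ-≤ a b≤a) (≤-reflexive (e a))))
      where
      e : ∀ a → a + a ≡ 2ℚ * a
      e = solve-∀ ℚ-ring

    p≤δ : ∀ δ → 0ℚ ≤ δ → fromℕℚ 16 ≤ δ * δ * N → p ≤ δ
    p≤δ δ 0≤δ h = *-cancelˡ {p} {δ} N 0<N (≤-trans y≤2a (^-cancel 3 (*-nonneg 0≤2 0≤a) (*-nonneg (0≤fromℕℚ n) 0≤δ)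
      (≤-trans (≤-reflexive (^-distrib-* 2ℚ a 4)) (≤-trans (*-monoʳ (2ℚ ^ 4) (0≤2^ 4) a⁴≤)
        (≤-trans (≤-reflexive (sym (*-identityʳ (2ℚ ^ 4 * (fromℕℚ 256 * N)))))
          (≤-trans (≤-reflexive (e₁ N)) (≤-trans (*-mono₂ {fromℕℚ 16 * fromℕℚ 16} (nonNegative⁻¹ (fromℕℚ 16 * fromℕℚ 16)) (*-nonneg (0≤fromℕℚ 16) (0≤fromℕℚ n)) (*-mono₂ (0≤fromℕℚ 16) (0≤fromℕℚ 16) h h) (*-monoˡ N (0≤fromℕℚ n) 16≤N))
            (≤-reflexive (e₂ δ N)))))))))
      where
      16≤N : fromℕℚ 16 ≤ N
      16≤N = fromℕℚ-mono (ℕP.≤-trans (ℕP.≤ᵇ⇒≤ 16 16384 _) n-large)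
      e₁ : ∀ N → 2ℚ ^ 4 * (fromℕℚ 256 * N) * 1ℚ ≡ fromℕℚ 16 * fromℕℚ 16 * (fromℕℚ 16 * N)
      e₁ = solve-∀ ℚ-ring
      e₂ : ∀ δ N → δ * δ * N * (δ * δ * N) * (N * N) ≡ N * δ * (N * δ * (N * δ * (N * δ * 1ℚ)))
      e₂ = solve-∀ ℚ-ring

    -- `N * (y * p) = y² ≤ 4 a²`, and `(4 a²)² = 16 a⁴ ≤ 4096 N`. The last is at most `(N / 2)²`
    -- once `N ≥ 16384`, the origin of that constant.
    yp≤½ : y * p ≤ ½
    yp≤½ = *-cancelˡ {y * p} {½} N 0<N (≤-trans (≤-reflexive (e₁ N p)) (≤-trans (*-mono₂ 0≤y 0≤y y≤2a y≤2a)
        (^-cancel 1 (*-nonneg (*-nonneg 0≤2 0≤a) (*-nonneg 0≤2 0≤a)) (*-nonneg (0≤fromℕℚ n) 0≤½)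
          (≤-trans (≤-reflexive (e₂ a)) (≤-trans (*-monoʳ (fromℕℚ 16) (0≤fromℕℚ 16) a⁴≤)
            (by-diff (½ ^ 2 * N * (N - fromℕℚ 16384)) (*-nonneg (*-nonneg (nonNegative⁻¹ (½ ^ 2)) (0≤fromℕℚ n)) (0≤-diff (fromℕℚ-mono n-large))) (e₃ N)))))))
      where
      e₁ : ∀ N p → N * (N * p * p) ≡ N * p * (N * p)
      e₁ = solve-∀ ℚ-ring
      e₂ : ∀ a → 2ℚ * a * (2ℚ * a) * (2ℚ * a * (2ℚ * a) * 1ℚ) ≡ fromℕℚ 16 * (a * (a * (a * (a * 1ℚ))))
      e₂ = solve-∀ ℚ-ring
      e₃ : ∀ N → fromℕℚ 16 * (fromℕℚ 256 * N) + ½ ^ 2 * N * (N - fromℕℚ 16384) ≡ N * ½ * (N * ½ * 1ℚ)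
      e₃ = solve-∀ ℚ-ring

    -- As `u = 1 + p * u`, the exponent of `grow-u` exceeds `y` by `y p u`, which is at most 1 by
    -- `yp≤½` and `u ≤ 2`.
    ypu : N * (p * u) ≤ y + 1ℚ
    ypu = ≤-trans (≤-reflexive (trans (cong (λ z → N * (p * z)) u≡) (e N p u))) (+-monoʳ-≤ y (*-mono₂ (*-nonneg 0≤y 0≤p) 0≤u yp≤½ u≤2))
      where
      u≡ : u ≡ 1ℚ + p * u
      u≡ = sym (trans (cong (_+ p * u) (sym qu)) (e′ p u))
        where
        e′ : ∀ p u → (1ℚ - p) * u + p * u ≡ u
        e′ = solve-∀ ℚ-ring
      e : ∀ N p u → N * (p * (1ℚ + p * u)) ≡ N * p + N * p * p * u
      e = solve-∀ ℚ-ring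

    -- If p is not much smaller than log n / n, the leaves are many; otherwise
    -- the isolated vertices are.
    μ-large : ∀ B → 0ℚ ≤ B → fromℕℚ 4 * B ≤ M → fromℕℚ 4 * (B * B) ≤ N → B ≤ μ
    μ-large B 0≤B 4B≤M B²≤N with ≤-total (fromℕℚ 4 * y) a
    ... | inj₂ a≤4y = ≤-trans B≤ (≤-trans (*-monoʳ N (0≤fromℕℚ n) (*-monoʳ w 0≤w (by-diff {y} ½ 0≤½ (+-comm y ½)))) μ≥)
      where
      main : u ^ n * (1ℚ + M) * (recip N * recip a) ≤ 1ℚ
      main = grow*decay≤1 (grow-* (^-nonneg n 0≤u) (+-nonneg 0≤1 0≤M) grow-u (grow-1+ 0≤M))
        (decay-mono (≤-trans (+-monoˡ-≤ M ypu) (≤-trans (≤-reflexive (e y M)) np≤)) ≤-refl (decay-* 0≤rN 0≤ra decay-a decay-b)) (*-nonneg 0≤rN 0≤ra)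
        where
        0≤rN = <⇒≤ (recip-pos 0<N)
        0≤ra = <⇒≤ (recip-pos (<-≤-trans (positive⁻¹ 1ℚ) 1≤a))
        e : ∀ y M → y + 1ℚ + M ≡ y + (M + 1ℚ)
        e = solve-∀ ℚ-ring
      1+M≤ : 1ℚ + M ≤ N * (w * a)
      1+M≤ = ≤-trans (≤-reflexive (trans (sym (*-identityʳ (1ℚ + M))) (trans (cong ((1ℚ + M) *_) (sym (trans (cong₂ _*_ (*-recip 0<N) (*-recip (<-≤-trans (positive⁻¹ 1ℚ) 1≤a))) refl))) (e (1ℚ + M) N (recip N) a (recip a)))))
        (≤-trans (*-monoʳ (N * a) (*-nonneg (0≤fromℕℚ n) 0≤a) (from-w {recip N * recip a} {1ℚ + M} (+-nonneg 0≤1 0≤M) main)) (≤-reflexive (e′ N a w)))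
        where
        e : ∀ m N r a s → m * (N * r * (a * s)) ≡ N * a * (m * (r * s))
        e = solve-∀ ℚ-ring
        e′ : ∀ N a w → N * a * w ≡ N * (w * a)
        e′ = solve-∀ ℚ-ring
      B≤ : B ≤ N * (w * y)
      B≤ = *-cancelˡ {B} {N * (w * y)} (fromℕℚ 4) (fromℕℚ-pos 3) (≤-trans 4B≤M (≤-trans (by-diff {M} 1ℚ 0≤1 (+-comm M 1ℚ)) (≤-trans 1+M≤
        (≤-trans (*-monoʳ N (0≤fromℕℚ n) (*-monoʳ w 0≤w a≤4y)) (≤-reflexive (e N w y))))))
        where
        e : ∀ N w y → N * (w * (fromℕℚ 4 * y)) ≡ fromℕℚ 4 * (N * (w * y))
        e = solve-∀ ℚ-ring
    ... | inj₁ 4y≤a = ≤-trans B≤ (≤-trans (*-monoʳ N (0≤fromℕℚ n) (*-monoʳ w 0≤w (by-diff {½} y 0≤y refl))) μ≥)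
      where
      0≤rN = <⇒≤ (recip-pos 0<N)
      main : u ^ n * u ^ n * recip N ≤ 1ℚ
      main = grow*decay≤1 (grow-* (^-nonneg n 0≤u) (^-nonneg n 0≤u) grow-u grow-u) (decay-mono (≤-trans (+-mono-≤ y≤ y≤) (≤-trans (≤-reflexive (e y)) 4y≤a)) ≤-refl decay-a) 0≤rN
        where
        y≤ : N * (p * u) ≤ 2ℚ * y
        y≤ = ≤-trans (≤-reflexive (trans (sym (*-assoc N p u)) (*-comm y u))) (*-monoˡ y 0≤y u≤2)
        e : ∀ y → 2ℚ * y + 2ℚ * y ≡ fromℕℚ 4 * y
        e = solve-∀ ℚ-ring
      r≤ww : recip N ≤ w * w
      r≤ww = ≤-trans (≤-reflexive (sym (trans (cong (_* recip N) (trans (e w (u ^ n)) (trans (cong₂ _*_ uw uw) refl))) (*-identityˡ (recip N)))))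
        (≤-trans (≤-reflexive (*-assoc (w * w) (u ^ n * u ^ n) (recip N))) (≤-trans (*-monoʳ (w * w) (*-nonneg 0≤w 0≤w) main) (≤-reflexive (*-identityʳ (w * w)))))
        where
        e : ∀ w v → w * w * (v * v) ≡ v * w * (v * w)
        e = solve-∀ ℚ-ring
      B≤ : B ≤ N * (w * ½)
      B≤ = ^-cancel 1 0≤B (*-nonneg (0≤fromℕℚ n) (*-nonneg 0≤w 0≤½)) (*-cancelˡ {B ^ 2} {(N * (w * ½)) ^ 2} (fromℕℚ 4) (fromℕℚ-pos 3)
        (≤-trans (≤-reflexive (cong (fromℕℚ 4 *_) (cong (B *_) (*-identityʳ B)))) (≤-trans B²≤N
          (≤-trans (≤-reflexive (sym (trans (*-assoc N N (recip N)) (trans (cong (N *_) (*-recip 0<N)) (*-identityʳ N)))))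
            (≤-trans (*-monoʳ (N * N) (*-nonneg (0≤fromℕℚ n) (0≤fromℕℚ n)) r≤ww) (≤-reflexive (e N w)))))))
        where
        e : ∀ N w → N * N * (w * w) ≡ fromℕℚ 4 * (N * (w * ½) * (N * (w * ½) * 1ℚ))
        e = solve-∀ ℚ-ring

recip-≥ : ∀ {x ε} → 0ℚ < ε → recip ε ≤ x → recip x ≤ ε
recip-≥ {x} {ε} 0<ε h = ≤-trans (recip-anti (recip-pos 0<ε) h) (≤-reflexive (trans (sym (*-identityˡ _)) (trans (cong (_* recip (recip ε)) (sym (*-recip 0<ε)))
  (trans (*-assoc ε (recip ε) (recip (recip ε))) (trans (cong (ε *_) (*-recip (recip-pos 0<ε))) (*-identityʳ ε))))))

open Sample using (module Prob)
open Prob using (Small; small-mono; small-𝟙)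

-- Opaque: as a plain numeral it would be compared in unary.
abstract
  large : ℕ
  large = 16384

  ≤large : 16384 ℕ.≤ large
  ≤large = ℕP.≤-refl

¬core-whp : ∀ ε → 0ℚ < ε → ∃₂ λ M n₀ → ∀ n p (0≤p : 0ℚ ≤ p) (p≤½ : p ≤ ½) a b → n₀ ℕ.≤ n →
  Decay a (recip (fromℕℚ n)) → Decay b (recip a) → 1ℚ ≤ a → b ≤ a → fromℕℚ n * p + M ≤ a + b →
  Small n p 0≤p (≤-trans p≤½ ½≤1) (λ s → IsCore (graph n s)) ε
¬core-whp ε 0<ε = M + 1ℚ , n₀ , λ n p 0≤p p≤½ a b n₀≤n da db 1≤a b≤a h →
    small-mono n p 0≤p (≤-trans p≤½ ½≤1) (λ s x → x) (bound n p 0≤p p≤½ a b n₀≤n da db 1≤a b≤a h)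
      (Pendant.small-core n p 0≤p p≤½ (3≤ n₀≤n))
  where
  δ B M : ℚ
  -- `p ≤ δ` puts the term `6 p` below `ε / 2`, and `μ ≥ B = 2 / ε` does the same for `recip μ`. The
  -- factor 4 in `M` is the one that `μ-large` asks for.
  δ = ½ ^ 4 * ε
  B = recip (½ * ε)
  M = fromℕℚ 4 * B
  0<½ε = half-pos 0<ε
  0≤B : 0ℚ ≤ B
  0≤B = <⇒≤ (recip-pos 0<½ε)
  0<δ : 0ℚ < δ
  0<δ = *-pos (positive⁻¹ (½ ^ 4)) 0<ε
  n₁ n₂ n₀ : ℕ
  n₁ = proj₁ (≤fromℕℚ (fromℕℚ 4 * (B * B)))
  n₂ = proj₁ (≤fromℕℚ (fromℕℚ 16 * (recip δ * recip δ)))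
  n₀ = large ℕ.+ (n₁ ℕ.+ n₂)
  16384≤ : ∀ {n} → n₀ ℕ.≤ n → 16384 ℕ.≤ n
  16384≤ h = ℕP.≤-trans ≤large (ℕP.m+n≤o⇒m≤o large h)
  3≤ : ∀ {n} → n₀ ℕ.≤ n → 3 ℕ.≤ n
  3≤ h = ℕP.≤-trans (ℕP.≤ᵇ⇒≤ 3 16384 _) (16384≤ h)
  bound : ∀ n p (0≤p : 0ℚ ≤ p) (p≤½ : p ≤ ½) a b → (h : n₀ ℕ.≤ n) →
    Decay a (recip (fromℕℚ n)) → Decay b (recip a) → 1ℚ ≤ a → b ≤ a → fromℕℚ n * p + (M + 1ℚ) ≤ a + b →
    recip (Pendant.μ n p 0≤p p≤½ (3≤ h)) + fromℕℚ 6 * p ≤ ε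
  bound n p 0≤p p≤½ a b h da db 1≤a b≤a np≤ = ≤-trans (+-mono-≤
      (recip-≥ 0<½ε (P.μ-large a b M da db 1≤a b≤a 0≤M np≤ (16384≤ h) B 0≤B ≤-refl
        (≤-trans (proj₂ (≤fromℕℚ (fromℕℚ 4 * (B * B)))) (fromℕℚ-mono (ℕP.m+n≤o⇒m≤o n₁ (ℕP.m+n≤o⇒n≤o large h))))))
      (≤-trans (*-monoʳ (fromℕℚ 6) (0≤fromℕℚ 6) (P.p≤δ a b M da db 1≤a b≤a 0≤M np≤ (16384≤ h) δ (<⇒≤ 0<δ) 16≤))
        (by-diff (½ ^ 3 * ε) (*-nonneg (nonNegative⁻¹ (½ ^ 3)) (<⇒≤ 0<ε)) (e ε))))
    (≤-reflexive (halves ε))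
    where
    module P = Pendant n p 0≤p p≤½ (3≤ h)
    0≤M : 0ℚ ≤ M
    0≤M = *-nonneg (0≤fromℕℚ 4) 0≤B
    e : ∀ ε → fromℕℚ 6 * (½ ^ 4 * ε) + ½ ^ 3 * ε ≡ ½ * ε
    e = solve-∀ ℚ-ring
    16≤ : fromℕℚ 16 ≤ δ * δ * fromℕℚ n
    16≤ = ≤-trans (≤-reflexive (sym (trans (e′ δ (recip δ)) (trans (cong (λ z → fromℕℚ 16 * (z * z)) (*-recip 0<δ)) refl))))
      (*-monoʳ (δ * δ) (*-nonneg (<⇒≤ 0<δ) (<⇒≤ 0<δ)) (≤-trans (proj₂ (≤fromℕℚ (fromℕℚ 16 * (recip δ * recip δ)))) (fromℕℚ-mono (ℕP.m+n≤o⇒n≤o n₁ (ℕP.m+n≤o⇒n≤o large h)))))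
      where
      e′ : ∀ δ r → δ * δ * (fromℕℚ 16 * (r * r)) ≡ fromℕℚ 16 * (δ * r * (δ * r))
      e′ = solve-∀ ℚ-ring

-- Scales, and the first half at rational probabilities

log-bracket : ∀ B E n → 1 ℕ.≤ n → n ℕ.< B ℕ.^ E → ∃ λ e → B ℕ.^ e ℕ.≤ n × n ℕ.< B ℕ.^ suc e
log-bracket B zero    n 1≤n n< = ⊥-elim (ℕP.<⇒≱ n< 1≤n)
log-bracket B (suc E) n 1≤n n< with B ℕ.^ E ℕP.≤? n
... | yes B^E≤n = E , B^E≤n , n<
... | no  B^E≰n = log-bracket B E n 1≤n (ℕP.≰⇒> B^E≰n)

n<2^n : ∀ n → n ℕ.< 2 ℕ.^ n
n<2^n zero    = ℕ.s≤s ℕ.z≤n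
n<2^n (suc n) = ℕP.≤-trans (ℕP.+-mono-≤ (ℕP.m^n>0 2 n) (n<2^n n)) (ℕP.≤-reflexive (cong (2 ℕ.^ n ℕ.+_) (sym (ℕP.+-identityʳ (2 ℕ.^ n)))))

scale : ∀ c E n → 1 ℕ.≤ c → 2 ℕ.^ (c ℕ.* E) ℕ.≤ n →
  ∃ λ e → E ℕ.≤ e × 2 ℕ.^ (c ℕ.* e) ℕ.≤ n × n ℕ.≤ 2 ℕ.^ (c ℕ.* e ℕ.+ c)
scale c E n 1≤c ≤n = build (log-bracket B n n (ℕP.≤-trans (ℕP.m^n>0 2 (c ℕ.* E)) ≤n)
    (ℕP.≤-trans (n<2^n n) (ℕP.≤-trans (ℕP.^-monoʳ-≤ 2 n≤cn) (ℕP.≤-reflexive (sym (ℕP.^-*-assoc 2 c n))))))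
  where
  B = 2 ℕ.^ c
  n≤cn : n ℕ.≤ c ℕ.* n
  n≤cn = ℕP.≤-trans (ℕP.≤-reflexive (sym (ℕP.*-identityˡ n))) (ℕP.*-monoˡ-≤ n 1≤c)
  build : (∃ λ e → B ℕ.^ e ℕ.≤ n × n ℕ.< B ℕ.^ suc e) → _
  build (e , e≤ , <e) = e , E≤e (E ℕP.≤? e) , ℕP.≤-trans (ℕP.≤-reflexive (sym (ℕP.^-*-assoc 2 c e))) e≤ ,
      ℕP.≤-trans (ℕP.<⇒≤ <e) (ℕP.≤-reflexive (trans (ℕP.^-*-assoc 2 c (suc e)) (cong (2 ℕ.^_) (trans (ℕP.*-suc c e) (ℕP.+-comm c (c ℕ.* e))))))
    where
    E≤e : Dec (E ℕ.≤ e) → E ℕ.≤ e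
    E≤e (yes h) = h
    E≤e (no ¬h) = ⊥-elim (ℕP.<⇒≱ <e (ℕP.≤-trans (ℕP.^-monoʳ-≤ B {{ℕ.>-nonZero (ℕP.m^n>0 2 c)}} (ℕP.≰⇒> ¬h))
      (ℕP.≤-trans (ℕP.≤-reflexive (ℕP.^-*-assoc 2 c E)) ≤n)))

-- One step doubles the right side and at most doubles the left, because `(k + 2)² ≤ 2 (k + 1)²`
-- from `k = 2` on.
square≤2^ : ∀ A B k → 2 ℕ.≤ k → A ℕ.* (B ℕ.* (suc k ℕ.* suc k)) ℕ.≤ 2 ℕ.^ k →
  ∀ j → A ℕ.* (B ℕ.* (suc (j ℕ.+ k) ℕ.* suc (j ℕ.+ k))) ℕ.≤ 2 ℕ.^ (j ℕ.+ k)
square≤2^ A B k 2≤k h zero    = h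
square≤2^ A B k 2≤k h (suc j) = ℕP.≤-trans (ℕP.*-monoʳ-≤ A (ℕP.*-monoʳ-≤ B (double (j ℕ.+ k) (ℕP.≤-trans 2≤k (ℕP.m≤n+m k j)))))
    (ℕP.≤-trans (ℕP.≤-reflexive (eq A B (suc (j ℕ.+ k)))) (ℕP.*-monoʳ-≤ 2 (square≤2^ A B k 2≤k h j)))
  where
  eq : ∀ A B x → A ℕ.* (B ℕ.* (2 ℕ.* (x ℕ.* x))) ≡ 2 ℕ.* (A ℕ.* (B ℕ.* (x ℕ.* x)))
  eq = ℕSolver.solve-∀
  double : ∀ k → 2 ℕ.≤ k → suc (suc k) ℕ.* suc (suc k) ℕ.≤ 2 ℕ.* (suc k ℕ.* suc k)
  double (suc (suc k)) _ = ℕP.≤-trans (ℕP.m≤m+n _ (k ℕ.* k ℕ.+ 4 ℕ.* k ℕ.+ 2)) (ℕP.≤-reflexive (eq₁ k))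
    where
    eq₁ : ∀ k → suc (suc (suc (suc k))) ℕ.* suc (suc (suc (suc k))) ℕ.+ (k ℕ.* k ℕ.+ 4 ℕ.* k ℕ.+ 2) ≡ 2 ℕ.* (suc (suc (suc k)) ℕ.* suc (suc (suc k)))
    eq₁ = ℕSolver.solve-∀
  double 1 (ℕ.s≤s ())

-- 8 e ≤ D + 2 gives 33 e ≤ 5 (D + 2), and 7 v d ≥ 7 (D - u).
multiple-large : ∀ u v m d D e → D ℕ.≤ u ℕ.+ v ℕ.* d → 8 ℕ.* e ℕ.≤ suc (suc D) → 7 ℕ.* u ℕ.+ suc m ℕ.+ 10 ℕ.≤ D →
  suc D ℕ.+ (33 ℕ.* e ℕ.+ m) ℕ.≤ 7 ℕ.* v ℕ.* d
multiple-large u v m d D e D≤ 8e≤ D-large = ℕP.+-cancelˡ-≤ (7 ℕ.* u) _ _ (ℕP.≤-trans (step₁ (7 ℕ.* u)) (ℕP.≤-trans (step₂ (7 ℕ.* u ℕ.+ suc m) D-large)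
    (ℕP.≤-trans (ℕP.*-monoʳ-≤ 7 D≤) (ℕP.≤-reflexive (trans (ℕP.*-distribˡ-+ 7 u (v ℕ.* d)) (cong (7 ℕ.* u ℕ.+_) (sym (ℕP.*-assoc 7 v d))))))))
  where
  step₁ : ∀ k → k ℕ.+ (suc D ℕ.+ (33 ℕ.* e ℕ.+ m)) ℕ.≤ k ℕ.+ suc m ℕ.+ D ℕ.+ 5 ℕ.* suc (suc D)
  step₁ k = ℕP.≤-trans (ℕP.≤-reflexive (eq k D (33 ℕ.* e) m)) (ℕP.+-monoʳ-≤ (k ℕ.+ suc m ℕ.+ D)
    (ℕP.≤-trans (ℕP.*-monoˡ-≤ e (ℕP.m≤m+n 33 7)) (ℕP.≤-trans (ℕP.≤-reflexive (ℕP.*-assoc 5 8 e)) (ℕP.*-monoʳ-≤ 5 8e≤))))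
    where
    eq : ∀ k D x m → k ℕ.+ (suc D ℕ.+ (x ℕ.+ m)) ≡ k ℕ.+ suc m ℕ.+ D ℕ.+ x
    eq = ℕSolver.solve-∀
  step₂ : ∀ k → k ℕ.+ 10 ℕ.≤ D → k ℕ.+ D ℕ.+ 5 ℕ.* suc (suc D) ℕ.≤ 7 ℕ.* D
  step₂ k h = ℕP.≤-trans (ℕP.≤-reflexive (eq k D)) (ℕP.≤-trans (ℕP.+-monoʳ-≤ (6 ℕ.* D) h) (ℕP.≤-reflexive (eq′ D)))
    where
    eq : ∀ k D → k ℕ.+ D ℕ.+ 5 ℕ.* suc (suc D) ≡ 6 ℕ.* D ℕ.+ (k ℕ.+ 10)
    eq = ℕSolver.solve-∀
    eq′ : ∀ D → 6 ℕ.* D ℕ.+ D ≡ 7 ℕ.* D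
    eq′ = ℕSolver.solve-∀

module _ (c : ℕ) (1344≤c : 1344 ℕ.≤ c) where

  l : ℕ
  l = 2 ℕ.^ (4 ℕ.* c)

  -- `256 * (l * l)` is the lower bound on `n p` behind `4N≤h²p`; the 1000 covers the remaining
  -- numerical comparisons, such as `32 (D + 1) ≤ 2 ^ e`.
  threshold : ℕ
  threshold = 256 ℕ.* (l ℕ.* l) ℕ.+ 1000

  sparse-whp : ∀ n p (0≤p : 0ℚ ≤ p) (p≤½ : p ≤ ½) e D a b M → threshold ℕ.≤ e →
    2 ℕ.^ (16 ℕ.* e) ℕ.≤ n → n ℕ.≤ 2 ℕ.^ (16 ℕ.* e ℕ.+ 16) → suc D ℕ.≤ 80640 ℕ.* (suc e ℕ.* suc e) →
    fromℕℚ D ≤ fromℕℚ n * p → fromℕℚ n * p ≤ fromℕℚ (suc D) →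
    Grow a (½ * fromℕℚ n) → Grow b (½ * a) → 1ℚ ≤ a → b ≤ a → fromℕℚ 8 ≤ M → a + b + M ≤ fromℕℚ n * p →
    ∃ λ ε₁ → 0ℚ ≤ ε₁ × ε₁ * M ≤ fromℕℚ 32 × Small n p 0≤p (≤-trans p≤½ ½≤1) (λ s → ¬ IsCore (graph n s)) (ε₁ + fromℕℚ 11 * ½ ^ e)
  sparse-whp n p 0≤p p≤½ e D a b M t≤e ≤n n≤ D-small D≤np np≤ ga gb 1≤a b≤a 8≤M ab≤ =
      N * (y * κ ^ (n ℕ.∸ 1)) , *-nonneg 0≤N (*-nonneg (<⇒≤ 0<y) (^-nonneg (n ℕ.∸ 1) 0≤κ)) , few-ones ,
      Folds.sparse-core (record { regime = regime ; d = d ; c = c ; h = h ; 192d≤y = 192d≤y ; cd-large = cd-large ; 4hl≤n = 4hl≤n ; 4N≤h²p = 4N≤h²p })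
    where
    p≤1 = ≤-trans p≤½ ½≤1
    1000≤e : 1000 ℕ.≤ e
    1000≤e = ℕP.≤-trans (ℕP.m≤n+m 1000 (256 ℕ.* (l ℕ.* l))) t≤e
    11≤e : 11 ℕ.≤ e
    11≤e = ℕP.≤-trans (ℕP.m≤m+n 11 989) 1000≤e
    32X≤ : 32 ℕ.* suc D ℕ.≤ 2 ℕ.^ e
    32X≤ = ℕP.≤-trans (ℕP.*-monoʳ-≤ 32 D-small)
      (subst (λ k → 32 ℕ.* (80640 ℕ.* (suc k ℕ.* suc k)) ℕ.≤ 2 ℕ.^ k) (ℕP.m∸n+n≡m {e} {40} (ℕP.≤-trans (ℕP.m≤m+n 40 960) 1000≤e)) (square≤2^ 32 80640 40 (ℕ.s≤s (ℕ.s≤s ℕ.z≤n)) (ℕP.≤ᵇ⇒≤ _ _ _) (e ℕ.∸ 40)))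
    regime : Regime
    regime = record
      { n = n ; p = p ; 0≤p = 0≤p ; p≤½ = p≤½ ; e = e ; X = suc D ; ≤n = ≤n ; n≤ = n≤ ; 11≤e = 11≤e ; 32X≤ = 32X≤ ; np≤X = np≤
      ; a = a ; b = b ; M = M ; grow-a = ga ; grow-b = gb ; 1≤a = 1≤a ; b≤a = b≤a ; 8≤M = 8≤M ; ab≤ = ab≤ }
    open Numbers regime
    e≤D : e ℕ.+ 6000 ℕ.≤ D
    e≤D = ℕP.+-cancelˡ-≤ 2 _ _ (ℕP.≤-trans (ℕP.≤-trans (ℕP.≤-reflexive (ℕP.+-comm 2 (e ℕ.+ 6000))) (ℕP.≤-trans (ℕP.≤-reflexive (ℕP.+-assoc e 6000 2)) (ℕP.+-monoʳ-≤ e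
        (ℕP.≤-trans (ℕP.m≤m+n 6002 998) (ℕP.*-monoʳ-≤ 7 1000≤e))))) 8e≤X+1)
    d = D DivMod./ 192
    192d≤D : 192 ℕ.* d ℕ.≤ D
    192d≤D = ℕP.≤-trans (ℕP.≤-reflexive (ℕP.*-comm 192 d)) (DivMod.m/n*n≤m D 192)
    192d≤y : fromℕℚ (192 ℕ.* d) ≤ fromℕℚ n * p
    192d≤y = ≤-trans (fromℕℚ-mono 192d≤D) D≤np
    D≤192d : D ℕ.≤ 191 ℕ.+ 192 ℕ.* d
    D≤192d = ℕP.≤-trans (ℕP.≤-reflexive (DivMod.m≡m%n+[m/n]*n D 192)) (ℕP.+-mono-≤ (ℕP.≤-pred (DivMod.m%n<n D 192)) (ℕP.≤-reflexive (ℕP.*-comm d 192)))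
    -- `d` is about `D / 192` and `1344 = 7 * 192`, so `c * d` is at least about `7 D`. This has
    -- room for `D` and for `33 e`, which is about `33 D / 8` at most.
    cd-large : suc D ℕ.+ (33 ℕ.* e ℕ.+ 34) ℕ.≤ c ℕ.* d
    cd-large = ℕP.≤-trans (multiple-large 191 192 34 d D e D≤192d 8e≤X+1 (ℕP.≤-trans (ℕP.m≤m+n 1382 4618) (ℕP.≤-trans (ℕP.m≤n+m 6000 e) e≤D))) (ℕP.*-monoˡ-≤ d 1344≤c)
    instance
      l≢0 : ℕ.NonZero (4 ℕ.* l)
      l≢0 = ℕ.>-nonZero (ℕP.*-mono-≤ {1} {4} {1} {l} (ℕP.m≤m+n 1 3) (ℕP.m^n>0 2 (4 ℕ.* c)))
    h = n DivMod./ (4 ℕ.* l)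
    1≤l : 1 ℕ.≤ l
    1≤l = ℕP.m^n>0 2 (4 ℕ.* c)
    hl≤n : h ℕ.* (4 ℕ.* l) ℕ.≤ n
    hl≤n = DivMod.m/n*n≤m n (4 ℕ.* l)
    4hl≤n : 4 ℕ.* (h ℕ.* l) ℕ.≤ n
    4hl≤n = ℕP.≤-trans (ℕP.≤-reflexive (eq h l)) hl≤n
      where
      eq : ∀ h l → 4 ℕ.* (h ℕ.* l) ≡ h ℕ.* (4 ℕ.* l)
      eq = ℕSolver.solve-∀
    256l²≤D : 256 ℕ.* (l ℕ.* l) ℕ.≤ D
    256l²≤D = ℕP.≤-trans (ℕP.m≤m+n (256 ℕ.* (l ℕ.* l)) 1000) (ℕP.≤-trans t≤e (ℕP.m+n≤o⇒m≤o e e≤D))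
    D≤n : D ℕ.≤ n
    D≤n = fromℕℚ-cancel-≤ (≤-trans D≤np (≤-trans (*-monoʳ (fromℕℚ n) (0≤fromℕℚ n) p≤1) (≤-reflexive (*-identityʳ (fromℕℚ n)))))
    n≤8lh : n ℕ.≤ 8 ℕ.* (l ℕ.* h)
    n≤8lh = ℕP.≤-trans (ℕP.<⇒≤ n<) (ℕP.≤-trans (ℕP.*-monoʳ-≤ (4 ℕ.* l) (ℕP.+-monoˡ-≤ h 1≤h)) (ℕP.≤-reflexive (eq l h)))
      where
      n< : n ℕ.< 4 ℕ.* l ℕ.* suc h
      n< = ℕP.≤-trans (ℕ.s≤s (ℕP.≤-reflexive (DivMod.m≡m%n+[m/n]*n n (4 ℕ.* l))))
        (ℕP.≤-trans (ℕP.+-monoˡ-≤ (h ℕ.* (4 ℕ.* l)) (DivMod.m%n<n n (4 ℕ.* l))) (ℕP.≤-reflexive (ℕP.*-comm (suc h) (4 ℕ.* l))))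
      1≤h : 1 ℕ.≤ h
      1≤h = DivMod.m≥n⇒m/n>0 (ℕP.≤-trans (ℕP.≤-trans (ℕP.*-mono-≤ {4} {256} {l} {l ℕ.* l} (ℕP.m≤m+n 4 252) (ℕP.m≤m*n l l {{ℕ.>-nonZero 1≤l}})) 256l²≤D) D≤n)
      eq : ∀ l h → 4 ℕ.* l ℕ.* (h ℕ.+ h) ≡ 8 ℕ.* (l ℕ.* h)
      eq = ℕSolver.solve-∀
    -- As `h` is `n / (4 l)` rounded down, `n ≤ 8 l h`. Hence `64 l² (4 n) ≤ n p n ≤ 64 l² h² p`,
    -- where the first step is `256 l² ≤ n p`.
    4N≤h²p : fromℕℚ 4 * fromℕℚ n ≤ fromℕℚ (h ℕ.* h) * p
    4N≤h²p = *-cancelˡ {fromℕℚ 4 * fromℕℚ n} {fromℕℚ (h ℕ.* h) * p} (fromℕℚ (64 ℕ.* (l ℕ.* l))) (<-≤-trans (positive⁻¹ 1ℚ) (fromℕℚ-mono {1} (ℕP.*-mono-≤ {1} {64} (ℕP.m≤m+n 1 63) (ℕP.*-mono-≤ 1≤l 1≤l))))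
      (≤-trans (≤-reflexive (trans (sym (*-assoc (fromℕℚ (64 ℕ.* (l ℕ.* l))) (fromℕℚ 4) (fromℕℚ n))) (cong (_* fromℕℚ n) (sym (fromℕℚ-* (64 ℕ.* (l ℕ.* l)) 4)))))
        (≤-trans (*-monoˡ (fromℕℚ n) (0≤fromℕℚ n) (≤-trans (fromℕℚ-mono (ℕP.≤-trans (ℕP.≤-reflexive (eq₁ (l ℕ.* l))) 256l²≤D)) D≤np))
          (≤-trans (≤-reflexive (trans (eq₂ (fromℕℚ n) p) (cong (_* p) (sym (fromℕℚ-* n n)))))
            (≤-trans (*-monoˡ p 0≤p (fromℕℚ-mono (ℕP.≤-trans (ℕP.*-mono-≤ n≤8lh n≤8lh) (ℕP.≤-reflexive (eq₃ l h)))))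
              (≤-reflexive (trans (cong (_* p) (fromℕℚ-* (64 ℕ.* (l ℕ.* l)) (h ℕ.* h))) (*-assoc (fromℕℚ (64 ℕ.* (l ℕ.* l))) (fromℕℚ (h ℕ.* h)) p)))))))
      where
      eq₁ : ∀ x → 64 ℕ.* x ℕ.* 4 ≡ 256 ℕ.* x
      eq₁ = ℕSolver.solve-∀
      eq₂ : ∀ n p → n * p * n ≡ n * n * p
      eq₂ = solve-∀ ℚ-ring
      eq₃ : ∀ l h → 8 ℕ.* (l ℕ.* h) ℕ.* (8 ℕ.* (l ℕ.* h)) ≡ 64 ℕ.* (l ℕ.* l) ℕ.* (h ℕ.* h)
      eq₃ = ℕSolver.solve-∀

  core-whp : ∀ ε → 0ℚ < ε → ∃₂ λ M n₀ → ∀ n p (0≤p : 0ℚ ≤ p) (p≤½ : p ≤ ½) a b → n₀ ℕ.≤ n →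
    Grow a (½ * fromℕℚ n) → Grow b (½ * a) → 1ℚ ≤ a → b ≤ a → a + b + M ≤ fromℕℚ n * p →
    Small n p 0≤p (≤-trans p≤½ ½≤1) (λ s → ¬ IsCore (graph n s)) ε
  core-whp ε 0<ε = M , 2 ℕ.^ (16 ℕ.* E) , λ n p 0≤p p≤½ a b n₀≤n ga gb 1≤a b≤a ab≤ →
      by-scale n p 0≤p p≤½ a b ga gb 1≤a b≤a ab≤ (scale 16 E n (ℕ.s≤s ℕ.z≤n) n₀≤n) (floor (fromℕℚ n * p) (*-nonneg (0≤fromℕℚ n) 0≤p))
    where
    0≤ε = <⇒≤ 0<ε
    -- This makes `ε₁ ≤ 32 / M ≤ ε / 2`; the other half of `ε` is for the error `11 * ½ ^ e`.
    M = fromℕℚ 8 + fromℕℚ 64 * recip ε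
    k = proj₁ (*½^-small (fromℕℚ 11) (half-pos 0<ε))
    E = k ℕ.+ threshold
    0≤64/ε : 0ℚ ≤ fromℕℚ 64 * recip ε
    0≤64/ε = *-nonneg (0≤fromℕℚ 64) (<⇒≤ (recip-pos 0<ε))
    8≤M : fromℕℚ 8 ≤ M
    8≤M = by-diff (fromℕℚ 64 * recip ε) 0≤64/ε refl
    small-η : ∀ e → E ℕ.≤ e → fromℕℚ 11 * ½ ^ e ≤ ½ * ε
    small-η e E≤e = subst (λ z → fromℕℚ 11 * z ≤ ½ * ε) (½^≡ e) (proj₂ (*½^-small (fromℕℚ 11) (half-pos 0<ε)) e (ℕP.m+n≤o⇒m≤o k E≤e))
    ½ε≤ε : ½ * ε ≤ ε
    ½ε≤ε = ≤-trans (*-monoˡ ε 0≤ε ½≤1) (≤-reflexive (*-identityˡ ε))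
    ε₁≤ : ∀ ε₁ → ε₁ * M ≤ fromℕℚ 32 → ε₁ ≤ ½ * ε
    ε₁≤ ε₁ h = *-cancelˡ {ε₁} {½ * ε} M (<-≤-trans (positive⁻¹ (fromℕℚ 8)) 8≤M) (≤-trans (≤-reflexive (*-comm M ε₁)) (≤-trans h
        (by-diff (fromℕℚ 4 * ε) (*-nonneg (0≤fromℕℚ 4) 0≤ε) (trans (eq ε) (trans (cong (λ z → fromℕℚ 8 * (½ * ε) + fromℕℚ 32 * z) (sym (*-recip 0<ε))) (eq′ ε (recip ε)))))))
      where
      eq : ∀ ε → fromℕℚ 32 + fromℕℚ 4 * ε ≡ fromℕℚ 8 * (½ * ε) + fromℕℚ 32 * 1ℚ
      eq = solve-∀ ℚ-ring
      eq′ : ∀ ε r → fromℕℚ 8 * (½ * ε) + fromℕℚ 32 * (ε * r) ≡ (fromℕℚ 8 + fromℕℚ 64 * r) * (½ * ε)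
      eq′ = solve-∀ ℚ-ring
    by-scale : ∀ n p (0≤p : 0ℚ ≤ p) (p≤½ : p ≤ ½) a b →
      Grow a (½ * fromℕℚ n) → Grow b (½ * a) → 1ℚ ≤ a → b ≤ a → a + b + M ≤ fromℕℚ n * p →
      (∃ λ e → E ℕ.≤ e × 2 ℕ.^ (16 ℕ.* e) ℕ.≤ n × n ℕ.≤ 2 ℕ.^ (16 ℕ.* e ℕ.+ 16)) →
      (∃ λ D → fromℕℚ D ≤ fromℕℚ n * p × fromℕℚ n * p ≤ fromℕℚ (suc D)) →
      Small n p 0≤p (≤-trans p≤½ ½≤1) (λ s → ¬ IsCore (graph n s)) ε
    by-scale n p 0≤p p≤½ a b ga gb 1≤a b≤a ab≤ (e , E≤e , ≤n , n≤) (D , D≤np , np≤) =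
        by-density (80640 ℕ.* (suc e ℕ.* suc e) ℕP.≤? D)
      where
      p≤1 = ≤-trans p≤½ ½≤1
      by-density : Dec (80640 ℕ.* (suc e ℕ.* suc e) ℕ.≤ D) → Small n p 0≤p p≤1 (λ s → ¬ IsCore (graph n s)) ε
      by-density (yes dense) = small-mono n p 0≤p p≤1 (λ s x → x)
        (≤-trans (*-monoˡ (½ ^ e) (0≤½^′ e) (fromℕℚ-mono {5} {11} (ℕP.m≤m+n 5 6))) (≤-trans (small-η e E≤e) ½ε≤ε))
        (Dense.dense-core n p 0≤p p≤½ e n≤ D D≤np dense)
      by-density (no sparse) = let (ε₁ , 0≤ε₁ , ε₁M , sm) = sparse-whp n p 0≤p p≤½ e D a b M (ℕP.m+n≤o⇒n≤o k E≤e) ≤n n≤ (ℕP.≰⇒> sparse)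
                                     D≤np np≤ ga gb 1≤a b≤a 8≤M ab≤
        in small-mono n p 0≤p p≤1 (λ s x → x) (≤-trans (+-mono-≤ (ε₁≤ ε₁ ε₁M) (small-η e E≤e)) (≤-reflexive (halves ε))) sm

open ℝ
open Expectation using (Ex)

-- Dependence of probabilities on p

neg-≤ : ∀ {x y} → x ≤ y → - y ≤ - x
neg-≤ = neg-antimono-≤

∣∣≤ : ∀ {x c} → - c ≤ x → x ≤ c → ∣ x ∣ ≤ c
∣∣≤ {x} {c} l h = ∣∣-lub x h (≤-trans (neg-≤ l) (≤-reflexive (e c)))
  where
  e : ∀ c → - (- c) ≡ c
  e = solve-∀ ℚ-ring

Near : ℚ → Set
Near x = ∣ x ∣ ≤ 2ℚ × ∣ 1ℚ - x ∣ ≤ 2ℚ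

Ex-bounded : ∀ n (f : Vec Bool n → ℚ) → ∃ λ B → 0ℚ ≤ B × (∀ x → Near x → ∣ Ex x n f ∣ ≤ B)
Ex-bounded zero    f = ∣ f [] ∣ , 0≤∣p∣ (f []) , λ _ _ → ≤-refl
Ex-bounded (suc n) f with Ex-bounded n (λ s → f (true ∷ s)) | Ex-bounded n (λ s → f (false ∷ s))
... | B₁ , 0≤B₁ , h₁ | B₂ , 0≤B₂ , h₂ = 2ℚ * B₁ + 2ℚ * B₂ , +-nonneg (*-nonneg 0≤2 0≤B₁) (*-nonneg 0≤2 0≤B₂) ,
  λ x nx → ∣+∣-≤ (x * _) ((1ℚ - x) * _) (∣*∣-≤ x _ (proj₁ nx) (h₁ x nx)) (∣*∣-≤ (1ℚ - x) _ (proj₂ nx) (h₂ x nx))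

-- A polynomial in `x` is Lipschitz on a bounded set. That the constant depends on `n` and `f` is
-- harmless, since `n` is fixed before an approximation of its probability is chosen.
Ex-Lipschitz : ∀ n (f : Vec Bool n → ℚ) →
  ∃ λ C → 0ℚ ≤ C × (∀ x y → Near x → Near y → ∣ Ex x n f - Ex y n f ∣ ≤ C * ∣ x - y ∣)
Ex-Lipschitz zero    f = 0ℚ , ≤-refl , λ x y _ _ → ≤-reflexive (trans (cong ∣_∣ (+-inverseʳ (f []))) (sym (*-zeroˡ ∣ x - y ∣)))
Ex-Lipschitz (suc n) f with Ex-Lipschitz n (λ s → f (true ∷ s)) | Ex-Lipschitz n (λ s → f (false ∷ s))
                          | Ex-bounded n (λ s → f (true ∷ s)) | Ex-bounded n (λ s → f (false ∷ s))
... | C₁ , 0≤C₁ , h₁ | C₂ , 0≤C₂ , h₂ | B₁ , 0≤B₁ , b₁ | B₂ , 0≤B₂ , b₂ =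
  (B₁ + B₂) + 2ℚ * (C₁ + C₂) , +-nonneg (+-nonneg 0≤B₁ 0≤B₂) (*-nonneg 0≤2 (+-nonneg 0≤C₁ 0≤C₂)) , bound
  where
  F G : ℚ → ℚ
  F x = Ex x n (λ s → f (true ∷ s))
  G x = Ex x n (λ s → f (false ∷ s))
  bound : ∀ x y → Near x → Near y → ∣ (x * F x + (1ℚ - x) * G x) - (y * F y + (1ℚ - y) * G y) ∣ ≤ ((B₁ + B₂) + 2ℚ * (C₁ + C₂)) * ∣ x - y ∣
  bound x y nx ny = subst (∣ (x * F x + (1ℚ - x) * G x) - (y * F y + (1ℚ - y) * G y) ∣ ≤_) (e′ B₁ B₂ C₁ C₂ ∣ x - y ∣)
    (∣+∣-≤-split ((x - y) * F x + (- (x - y)) * G x) (y * (F x - F y) + (1ℚ - y) * (G x - G y)) (e x y (F x) (F y) (G x) (G y))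
      (∣+∣-≤ ((x - y) * F x) ((- (x - y)) * G x) (∣*∣-≤ (x - y) (F x) ≤-refl (b₁ x nx))
        (∣*∣-≤ (- (x - y)) (G x) (≤-reflexive (∣-p∣≡∣p∣ (x - y))) (b₂ x nx)))
      (∣+∣-≤ (y * (F x - F y)) ((1ℚ - y) * (G x - G y)) (∣*∣-≤ y (F x - F y) (proj₁ ny) (h₁ x y nx ny))
        (∣*∣-≤ (1ℚ - y) (G x - G y) (proj₂ ny) (h₂ x y nx ny))))
    where
    e : ∀ x y a b c d → ((x - y) * a + (- (x - y)) * c) + (y * (a - b) + (1ℚ - y) * (c - d)) ≡ (x * a + (1ℚ - x) * c) - (y * b + (1ℚ - y) * d)
    e = solve-∀ ℚ-ring
    e′ : ∀ a b c d z → (z * a + z * b) + (2ℚ * (c * z) + 2ℚ * (d * z)) ≡ ((a + b) + 2ℚ * (c + d)) * z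
    e′ = solve-∀ ℚ-ring

clamp : ℚ → ℚ
clamp x = (x ⊔ 0ℚ) ⊓ ½

0≤clamp : ∀ x → 0ℚ ≤ clamp x
0≤clamp x = ⊓-glb (p≤q⊔p x 0ℚ) 0≤½

clamp≤½ : ∀ x → clamp x ≤ ½
clamp≤½ x = p⊓q≤q (x ⊔ 0ℚ) ½

clamp-near : ∀ x {δ} → 0ℚ ≤ δ → - δ ≤ x → x ≤ ½ + δ → ∣ x - clamp x ∣ ≤ δ
clamp-near x {δ} 0≤δ l h = ∣∣≤ (≤-diff (subst (0ℚ ≤_) (e₁ x (clamp x) δ) (0≤-diff upper))) (≤-diff (subst (0ℚ ≤_) (e₂ x (clamp x) δ) (0≤-diff lower)))
  where
  upper : clamp x ≤ x + δ
  upper = ≤-trans (p⊓q≤p (x ⊔ 0ℚ) ½) (⊔-lub (by-diff {x} {x + δ} δ 0≤δ refl) (subst (_≤ x + δ) (+-inverseˡ δ) (+-monoˡ-≤ δ l)))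
  lower : x - δ ≤ clamp x
  lower = ⊓-glb (≤-trans (by-diff {x - δ} δ 0≤δ (e₃ x δ)) (p≤p⊔q x 0ℚ)) (≤-diff (subst (0ℚ ≤_) (e₄ x δ) (0≤-diff h)))
    where
    e₃ : ∀ x δ → x - δ + δ ≡ x
    e₃ = solve-∀ ℚ-ring
    e₄ : ∀ x δ → ½ + δ - x ≡ ½ - (x - δ)
    e₄ = solve-∀ ℚ-ring
  e₁ : ∀ x c δ → x + δ - c ≡ x - c - (- δ)
  e₁ = solve-∀ ℚ-ring
  e₂ : ∀ x c δ → c - (x - δ) ≡ δ - (x - c)
  e₂ = solve-∀ ℚ-ring

≤½⇒Near : ∀ x → - ½ ≤ x → x ≤ 1ℚ → Near x
≤½⇒Near x l h = ∣∣≤ (≤-trans (≤ᵇ⇒≤ {(- 2ℚ)} {(- ½)} _) l) (≤-trans h (≤ᵇ⇒≤ {1ℚ} {2ℚ} _)) ,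
  ∣∣≤ (≤-diff (subst (0ℚ ≤_) (e₁ x) (+-nonneg (0≤-diff h) 0≤2))) (≤-diff (subst (0ℚ ≤_) (e₂ x) (+-nonneg (0≤-diff l) 0≤½)))
  where
  e₁ : ∀ x → (1ℚ - x) + 2ℚ ≡ (1ℚ - x) - (- 2ℚ)
  e₁ = solve-∀ ℚ-ring
  e₂ : ∀ x → (x - (- ½)) + ½ ≡ 2ℚ - (1ℚ - x)
  e₂ = solve-∀ ℚ-ring

-- Approximations of real numbers

-- `_≤ℝ_` is a negation and carries no modulus, so the one of the Cauchy sequence is used: a late
-- term above `q + δ` would keep all later ones above `q + ½ * δ`, which proves that `q` is less
-- than `x`.
≤ℝ-fromℚ : ∀ x q → x ≤ℝ fromℚ q → ∀ δ → 0ℚ < δ → ∃ λ K → ∀ k → K ℕ.≤ k → seq x k ≤ q + δ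
≤ℝ-fromℚ x q x≤q δ 0<δ with is-cauchy x (½ * δ) (half-pos 0<δ)
... | K , near = K , λ k K≤k → bound k K≤k (seq x k ≤? q + δ)
  where
  bound : ∀ k → K ℕ.≤ k → Dec (seq x k ≤ q + δ) → seq x k ≤ q + δ
  bound k K≤k (yes le) = le
  bound k K≤k (no ¬le) = ⊥-elim (x≤q (½ * δ , K , half-pos 0<δ , λ m K≤m →
      ≤-diff (subst (0ℚ ≤_) (e (seq x m) (seq x k) q δ)
        (+-nonneg (0≤-diff (≤-trans (p≤∣p∣ (seq x k - seq x m)) (near k m K≤k K≤m))) (0≤-diff (<⇒≤ (≰⇒> ¬le)))))))
    where
    e : ∀ m k q δ → (½ * δ - (k - m)) + (k - (q + δ)) ≡ m - q - ½ * δ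
    e = solve-∀ ℚ-ring

fromℚ-≤ℝ : ∀ x q → fromℚ q ≤ℝ x → ∀ δ → 0ℚ < δ → ∃ λ K → ∀ k → K ℕ.≤ k → q - δ ≤ seq x k
fromℚ-≤ℝ x q q≤x δ 0<δ with is-cauchy x (½ * δ) (half-pos 0<δ)
... | K , near = K , λ k K≤k → bound k K≤k (q - δ ≤? seq x k)
  where
  bound : ∀ k → K ℕ.≤ k → Dec (q - δ ≤ seq x k) → q - δ ≤ seq x k
  bound k K≤k (yes le) = le
  bound k K≤k (no ¬le) = ⊥-elim (q≤x (½ * δ , K , half-pos 0<δ , λ m K≤m →
      ≤-diff (subst (0ℚ ≤_) (e (seq x m) (seq x k) q δ)
        (+-nonneg (0≤-diff (≤-trans (p≤∣p∣ (seq x m - seq x k)) (near m k K≤m K≤k))) (0≤-diff (<⇒≤ (≰⇒> ¬le)))))))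
    where
    e : ∀ m k q δ → (½ * δ - (m - k)) + ((q - δ) - k) ≡ q - m - ½ * δ
    e = solve-∀ ℚ-ring

seq-^ : ∀ x m k → seq (x ^ℝ m) k ≡ seq x k ^ m
seq-^ x zero    k = refl
seq-^ x (suc m) k = cong (seq x k *_) (seq-^ x m k)

seq-sum : ∀ {A : Set} (W : A → ℝ) (w : A → ℚ) k → (∀ S → seq (W S) k ≡ w S) → ∀ l →
  seq (sumℝ (map W l)) k ≡ List.foldr _+_ 0ℚ (map w l)
seq-sum W w k h []      = refl
seq-sum W w k h (S ∷ l) = cong₂ _+_ (h S) (seq-sum W w k h l)

seq-ℙ : ∀ n p {P : Pred (Graph n) _} (P? : Decidable P) k →
  seq (ℙ[𝒢⟨ n , p ⟩∈ P? ]) k ≡ Ex (seq p k) (length (pairs n)) (λ s → 𝟙 (P? (graph n s)))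
seq-ℙ n p P? k = trans
  (seq-sum _ (weight _≟ᴾ_ (seq p k) (length (pairs n))) k
    (λ S → cong₂ _*_ (seq-^ p (length S) k) (seq-^ (1ℝ -ℝ p) (length (pairs n) ℕ.∸ length S) k))
    (filter (P? ∘ fromEdges) (sublists (pairs n))))
  (probability n (seq p k) P?)
  where open Sample n

-- It suffices to bound, for large indices k, the probability of failure at
-- the rational approximations of p, moved into the interval [0, ½].
whp : ∀ (p : ℕ → ℝ) → (∀ n → 0ℝ ≤ℝ p n) → (∀ n → p n ≤ℝ ½ℝ) → (P : GraphProperty) (P? : ∀ {n} → Decidable (P {n})) →
  (∀ ε → 0ℚ < ε → ∃ λ n₀ → ∀ n → n₀ ℕ.≤ n → ∃₂ λ δ K → 0ℚ < δ × (∀ k → K ℕ.≤ k →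
    ∀ x (0≤x : 0ℚ ≤ x) (x≤½ : x ≤ ½) → ∣ seq (p n) k - x ∣ ≤ δ →
    Small n x 0≤x (≤-trans x≤½ ½≤1) (λ s → ¬ P (graph n s)) ε)) →
  WithHighProbability p P P?
whp p 0≤p p≤½ P P? bound ε (δ₀ , K₀ , 0<δ₀ , δ₀≤ε) = n₀ , λ n n₀≤n → at n (proj₂ (bound δ₁ 0<δ₁) n n₀≤n)
  where
  δ₁ : ℚ
  δ₁ = ½ * (½ * δ₀)
  0<δ₁ : 0ℚ < δ₁
  0<δ₁ = half-pos (half-pos 0<δ₀)
  n₀ = proj₁ (bound δ₁ 0<δ₁)
  at : ∀ n → (∃₂ λ δ K → 0ℚ < δ × (∀ k → K ℕ.≤ k → ∀ x (0≤x : 0ℚ ≤ x) (x≤½ : x ≤ ½) → ∣ seq (p n) k - x ∣ ≤ δ →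
    Small n x 0≤x (≤-trans x≤½ ½≤1) (λ s → ¬ P (graph n s)) δ₁)) →
    ∣ ℙ[𝒢⟨ n , p n ⟩∈ P? ] -ℝ 1ℝ ∣ℝ <ℝ ε
  at n (δ , K , 0<δ , failure) = ½ * δ₀ , K′ , half-pos 0<δ₀ , λ k K′≤k → conclude k (≥K₀ K′≤k) (≥K K′≤k) (≥Kl K′≤k) (≥Ku K′≤k)
    where
    L = length (pairs n)
    f : Vec Bool L → ℚ
    f s = 𝟙 (P? (graph n s))
    lip = Ex-Lipschitz L f
    C = proj₁ lip
    0≤C = proj₁ (proj₂ lip)
    -- At most `δ` for `failure`, at most `½` for `Near`, and small enough for the Lipschitz error
    -- to stay below `δ₁`; `1 + C` is inverted because `C` may be 0.
    γ : ℚ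
    γ = (δ ⊓ ½) ⊓ (δ₁ * recip (1ℚ + C))
    0<1+C : 0ℚ < 1ℚ + C
    0<1+C = <-≤-trans (positive⁻¹ 1ℚ) (by-diff C 0≤C refl)
    ⊓-pos : ∀ {x y} → 0ℚ < x → 0ℚ < y → 0ℚ < x ⊓ y
    ⊓-pos {x} {y} 0<x 0<y with ≤-total x y
    ... | inj₁ le = subst (0ℚ <_) (sym (p≤q⇒p⊓q≡p le)) 0<x
    ... | inj₂ ge = subst (0ℚ <_) (sym (p≥q⇒p⊓q≡q ge)) 0<y
    0<γ : 0ℚ < γ
    0<γ = ⊓-pos (⊓-pos 0<δ (positive⁻¹ ½)) (*-pos 0<δ₁ (recip-pos 0<1+C))
    γ≤δ : γ ≤ δ
    γ≤δ = ≤-trans (p⊓q≤p (δ ⊓ ½) _) (p⊓q≤p δ ½)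
    γ≤½ : γ ≤ ½
    γ≤½ = ≤-trans (p⊓q≤p (δ ⊓ ½) _) (p⊓q≤q δ ½)
    Cγ≤δ₁ : C * γ ≤ δ₁
    Cγ≤δ₁ = ≤-trans (*-mono₂ 0≤C (<⇒≤ 0<γ) (by-diff {C} 1ℚ 0≤1 (+-comm C 1ℚ)) (p⊓q≤q (δ ⊓ ½) (δ₁ * recip (1ℚ + C))))
      (≤-reflexive (*-recip-assoc (1ℚ + C) δ₁ 0<1+C))
    lo = fromℚ-≤ℝ (p n) 0ℚ (0≤p n) γ 0<γ
    hi = ≤ℝ-fromℚ (p n) ½ (p≤½ n) γ 0<γ
    K′ = (K₀ ℕ.⊔ K) ℕ.⊔ (proj₁ lo ℕ.⊔ proj₁ hi)
    ≥K₀ : ∀ {k} → K′ ℕ.≤ k → K₀ ℕ.≤ k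
    ≥K₀ h = ℕP.m⊔n≤o⇒m≤o K₀ K (ℕP.m⊔n≤o⇒m≤o (K₀ ℕ.⊔ K) _ h)
    ≥K : ∀ {k} → K′ ℕ.≤ k → K ℕ.≤ k
    ≥K h = ℕP.m⊔n≤o⇒n≤o K₀ K (ℕP.m⊔n≤o⇒m≤o (K₀ ℕ.⊔ K) _ h)
    ≥Kl : ∀ {k} → K′ ℕ.≤ k → proj₁ lo ℕ.≤ k
    ≥Kl h = ℕP.m⊔n≤o⇒m≤o (proj₁ lo) (proj₁ hi) (ℕP.m⊔n≤o⇒n≤o (K₀ ℕ.⊔ K) _ h)
    ≥Ku : ∀ {k} → K′ ℕ.≤ k → proj₁ hi ℕ.≤ k
    ≥Ku h = ℕP.m⊔n≤o⇒n≤o (proj₁ lo) (proj₁ hi) (ℕP.m⊔n≤o⇒n≤o (K₀ ℕ.⊔ K) _ h)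
    conclude : ∀ k → K₀ ℕ.≤ k → K ℕ.≤ k → proj₁ lo ℕ.≤ k → proj₁ hi ℕ.≤ k →
      ½ * δ₀ ≤ seq ε k - ∣ seq ℙ[𝒢⟨ n , p n ⟩∈ P? ] k - 1ℚ ∣
    conclude k K₀≤k K≤k lo≤k hi≤k = ≤-diff (subst (0ℚ ≤_) (e (seq ε k) δ₀ ∣ seq ℙ[𝒢⟨ n , p n ⟩∈ P? ] k - 1ℚ ∣)
        (+-nonneg (0≤-diff (δ₀≤ε k K₀≤k)) (0≤-diff close)))
      where
      e : ∀ ε δ z → ε - 0ℚ - δ + (½ * δ - z) ≡ ε - z - ½ * δ
      e = solve-∀ ℚ-ring
      pk = seq (p n) k
      x = clamp pk
      near : ∣ pk - x ∣ ≤ γ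
      near = clamp-near pk (<⇒≤ 0<γ) (subst (_≤ pk) (+-identityˡ (- γ)) (proj₂ lo k lo≤k)) (proj₂ hi k hi≤k)
      Near-pk : Near pk
      Near-pk = ≤½⇒Near pk (≤-trans (neg-≤ γ≤½) (subst (_≤ pk) (+-identityˡ (- γ)) (proj₂ lo k lo≤k)))
        (≤-trans (proj₂ hi k hi≤k) (+-monoʳ-≤ ½ γ≤½))
      Near-x : Near x
      Near-x = ≤½⇒Near x (≤-trans (≤ᵇ⇒≤ {(- ½)} {0ℚ} _) (0≤clamp pk)) (≤-trans (clamp≤½ pk) ½≤1)
      sm = failure k K≤k x (0≤clamp pk) (clamp≤½ pk) (≤-trans near γ≤δ)
      p≤1 = ≤-trans (clamp≤½ pk) ½≤1
      g : Vec Bool L → ℚ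
      g s = 𝟙 (¬? (P? (graph n s)))
      f+g : Ex x L f + Ex x L g ≡ 1ℚ
      f+g = trans (sym (Expectation.Ex-+ x L f g)) (trans (Expectation.Ex-cong x L (λ s → one (P? (graph n s)))) (Expectation.Ex-const x L 1ℚ))
        where
        one : ∀ {X : Set} (d : Dec X) → 𝟙 d + 𝟙 (¬? d) ≡ 1ℚ
        one (yes _) = refl
        one (no _)  = refl
      Eg≤ : Ex x L g ≤ δ₁
      Eg≤ = small-𝟙 n x (0≤clamp pk) p≤1 (λ s → ¬? (P? (graph n s))) sm
      0≤Eg : 0ℚ ≤ Ex x L g
      0≤Eg = subst (_≤ Ex x L g) (Expectation.Ex-const x L 0ℚ) (Prob.E-mono n x (0≤clamp pk) p≤1 (λ s → nonneg (¬? (P? (graph n s)))))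
        where
        nonneg : ∀ {X : Set} (d : Dec X) → 0ℚ ≤ 𝟙 d
        nonneg (yes _) = 0≤1
        nonneg (no _)  = ≤-refl
      failure≤ : ∣ Ex x L f - 1ℚ ∣ ≤ δ₁
      failure≤ = subst (λ z → ∣ z ∣ ≤ δ₁) (trans (e′ (Ex x L f) (Ex x L g)) (cong (λ z → Ex x L f - z) f+g))
          (≤-trans (≤-reflexive (trans (∣-p∣≡∣p∣ (Ex x L g)) (0≤p⇒∣p∣≡p 0≤Eg))) Eg≤)
        where
        e′ : ∀ a b → - b ≡ a - (a + b)
        e′ = solve-∀ ℚ-ring
      close : ∣ seq ℙ[𝒢⟨ n , p n ⟩∈ P? ] k - 1ℚ ∣ ≤ ½ * δ₀
      close = subst₂ (λ z w → ∣ z - 1ℚ ∣ ≤ w) (sym (seq-ℙ n (p n) P? k)) (halves (½ * δ₀))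
        (∣+∣-≤-split (Ex pk L f - Ex x L f) (Ex x L f - 1ℚ) (e′ (Ex pk L f) (Ex x L f))
          (≤-trans (proj₂ (proj₂ lip) pk x Near-pk Near-x) (≤-trans (*-monoʳ C 0≤C near) Cγ≤δ₁)) failure≤)
        where
        e′ : ∀ a b → (a - b) + (b - 1ℚ) ≡ a - 1ℚ
        e′ = solve-∀ ℚ-ring

-- Rational approximations of log n and log (log n)

module Logs (n : ℕ) (9≤n : 9 ℕ.≤ n) where

  N : ℚ
  N = fromℕℚ n

  -- When `n` is a double successor, these are definitionally the `k`-th terms of `logℕ n` and
  -- `loglogℕ n`.
  a b : ℕ → ℚ
  a k = riemann k 1ℚ N
  b k = riemann k 1ℚ (a k)

  1≤N : 1ℚ ≤ N
  1≤N = fromℕℚ-mono {1} (ℕP.≤-trans (ℕP.m≤m+n 1 8) 9≤n)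

  fine : ∃ λ K → ∀ k → K ℕ.≤ k → ½^ k * (N * N) ≤ ½
  fine = proj₁ small , λ k K≤k → ≤-trans (≤-reflexive (*-comm (½^ k) (N * N))) (proj₂ small k K≤k)
    where
    small = *½^-small (N * N) (positive⁻¹ ½)

  a≤N : ∀ k → a k ≤ N
  a≤N k = ≤-trans (riemann≤ k ≤-refl 1≤N) (by-diff {N - 1ℚ} 1ℚ 0≤1 (e N))
    where
    e : ∀ N → N - 1ℚ + 1ℚ ≡ N
    e = solve-∀ ℚ-ring

  module _ (k : ℕ) (fine-k : ½^ k * (N * N) ≤ ½) where

    grow-a : Grow (a k) (½ * N)
    grow-a = grow-riemann-½ k 1≤N fine-k

    decay-a : Decay (a k) (recip N)
    decay-a = subst (Decay (a k)) (*-identityˡ (recip N)) (decay-riemann k (positive⁻¹ 1ℚ) 1≤N)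

    -- Otherwise `grow⇒≤2^` would give `½ * N ≤ 2 ^ 2`, which `9 ≤ n` contradicts; this is where 9
    -- comes from.
    1≤a : 1ℚ ≤ a k
    1≤a with ≤-total 1ℚ (a k)
    ... | inj₁ h = h
    ... | inj₂ h = ⊥-elim (<-irrefl refl (<-≤-trans (≤-<-trans (grow⇒≤2^ 2 h grow-a) 4<9/2) (*-monoʳ ½ 0≤½ (fromℕℚ-mono 9≤n))))
      where
      4<9/2 : 2ℚ ^ 2 < ½ * fromℕℚ 9
      4<9/2 = from-diff (positive⁻¹ (½ * fromℕℚ 9 - 2ℚ ^ 2))
        where
        from-diff : 0ℚ < ½ * fromℕℚ 9 - 2ℚ ^ 2 → 2ℚ ^ 2 < ½ * fromℕℚ 9
        from-diff h = subst₂ _<_ (+-identityˡ (2ℚ ^ 2)) refl (+-monoˡ-< (2ℚ ^ 2) h)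

    grow-b : Grow (b k) (½ * a k)
    grow-b = grow-riemann-½ k 1≤a (≤-trans (*-monoʳ (½^ k) (0≤½^ k) (*-mono₂ (≤-trans 0≤1 1≤a) (≤-trans 0≤1 1≤a) (a≤N k) (a≤N k))) fine-k)

    decay-b : Decay (b k) (recip (a k))
    decay-b = subst (Decay (b k)) (*-identityˡ (recip (a k))) (decay-riemann k (positive⁻¹ 1ℚ) 1≤a)

    b≤a : b k ≤ a k
    b≤a = ≤-trans (riemann≤ k ≤-refl 1≤a) (by-diff {a k - 1ℚ} 1ℚ 0≤1 (e (a k)))
      where
      e : ∀ N → N - 1ℚ + 1ℚ ≡ N
      e = solve-∀ ℚ-ring

-- From rational to real probabilities

shift-p : ∀ {N x y} → 0ℚ < N → ∣ x - y ∣ ≤ recip N → N * x ≤ N * y + 1ℚ × N * y ≤ N * x + 1ℚ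
shift-p {N} {x} {y} 0<N h = half x y h , half y x (subst (_≤ recip N) (∣-∣-sym x y) h)
  where
  half : ∀ x y → ∣ x - y ∣ ≤ recip N → N * x ≤ N * y + 1ℚ
  half x y h = ≤-trans (≤-reflexive (e N x y)) (+-monoʳ-≤ (N * y) (≤-trans (*-monoʳ N (<⇒≤ 0<N) (≤-trans (p≤∣p∣ (x - y)) h)) (≤-reflexive (*-recip 0<N))))
    where
    e : ∀ N x y → N * x ≡ N * y + N * (x - y)
    e = solve-∀ ℚ-ring

theorem1 : (p : ℕ → ℝ) →
    (∀ n → 0ℝ ≤ℝ p n) →
    (∀ n → p n ≤ℝ 1ℝ) →
    (∀ n → p n ≤ℝ ½ℝ) →
    let s = λ n → fromℕ n *ℝ p n -ℝ logℕ n -ℝ loglogℕ n in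
    (TendsTo+∞ s → WithHighProbability p IsCore IsCore?) ×
    (TendsTo-∞ s → WithHighProbability p (λ G → ¬ IsCore G) (λ G → ¬? (IsCore? G)))
theorem1 p 0≤p _ p≤½ = above , below
  where
  s : ℕ → ℝ
  s n = fromℕ n *ℝ p n -ℝ logℕ n -ℝ loglogℕ n

  above : TendsTo+∞ s → WithHighProbability p IsCore IsCore?
  above s→∞ = whp p 0≤p p≤½ IsCore IsCore? λ ε 0<ε →
    let (M , n₀ , h) = core-whp 1344 ℕP.≤-refl ε 0<ε
        -- The extra 1 pays for replacing an approximation of `p n` by a probability within `1 / n`
        -- of it, which changes `n p` by at most 1.
        (n₁ , large) = s→∞ (fromℚ (M + 1ℚ))
    in 9 ℕ.+ (n₀ ℕ.+ n₁) , λ n n≥ → at ε M n₀ h n n≥ (large n (ℕP.m+n≤o⇒n≤o n₀ (ℕP.m+n≤o⇒n≤o 9 n≥)))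
    where
    at : ∀ ε M n₀ → (∀ n x (0≤x : 0ℚ ≤ x) (x≤½ : x ≤ ½) a b → n₀ ℕ.≤ n → Grow a (½ * fromℕℚ n) → Grow b (½ * a) → 1ℚ ≤ a → b ≤ a →
        a + b + M ≤ fromℕℚ n * x → Small n x 0≤x (≤-trans x≤½ ½≤1) (λ s → ¬ IsCore (graph n s)) ε) →
      ∀ n {n₁} → 9 ℕ.+ (n₀ ℕ.+ n₁) ℕ.≤ n → fromℚ (M + 1ℚ) <ℝ s n →
      ∃₂ λ δ K → 0ℚ < δ × (∀ k → K ℕ.≤ k → ∀ x (0≤x : 0ℚ ≤ x) (x≤½ : x ≤ ½) → ∣ seq (p n) k - x ∣ ≤ δ →
        Small n x 0≤x (≤-trans x≤½ ½≤1) (λ s → ¬ IsCore (graph n s)) ε)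
    -- Splitting `n` down to a double successor lets `logℕ` and `loglogℕ` reduce to the Riemann sums
    -- of `Logs`.
    at ε M n₀ h 1 (ℕ.s≤s ())
    at ε M n₀ h (suc (suc m)) n≥ (ε′ , K , 0<ε′ , above-M) = recip N , K ℕ.⊔ proj₁ fine , recip-pos 0<N , λ k K≤k x 0≤x x≤½ near →
        let fk = proj₂ fine k (ℕP.m⊔n≤o⇒n≤o K (proj₁ fine) K≤k)
        in h n x 0≤x x≤½ (a k) (b k) (ℕP.m+n≤o⇒m≤o n₀ (ℕP.m+n≤o⇒n≤o 9 n≥)) (grow-a k fk) (grow-b k fk) (1≤a k fk) (b≤a k fk)
          (≤-diff (subst (0ℚ ≤_) (e (seq (p n) k) N (a k) (b k) M x ε′)
            (+-nonneg (+-nonneg (0≤-diff (above-M k (ℕP.m⊔n≤o⇒m≤o K (proj₁ fine) K≤k))) (<⇒≤ 0<ε′)) (0≤-diff (proj₁ (shift-p {N} {seq (p n) k} {x} 0<N near))))))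
      where
      n = suc (suc m)
      open Logs n (ℕP.m+n≤o⇒m≤o 9 n≥)
      0<N : 0ℚ < N
      0<N = fromℕℚ-pos (suc m)
      e : ∀ y N a b M x ε → (N * y + - a + - b - (M + 1ℚ) - ε) + ε + (N * x + 1ℚ - N * y) ≡ N * x - (a + b + M)
      e = solve-∀ ℚ-ring

  below : TendsTo-∞ s → WithHighProbability p (λ G → ¬ IsCore G) (λ G → ¬? (IsCore? G))
  below s→-∞ = whp p 0≤p p≤½ (λ G → ¬ IsCore G) (λ G → ¬? (IsCore? G)) λ ε 0<ε →
    let (M , n₀ , h) = ¬core-whp ε 0<ε
        (n₁ , small) = s→-∞ (fromℚ (- (M + 1ℚ)))
    in 9 ℕ.+ (n₀ ℕ.+ n₁) , λ n n≥ → at ε M n₀ h n n≥ (small n (ℕP.m+n≤o⇒n≤o n₀ (ℕP.m+n≤o⇒n≤o 9 n≥)))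
    where
    at : ∀ ε M n₀ → (∀ n x (0≤x : 0ℚ ≤ x) (x≤½ : x ≤ ½) a b → n₀ ℕ.≤ n → Decay a (recip (fromℕℚ n)) → Decay b (recip a) → 1ℚ ≤ a → b ≤ a →
        fromℕℚ n * x + M ≤ a + b → Small n x 0≤x (≤-trans x≤½ ½≤1) (λ s → IsCore (graph n s)) ε) →
      ∀ n {n₁} → 9 ℕ.+ (n₀ ℕ.+ n₁) ℕ.≤ n → s n <ℝ fromℚ (- (M + 1ℚ)) →
      ∃₂ λ δ K → 0ℚ < δ × (∀ k → K ℕ.≤ k → ∀ x (0≤x : 0ℚ ≤ x) (x≤½ : x ≤ ½) → ∣ seq (p n) k - x ∣ ≤ δ →
        Small n x 0≤x (≤-trans x≤½ ½≤1) (λ s → ¬ (¬ IsCore (graph n s))) ε)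
    at ε M n₀ h 1 (ℕ.s≤s ())
    at ε M n₀ h (suc (suc m)) n≥ (ε′ , K , 0<ε′ , below-M) = recip N , K ℕ.⊔ proj₁ fine , recip-pos 0<N , λ k K≤k x 0≤x x≤½ near →
        let fk = proj₂ fine k (ℕP.m⊔n≤o⇒n≤o K (proj₁ fine) K≤k)
        in small-mono n x 0≤x (≤-trans x≤½ ½≤1) (λ s → decidable-stable (IsCore? (graph n s))) ≤-refl
          (h n x 0≤x x≤½ (a k) (b k) (ℕP.m+n≤o⇒m≤o n₀ (ℕP.m+n≤o⇒n≤o 9 n≥)) (decay-a k fk) (decay-b k fk) (1≤a k fk) (b≤a k fk)
            (≤-diff (subst (0ℚ ≤_) (e (seq (p n) k) N (a k) (b k) M x ε′)
              (+-nonneg (+-nonneg (0≤-diff (below-M k (ℕP.m⊔n≤o⇒m≤o K (proj₁ fine) K≤k))) (<⇒≤ 0<ε′)) (0≤-diff (proj₂ (shift-p {N} {seq (p n) k} {x} 0<N near)))))))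
      where
      n = suc (suc m)
      open Logs n (ℕP.m+n≤o⇒m≤o 9 n≥)
      0<N : 0ℚ < N
      0<N = fromℕℚ-pos (suc m)
      e : ∀ y N a b M x ε → (- (M + 1ℚ) - (N * y + - a + - b) - ε) + ε + (N * y + 1ℚ - N * x) ≡ a + b - (N * x + M)
      e = solve-∀ ℚ-ring
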